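{- Let $\theta$ be the unique positive real solution of $W(\theta)=1$, where $W(x)=\sum_{n\ge1}\frac{\mathcal{W}_2(1,n)}{n!}x^n$, and let $\nu = 1/\theta = 1.7521819\ldots$. Then $$M_2(n)/n! \le \nu^n$$ for all $n\ge 1$, and the constant is optimal: we have the more precise asymptotic formula $$M_2(n)/n! \sim \lambda\, n^{ -1/2}\,\nu^n \quad (n\to\infty)$$ with a constant $\lambda = 0.2769343\ldots$.
   Context: $\mathbb{N}_0$ denotes the nonnegative integers. For positive integers $\ell,n$, let $$\mathcal{U}_2(\ell,n)=\#\{(a_1,\ldots,a_n)\in\mathbb{N}_0^n : 2^{a_1}+\cdots+2^{a_n}=\ell\}.$$ For a positive integer $s$, $\mathcal{W}_2(s,n)$ is the maximum of $\mathcal{U}_2(\ell,n)$ over all positive integers $\ell$ whose binary sum of digits equals $s$. Further, $$M_2(n)=\max_{\ell\ge1}\,\mathcal{U}_2(\ell,n)=\max_{s\ge1}\,\mathcal{W}_2(s,n)$$ is the maximum number of representations of a positive integer as an ordered sum of exactly $n$ powers of $2$. -}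

module Defs where

open import Data.Digit using (toNatDigits)
open import Data.Integer using (+_)
import Data.Integer as ℤ
import Data.Integer.Properties as ℤ
import Data.Integer.Tactic.RingSolver as ℤ-Solver
open import Data.List.Base using (List; []; _∷_; [_]; length; filter; cartesianProductWith; upTo)
open import Data.Nat.ListAction using (sum)
open import Data.List.Membership.Propositional using (_∈_)
open import Data.List.Membership.Propositional.Properties
  using (∈-filter⁺; ∈-filter⁻; ∈-cartesianProductWith⁺; ∈-upTo⁺)
open import Data.List.Relation.Unary.Any using (here)
open import Data.List.Relation.Unary.All using ([])
open import Data.List.Relation.Unary.AllPairs using ([]; _∷_)
open import Data.List.Relation.Unary.Unique.Propositional using (Unique)
import Data.List.Relation.Unary.Unique.Propositional.Properties as Unique
open import Data.Nat.Base as ℕ using (ℕ; zero; suc; NonZero; _!; s≤s; z≤n)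
import Data.Nat.Properties as ℕ
import Data.Nat.Tactic.RingSolver as ℕ-Solver
open import Data.Product using (∃-syntax; _×_; _,_; proj₁; proj₂)
open import Data.Rational.Base as ℚ using (ℚ; 0ℚ; 1ℚ; ½; mkℚ)
import Data.Rational.Properties as ℚ
open import Data.Rational.Solver using (module +-*-Solver)
import Data.Rational.Unnormalised.Base as ℚᵘ
import Data.Rational.Unnormalised.Properties as ℚᵘ
open import Data.Sum using (inj₁; inj₂)
open import Data.Vec.Base using (Vec; []; _∷_)
import Data.Vec.Base as Vec
open import Data.Vec.Properties using (∷-injective)
open import Data.Vec.Relation.Unary.All using (All; []; _∷_)
open import Function using (_⇔_; mk⇔)
open import Relation.Binary.PropositionalEquality hiding ([_])
open import Relation.Nullary using (yes; no; contradiction)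

------------------------------------------------------------------------
-- Representations by sums of powers of 2

value : ∀ {n} → Vec ℕ n → ℕ
value as = Vec.sum (Vec.map (2 ℕ.^_) as)

tuplesBelow : ℕ → ∀ n → List (Vec ℕ n)
tuplesBelow k zero    = [ [] ]
tuplesBelow k (suc n) = cartesianProductWith _∷_ (upTo k) (tuplesBelow k n)

-- Only exponents a < ℓ have to be searched, because 2 ^ a ≤ ℓ forces a < ℓ.
representations : (ℓ n : ℕ) → List (Vec ℕ n)
representations ℓ n = filter (λ as → value as ℕ.≟ ℓ) (tuplesBelow ℓ n)

U₂ : (ℓ n : ℕ) → ℕ
U₂ ℓ n = length (representations ℓ n)

private
  a<2^a : ∀ a → a ℕ.< 2 ℕ.^ a
  a<2^a zero    = s≤s z≤n
  a<2^a (suc a) = begin-strict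
    suc a                     ≤⟨ a<2^a a ⟩
    2 ℕ.^ a                   <⟨ ℕ.m<m+n (2 ℕ.^ a) (ℕ.≤-<-trans z≤n (a<2^a a)) ⟩
    2 ℕ.^ a ℕ.+ 2 ℕ.^ a       ≡⟨ cong (2 ℕ.^ a ℕ.+_) (ℕ.+-identityʳ (2 ℕ.^ a)) ⟨
    2 ℕ.^ suc a               ∎
    where open ℕ.≤-Reasoning

  below-value : ∀ {n ℓ} (as : Vec ℕ n) → value as ℕ.≤ ℓ → All (ℕ._< ℓ) as
  below-value []       _ = []
  below-value (a ∷ as) p =
    ℕ.<-≤-trans (a<2^a a) (ℕ.≤-trans (ℕ.m≤m+n (2 ℕ.^ a) (value as)) p)
    ∷ below-value as (ℕ.≤-trans (ℕ.m≤n+m (value as) (2 ℕ.^ a)) p)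

  ∈-tuplesBelow : ∀ {k n} {as : Vec ℕ n} → All (ℕ._< k) as → as ∈ tuplesBelow k n
  ∈-tuplesBelow []       = here refl
  ∈-tuplesBelow (p ∷ ps) = ∈-cartesianProductWith⁺ _∷_ (∈-upTo⁺ p) (∈-tuplesBelow ps)

  tuplesBelow-unique : ∀ k n → Unique (tuplesBelow k n)
  tuplesBelow-unique k zero    = [] ∷ []
  tuplesBelow-unique k (suc n) =
    Unique.cartesianProductWith⁺ _∷_ ∷-injective (Unique.upTo⁺ k) (tuplesBelow-unique k n)

∈-representations : ∀ {ℓ n} {as : Vec ℕ n} → as ∈ representations ℓ n ⇔ value as ≡ ℓ
∈-representations {ℓ} {n} {as} = mk⇔
  (λ p → proj₂ (∈-filter⁻ (λ bs → value bs ℕ.≟ ℓ) {xs = tuplesBelow ℓ n} p))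
  (λ q → ∈-filter⁺ (λ bs → value bs ℕ.≟ ℓ)
           (∈-tuplesBelow (below-value as (ℕ.≤-reflexive q))) q)

representations-unique : ∀ ℓ n → Unique (representations ℓ n)
representations-unique ℓ n =
  Unique.filter⁺ (λ bs → value bs ℕ.≟ ℓ) (tuplesBelow-unique ℓ n)

binaryDigitSum : ℕ → ℕ
binaryDigitSum ℓ = sum (toNatDigits 2 ℓ)

IsMaximum : (P : ℕ → Set) (f : ℕ → ℕ) → ℕ → Set
IsMaximum P f m = (∃[ ℓ ] P ℓ × f ℓ ≡ m) × (∀ ℓ → P ℓ → f ℓ ℕ.≤ m)

-- The maxima range over infinitely many ℓ, so they are specified rather than
-- computed; a number satisfying the specification is unique.
IsW₂ : (s n : ℕ) → ℕ → Set
IsW₂ s n = IsMaximum (λ ℓ → 1 ℕ.≤ ℓ × binaryDigitSum ℓ ≡ s) (λ ℓ → U₂ ℓ n)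

IsM₂ : ℕ → ℕ → Set
IsM₂ n = IsMaximum (λ ℓ → 1 ℕ.≤ ℓ) (λ ℓ → U₂ ℓ n)

------------------------------------------------------------------------
-- Rational approximations to √n

isqrt : ℕ → ℕ
isqrt zero    = 0
isqrt (suc n) with suc (isqrt n) ℕ.* suc (isqrt n) ℕ.≤? suc n
... | yes _ = suc (isqrt n)
... | no  _ = isqrt n

isqrt-spec : ∀ n → isqrt n ℕ.* isqrt n ℕ.≤ n × n ℕ.< suc (isqrt n) ℕ.* suc (isqrt n)
isqrt-spec zero    = z≤n , s≤s z≤n
isqrt-spec (suc n) with suc (isqrt n) ℕ.* suc (isqrt n) ℕ.≤? suc n
... | yes p = p , ℕ.≤-<-trans (proj₂ (isqrt-spec n))
                    (ℕ.*-mono-< (ℕ.n<1+n (suc (isqrt n))) (ℕ.n<1+n (suc (isqrt n))))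
... | no ¬p = ℕ.≤-trans (proj₁ (isqrt-spec n)) (ℕ.n≤1+n n) , ℕ.≰⇒> ¬p

-- ⌊√n · (k + 1)⌋ / (k + 1)
√-approx : ℕ → ℕ → ℚ
√-approx n k = + isqrt (n ℕ.* (suc k ℕ.* suc k)) ℚ./ suc k

private
  /-mono-< : ∀ a b c d .⦃ _ : NonZero b ⦄ .⦃ _ : NonZero d ⦄ →
             a ℕ.* d ℕ.< c ℕ.* b → + a ℚ./ b ℚ.< + c ℚ./ d
  /-mono-< a b@(suc _) c d@(suc _) h = ℚ.toℚᵘ-cancel-<
    (ℚᵘ.<-respˡ-≃ (ℚᵘ.≃-sym (ℚ.toℚᵘ-fromℚᵘ (+ a ℚᵘ./ b)))
      (ℚᵘ.<-respʳ-≃ (ℚᵘ.≃-sym (ℚ.toℚᵘ-fromℚᵘ (+ c ℚᵘ./ d)))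
        (ℚᵘ.*<* (subst₂ ℤ._<_ (ℤ.pos-* a d) (ℤ.pos-* c b) (ℤ.+<+ h)))))

  square-cancel-< : ∀ {a b} → a ℕ.* a ℕ.< b ℕ.* b → a ℕ.< b
  square-cancel-< {a} {b} h with a ℕ.<? b
  ... | yes p = p
  ... | no ¬p = contradiction h (ℕ.≤⇒≯ (ℕ.*-mono-≤ (ℕ.≮⇒≥ ¬p) (ℕ.≮⇒≥ ¬p)))

  /-suc : ∀ b d .⦃ _ : NonZero d ⦄ → + suc b ℚ./ d ≡ + b ℚ./ d ℚ.+ + 1 ℚ./ d
  /-suc b d@(suc _) = ℚ.toℚᵘ-injective (begin-equality
    ℚ.toℚᵘ (+ suc b ℚ./ d)                           ≃⟨ ℚ.toℚᵘ-fromℚᵘ (+ suc b ℚᵘ./ d) ⟩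
    + suc b ℚᵘ./ d                                   ≃⟨ ℚᵘ.*≡* (eq (+ b) (+ d)) ⟩
    + b ℚᵘ./ d ℚᵘ.+ + 1 ℚᵘ./ d                       ≃⟨ ℚᵘ.+-cong (ℚ.toℚᵘ-fromℚᵘ (+ b ℚᵘ./ d)) (ℚ.toℚᵘ-fromℚᵘ (+ 1 ℚᵘ./ d)) ⟨
    ℚ.toℚᵘ (+ b ℚ./ d) ℚᵘ.+ ℚ.toℚᵘ (+ 1 ℚ./ d)       ≃⟨ ℚ.toℚᵘ-homo-+ (+ b ℚ./ d) (+ 1 ℚ./ d) ⟨
    ℚ.toℚᵘ (+ b ℚ./ d ℚ.+ + 1 ℚ./ d)                 ∎)
    where
    open ℚᵘ.≤-Reasoning
    eq : ∀ b d → (+ 1 ℤ.+ b) ℤ.* (d ℤ.* d) ≡ (b ℤ.* d ℤ.+ + 1 ℤ.* d) ℤ.* d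
    eq = ℤ-Solver.solve-∀

  1/n<ε : ∀ ε → 0ℚ ℚ.< ε → ∀ n → ℚ.↧ₙ ε ℕ.≤ n → + 1 ℚ./ suc n ℚ.< ε
  1/n<ε ε@(mkℚ (+ suc p) d-1 _) _ n d≤n = subst (+ 1 ℚ./ suc n ℚ.<_) (ℚ.↥p/↧p≡p ε)
    (/-mono-< 1 (suc n) (suc p) (suc d-1)
      (ℕ.≤-<-trans (ℕ.≤-reflexive (ℕ.*-identityˡ (suc d-1)))
        (ℕ.<-≤-trans (s≤s d≤n) (ℕ.m≤m+n (suc n) (p ℕ.* suc n)))))
  1/n<ε (mkℚ (+ zero) _ _)   (ℚ.*<* (ℤ.+<+ ()))
  1/n<ε (mkℚ ℤ.-[1+ _ ] _ _) (ℚ.*<* ())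

  √-approx-close : ∀ n i j → √-approx n i ℚ.< √-approx n j ℚ.+ + 1 ℚ./ suc j
  √-approx-close n i j = subst (√-approx n i ℚ.<_) (/-suc b (suc j))
    (/-mono-< a (suc i) (suc b) (suc j) (square-cancel-< (begin-strict
      (a ℕ.* suc j) ℕ.* (a ℕ.* suc j)              ≡⟨ swap a (suc j) ⟩
      (a ℕ.* a) ℕ.* (suc j ℕ.* suc j)              ≤⟨ ℕ.*-monoˡ-≤ (suc j ℕ.* suc j) (proj₁ (isqrt-spec (n ℕ.* (suc i ℕ.* suc i)))) ⟩
      n ℕ.* (suc i ℕ.* suc i) ℕ.* (suc j ℕ.* suc j) ≡⟨ rot n (suc i ℕ.* suc i) (suc j ℕ.* suc j) ⟩
      n ℕ.* (suc j ℕ.* suc j) ℕ.* (suc i ℕ.* suc i) <⟨ ℕ.*-monoˡ-< (suc i ℕ.* suc i) (proj₂ (isqrt-spec (n ℕ.* (suc j ℕ.* suc j)))) ⟩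
      (suc b ℕ.* suc b) ℕ.* (suc i ℕ.* suc i)      ≡⟨ swap (suc b) (suc i) ⟨
      (suc b ℕ.* suc i) ℕ.* (suc b ℕ.* suc i)      ∎)))
    where
    open ℕ.≤-Reasoning
    a = isqrt (n ℕ.* (suc i ℕ.* suc i))
    b = isqrt (n ℕ.* (suc j ℕ.* suc j))
    swap : ∀ a c → (a ℕ.* c) ℕ.* (a ℕ.* c) ≡ (a ℕ.* a) ℕ.* (c ℕ.* c)
    swap = ℕ-Solver.solve-∀
    rot : ∀ a b c → a ℕ.* b ℕ.* c ≡ a ℕ.* c ℕ.* b
    rot = ℕ-Solver.solve-∀

  √-approx-lower : ∀ n k → 1 ℕ.* suc k ℕ.< isqrt (suc n ℕ.* (suc k ℕ.* suc k)) ℕ.* 2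
  √-approx-lower n k = begin-strict
    1 ℕ.* suc k    ≡⟨ ℕ.*-identityˡ (suc k) ⟩
    suc k          ≤⟨ sk≤r ⟩
    r              <⟨ ℕ.m<m*n r 2 ⦃ ℕ.>-nonZero (ℕ.<-≤-trans (s≤s z≤n) sk≤r) ⦄ (s≤s (s≤s z≤n)) ⟩
    r ℕ.* 2        ∎
    where
    open ℕ.≤-Reasoning
    N = suc n ℕ.* (suc k ℕ.* suc k)
    r = isqrt N
    sk≤r : suc k ℕ.≤ r
    sk≤r = ℕ.≤-pred (square-cancel-< (ℕ.≤-<-trans (ℕ.m≤m+n _ _) (proj₂ (isqrt-spec N))))

------------------------------------------------------------------------
-- Real numbers as Cauchy sequences of rationals, up to _≃_

record ℝ : Set where
  constructor mkℝ
  field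
    seq    : ℕ → ℚ
    cauchy : ∀ ε → 0ℚ ℚ.< ε →
             ∃[ N ] (∀ m n → N ℕ.≤ m → N ℕ.≤ n → ℚ.∣ seq m ℚ.- seq n ∣ ℚ.< ε)

open ℝ public

infix  4 _≃_ _<_ _≤_
infixl 6 _+_ _-_
infixl 7 _*_
infix  8 -_
infixr 9 _^_
infix  9 √_

_≃_ : ℝ → ℝ → Set
x ≃ y = ∀ ε → 0ℚ ℚ.< ε → ∃[ N ] (∀ n → N ℕ.≤ n → ℚ.∣ seq x n ℚ.- seq y n ∣ ℚ.< ε)

_≤_ : ℝ → ℝ → Set
x ≤ y = ∀ ε → 0ℚ ℚ.< ε → ∃[ N ] (∀ n → N ℕ.≤ n → seq x n ℚ.≤ seq y n ℚ.+ ε)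

_<_ : ℝ → ℝ → Set
x < y = ∃[ δ ] (0ℚ ℚ.< δ × ∃[ N ] (∀ n → N ℕ.≤ n → seq x n ℚ.+ δ ℚ.≤ seq y n))

private
  module R = +-*-Solver
  open R using (_:+_; _:-_; _:*_; :-_; _:=_; con)
  open ℚ.≤-Reasoning

  halves : ∀ ε → ε ℚ.* ½ ℚ.+ ε ℚ.* ½ ≡ ε
  halves = R.solve 1 (λ e → e :* con ½ :+ e :* con ½ := e) refl

  *-pos : ∀ {p q} → 0ℚ ℚ.< p → 0ℚ ℚ.< q → 0ℚ ℚ.< p ℚ.* q
  *-pos {p} {q} p>0 q>0 =
    ℚ.positive⁻¹ (p ℚ.* q) ⦃ ℚ.pos*pos⇒pos p ⦃ ℚ.positive p>0 ⦄ q ⦃ ℚ.positive q>0 ⦄ ⦄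

  half-pos : ∀ {ε} → 0ℚ ℚ.< ε → 0ℚ ℚ.< ε ℚ.* ½
  half-pos ε>0 = *-pos ε>0 (ℚ.positive⁻¹ ½)

  *-mono-<-≤ : ∀ {p q r s} → 0ℚ ℚ.≤ p → p ℚ.≤ r → 0ℚ ℚ.< r → q ℚ.< s → 0ℚ ℚ.≤ q →
               p ℚ.* q ℚ.< r ℚ.* s
  *-mono-<-≤ {p} {q} {r} {s} 0≤p p≤r 0<r q<s 0≤q = begin-strict
    p ℚ.* q  ≤⟨ ℚ.*-monoʳ-≤-nonNeg q ⦃ ℚ.nonNegative 0≤q ⦄ p≤r ⟩
    r ℚ.* q  <⟨ ℚ.*-monoʳ-<-pos r ⦃ ℚ.positive 0<r ⦄ q<s ⟩
    r ℚ.* s  ∎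

  p≤∣p∣ : ∀ p → p ℚ.≤ ℚ.∣ p ∣
  p≤∣p∣ p with ℚ.≤-total 0ℚ p
  ... | inj₁ 0≤p = ℚ.≤-reflexive (sym (ℚ.0≤p⇒∣p∣≡p 0≤p))
  ... | inj₂ p≤0 = ℚ.≤-trans p≤0 (ℚ.0≤∣p∣ p)

  ∣∣-< : ∀ {p ε} → p ℚ.< ε → ℚ.- p ℚ.< ε → ℚ.∣ p ∣ ℚ.< ε
  ∣∣-< {p} p<ε -p<ε with ℚ.∣p∣≡p∨∣p∣≡-p p
  ... | inj₁ e = subst (ℚ._< _) (sym e) p<ε
  ... | inj₂ e = subst (ℚ._< _) (sym e) -p<ε

  ∣p∣≤∣q∣+∣p-q∣ : ∀ p q → ℚ.∣ p ∣ ℚ.≤ ℚ.∣ q ∣ ℚ.+ ℚ.∣ p ℚ.- q ∣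
  ∣p∣≤∣q∣+∣p-q∣ p q = begin
    ℚ.∣ p ∣                      ≡⟨ cong ℚ.∣_∣ (R.solve 2 (λ p q → p := q :+ (p :- q)) refl p q) ⟩
    ℚ.∣ q ℚ.+ (p ℚ.- q) ∣        ≤⟨ ℚ.∣p+q∣≤∣p∣+∣q∣ q (p ℚ.- q) ⟩
    ℚ.∣ q ∣ ℚ.+ ℚ.∣ p ℚ.- q ∣    ∎

  ∣p-q∣≡∣q-p∣ : ∀ p q → ℚ.∣ p ℚ.- q ∣ ≡ ℚ.∣ q ℚ.- p ∣
  ∣p-q∣≡∣q-p∣ p q = trans
    (cong ℚ.∣_∣ (R.solve 2 (λ p q → p :- q := :- (q :- p)) refl p q))
    (ℚ.∣-p∣≡∣p∣ (q ℚ.- p))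

  ∣∣p∣-∣q∣∣<ε : ∀ p q {ε} → ℚ.∣ p ℚ.- q ∣ ℚ.< ε → ℚ.∣ ℚ.∣ p ∣ ℚ.- ℚ.∣ q ∣ ∣ ℚ.< ε
  ∣∣p∣-∣q∣∣<ε p q {ε} h = ∣∣-<
    (ℚ.≤-<-trans (lem p q) h)
    (subst (ℚ._< ε) (R.solve 2 (λ a b → b :- a := :- (a :- b)) refl ℚ.∣ p ∣ ℚ.∣ q ∣)
      (ℚ.≤-<-trans (lem q p) (subst (ℚ._< ε) (∣p-q∣≡∣q-p∣ p q) h)))
    where
    lem : ∀ p q → ℚ.∣ p ∣ ℚ.- ℚ.∣ q ∣ ℚ.≤ ℚ.∣ p ℚ.- q ∣
    lem p q = begin
      ℚ.∣ p ∣ ℚ.- ℚ.∣ q ∣                            ≤⟨ ℚ.+-monoˡ-≤ (ℚ.- ℚ.∣ q ∣) (∣p∣≤∣q∣+∣p-q∣ p q) ⟩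
      ℚ.∣ q ∣ ℚ.+ ℚ.∣ p ℚ.- q ∣ ℚ.- ℚ.∣ q ∣          ≡⟨ R.solve 2 (λ a b → a :+ b :- a := b) refl ℚ.∣ q ∣ ℚ.∣ p ℚ.- q ∣ ⟩
      ℚ.∣ p ℚ.- q ∣                                  ∎

  bounded : ∀ x → ∃[ B ] (0ℚ ℚ.< B × ∃[ N ] (∀ n → N ℕ.≤ n → ℚ.∣ seq x n ∣ ℚ.≤ B))
  bounded x with cauchy x 1ℚ (ℚ.positive⁻¹ 1ℚ)
  ... | N , close = ℚ.∣ seq x N ∣ ℚ.+ 1ℚ
      , ℚ.+-mono-≤-< (ℚ.0≤∣p∣ (seq x N)) (ℚ.positive⁻¹ 1ℚ)
      , N
      , λ n N≤n → ℚ.≤-trans (∣p∣≤∣q∣+∣p-q∣ (seq x n) (seq x N))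
          (ℚ.+-monoʳ-≤ ℚ.∣ seq x N ∣ (ℚ.<⇒≤ (close n N N≤n ℕ.≤-refl)))

  ⊔-≤ˡ : ∀ {m n o} → m ℕ.⊔ n ℕ.≤ o → m ℕ.≤ o
  ⊔-≤ˡ = ℕ.m⊔n≤o⇒m≤o _ _

  ⊔-≤ʳ : ∀ {m n o} → m ℕ.⊔ n ℕ.≤ o → n ℕ.≤ o
  ⊔-≤ʳ = ℕ.m⊔n≤o⇒n≤o _ _

  0<1/ : ∀ p .⦃ _ : ℚ.Positive p ⦄ → 0ℚ ℚ.< (ℚ.1/ p) ⦃ ℚ.pos⇒nonZero p ⦄
  0<1/ p = ℚ.positive⁻¹ _ ⦃ ℚ.1/pos⇒pos p ⦄

fromℚ : ℚ → ℝ
fromℚ q = mkℝ (λ _ → q) λ ε ε>0 →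
  0 , λ _ _ _ _ → subst (λ r → ℚ.∣ r ∣ ℚ.< ε) (sym (ℚ.+-inverseʳ q)) ε>0

0ℝ 1ℝ : ℝ
0ℝ = fromℚ 0ℚ
1ℝ = fromℚ 1ℚ

_+_ : ℝ → ℝ → ℝ
x + y = mkℝ (λ n → seq x n ℚ.+ seq y n) λ ε ε>0 →
  let N₁ , h₁ = cauchy x (ε ℚ.* ½) (half-pos ε>0)
      N₂ , h₂ = cauchy y (ε ℚ.* ½) (half-pos ε>0)
  in N₁ ℕ.⊔ N₂ , λ m n p q →
  let xm = seq x m; xn = seq x n; ym = seq y m; yn = seq y n in
  begin-strict
    ℚ.∣ (xm ℚ.+ ym) ℚ.- (xn ℚ.+ yn) ∣
      ≡⟨ cong ℚ.∣_∣ (R.solve 4 (λ a b c d → (a :+ c) :- (b :+ d) := (a :- b) :+ (c :- d)) refl xm xn ym yn) ⟩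
    ℚ.∣ (xm ℚ.- xn) ℚ.+ (ym ℚ.- yn) ∣
      ≤⟨ ℚ.∣p+q∣≤∣p∣+∣q∣ (xm ℚ.- xn) (ym ℚ.- yn) ⟩
    ℚ.∣ xm ℚ.- xn ∣ ℚ.+ ℚ.∣ ym ℚ.- yn ∣
      <⟨ ℚ.+-mono-< (h₁ m n (⊔-≤ˡ p) (⊔-≤ˡ q)) (h₂ m n (⊔-≤ʳ p) (⊔-≤ʳ q)) ⟩
    ε ℚ.* ½ ℚ.+ ε ℚ.* ½
      ≡⟨ halves ε ⟩
    ε ∎

-_ : ℝ → ℝ
- x = mkℝ (λ n → ℚ.- seq x n) λ ε ε>0 →
  let N , h = cauchy x ε ε>0 in N , λ m n p q →
  subst (ℚ._< ε)
    (trans (sym (ℚ.∣-p∣≡∣p∣ (seq x m ℚ.- seq x n)))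
      (cong ℚ.∣_∣ (R.solve 2 (λ a b → :- (a :- b) := :- a :- :- b) refl (seq x m) (seq x n))))
    (h m n p q)

_-_ : ℝ → ℝ → ℝ
x - y = x + (- y)

∣_∣ : ℝ → ℝ
∣ x ∣ = mkℝ (λ n → ℚ.∣ seq x n ∣) λ ε ε>0 →
  let N , h = cauchy x ε ε>0 in N , λ m n p q → ∣∣p∣-∣q∣∣<ε (seq x m) (seq x n) (h m n p q)

_*_ : ℝ → ℝ → ℝ
x * y = mkℝ (λ n → seq x n ℚ.* seq y n) λ ε ε>0 →
  let A , A>0 , N₁ , x≤A = bounded x
      B , B>0 , N₂ , y≤B = bounded y
      C>0 = ℚ.+-mono-< A>0 B>0
      C = A ℚ.+ B
      instance
        C⁺ : ℚ.Positive C
        C⁺ = ℚ.positive C>0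
        C≢0 : ℚ.NonZero C
        C≢0 = ℚ.pos⇒nonZero C
      η = ε ℚ.* ℚ.1/ C
      η>0 = *-pos ε>0 (0<1/ C)
      N₃ , h₁ = cauchy x η η>0
      N₄ , h₂ = cauchy y η η>0
      N₁₂ = N₁ ℕ.⊔ N₂
      N₃₄ = N₃ ℕ.⊔ N₄
  in N₁₂ ℕ.⊔ N₃₄ , λ m n p q →
  let xm = seq x m; xn = seq x n; ym = seq y m; yn = seq y n
      p₁₂ = ℕ.m⊔n≤o⇒m≤o N₁₂ N₃₄ p; p₃₄ = ℕ.m⊔n≤o⇒n≤o N₁₂ N₃₄ p
      q₁₂ = ℕ.m⊔n≤o⇒m≤o N₁₂ N₃₄ q; q₃₄ = ℕ.m⊔n≤o⇒n≤o N₁₂ N₃₄ q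
  in
  begin-strict
    ℚ.∣ xm ℚ.* ym ℚ.- xn ℚ.* yn ∣
      ≡⟨ cong ℚ.∣_∣ (R.solve 4 (λ a b c d → a :* c :- b :* d := a :* (c :- d) :+ d :* (a :- b)) refl xm xn ym yn) ⟩
    ℚ.∣ xm ℚ.* (ym ℚ.- yn) ℚ.+ yn ℚ.* (xm ℚ.- xn) ∣
      ≤⟨ ℚ.∣p+q∣≤∣p∣+∣q∣ (xm ℚ.* (ym ℚ.- yn)) (yn ℚ.* (xm ℚ.- xn)) ⟩
    ℚ.∣ xm ℚ.* (ym ℚ.- yn) ∣ ℚ.+ ℚ.∣ yn ℚ.* (xm ℚ.- xn) ∣
      ≡⟨ cong₂ ℚ._+_ (ℚ.∣p*q∣≡∣p∣*∣q∣ xm (ym ℚ.- yn)) (ℚ.∣p*q∣≡∣p∣*∣q∣ yn (xm ℚ.- xn)) ⟩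
    ℚ.∣ xm ∣ ℚ.* ℚ.∣ ym ℚ.- yn ∣ ℚ.+ ℚ.∣ yn ∣ ℚ.* ℚ.∣ xm ℚ.- xn ∣
      <⟨ ℚ.+-mono-<
           (*-mono-<-≤ (ℚ.0≤∣p∣ xm) (x≤A m (ℕ.m⊔n≤o⇒m≤o N₁ N₂ p₁₂)) A>0
             (h₂ m n (ℕ.m⊔n≤o⇒n≤o N₃ N₄ p₃₄) (ℕ.m⊔n≤o⇒n≤o N₃ N₄ q₃₄)) (ℚ.0≤∣p∣ _))
           (*-mono-<-≤ (ℚ.0≤∣p∣ yn) (y≤B n (ℕ.m⊔n≤o⇒n≤o N₁ N₂ q₁₂)) B>0
             (h₁ m n (ℕ.m⊔n≤o⇒m≤o N₃ N₄ p₃₄) (ℕ.m⊔n≤o⇒m≤o N₃ N₄ q₃₄)) (ℚ.0≤∣p∣ _)) ⟩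
    A ℚ.* η ℚ.+ B ℚ.* η
      ≡⟨ R.solve 4 (λ a b e i → a :* (e :* i) :+ b :* (e :* i) := e :* ((a :+ b) :* i)) refl A B ε (ℚ.1/ C) ⟩
    ε ℚ.* (C ℚ.* ℚ.1/ C)
      ≡⟨ cong (ε ℚ.*_) (ℚ.*-inverseʳ C) ⟩
    ε ℚ.* 1ℚ
      ≡⟨ ℚ.*-identityʳ ε ⟩
    ε ∎

_^_ : ℝ → ℕ → ℝ
x ^ zero  = 1ℝ
x ^ suc n = x * x ^ n

private
  ⊔-positive : ∀ {δ} → 0ℚ ℚ.< δ → ∀ q → ℚ.Positive (q ℚ.⊔ δ)
  ⊔-positive {δ} δ>0 q = ℚ.positive (ℚ.<-≤-trans δ>0 (ℚ.p≤q⊔p q δ))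

-- The terms seq x n ≥ δ are inverted as they are; the finitely many initial
-- terms that may be smaller are first replaced by δ.
inv : (x : ℝ) → 0ℝ < x → ℝ
inv x (δ , δ>0 , N , δ≤x) = mkℝ y λ ε ε>0 →
  let N′ , h = cauchy x (ε ℚ.* (δ ℚ.* δ)) (*-pos ε>0 (*-pos δ>0 δ>0))
  in N ℕ.⊔ N′ , λ m n p q →
  let xm = seq x m; xn = seq x n; ym = y m; yn = y n in
  ℚ.*-cancelʳ-<-nonNeg (δ ℚ.* δ)
    ⦃ ℚ.pos⇒nonNeg (δ ℚ.* δ) ⦃ ℚ.positive (*-pos δ>0 δ>0) ⦄ ⦄ (begin-strict
      ℚ.∣ ym ℚ.- yn ∣ ℚ.* (δ ℚ.* δ)
        ≤⟨ ℚ.*-monoˡ-≤-nonNeg ℚ.∣ ym ℚ.- yn ∣ ⦃ ℚ.nonNegative (ℚ.0≤∣p∣ (ym ℚ.- yn)) ⦄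
             (ℚ.≤-trans
               (ℚ.*-monoˡ-≤-nonNeg δ ⦃ ℚ.nonNegative (ℚ.<⇒≤ δ>0) ⦄ (δ≤seq n (⊔-≤ˡ q)))
               (ℚ.*-monoʳ-≤-nonNeg xn ⦃ ℚ.nonNegative (0≤seq n (⊔-≤ˡ q)) ⦄ (δ≤seq m (⊔-≤ˡ p)))) ⟩
      ℚ.∣ ym ℚ.- yn ∣ ℚ.* (xm ℚ.* xn)
        ≡⟨ cong (ℚ.∣ ym ℚ.- yn ∣ ℚ.*_)
             (cong₂ ℚ._*_ (ℚ.0≤p⇒∣p∣≡p (0≤seq m (⊔-≤ˡ p))) (ℚ.0≤p⇒∣p∣≡p (0≤seq n (⊔-≤ˡ q)))) ⟨
      ℚ.∣ ym ℚ.- yn ∣ ℚ.* (ℚ.∣ xm ∣ ℚ.* ℚ.∣ xn ∣)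
        ≡⟨ cong (ℚ.∣ ym ℚ.- yn ∣ ℚ.*_) (ℚ.∣p*q∣≡∣p∣*∣q∣ xm xn) ⟨
      ℚ.∣ ym ℚ.- yn ∣ ℚ.* ℚ.∣ xm ℚ.* xn ∣
        ≡⟨ ℚ.∣p*q∣≡∣p∣*∣q∣ (ym ℚ.- yn) (xm ℚ.* xn) ⟨
      ℚ.∣ (ym ℚ.- yn) ℚ.* (xm ℚ.* xn) ∣
        ≡⟨ cong ℚ.∣_∣ (R.solve 4 (λ a b c d →
             (c :- d) :* (a :* b) := (a :* c) :* b :- (b :* d) :* a) refl xm xn ym yn) ⟩
      ℚ.∣ (xm ℚ.* ym) ℚ.* xn ℚ.- (xn ℚ.* yn) ℚ.* xm ∣
        ≡⟨ cong₂ (λ a b → ℚ.∣ a ℚ.* xn ℚ.- b ℚ.* xm ∣) (seq*y m (⊔-≤ˡ p)) (seq*y n (⊔-≤ˡ q)) ⟩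
      ℚ.∣ 1ℚ ℚ.* xn ℚ.- 1ℚ ℚ.* xm ∣
        ≡⟨ cong₂ (λ a b → ℚ.∣ a ℚ.- b ∣) (ℚ.*-identityˡ xn) (ℚ.*-identityˡ xm) ⟩
      ℚ.∣ xn ℚ.- xm ∣
        <⟨ h n m (⊔-≤ʳ q) (⊔-≤ʳ p) ⟩
      ε ℚ.* (δ ℚ.* δ) ∎)
  where
  instance
    pos : ∀ {n} → ℚ.Positive (seq x n ℚ.⊔ δ)
    pos {n} = ⊔-positive δ>0 (seq x n)
    nz : ∀ {n} → ℚ.NonZero (seq x n ℚ.⊔ δ)
    nz {n} = ℚ.pos⇒nonZero (seq x n ℚ.⊔ δ)
  y : ℕ → ℚ
  y n = ℚ.1/ (seq x n ℚ.⊔ δ)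
  δ≤seq : ∀ n → N ℕ.≤ n → δ ℚ.≤ seq x n
  δ≤seq n N≤n = subst (ℚ._≤ seq x n) (ℚ.+-identityˡ δ) (δ≤x n N≤n)
  0≤seq : ∀ n → N ℕ.≤ n → 0ℚ ℚ.≤ seq x n
  0≤seq n N≤n = ℚ.≤-trans (ℚ.<⇒≤ δ>0) (δ≤seq n N≤n)
  seq*y : ∀ n → N ℕ.≤ n → seq x n ℚ.* y n ≡ 1ℚ
  seq*y n N≤n = trans
    (cong (ℚ._* y n) (sym (ℚ.p≥q⇒p⊔q≡p (δ≤seq n N≤n))))
    (ℚ.*-inverseʳ (seq x n ℚ.⊔ δ))

*-inverseʳ : ∀ x (x>0 : 0ℝ < x) → x * inv x x>0 ≃ 1ℝ
*-inverseʳ x (δ , δ>0 , N , δ≤x) ε ε>0 = N , λ n N≤n →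
  let instance _ = ℚ.pos⇒nonZero (seq x n ℚ.⊔ δ) ⦃ ⊔-positive δ>0 (seq x n) ⦄
      δ≤xn = subst (ℚ._≤ seq x n) (ℚ.+-identityˡ δ) (δ≤x n N≤n)
      x*y≡1 = trans (cong (ℚ._* ℚ.1/ (seq x n ℚ.⊔ δ)) (sym (ℚ.p≥q⇒p⊔q≡p δ≤xn)))
                    (ℚ.*-inverseʳ (seq x n ℚ.⊔ δ))
  in subst (λ r → ℚ.∣ r ℚ.- 1ℚ ∣ ℚ.< ε) (sym x*y≡1) ε>0

√_ : ℕ → ℝ
√ n = mkℝ (√-approx n) λ ε ε>0 → ℚ.↧ₙ ε , λ i j p q →
  ∣∣-< (step ε i j (1/n<ε ε ε>0 j q))
       (subst (ℚ._< ε) (R.solve 2 (λ a b → b :- a := :- (a :- b)) refl (√-approx n i) (√-approx n j))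
         (step ε j i (1/n<ε ε ε>0 i p)))
  where
  step : ∀ ε i j → + 1 ℚ./ suc j ℚ.< ε → √-approx n i ℚ.- √-approx n j ℚ.< ε
  step ε i j h = begin-strict
    a ℚ.- b                     <⟨ ℚ.+-monoˡ-< (ℚ.- b) (√-approx-close n i j) ⟩
    b ℚ.+ e ℚ.- b               ≡⟨ R.solve 2 (λ b e → b :+ e :- b := e) refl b e ⟩
    e                           <⟨ h ⟩
    ε                           ∎
    where
    a = √-approx n i
    b = √-approx n j
    e = + 1 ℚ./ suc j

√-pos : ∀ n .⦃ _ : NonZero n ⦄ → 0ℝ < √ n
√-pos (suc n) = ½ , ℚ.positive⁻¹ ½ , 0 , λ k _ →
  subst (ℚ._≤ √-approx (suc n) k) (sym (ℚ.+-identityˡ ½))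
    (ℚ.<⇒≤ (/-mono-< 1 2 (isqrt (suc n ℕ.* (suc k ℕ.* suc k))) (suc k) (√-approx-lower n k)))

_^-½ : (n : ℕ) → .⦃ _ : NonZero n ⦄ → ℝ
n ^-½ = inv (√ n) (√-pos n)

------------------------------------------------------------------------
-- Limits and asymptotics

infix  4 _⟶_ _∼_
infixl 7 _/_!

_⟶_ : (ℕ → ℝ) → ℝ → Set
u ⟶ x = ∀ ε → 0ℝ < ε → ∃[ N ] (∀ n → N ℕ.≤ n → ∣ u n - x ∣ ≤ ε)

-- t 1 + ⋯ + t n
partialSum : (ℕ → ℝ) → ℕ → ℝ
partialSum t zero    = 0ℝ
partialSum t (suc n) = partialSum t n + t (suc n)

Sequence⁺ : Set
Sequence⁺ = (n : ℕ) → .⦃ _ : NonZero n ⦄ → ℝ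

-- f n = g n · (1 + o(1))
_∼_ : Sequence⁺ → Sequence⁺ → Set
f ∼ g = ∀ ε → 0ℝ < ε →
  ∃[ N ] (∀ n .⦃ _ : NonZero n ⦄ → N ℕ.≤ n → ∣ f n - g n ∣ ≤ ε * ∣ g n ∣)

_/_! : ℕ → ℕ → ℝ
a / n ! = fromℚ ((+ a ℚ./ n !) ⦃ n ℕ.!≢0 ⦄)

infix 4 EGF[_,_]≃_

-- Σ_{n ≥ 1} (a n / n!) xⁿ converges and has the value y
EGF[_,_]≃_ : (ℕ → ℕ) → ℝ → ℝ → Set
EGF[ a , x ]≃ y = partialSum (λ n → a n / n ! * x ^ n) ⟶ y

{-# OPTIONS --safe #-}
module Submission where

-- Let W = Σₙ 𝒲₂(1, n) xⁿ/n!.  Each binary digit of ℓ is represented separately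
-- when the digits are far apart, and splitting a representation at a digit shows
-- that nothing is gained otherwise; so 𝒲₂(s, n)/n! is the n-th coefficient of Wˢ
-- and M₂(n)/n! is the largest of these over s.  Since W(θ) = 1, [xⁿ] Wˢ · θⁿ is
-- the probability that a sum of s independent variables with the law W_k θᵏ is n.
-- It is therefore at most 1, and a local limit theorem shows that its maximum over
-- s is asymptotic to λ n^(-1/2) with λ² = μ/(2πσ²), where μ and σ² are the mean and
-- the variance of the law.  For the local limit theorem the summands are exchanged
-- one by one for fair coins with the same total mean and variance; each exchange
-- costs a third difference of a smooth law, and π enters as the limit of central
-- binomial probabilities.  All estimates are made for rational approximations of θ.
-- The numerical constants follow from the exact values of the first 111
-- coefficients of W and a geometric bound for the others.

open import Data.Integer.Base using (+_)
open import Data.Nat.Base as ℕ using (ℕ; NonZero; zero; suc; s≤s; z≤n)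
import Data.Nat.Properties as ℕ
import Data.Nat.Tactic.RingSolver as ℕ-Solver
open import Data.Product using (∃-syntax; Σ-syntax; _×_; _,_; proj₁; proj₂)
open import Data.Rational.Base using () renaming (_/_ to _÷_)
import Data.Rational.Base as ℚ
import Data.Rational.Properties as ℚ
open import Data.Sum using (_⊎_; inj₁; inj₂)
import Defs as ℝ
open import Relation.Binary.PropositionalEquality
open import Relation.Nullary using (¬_; Dec; yes; no; contradiction)
open import Tactic.RingSolver using (solve-∀)

-- Local limit theorems usually rest on characteristic functions. Here every estimate is an
-- inequality between rationals, and differences of sequences, measured in L1 and in the supremum,
-- take their place. An exchange that preserves mean and variance alters the law by a multiple of
-- `(1 - X)³`; a third difference of a product of n smooth laws is O(n^(-2)), so n exchanges cost
-- O(1/n), less than the order n^(-1/2) of the law. Mean and variance of the law are no multiples of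
-- those of shifts and coins; therefore a formal factor `K`, quadratic in `1 - X`, carries the part
-- not yet matched. Every copy of the law is first shifted by 9, because the at most 21 coins that
-- match its variance have mean up to 21/2. The rational used for θ at index n must survive an n-th
-- power and a factor s² ≤ n², which fixes its accuracy at O(n^(-2)). Neither π nor a square root is
-- constructed for λ: with c_a the central probability of 2a coins, k c_a tends to the square root
-- of g/π when a is close to k²/g.

-- Ordered-field arithmetic of the rationals, natural numbers in it, and division

module RationalArithmetic where

 open import Data.Integer.Base using (-[1+_])
 import Data.Integer.Base as ℤ
 import Data.Integer.Properties as ℤ
 import Data.Nat.DivMod as ℕ
 open import Data.Rational.Base public
 import Data.Rational.Unnormalised.Base as ℚᵘ
 import Data.Rational.Unnormalised.Properties as ℚᵘ
 open import Level using (0ℓ)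
 open import Relation.Nullary.Decidable using (dec⇒maybe)
 import Tactic.RingSolver.Core.AlmostCommutativeRing as ACR

 open import Data.Rational.Properties public using (≤-trans; ≤-reflexive; +-identityʳ; +-mono-≤; ≤ᵇ⇒≤; <⇒≤; ≤-refl; +-monoʳ-≤; *-identityʳ; *-identityˡ; +-monoˡ-≤; +-identityˡ; *-zeroˡ; *-zeroʳ; *-comm; <-≤-trans; ≤-<-trans; *-assoc; ≤-total; +-inverseʳ; +-comm; +-assoc; *-distribˡ-+; neg-antimono-≤; ≰⇒>; module ≤-Reasoning)
   renaming (nonNegative⁻¹ to ≥0; positive⁻¹ to >0)

 ℚ-ring : ACR.AlmostCommutativeRing 0ℓ 0ℓ
 ℚ-ring = ACR.fromCommutativeRing ℚ.+-*-commutativeRing (λ x → dec⇒maybe (0ℚ ℚ.≟ x))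

 infixr 9 _^_
 _^_ : ℚ → ℕ → ℚ
 x ^ zero  = 1ℚ
 x ^ suc n = x * x ^ n

 <⇒≱ : ∀ {a b} → a < b → ¬ (b ≤ a)
 <⇒≱ p q = ℚ.<-irrefl refl (<-≤-trans p q)

 private
   +-diff : ∀ a b → a + (b - a) ≡ b
   +-diff = solve-∀ ℚ-ring

 0≤-diff : ∀ {a b} → a ≤ b → 0ℚ ≤ b - a
 0≤-diff {a} {b} h = subst (_≤ b - a) (+-inverseʳ a) (+-monoˡ-≤ (- a) h)

 -- Most inequalities below go through this certificate: the slack is written as a combination of
 -- visibly nonnegative terms, usually known differences with nonnegative multipliers, and the ring
 -- solver checks the identity.
 ≤-cert : ∀ {a b e} → 0ℚ ≤ e → e ≡ b - a → a ≤ b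
 ≤-cert {a} {b} h eq = subst₂ _≤_ (+-identityʳ a) (+-diff a b) (+-monoʳ-≤ a (subst (0ℚ ≤_) eq h))

 0<-diff : ∀ {a b} → a < b → 0ℚ < b - a
 0<-diff {a} {b} h = subst (_< b - a) (+-inverseʳ a) (ℚ.+-monoˡ-< (- a) h)

 <-cert : ∀ {a b e} → 0ℚ < e → e ≡ b - a → a < b
 <-cert {a} {b} h eq = subst₂ _<_ (+-identityʳ a) (+-diff a b) (ℚ.+-monoʳ-< a (subst (0ℚ <_) eq h))

 0≤+ : ∀ {a b} → 0ℚ ≤ a → 0ℚ ≤ b → 0ℚ ≤ a + b
 0≤+ = +-mono-≤

 0≤* : ∀ {a b} → 0ℚ ≤ a → 0ℚ ≤ b → 0ℚ ≤ a * b
 0≤* {a} {b} p q = subst (_≤ a * b) (*-zeroʳ a) (ℚ.*-monoˡ-≤-nonNeg a ⦃ nonNegative p ⦄ q)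

 0<* : ∀ {a b} → 0ℚ < a → 0ℚ < b → 0ℚ < a * b
 0<* {a} {b} p q = subst (_< a * b) (*-zeroʳ a) (ℚ.*-monoʳ-<-pos a ⦃ positive p ⦄ q)

 0<+ : ∀ {a b} → 0ℚ < a → 0ℚ ≤ b → 0ℚ < a + b
 0<+ = ℚ.+-mono-<-≤

 0≤1 : 0ℚ ≤ 1ℚ
 0≤1 = ≥0 1ℚ

 0<1 : 0ℚ < 1ℚ
 0<1 = >0 1ℚ

 *-mono-≤ : ∀ {a b c d} → 0ℚ ≤ a → 0ℚ ≤ c → a ≤ b → c ≤ d → a * c ≤ b * d
 *-mono-≤ {a} {b} {c} {d} 0≤a 0≤c a≤b c≤d = ≤-trans
   (ℚ.*-monoʳ-≤-nonNeg c ⦃ nonNegative 0≤c ⦄ a≤b)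
   (ℚ.*-monoˡ-≤-nonNeg b ⦃ nonNegative (≤-trans 0≤a a≤b) ⦄ c≤d)

 *-monoˡ : ∀ {a b c} → 0ℚ ≤ c → a ≤ b → c * a ≤ c * b
 *-monoˡ {c = c} 0≤c = ℚ.*-monoˡ-≤-nonNeg c ⦃ nonNegative 0≤c ⦄

 *-monoʳ : ∀ {a b c} → 0ℚ ≤ c → a ≤ b → a * c ≤ b * c
 *-monoʳ {c = c} 0≤c = ℚ.*-monoʳ-≤-nonNeg c ⦃ nonNegative 0≤c ⦄

 *-cancelˡ-≤ : ∀ {a b c} → 0ℚ < c → c * a ≤ c * b → a ≤ b
 *-cancelˡ-≤ {c = c} 0<c = ℚ.*-cancelˡ-≤-pos c ⦃ positive 0<c ⦄

 *-cancelˡ-< : ∀ {a b c} → 0ℚ < c → c * a < c * b → a < b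
 *-cancelˡ-< {c = c} 0<c = ℚ.*-cancelˡ-<-nonNeg c ⦃ nonNegative (<⇒≤ 0<c) ⦄

 ≤*⇒≤ : ∀ {a b} → 0ℚ ≤ a → 1ℚ ≤ b → a ≤ b * a
 ≤*⇒≤ {a} {b} 0≤a 1≤b = subst (_≤ b * a) (*-identityˡ a) (*-monoʳ 0≤a 1≤b)

 neg-sq : ∀ a → - a * - a ≡ a * a
 neg-sq = solve-∀ ℚ-ring

 0≤sq : ∀ a → 0ℚ ≤ a * a
 0≤sq a with ≤-total 0ℚ a
 ... | inj₁ h = 0≤* h h
 ... | inj₂ h = subst (0ℚ ≤_) (neg-sq a) (0≤* h′ h′)
   where h′ = neg-antimono-≤ h

 sq-cancel-≤ : ∀ {a b} → 0ℚ ≤ b → a * a ≤ b * b → a ≤ b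
 sq-cancel-≤ {a} {b} 0≤b h with a ℚ.≤? b
 ... | yes p = p
 ... | no ¬p = contradiction h (<⇒≱ (≤-<-trans
         (*-monoˡ 0≤b (<⇒≤ b<a))
         (ℚ.*-monoˡ-<-pos a ⦃ positive (≤-<-trans 0≤b b<a) ⦄ b<a)))
   where b<a = ≰⇒> ¬p

 ^-nonneg : ∀ {x} n → 0ℚ ≤ x → 0ℚ ≤ x ^ n
 ^-nonneg zero    h = 0≤1
 ^-nonneg (suc n) h = 0≤* h (^-nonneg n h)

 ^-pos : ∀ {x} n → 0ℚ < x → 0ℚ < x ^ n
 ^-pos zero    h = 0<1
 ^-pos (suc n) h = 0<* h (^-pos n h)

 ^-mono-≤ : ∀ {x y} n → 0ℚ ≤ x → x ≤ y → x ^ n ≤ y ^ n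
 ^-mono-≤ zero    0≤x x≤y = ≤-refl
 ^-mono-≤ (suc n) 0≤x x≤y = *-mono-≤ 0≤x (^-nonneg n 0≤x) x≤y (^-mono-≤ n 0≤x x≤y)

 private
   ^-+-step : ∀ x a b → x * (a * b) ≡ x * a * b
   ^-+-step = solve-∀ ℚ-ring
   ^-*-step : ∀ x y a b → x * y * (a * b) ≡ x * a * (y * b)
   ^-*-step = solve-∀ ℚ-ring

 ^-+ : ∀ x m n → x ^ (m ℕ.+ n) ≡ x ^ m * x ^ n
 ^-+ x zero    n = sym (*-identityˡ _)
 ^-+ x (suc m) n = trans (cong (x *_) (^-+ x m n)) (^-+-step x (x ^ m) (x ^ n))

 ^-distrib-* : ∀ x y n → (x * y) ^ n ≡ x ^ n * y ^ n
 ^-distrib-* x y zero    = refl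
 ^-distrib-* x y (suc n) = trans (cong (x * y *_) (^-distrib-* x y n)) (^-*-step x y (x ^ n) (y ^ n))

 1^ : ∀ n → 1ℚ ^ n ≡ 1ℚ
 1^ zero    = refl
 1^ (suc n) = trans (*-identityˡ _) (1^ n)

 ≤∣∣ : ∀ a → a ≤ ∣ a ∣
 ≤∣∣ a with ≤-total 0ℚ a
 ... | inj₁ h = ≤-reflexive (sym (ℚ.0≤p⇒∣p∣≡p h))
 ... | inj₂ h = ≤-trans h (ℚ.0≤∣p∣ a)

 ∣∣≤ : ∀ {a c} → a ≤ c → - a ≤ c → ∣ a ∣ ≤ c
 ∣∣≤ {a} h₁ h₂ with ℚ.∣p∣≡p∨∣p∣≡-p a
 ... | inj₁ e = subst (_≤ _) (sym e) h₁
 ... | inj₂ e = subst (_≤ _) (sym e) h₂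

 private
   neg-diff : ∀ a b → - (a - b) ≡ b - a
   neg-diff = solve-∀ ℚ-ring
   via : ∀ a b c → (a - b) + (b - c) ≡ a - c
   via = solve-∀ ℚ-ring
   plus-diff : ∀ a b e → b + e - a ≡ e - (a - b)
   plus-diff = solve-∀ ℚ-ring

 ∣-∣-sym : ∀ a b → ∣ a - b ∣ ≡ ∣ b - a ∣
 ∣-∣-sym a b = trans (sym (ℚ.∣-p∣≡∣p∣ (a - b))) (cong ∣_∣ (neg-diff a b))

 ∣-∣≤ : ∀ {a b e} → a ≤ b + e → b ≤ a + e → ∣ a - b ∣ ≤ e
 ∣-∣≤ {a} {b} {e} h₁ h₂ = ∣∣≤
   (≤-cert (0≤-diff h₁) (plus-diff a b e))
   (≤-cert (0≤-diff h₂) (trans (plus-diff b a e) (cong (λ z → e - z) (sym (neg-diff a b)))))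

 ∣-∣⇒≤ : ∀ {a b e} → ∣ a - b ∣ ≤ e → a ≤ b + e
 ∣-∣⇒≤ {a} {b} {e} h = ≤-cert (0≤-diff (≤-trans (≤∣∣ (a - b)) h)) (sym (plus-diff a b e))

 ∣-∣⇒≥ : ∀ {a b e} → ∣ a - b ∣ ≤ e → b ≤ a + e
 ∣-∣⇒≥ {a} {b} {e} h = ∣-∣⇒≤ (subst (_≤ e) (∣-∣-sym a b) h)

 ∣∣-tri : ∀ a b c → ∣ a - c ∣ ≤ ∣ a - b ∣ + ∣ b - c ∣
 ∣∣-tri a b c = subst (λ z → ∣ z ∣ ≤ ∣ a - b ∣ + ∣ b - c ∣) (via a b c) (ℚ.∣p+q∣≤∣p∣+∣q∣ (a - b) (b - c))

 abstract
   -- Abstract, so that the type checker does not normalise numerals and long products as fractions;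
   -- closed values are recovered through `ι≡`.
   ι : ℕ → ℚ
   ι n = + n / 1

   ι≡ : ∀ n → ι n ≡ + n / 1
   ι≡ n = refl

 private
   ≃-/1 : ∀ n → toℚᵘ (ι n) ℚᵘ.≃ (+ n ℚᵘ./ 1)
   ≃-/1 n = subst (λ z → toℚᵘ z ℚᵘ.≃ (+ n ℚᵘ./ 1)) (sym (ι≡ n)) (ℚ.toℚᵘ-fromℚᵘ (+ n ℚᵘ./ 1))

 ι-+ : ∀ m n → ι (m ℕ.+ n) ≡ ι m + ι n
 ι-+ m n = ℚ.toℚᵘ-injective (begin-equality
   toℚᵘ (ι (m ℕ.+ n))                  ≃⟨ ≃-/1 (m ℕ.+ n) ⟩
   + (m ℕ.+ n) ℚᵘ./ 1                  ≃⟨ ℚᵘ.*≡* (cong (ℤ._* + 1) (cong₂ ℤ._+_ (sym (ℤ.*-identityʳ (+ m))) (sym (ℤ.*-identityʳ (+ n))))) ⟩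
   (+ m ℚᵘ./ 1) ℚᵘ.+ (+ n ℚᵘ./ 1)      ≃⟨ ℚᵘ.+-cong (≃-/1 m) (≃-/1 n) ⟨
   toℚᵘ (ι m) ℚᵘ.+ toℚᵘ (ι n)          ≃⟨ ℚ.toℚᵘ-homo-+ (ι m) (ι n) ⟨
   toℚᵘ (ι m + ι n) ∎)
   where open ℚᵘ.≤-Reasoning

 ι-* : ∀ m n → ι (m ℕ.* n) ≡ ι m * ι n
 ι-* m n = ℚ.toℚᵘ-injective (begin-equality
   toℚᵘ (ι (m ℕ.* n))                  ≃⟨ ≃-/1 (m ℕ.* n) ⟩
   + (m ℕ.* n) ℚᵘ./ 1                  ≃⟨ ℚᵘ.*≡* (cong (ℤ._* + 1) (ℤ.pos-* m n)) ⟩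
   (+ m ℚᵘ./ 1) ℚᵘ.* (+ n ℚᵘ./ 1)      ≃⟨ ℚᵘ.*-cong (≃-/1 m) (≃-/1 n) ⟨
   toℚᵘ (ι m) ℚᵘ.* toℚᵘ (ι n)          ≃⟨ ℚ.toℚᵘ-homo-* (ι m) (ι n) ⟨
   toℚᵘ (ι m * ι n) ∎)
   where open ℚᵘ.≤-Reasoning

 ι-0 : ι 0 ≡ 0ℚ
 ι-0 = ι≡ 0

 ι-1 : ι 1 ≡ 1ℚ
 ι-1 = ι≡ 1

 ι-suc : ∀ n → ι (suc n) ≡ ι n + 1ℚ
 ι-suc n = trans (cong ι (ℕ.+-comm 1 n)) (trans (ι-+ n 1) (cong (λ z → ι n + z) ι-1))

 0≤ι : ∀ n → 0ℚ ≤ ι n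
 0≤ι zero    = ≤-reflexive (sym ι-0)
 0≤ι (suc n) = subst (0ℚ ≤_) (sym (ι-suc n)) (0≤+ (0≤ι n) 0≤1)

 ι-mono : ∀ {m n} → m ℕ.≤ n → ι m ≤ ι n
 ι-mono {m} h with ℕ.m≤n⇒∃[o]m+o≡n h
 ... | o , refl = subst₂ _≤_ (+-identityʳ (ι m)) (sym (ι-+ m o)) (+-monoʳ-≤ (ι m) (0≤ι o))

 0<ι : ∀ n → 0ℚ < ι (suc n)
 0<ι n = <-≤-trans (ℚ.<-respʳ-≡ (sym ι-1) 0<1) (ι-mono (s≤s z≤n))

 1≤ι : ∀ n → 1ℚ ≤ ι (suc n)
 1≤ι n = subst (_≤ ι (suc n)) ι-1 (ι-mono (s≤s z≤n))

 ι-mono-< : ∀ {m n} → m ℕ.< n → ι m < ι n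
 ι-mono-< {m} h = <-≤-trans
   (subst₂ _<_ (+-identityʳ (ι m)) (sym (ι-suc m)) (ℚ.+-monoʳ-< (ι m) 0<1)) (ι-mono h)

 ι-cancel-≤ : ∀ {m n} → ι m ≤ ι n → m ℕ.≤ n
 ι-cancel-≤ {m} {n} h with m ℕ.≤? n
 ... | yes p = p
 ... | no ¬p = contradiction h (<⇒≱ (ι-mono-< (ℕ.≰⇒> ¬p)))

 ι-cancel-< : ∀ {m n} → ι m < ι n → m ℕ.< n
 ι-cancel-< {m} {n} h with m ℕ.<? n
 ... | yes p = p
 ... | no ¬p = contradiction (ι-mono (ℕ.≮⇒≥ ¬p)) (<⇒≱ h)

 ι-^ : ∀ m n → ι (m ℕ.^ n) ≡ ι m ^ n
 ι-^ m zero    = ι-1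
 ι-^ m (suc n) = trans (ι-* m (m ℕ.^ n)) (cong (ι m *_) (ι-^ m n))

 -- A total inverse, with 0 ⁻¹ = 0

 infix 10 _⁻¹
 infixl 7 _÷′_

 abstract
   _⁻¹ : ℚ → ℚ
   x ⁻¹ with x ℚ.≟ 0ℚ
   ... | yes _  = 0ℚ
   ... | no x≢0 = (1/ x) ⦃ ≢-nonZero x≢0 ⦄

   *-⁻¹ : ∀ {x} → 0ℚ < x → x * x ⁻¹ ≡ 1ℚ
   *-⁻¹ {x} 0<x with x ℚ.≟ 0ℚ
   ... | yes x≡0 = contradiction (sym x≡0) (ℚ.<⇒≢ 0<x)
   ... | no x≢0  = ℚ.*-inverseʳ x ⦃ ≢-nonZero x≢0 ⦄

 _÷′_ : ℚ → ℚ → ℚ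
 x ÷′ y = x * y ⁻¹

 ⁻¹-* : ∀ {x} → 0ℚ < x → x ⁻¹ * x ≡ 1ℚ
 ⁻¹-* {x} h = trans (*-comm (x ⁻¹) x) (*-⁻¹ h)

 0<⁻¹ : ∀ {x} → 0ℚ < x → 0ℚ < x ⁻¹
 0<⁻¹ {x} h = *-cancelˡ-< h (subst₂ _<_ (sym (*-zeroʳ x)) (sym (*-⁻¹ h)) 0<1)

 0≤⁻¹ : ∀ {x} → 0ℚ < x → 0ℚ ≤ x ⁻¹
 0≤⁻¹ h = <⇒≤ (0<⁻¹ h)

 ⁻¹-unique : ∀ {x y} → 0ℚ < x → x * y ≡ 1ℚ → y ≡ x ⁻¹
 ⁻¹-unique {x} {y} h e = begin
   y ≡⟨ *-identityˡ y ⟨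
   1ℚ * y ≡⟨ cong (_* y) (⁻¹-* h) ⟨
   x ⁻¹ * x * y ≡⟨ *-assoc (x ⁻¹) x y ⟩
   x ⁻¹ * (x * y) ≡⟨ cong (x ⁻¹ *_) e ⟩
   x ⁻¹ * 1ℚ ≡⟨ *-identityʳ (x ⁻¹) ⟩
   x ⁻¹ ∎
   where open ≡-Reasoning

 ÷-≤ : ∀ {a b c} → 0ℚ < b → a ≤ c * b → a ÷′ b ≤ c
 ÷-≤ {a} {b} {c} h p = subst (a * b ⁻¹ ≤_)
   (trans (*-assoc c b (b ⁻¹)) (trans (cong (c *_) (*-⁻¹ h)) (*-identityʳ c)))
   (*-monoʳ (0≤⁻¹ h) p)

 ≤-÷ : ∀ {a b c} → 0ℚ < b → c * b ≤ a → c ≤ a ÷′ b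
 ≤-÷ {a} {b} {c} h p = subst (_≤ a * b ⁻¹)
   (trans (*-assoc c b (b ⁻¹)) (trans (cong (c *_) (*-⁻¹ h)) (*-identityʳ c)))
   (*-monoʳ (0≤⁻¹ h) p)

 ÷-* : ∀ {a b} → 0ℚ < b → a ÷′ b * b ≡ a
 ÷-* {a} {b} h = trans (*-assoc a (b ⁻¹) b) (trans (cong (a *_) (⁻¹-* h)) (*-identityʳ a))

 ⁻¹-anti : ∀ {x y} → 0ℚ < x → x ≤ y → y ⁻¹ ≤ x ⁻¹
 ⁻¹-anti {x} {y} 0<x x≤y = subst (_≤ x ⁻¹) (*-identityˡ (y ⁻¹))
   (÷-≤ 0<y (subst (_≤ x ⁻¹ * y) (⁻¹-* 0<x) (*-monoˡ (0≤⁻¹ 0<x) x≤y)))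
   where 0<y = <-≤-trans 0<x x≤y

 nat-floor : ∀ x → 0ℚ ≤ x → ∃[ n ] (ι n ≤ x × x < ι n + 1ℚ)
 nat-floor x@(mkℚ (+ p) d-1 _) _ = q , lower , upper
   where
   d = suc d-1
   q = p ℕ./ d
   r = p ℕ.% d
   0<d : 0ℚ < ι d
   0<d = 0<ι d-1
   x*d : x * ι d ≡ ι p
   x*d = ℚ.toℚᵘ-injective (begin-equality
     toℚᵘ (x * ι d)                   ≃⟨ ℚ.toℚᵘ-homo-* x (ι d) ⟩
     toℚᵘ x ℚᵘ.* toℚᵘ (ι d)           ≃⟨ ℚᵘ.*-cong (ℚᵘ.≃-refl {toℚᵘ x}) (≃-/1 d) ⟩
     (+ p ℚᵘ./ d) ℚᵘ.* (+ d ℚᵘ./ 1)   ≃⟨ ℚᵘ.*≡* (trans (ℤ.*-identityʳ (+ p ℤ.* + d)) (cong (λ z → + p ℤ.* + z) (sym (ℕ.*-identityʳ d)))) ⟩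
     + p ℚᵘ./ 1                       ≃⟨ ≃-/1 p ⟨
     toℚᵘ (ι p) ∎)
     where open ℚᵘ.≤-Reasoning
   comm : ι d * x ≡ ι p
   comm = trans (*-comm (ι d) x) x*d
   p≡ : p ≡ r ℕ.+ q ℕ.* d
   p≡ = ℕ.m≡m%n+[m/n]*n p d
   lower : ι q ≤ x
   lower = *-cancelˡ-≤ 0<d (subst₂ _≤_ (trans (ι-* q d) (*-comm (ι q) (ι d))) (sym comm)
     (ι-mono (subst (q ℕ.* d ℕ.≤_) (sym p≡) (ℕ.m≤n+m (q ℕ.* d) r))))
   upper : x < ι q + 1ℚ
   upper = *-cancelˡ-< 0<d (subst₂ _<_ (sym comm)
     (trans (ι-* (suc q) d) (trans (*-comm (ι (suc q)) (ι d)) (cong (ι d *_) (ι-suc q))))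
     (ι-mono-< (subst (ℕ._< suc q ℕ.* d) (sym p≡) (ℕ.+-monoˡ-< (q ℕ.* d) (ℕ.m%n<n p d)))))
 nat-floor (mkℚ -[1+ _ ] _ _) (*≤* ())

 archimedes : ∀ x → ∃[ n ] x < ι n
 archimedes x with ≤-total 0ℚ x
 ... | inj₂ x≤0 = 1 , ≤-<-trans x≤0 (0<ι 0)
 ... | inj₁ 0≤x with nat-floor x 0≤x
 ...   | n , _ , x<n+1 = suc n , subst (x <_) (sym (ι-suc n)) x<n+1

 /-≡ : ∀ a b .⦃ _ : ℕ.NonZero b ⦄ → (+ a / b) ≡ ι a * ι b ⁻¹
 /-≡ a b@(suc b-1) = trans (sym (*-identityʳ _)) (trans (cong (+ a / b *_) (sym (*-⁻¹ (0<ι b-1))))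
   (trans (sym (*-assoc (+ a / b) (ι b) (ι b ⁻¹))) (cong (_* ι b ⁻¹) eq)))
   where
   eq : (+ a / b) * ι b ≡ ι a
   eq = ℚ.toℚᵘ-injective (begin-equality
     toℚᵘ (+ a / b * ι b)                   ≃⟨ ℚ.toℚᵘ-homo-* (+ a / b) (ι b) ⟩
     toℚᵘ (+ a / b) ℚᵘ.* toℚᵘ (ι b)         ≃⟨ ℚᵘ.*-cong (ℚ.toℚᵘ-fromℚᵘ (+ a ℚᵘ./ b)) (≃-/1 b) ⟩
     (+ a ℚᵘ./ b) ℚᵘ.* (+ b ℚᵘ./ 1)         ≃⟨ ℚᵘ.*≡* (trans (ℤ.*-identityʳ (+ a ℤ.* + b)) (cong (λ z → + a ℤ.* + z) (sym (ℕ.*-identityʳ b)))) ⟩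
     + a ℚᵘ./ 1                             ≃⟨ ≃-/1 a ⟨
     toℚᵘ (ι a) ∎)
     where open ℚᵘ.≤-Reasoning

-- Formal power series over the rationals, with L1 and supremum bounds

module PowerSeries where

 open import Algebra.Bundles using (CommutativeRing)
 import Algebra.Solver.Ring as RingSolver
 import Algebra.Solver.Ring.AlmostCommutativeRing as ACR
 open import Level using (0ℓ)
 open import Relation.Nullary.Decidable using (dec⇒maybe)
 open import Data.Maybe.Base as Maybe using ()
 open RationalArithmetic

 PS : Set
 PS = ℕ → ℚ

 infix  4 _≤̇_
 infixl 6 _⊕_
 infixl 7 _⊛_
 infix  8 ⊖_

 tl : PS → PS
 tl f n = f (suc n)

 C : ℚ → PS
 C q zero    = q
 C q (suc n) = 0ℚ

 X : PS
 X zero    = 0ℚ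
 X (suc n) = C 1ℚ n

 _⊕_ : PS → PS → PS
 (f ⊕ g) n = f n + g n

 ⊖_ : PS → PS
 (⊖ f) n = - f n

 -- The Cauchy product by recursion on the degree, with the first factor split as `f 0` plus `X`
 -- times `tl f`; proofs about products follow the same recursion.
 _⊛_ : PS → PS → PS
 (f ⊛ g) zero    = f 0 * g 0
 (f ⊛ g) (suc n) = f 0 * g (suc n) + (tl f ⊛ g) n

 pow : PS → ℕ → PS
 pow f zero    = C 1ℚ
 pow f (suc n) = f ⊛ pow f n

 ⊛-cong : ∀ {f f′ g g′} → f ≗ f′ → g ≗ g′ → f ⊛ g ≗ f′ ⊛ g′
 ⊛-cong p q zero    = cong₂ _*_ (p 0) (q 0)
 ⊛-cong p q (suc n) = cong₂ _+_ (cong₂ _*_ (p 0) (q (suc n))) (⊛-cong (λ i → p (suc i)) q n)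

 ⊛-zeroˡ : ∀ f g → (∀ n → f n ≡ 0ℚ) → ∀ n → (f ⊛ g) n ≡ 0ℚ
 ⊛-zeroˡ f g p zero    = trans (cong (_* g 0) (p 0)) (*-zeroˡ (g 0))
 ⊛-zeroˡ f g p (suc n) = trans
   (cong₂ _+_ (trans (cong (_* g (suc n)) (p 0)) (*-zeroˡ (g (suc n)))) (⊛-zeroˡ (tl f) g (λ i → p (suc i)) n))
   (+-identityʳ 0ℚ)

 C-⊛ : ∀ q g n → (C q ⊛ g) n ≡ q * g n
 C-⊛ q g zero    = refl
 C-⊛ q g (suc n) = trans (cong (λ z → q * g (suc n) + z) (⊛-zeroˡ (tl (C q)) g (λ _ → refl) n)) (+-identityʳ _)

 private
   distr : ∀ a b x u v → (a + b) * x + (u + v) ≡ (a * x + u) + (b * x + v)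
   distr = solve-∀ ℚ-ring
   scaled : ∀ q a x u → q * a * x + q * u ≡ q * (a * x + u)
   scaled = solve-∀ ℚ-ring
   swap-mid : ∀ a b c → a + (b + c) ≡ b + (a + c)
   swap-mid = solve-∀ ℚ-ring
   assoc-step : ∀ a b x u v → a * b * x + (a * u + v) ≡ a * (b * x + u) + v
   assoc-step = solve-∀ ℚ-ring

 ⊛-distribʳ : ∀ h f g → (f ⊕ g) ⊛ h ≗ f ⊛ h ⊕ g ⊛ h
 ⊛-distribʳ h f g zero    = ℚ.*-distribʳ-+ (h 0) (f 0) (g 0)
 ⊛-distribʳ h f g (suc n) = trans
   (cong (λ z → (f 0 + g 0) * h (suc n) + z) (⊛-distribʳ h (tl f) (tl g) n))
   (distr (f 0) (g 0) (h (suc n)) ((tl f ⊛ h) n) ((tl g ⊛ h) n))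

 scale-⊛ : ∀ q f g n → ((λ i → q * f i) ⊛ g) n ≡ q * (f ⊛ g) n
 scale-⊛ q f g zero    = *-assoc q (f 0) (g 0)
 scale-⊛ q f g (suc n) = trans
   (cong (λ z → q * f 0 * g (suc n) + z) (scale-⊛ q (tl f) g n))
   (scaled q (f 0) (g (suc n)) ((tl f ⊛ g) n))

 ⊛-assoc : ∀ f g h → (f ⊛ g) ⊛ h ≗ f ⊛ (g ⊛ h)
 ⊛-assoc f g h zero    = *-assoc (f 0) (g 0) (h 0)
 ⊛-assoc f g h (suc n) = begin
   f 0 * g 0 * h (suc n) + (tl (f ⊛ g) ⊛ h) n
     ≡⟨ cong (λ z → f 0 * g 0 * h (suc n) + z) (⊛-distribʳ h (λ i → f 0 * tl g i) (tl f ⊛ g) n) ⟩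
   f 0 * g 0 * h (suc n) + (((λ i → f 0 * tl g i) ⊛ h) n + ((tl f ⊛ g) ⊛ h) n)
     ≡⟨ cong₂ (λ u v → f 0 * g 0 * h (suc n) + (u + v)) (scale-⊛ (f 0) (tl g) h n) (⊛-assoc (tl f) g h n) ⟩
   f 0 * g 0 * h (suc n) + (f 0 * (tl g ⊛ h) n + (tl f ⊛ (g ⊛ h)) n)
     ≡⟨ assoc-step (f 0) (g 0) (h (suc n)) _ _ ⟩
   f 0 * (g 0 * h (suc n) + (tl g ⊛ h) n) + (tl f ⊛ (g ⊛ h)) n ∎
   where open ≡-Reasoning

 ⊛-suc : ∀ f g n → (f ⊛ g) (suc n) ≡ f (suc n) * g 0 + (f ⊛ tl g) n
 ⊛-suc f g zero    = +-comm (f 0 * g 1) (f 1 * g 0)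
 ⊛-suc f g (suc n) = trans
   (cong (λ z → f 0 * g (suc (suc n)) + z) (⊛-suc (tl f) g n))
   (swap-mid (f 0 * g (suc (suc n))) (f (suc (suc n)) * g 0) ((tl f ⊛ tl g) n))

 ⊛-comm : ∀ f g → f ⊛ g ≗ g ⊛ f
 ⊛-comm f g zero    = *-comm (f 0) (g 0)
 ⊛-comm f g (suc n) = trans (⊛-suc f g n)
   (cong₂ _+_ (*-comm (f (suc n)) (g 0)) (⊛-comm f (tl g) n))

 ⊛-identityˡ : ∀ f → C 1ℚ ⊛ f ≗ f
 ⊛-identityˡ f n = trans (C-⊛ 1ℚ f n) (*-identityˡ (f n))

 PS-ring : CommutativeRing 0ℓ 0ℓ
 PS-ring = record
   { Carrier = PS ; _≈_ = _≗_ ; _+_ = _⊕_ ; _*_ = _⊛_ ; -_ = ⊖_ ; 0# = C 0ℚ ; 1# = C 1ℚ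
   ; isCommutativeRing = record
     { isRing = record
       { +-isAbelianGroup = record
         { isGroup = record
           { isMonoid = record
             { isSemigroup = record
               { isMagma = record
                 { isEquivalence = record { refl = λ _ → refl ; sym = λ p n → sym (p n) ; trans = λ p q n → trans (p n) (q n) }
                 ; ∙-cong = λ p q n → cong₂ _+_ (p n) (q n) }
               ; assoc = λ f g h n → +-assoc (f n) (g n) (h n) }
             ; identity = (λ f → zeroˡ f) , (λ f n → trans (+-comm (f n) (C 0ℚ n)) (zeroˡ f n)) }
           ; inverse = (λ f n → trans (ℚ.+-inverseˡ (f n)) (sym (C0 n))) , (λ f n → trans (+-inverseʳ (f n)) (sym (C0 n)))
           ; ⁻¹-cong = λ p n → cong -_ (p n) }
         ; comm = λ f g n → +-comm (f n) (g n) }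
       ; *-cong = ⊛-cong
       ; *-assoc = ⊛-assoc
       ; *-identity = ⊛-identityˡ , (λ f n → trans (⊛-comm f (C 1ℚ) n) (⊛-identityˡ f n))
       ; distrib = (λ f g h n → trans (⊛-comm f (g ⊕ h) n) (trans (⊛-distribʳ f g h n) (cong₂ _+_ (⊛-comm g f n) (⊛-comm h f n)))) , ⊛-distribʳ }
     ; *-comm = ⊛-comm } }
   where
   C0 : ∀ n → C 0ℚ n ≡ 0ℚ
   C0 zero    = refl
   C0 (suc n) = refl
   zeroˡ : ∀ f → C 0ℚ ⊕ f ≗ f
   zeroˡ f n = trans (cong (_+ f n) (C0 n)) (+-identityˡ (f n))

 open CommutativeRing PS-ring public using ()
   renaming (refl to ≗-refl; sym to ≗-sym; trans to ≗-trans; +-cong to ⊕-cong; setoid to PS-setoid; distribˡ to ⊛-distribˡ)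

 private
   C-homo-+ : ∀ p q → C (p + q) ≗ C p ⊕ C q
   C-homo-+ p q zero    = refl
   C-homo-+ p q (suc n) = refl
   C-homo-neg : ∀ p → C (- p) ≗ ⊖ C p
   C-homo-neg p zero    = refl
   C-homo-neg p (suc n) = refl

 C-homo-* : ∀ p q → C (p * q) ≗ C p ⊛ C q
 C-homo-* p q n = trans (helper n) (sym (C-⊛ p (C q) n))
   where
   helper : ∀ n → C (p * q) n ≡ p * C q n
   helper zero    = refl
   helper (suc n) = sym (*-zeroʳ p)

 PS-almost-ring : ACR.AlmostCommutativeRing 0ℓ 0ℓ
 PS-almost-ring = ACR.fromCommutativeRing PS-ring

 -- Rational constants become coefficients for the ring solver, so that identities of series with
 -- constants such as ½ are decided as polynomial identities.
 C-morphism : CommutativeRing.rawRing ℚ.+-*-commutativeRing ACR.-Raw-AlmostCommutative⟶ PS-almost-ring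
 C-morphism = record { ⟦_⟧ = C ; +-homo = C-homo-+ ; *-homo = C-homo-* ; -‿homo = C-homo-neg ; 0-homo = λ _ → refl ; 1-homo = λ _ → refl }

 C-≟ : ∀ p q → Maybe.Maybe (C p ≗ C q)
 C-≟ p q = Maybe.map (λ { refl _ → refl }) (dec⇒maybe (p ℚ.≟ q))

 module PS-Solver = RingSolver (CommutativeRing.rawRing ℚ.+-*-commutativeRing) PS-almost-ring C-morphism C-≟

 -- Multiplication by `1 - X` takes backward differences. It is also the expansion variable at
 -- `X = 1`, where the moments of a law appear as Taylor coefficients.
 D : PS
 D = C 1ℚ ⊕ ⊖ X

 pow-cong : ∀ {f g} n → f ≗ g → pow f n ≗ pow g n
 pow-cong zero    p = λ _ → refl
 pow-cong (suc n) p = ⊛-cong p (pow-cong n p)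

 pow-+ : ∀ f m n → pow f (m ℕ.+ n) ≗ pow f m ⊛ pow f n
 pow-+ f zero    n = ≗-sym (⊛-identityˡ (pow f n))
 pow-+ f (suc m) n = ≗-trans (⊛-cong (≗-refl {f}) (pow-+ f m n)) (≗-sym (⊛-assoc f (pow f m) (pow f n)))

 X-⊛-suc : ∀ f n → (X ⊛ f) (suc n) ≡ f n
 X-⊛-suc f n = trans (cong (_+ (tl X ⊛ f) n) (*-zeroˡ (f (suc n)))) (trans (+-identityˡ _)
   (⊛-identityˡ f n))

 X-⊛-zero : ∀ f → (X ⊛ f) 0 ≡ 0ℚ
 X-⊛-zero f = *-zeroˡ (f 0)

 powX-⊛ : ∀ k f n → (pow X k ⊛ f) (k ℕ.+ n) ≡ f n
 powX-⊛ zero    f n = ⊛-identityˡ f n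
 powX-⊛ (suc k) f n = trans (⊛-assoc X (pow X k) f (suc k ℕ.+ n)) (trans (X-⊛-suc (pow X k ⊛ f) (k ℕ.+ n)) (powX-⊛ k f n))

 powX-⊛-< : ∀ k f n → n ℕ.< k → (pow X k ⊛ f) n ≡ 0ℚ
 powX-⊛-< (suc k) f zero    _         = trans (⊛-assoc X (pow X k) f 0) (X-⊛-zero (pow X k ⊛ f))
 powX-⊛-< (suc k) f (suc n) (s≤s n<k) = trans (⊛-assoc X (pow X k) f (suc n)) (trans (X-⊛-suc (pow X k ⊛ f) n) (powX-⊛-< k f n n<k))

 _≤̇_ : PS → PS → Set
 f ≤̇ g = ∀ n → f n ≤ g n

 Nonneg : PS → Set
 Nonneg f = ∀ n → 0ℚ ≤ f n

 Nonneg-C : ∀ {q} → 0ℚ ≤ q → Nonneg (C q)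
 Nonneg-C h zero    = h
 Nonneg-C h (suc n) = ≤-refl

 Nonneg-X : Nonneg X
 Nonneg-X zero    = ≤-refl
 Nonneg-X (suc n) = Nonneg-C 0≤1 n

 Nonneg-⊕ : ∀ {f g} → Nonneg f → Nonneg g → Nonneg (f ⊕ g)
 Nonneg-⊕ p q n = 0≤+ (p n) (q n)

 Nonneg-⊛ : ∀ {f g} → Nonneg f → Nonneg g → Nonneg (f ⊛ g)
 Nonneg-⊛ p q zero    = 0≤* (p 0) (q 0)
 Nonneg-⊛ p q (suc n) = 0≤+ (0≤* (p 0) (q (suc n))) (Nonneg-⊛ (λ i → p (suc i)) q n)

 Nonneg-pow : ∀ {f} n → Nonneg f → Nonneg (pow f n)
 Nonneg-pow zero    p = Nonneg-C 0≤1
 Nonneg-pow (suc n) p = Nonneg-⊛ p (Nonneg-pow n p)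

 ⊛-mono : ∀ {f f′ g g′} → Nonneg f → Nonneg g → f ≤̇ f′ → g ≤̇ g′ → f ⊛ g ≤̇ f′ ⊛ g′
 ⊛-mono p q u v zero    = *-mono-≤ (p 0) (q 0) (u 0) (v 0)
 ⊛-mono p q u v (suc n) = +-mono-≤ (*-mono-≤ (p 0) (q (suc n)) (u 0) (v (suc n)))
   (⊛-mono (λ i → p (suc i)) q (λ i → u (suc i)) v n)

 -- Low coefficients of a product involve only low coefficients of the factors. Truncated and
 -- complete laws are compared through this.
 ⊛-mono-upTo : ∀ {f f′ g g′} N → Nonneg f → Nonneg g → (∀ i → i ℕ.≤ N → f i ≤ f′ i) → (∀ i → i ℕ.≤ N → g i ≤ g′ i) →
     ∀ i → i ℕ.≤ N → (f ⊛ g) i ≤ (f′ ⊛ g′) i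
 ⊛-mono-upTo N p q u v zero    h = *-mono-≤ (p 0) (q 0) (u 0 h) (v 0 h)
 ⊛-mono-upTo (suc N) p q u v (suc n) (s≤s h) = +-mono-≤
   (*-mono-≤ (p 0) (q (suc n)) (u 0 z≤n) (v (suc n) (s≤s h)))
   (⊛-mono-upTo N (λ i → p (suc i)) q (λ i i≤ → u (suc i) (s≤s i≤)) (λ i i≤ → v i (ℕ.m≤n⇒m≤1+n i≤)) n h)

 S : PS → ℕ → ℚ
 S f zero    = 0ℚ
 S f (suc n) = f 0 + S (tl f) n

 S-cong : ∀ {f g} n → f ≗ g → S f n ≡ S g n
 S-cong zero    p = refl
 S-cong (suc n) p = cong₂ _+_ (p 0) (S-cong n (λ i → p (suc i)))

 S-mono : ∀ {f g} n → f ≤̇ g → S f n ≤ S g n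
 S-mono zero    p = ≤-refl
 S-mono (suc n) p = +-mono-≤ (p 0) (S-mono n (λ i → p (suc i)))

 S-nonneg : ∀ {f} n → Nonneg f → 0ℚ ≤ S f n
 S-nonneg zero    p = ≤-refl
 S-nonneg (suc n) p = 0≤+ (p 0) (S-nonneg n (λ i → p (suc i)))

 private
   interchange : ∀ a b c d → (a + b) + (c + d) ≡ (a + c) + (b + d)
   interchange = solve-∀ ℚ-ring

 S-⊕ : ∀ f g n → S (f ⊕ g) n ≡ S f n + S g n
 S-⊕ f g zero    = refl
 S-⊕ f g (suc n) = trans (cong (λ z → f 0 + g 0 + z) (S-⊕ (tl f) (tl g) n)) (interchange (f 0) (g 0) _ _)

 S-scale : ∀ q f n → S (λ i → q * f i) n ≡ q * S f n
 S-scale q f zero    = sym (*-zeroʳ q)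
 S-scale q f (suc n) = trans (cong (λ z → q * f 0 + z) (S-scale q (tl f) n)) (sym (*-distribˡ-+ q (f 0) _))

 S-last : ∀ f n → S f (suc n) ≡ S f n + f n
 S-last f zero    = +-comm (f 0) 0ℚ
 S-last f (suc n) = trans (cong (λ z → f 0 + z) (S-last (tl f) n)) (sym (+-assoc (f 0) _ _))

 S-+ : ∀ f m n → S f (m ℕ.+ n) ≡ S f m + S (λ i → f (m ℕ.+ i)) n
 S-+ f zero    n = sym (+-identityˡ _)
 S-+ f (suc m) n = trans (cong (λ z → f 0 + z) (S-+ (tl f) m n)) (sym (+-assoc (f 0) _ _))

 S-mono-n : ∀ {f m n} → Nonneg f → m ℕ.≤ n → S f m ≤ S f n
 S-mono-n {f} {m} p h with ℕ.m≤n⇒∃[o]m+o≡n h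
 ... | o , refl = subst₂ _≤_ (+-identityʳ _) (sym (S-+ f m o)) (+-monoʳ-≤ (S f m) (S-nonneg o (λ i → p (m ℕ.+ i))))

 term≤S : ∀ {f} n → Nonneg f → f n ≤ S f (suc n)
 term≤S {f} n p = subst₂ _≤_ (+-identityˡ (f n)) (sym (S-last f n)) (+-monoˡ-≤ (f n) (S-nonneg n p))

 S-zero : ∀ f n → (∀ i → f i ≡ 0ℚ) → S f n ≡ 0ℚ
 S-zero f zero    p = refl
 S-zero f (suc n) p = trans (cong₂ _+_ (p 0) (S-zero (tl f) n (λ i → p (suc i)))) (+-identityʳ 0ℚ)

 -- On the left stand the products `f i * g j` with `i + j < n`, on the right all those with `i < n`
 -- and `j < n`.
 S-⊛-≤ : ∀ {f g} n → Nonneg f → Nonneg g → S (f ⊛ g) n ≤ S f n * S g n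
 S-⊛-≤ {f} {g} zero    p q = ≤-reflexive (sym (*-zeroʳ 0ℚ))
 S-⊛-≤ {f} {g} (suc n) p q = begin
   f 0 * g 0 + S (tl (f ⊛ g)) n ≡⟨ cong (λ z → f 0 * g 0 + z) (S-⊕ (λ i → f 0 * g (suc i)) (tl f ⊛ g) n) ⟩
   f 0 * g 0 + (S (λ i → f 0 * tl g i) n + S (tl f ⊛ g) n) ≡⟨ cong (λ z → f 0 * g 0 + (z + S (tl f ⊛ g) n)) (S-scale (f 0) (tl g) n) ⟩
   f 0 * g 0 + (f 0 * S (tl g) n + S (tl f ⊛ g) n) ≤⟨ +-monoʳ-≤ (f 0 * g 0) (+-monoʳ-≤ (f 0 * S (tl g) n)
       (≤-trans (S-⊛-≤ n p′ q) (*-monoˡ (S-nonneg n p′) (S-mono-n q (ℕ.n≤1+n n))))) ⟩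
   f 0 * g 0 + (f 0 * S (tl g) n + S (tl f) n * S g (suc n)) ≡⟨ collect (f 0) (g 0) (S (tl g) n) (S (tl f) n) ⟩
   S f (suc n) * S g (suc n) ∎
   where
   open ≤-Reasoning
   p′ = λ i → p (suc i)
   collect : ∀ a b c d → a * b + (a * c + d * (b + c)) ≡ (a + d) * (b + c)
   collect = solve-∀ ℚ-ring

 abs : PS → PS
 abs f n = ∣ f n ∣

 Nonneg-abs : ∀ f → Nonneg (abs f)
 Nonneg-abs f n = ℚ.0≤∣p∣ (f n)

 abs-⊛ : ∀ f g → abs (f ⊛ g) ≤̇ abs f ⊛ abs g
 abs-⊛ f g zero    = ≤-reflexive (ℚ.∣p*q∣≡∣p∣*∣q∣ (f 0) (g 0))
 abs-⊛ f g (suc n) = ≤-trans (ℚ.∣p+q∣≤∣p∣+∣q∣ (f 0 * g (suc n)) ((tl f ⊛ g) n))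
   (+-mono-≤ (≤-reflexive (ℚ.∣p*q∣≡∣p∣*∣q∣ (f 0) (g (suc n)))) (abs-⊛ (tl f) g n))

 abs-nonneg : ∀ {f} → Nonneg f → abs f ≗ f
 abs-nonneg p n = ℚ.0≤p⇒∣p∣≡p (p n)

 -- Norms appear only as upper bounds for partial sums and for coefficients, so that no infinite sum
 -- has to exist.
 L1 Sup : PS → ℚ → Set
 L1 f c = ∀ n → S (abs f) n ≤ c
 Sup f c = ∀ n → ∣ f n ∣ ≤ c

 L1-cong : ∀ {f g c} → f ≗ g → L1 f c → L1 g c
 L1-cong {c = c} p h n = subst (_≤ c) (S-cong n (λ i → cong ∣_∣ (p i))) (h n)

 Sup-cong : ∀ {f g c} → f ≗ g → Sup f c → Sup g c
 Sup-cong {c = c} p h n = subst (λ z → ∣ z ∣ ≤ c) (p n) (h n)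

 L1-≥0 : ∀ {f c} → L1 f c → 0ℚ ≤ c
 L1-≥0 h = h 0

 Sup-≥0 : ∀ {f c} → Sup f c → 0ℚ ≤ c
 Sup-≥0 {f} h = ≤-trans (ℚ.0≤∣p∣ (f 0)) (h 0)

 L1-mono : ∀ {f c d} → c ≤ d → L1 f c → L1 f d
 L1-mono p h n = ≤-trans (h n) p

 Sup-mono : ∀ {f c d} → c ≤ d → Sup f c → Sup f d
 Sup-mono p h n = ≤-trans (h n) p

 L1-⊛ : ∀ {f g a b} → L1 f a → L1 g b → L1 (f ⊛ g) (a * b)
 L1-⊛ {f} {g} p q n = ≤-trans (S-mono n (abs-⊛ f g)) (≤-trans (S-⊛-≤ n (Nonneg-abs f) (Nonneg-abs g))
   (*-mono-≤ (S-nonneg n (Nonneg-abs f)) (S-nonneg n (Nonneg-abs g)) (p n) (q n)))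

 L1-⊕ : ∀ {f g a b} → L1 f a → L1 g b → L1 (f ⊕ g) (a + b)
 L1-⊕ {f} {g} p q n = ≤-trans (S-mono n (λ i → ℚ.∣p+q∣≤∣p∣+∣q∣ (f i) (g i)))
   (≤-trans (≤-reflexive (S-⊕ (abs f) (abs g) n)) (+-mono-≤ (p n) (q n)))

 L1-⊖ : ∀ {f a} → L1 f a → L1 (⊖ f) a
 L1-⊖ {f} {a} p n = subst (_≤ a) (S-cong n (λ i → sym (ℚ.∣-p∣≡∣p∣ (f i)))) (p n)

 L1-C : ∀ q → L1 (C q) ∣ q ∣
 L1-C q zero    = ℚ.0≤∣p∣ q
 L1-C q (suc n) = ≤-reflexive (trans (cong (λ z → ∣ q ∣ + z) (S-zero (λ i → ∣ C q (suc i) ∣) n (λ _ → refl))) (+-identityʳ ∣ q ∣))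

 L1-X : L1 X 1ℚ
 L1-X zero    = 0≤1
 L1-X (suc n) = ≤-trans (≤-reflexive (+-identityˡ _)) (L1-C 1ℚ n)

 L1-pow1 : ∀ {f} n → L1 f 1ℚ → L1 (pow f n) 1ℚ
 L1-pow1 zero    h = L1-C 1ℚ
 L1-pow1 (suc n) h = L1-⊛ h (L1-pow1 n h)

 -- Young's inequality for convolutions. In a product of laws it lets some factors absorb a
 -- difference, measured in L1, while a last one contributes its maximum.
 Sup-⊛ : ∀ {f g a b} → L1 f a → Sup g b → Sup (f ⊛ g) (a * b)
 Sup-⊛ {f} {g} {a} {b} p q n = ≤-trans (bound f n) (*-monoʳ (Sup-≥0 q) (p (suc n)))
   where
   bound : ∀ f n → ∣ (f ⊛ g) n ∣ ≤ S (abs f) (suc n) * b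
   bound f zero    = ≤-trans (≤-reflexive (trans (ℚ.∣p*q∣≡∣p∣*∣q∣ (f 0) (g 0)) (cong (_* ∣ g 0 ∣) (sym (+-identityʳ ∣ f 0 ∣)))))
     (*-monoˡ (0≤+ (ℚ.0≤∣p∣ (f 0)) ≤-refl) (q 0))
   bound f (suc n) = begin
     ∣ f 0 * g (suc n) + (tl f ⊛ g) n ∣ ≤⟨ ℚ.∣p+q∣≤∣p∣+∣q∣ (f 0 * g (suc n)) ((tl f ⊛ g) n) ⟩
     ∣ f 0 * g (suc n) ∣ + ∣ (tl f ⊛ g) n ∣ ≤⟨ +-mono-≤ (≤-reflexive (ℚ.∣p*q∣≡∣p∣*∣q∣ (f 0) (g (suc n)))) (bound (tl f) n) ⟩
     ∣ f 0 ∣ * ∣ g (suc n) ∣ + S (abs (tl f)) (suc n) * b ≤⟨ +-monoˡ-≤ _ (*-monoˡ (ℚ.0≤∣p∣ (f 0)) (q (suc n))) ⟩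
     ∣ f 0 ∣ * b + S (abs (tl f)) (suc n) * b ≡⟨ ℚ.*-distribʳ-+ b ∣ f 0 ∣ _ ⟨
     S (abs f) (suc (suc n)) * b ∎
     where open ≤-Reasoning

 Sup-⊕ : ∀ {f g a b} → Sup f a → Sup g b → Sup (f ⊕ g) (a + b)
 Sup-⊕ {f} {g} p q n = ≤-trans (ℚ.∣p+q∣≤∣p∣+∣q∣ (f n) (g n)) (+-mono-≤ (p n) (q n))

 L1⇒Sup : ∀ {f c} → L1 f c → Sup f c
 L1⇒Sup {f} h n = ≤-trans (term≤S n (Nonneg-abs f)) (h (suc n))

 -- The series f(xX). With x close to θ it turns the coefficients of the series W of the
 -- representations into a probability law.
 weight : ℚ → PS → PS
 weight x f n = f n * x ^ n

 private
   weight-step : ∀ a b x xs u → (a * b) * (x * xs) + x * (u * xs) ≡ (a * b + u) * (x * xs)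
   weight-step = solve-∀ ℚ-ring
   weight-step′ : ∀ a b xs → a * 1ℚ * (b * xs) ≡ a * b * xs
   weight-step′ = solve-∀ ℚ-ring
   rearr : ∀ x u xs → u * (x * xs) ≡ x * (u * xs)
   rearr = solve-∀ ℚ-ring

 weight-⊛ : ∀ x f g → weight x (f ⊛ g) ≗ weight x f ⊛ weight x g
 weight-⊛ x f g zero    = sym (weight-step′ (f 0) (g 0) 1ℚ)
 weight-⊛ x f g (suc n) = sym (trans
   (cong₂ _+_ (weight-step′ (f 0) (g (suc n)) (x * x ^ n))
     (trans (⊛-cong (λ i → rearr x (f (suc i)) (x ^ i)) (λ _ → refl) n)
       (trans (scale-⊛ x (weight x (tl f)) (weight x g) n) (cong (x *_) (sym (weight-⊛ x (tl f) g n))))))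
   (weight-step (f 0) (g (suc n)) x (x ^ n) ((tl f ⊛ g) n)))

 weight-pow : ∀ x f k → weight x (pow f k) ≗ pow (weight x f) k
 weight-pow x f zero    zero    = refl
 weight-pow x f zero    (suc n) = *-zeroˡ (x * x ^ n)
 weight-pow x f (suc k) n = trans (weight-⊛ x f (pow f k) n) (⊛-cong (λ _ → refl) (weight-pow x f k) n)

 Nonneg-weight : ∀ {x f} → 0ℚ ≤ x → Nonneg f → Nonneg (weight x f)
 Nonneg-weight 0≤x p n = 0≤* (p n) (^-nonneg n 0≤x)

 -- The Euler operator X d/dX. On exponential generating functions it marks one labelled element.
 θ : PS → PS
 θ f n = ι n * f n

 private
   leib : ∀ k a b u v w → k * (a * b) + a * b + (u + w + v) ≡ (u + v) + (a * ((k + 1ℚ) * b) + w)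
   leib = solve-∀ ℚ-ring
   θ-tl : ∀ k a → (k + 1ℚ) * a ≡ k * a + a
   θ-tl = solve-∀ ℚ-ring
   0*0 : ∀ a b → 0ℚ * (a * b) ≡ 0ℚ * a * b + a * (0ℚ * b)
   0*0 = solve-∀ ℚ-ring
   0*a*b : ∀ a b u → 0ℚ * a * b + u ≡ u
   0*a*b = solve-∀ ℚ-ring
   expand : ∀ k a b u → (k + 1ℚ) * (a * b + u) ≡ k * (a * b) + a * b + (k * u + u)
   expand = solve-∀ ℚ-ring

 θ-⊛ : ∀ f g → θ (f ⊛ g) ≗ θ f ⊛ g ⊕ f ⊛ θ g
 θ-⊛ f g zero    = subst (λ z → z * (f 0 * g 0) ≡ z * f 0 * g 0 + f 0 * (z * g 0)) (sym ι-0) (0*0 (f 0) (g 0))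
 θ-⊛ f g (suc n) = begin
   ι (suc n) * (f 0 * g (suc n) + (tl f ⊛ g) n)
     ≡⟨ cong (_* (f 0 * g (suc n) + (tl f ⊛ g) n)) (ι-suc n) ⟩
   (ι n + 1ℚ) * (f 0 * g (suc n) + (tl f ⊛ g) n)
     ≡⟨ expand (ι n) (f 0) (g (suc n)) _ ⟩
   ι n * (f 0 * g (suc n)) + f 0 * g (suc n) + (ι n * (tl f ⊛ g) n + (tl f ⊛ g) n)
     ≡⟨ cong (λ z → ι n * (f 0 * g (suc n)) + f 0 * g (suc n) + (z + (tl f ⊛ g) n)) (θ-⊛ (tl f) g n) ⟩
   ι n * (f 0 * g (suc n)) + f 0 * g (suc n) + ((θ (tl f) ⊛ g) n + (tl f ⊛ θ g) n + (tl f ⊛ g) n)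
     ≡⟨ leib (ι n) (f 0) (g (suc n)) ((θ (tl f) ⊛ g) n) ((tl f ⊛ g) n) ((tl f ⊛ θ g) n) ⟩
   ((θ (tl f) ⊛ g) n + (tl f ⊛ g) n) + (f 0 * ((ι n + 1ℚ) * g (suc n)) + (tl f ⊛ θ g) n)
     ≡⟨ cong₂ _+_ left (cong (λ z → f 0 * (z * g (suc n)) + (tl f ⊛ θ g) n) (sym (ι-suc n))) ⟩
   (θ f ⊛ g) (suc n) + (f ⊛ θ g) (suc n) ∎
   where
   open ≡-Reasoning
   left : (θ (tl f) ⊛ g) n + (tl f ⊛ g) n ≡ (θ f ⊛ g) (suc n)
   left = begin
     (θ (tl f) ⊛ g) n + (tl f ⊛ g) n
       ≡⟨ ⊛-distribʳ g (θ (tl f)) (tl f) n ⟨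
     ((θ (tl f) ⊕ tl f) ⊛ g) n
       ≡⟨ ⊛-cong (λ i → trans (sym (θ-tl (ι i) (f (suc i)))) (cong (_* f (suc i)) (sym (ι-suc i)))) (λ _ → refl) n ⟩
     (tl (θ f) ⊛ g) n
       ≡⟨ 0*a*b (f 0) (g (suc n)) _ ⟨
     0ℚ * f 0 * g (suc n) + (tl (θ f) ⊛ g) n
       ≡⟨ cong (λ z → z * f 0 * g (suc n) + (tl (θ f) ⊛ g) n) (sym ι-0) ⟩
     (θ f ⊛ g) (suc n) ∎

-- Symmetric binomial laws: unimodality and central probabilities

module Coins where

 open import Data.Nat.Base using (⌊_/2⌋; ⌈_/2⌉)
 open RationalArithmetic
 open PowerSeries
 open PS-Solver using (_:+_; _:*_; :-_; _:=_; con) renaming (solve to PS-solve)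

 B : PS
 B = C ½ ⊛ (C 1ℚ ⊕ X)

 -- The law of the number of heads among `t` fair coins: binomial coefficients divided by 2ᵗ.
 coin : ℕ → PS
 coin t = pow B t

 B-⊛-suc : ∀ f n → (B ⊛ f) (suc n) ≡ ½ * (f n + f (suc n))
 B-⊛-suc f n = begin
   (B ⊛ f) (suc n) ≡⟨ ⊛-assoc (C ½) (C 1ℚ ⊕ X) f (suc n) ⟩
   (C ½ ⊛ ((C 1ℚ ⊕ X) ⊛ f)) (suc n) ≡⟨ C-⊛ ½ ((C 1ℚ ⊕ X) ⊛ f) (suc n) ⟩
   ½ * ((C 1ℚ ⊕ X) ⊛ f) (suc n) ≡⟨ cong (½ *_) (⊛-distribʳ f (C 1ℚ) X (suc n)) ⟩
   ½ * ((C 1ℚ ⊛ f) (suc n) + (X ⊛ f) (suc n)) ≡⟨ cong (½ *_) (cong₂ _+_ (⊛-identityˡ f (suc n)) (X-⊛-suc f n)) ⟩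
   ½ * (f (suc n) + f n) ≡⟨ cong (½ *_) (+-comm (f (suc n)) (f n)) ⟩
   ½ * (f n + f (suc n)) ∎
   where open ≡-Reasoning

 Nonneg-B : Nonneg B
 Nonneg-B = Nonneg-⊛ (Nonneg-C (≥0 ½)) (Nonneg-⊕ (Nonneg-C 0≤1) Nonneg-X)

 L1-B : L1 B 1ℚ
 L1-B = L1-⊛ (L1-C ½) (L1-⊕ (L1-C 1ℚ) L1-X)

 D-⊛-zero : ∀ f → (D ⊛ f) 0 ≡ f 0
 D-⊛-zero f = *-identityˡ (f 0)

 D-⊛-suc : ∀ f n → (D ⊛ f) (suc n) ≡ f (suc n) - f n
 D-⊛-suc f n = begin
   (D ⊛ f) (suc n) ≡⟨ PS-solve 2 (λ x f → (con 1ℚ :+ :- x) :* f := f :+ :- (x :* f)) ≗-refl X f (suc n) ⟩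
   f (suc n) + - (X ⊛ f) (suc n) ≡⟨ cong (λ z → f (suc n) - z) (X-⊛-suc f n) ⟩
   f (suc n) - f n ∎
   where open ≡-Reasoning

 L1-D : L1 D (+ 2 / 1)
 L1-D = L1-⊕ (L1-C 1ℚ) (L1-⊖ L1-X)

 private
   base-0 : ∀ x → x * 0ℚ ≡ (0ℚ - 0ℚ) * 1ℚ
   base-0 = solve-∀ ℚ-ring
   base-s : ∀ x k → x * 0ℚ ≡ (0ℚ - k) * 0ℚ
   base-s = solve-∀ ℚ-ring
   step-0 : ∀ t b₀ → 1ℚ * (½ * (b₀ + (t - 0ℚ) * b₀)) ≡ (t + 1ℚ - 0ℚ) * (½ * b₀)
   step-0 = solve-∀ ℚ-ring
   step-1 : ∀ t k b₀ b₁ b₂ → (k + 1ℚ + 1ℚ) * b₂ ≡ (t - (k + 1ℚ)) * b₁ → (k + 1ℚ) * b₁ ≡ (t - k) * b₀ →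
     (k + 1ℚ + 1ℚ) * (½ * (b₁ + b₂)) ≡ (t + 1ℚ - (k + 1ℚ)) * (½ * (b₀ + b₁))
   step-1 t k b₀ b₁ b₂ e₁ e₂ = trans (r₁ k b₁ b₂) (trans (cong (λ z → ½ * ((k + 1ℚ + 1ℚ) * b₁ + z)) e₁)
     (trans (r₂ t k b₁) (trans (cong (λ z → ½ * (z + (t - k) * b₁)) e₂) (r₃ t k b₀ b₁))))
     where
     r₁ : ∀ k b₁ b₂ → (k + 1ℚ + 1ℚ) * (½ * (b₁ + b₂)) ≡ ½ * ((k + 1ℚ + 1ℚ) * b₁ + (k + 1ℚ + 1ℚ) * b₂)
     r₁ = solve-∀ ℚ-ring
     r₂ : ∀ t k b₁ → ½ * ((k + 1ℚ + 1ℚ) * b₁ + (t - (k + 1ℚ)) * b₁) ≡ ½ * ((k + 1ℚ) * b₁ + (t - k) * b₁)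
     r₂ = solve-∀ ℚ-ring
     r₃ : ∀ t k b₀ b₁ → ½ * ((t - k) * b₀ + (t - k) * b₁) ≡ (t + 1ℚ - (k + 1ℚ)) * (½ * (b₀ + b₁))
     r₃ = solve-∀ ℚ-ring

 -- The ratio of neighbouring binomial coefficients, from Pascal's rule by induction on `t`. It
 -- stands in for closed formulas: comparing t - k with k + 1 decides where the law rises and where
 -- it falls.
 coin-step : ∀ t k → ι (suc k) * coin t (suc k) ≡ (ι t - ι k) * coin t k
 coin-step zero    zero    = trans (base-0 (ι 1)) (cong (λ z → (z - z) * 1ℚ) (sym ι-0))
 coin-step zero    (suc k) = trans (base-s (ι (suc (suc k))) (ι (suc k))) (cong (λ z → (z - ι (suc k)) * 0ℚ) (sym ι-0))
 coin-step (suc t) zero    = begin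
   ι 1 * coin (suc t) 1 ≡⟨ cong₂ _*_ ι-1 (B-⊛-suc (coin t) 0) ⟩
   1ℚ * (½ * (coin t 0 + coin t 1)) ≡⟨ cong (λ z → 1ℚ * (½ * (coin t 0 + z))) ih ⟩
   1ℚ * (½ * (coin t 0 + (ι t - 0ℚ) * coin t 0)) ≡⟨ step-0 (ι t) (coin t 0) ⟩
   (ι t + 1ℚ - 0ℚ) * (½ * coin t 0) ≡⟨ cong₂ (λ u v → (u - v) * (½ * coin t 0)) (sym (ι-suc t)) (sym ι-0) ⟩
   (ι (suc t) - ι 0) * coin (suc t) 0 ∎
   where
   open ≡-Reasoning
   ih : coin t 1 ≡ (ι t - 0ℚ) * coin t 0
   ih = trans (sym (*-identityˡ (coin t 1))) (trans (cong (_* coin t 1) (sym ι-1))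
     (trans (coin-step t 0) (cong (λ z → (ι t - z) * coin t 0) ι-0)))
 coin-step (suc t) (suc k) = begin
   ι (suc (suc k)) * coin (suc t) (suc (suc k))
     ≡⟨ cong₂ _*_ eqk2 (B-⊛-suc (coin t) (suc k)) ⟩
   (ι k + 1ℚ + 1ℚ) * (½ * (coin t (suc k) + coin t (suc (suc k))))
     ≡⟨ step-1 (ι t) (ι k) (coin t k) (coin t (suc k)) (coin t (suc (suc k)))
          (subst₂ (λ u v → u * coin t (suc (suc k)) ≡ (ι t - v) * coin t (suc k)) eqk2 (ι-suc k) (coin-step t (suc k)))
          (subst (λ u → u * coin t (suc k) ≡ (ι t - ι k) * coin t k) (ι-suc k) (coin-step t k)) ⟩
   (ι t + 1ℚ - (ι k + 1ℚ)) * (½ * (coin t k + coin t (suc k)))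
     ≡⟨ cong₂ _*_ (cong₂ _-_ (sym (ι-suc t)) (sym (ι-suc k))) (sym (B-⊛-suc (coin t) k)) ⟩
   (ι (suc t) - ι (suc k)) * coin (suc t) (suc k) ∎
   where
   open ≡-Reasoning
   eqk2 : ι (suc (suc k)) ≡ ι k + 1ℚ + 1ℚ
   eqk2 = trans (ι-suc (suc k)) (cong (_+ 1ℚ) (ι-suc k))

 Nonneg-coin : ∀ t → Nonneg (coin t)
 Nonneg-coin t = Nonneg-pow t Nonneg-B

 coin-increasing : ∀ t k → suc (k ℕ.+ k) ℕ.≤ t → coin t k ≤ coin t (suc k)
 coin-increasing t k h = *-cancelˡ-≤ (0<ι k) (subst (ι (suc k) * coin t k ≤_) (sym (coin-step t k))
   (*-monoʳ (Nonneg-coin t k) (≤-cert {ι (suc k)} {ι t - ι k} (0≤-diff (ι-mono h)) eq)))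
   where
   eq : ι t - ι (suc (k ℕ.+ k)) ≡ ι t - ι k - ι (suc k)
   eq = trans (cong (λ z → ι t - z) (trans (ι-suc (k ℕ.+ k)) (cong (_+ 1ℚ) (ι-+ k k))))
     (trans (r (ι t) (ι k)) (cong (λ z → ι t - ι k - z) (sym (ι-suc k))))
     where
     r : ∀ t k → t - (k + k + 1ℚ) ≡ t - k - (k + 1ℚ)
     r = solve-∀ ℚ-ring

 coin-decreasing : ∀ t k → t ℕ.≤ suc (k ℕ.+ k) → coin t (suc k) ≤ coin t k
 coin-decreasing t k h = *-cancelˡ-≤ (0<ι k) (subst (_≤ ι (suc k) * coin t k) (sym (coin-step t k))
   (*-monoʳ (Nonneg-coin t k) (≤-cert {ι t - ι k} {ι (suc k)} (0≤-diff (ι-mono h)) eq)))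
   where
   eq : ι (suc (k ℕ.+ k)) - ι t ≡ ι (suc k) - (ι t - ι k)
   eq = trans (cong (_- ι t) (trans (ι-suc (k ℕ.+ k)) (cong (_+ 1ℚ) (ι-+ k k))))
     (trans (r (ι t) (ι k)) (cong (_- (ι t - ι k)) (sym (ι-suc k))))
     where
     r : ∀ t k → (k + k + 1ℚ) - t ≡ (k + 1ℚ) - (t - k)
     r = solve-∀ ℚ-ring

 module Unimodal (f : PS) (h : ℕ) (f≥0 : Nonneg f)
   (up : ∀ k → k ℕ.< h → f k ≤ f (suc k)) (down : ∀ k → h ℕ.≤ k → f (suc k) ≤ f k) where

   private
     below : ∀ o k → k ℕ.+ o ≡ h → f k ≤ f h
     below zero    k e = ≤-reflexive (cong f (trans (sym (ℕ.+-identityʳ k)) e))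
     below (suc o) k e = ≤-trans (up k (subst (k ℕ.<_) e (ℕ.m<m+n k (s≤s z≤n)))) (below o (suc k) (trans (sym (ℕ.+-suc k o)) e))
     above : ∀ o → f (h ℕ.+ o) ≤ f h
     above zero    = ≤-reflexive (cong f (ℕ.+-identityʳ h))
     above (suc o) = ≤-trans (subst (λ z → f z ≤ f (h ℕ.+ o)) (sym (ℕ.+-suc h o)) (down (h ℕ.+ o) (ℕ.m≤m+n h o))) (above o)

   mode-max : ∀ k → f k ≤ f h
   mode-max k with ℕ.≤-total k h
   ... | inj₁ k≤h = let o , e = ℕ.m≤n⇒∃[o]m+o≡n k≤h in below o k e
   ... | inj₂ h≤k = let o , e = ℕ.m≤n⇒∃[o]m+o≡n h≤k in subst (λ z → f z ≤ f h) e (above o)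

   Sup-mode : Sup f (f h)
   Sup-mode k = subst (_≤ f h) (sym (ℚ.0≤p⇒∣p∣≡p (f≥0 k))) (mode-max k)

   private
     ∣Δ∣-up : ∀ {a b} → a ≤ b → ∣ b - a ∣ ≡ b - a
     ∣Δ∣-up p = ℚ.0≤p⇒∣p∣≡p (0≤-diff p)
     ∣Δ∣-down : ∀ {a b} → b ≤ a → ∣ b - a ∣ ≡ a - b
     ∣Δ∣-down {a} {b} p = trans (∣-∣-sym b a) (∣Δ∣-up p)
     r₁ : ∀ a b → a + (b - a) ≡ b
     r₁ = solve-∀ ℚ-ring
     r₂ : ∀ s a b → s + (a - b) + b ≡ s + a
     r₂ = solve-∀ ℚ-ring
     rising : ∀ k → k ℕ.≤ h → S (abs (D ⊛ f)) (suc k) ≡ f k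
     rising zero    _ = trans (+-identityʳ _) (trans (cong ∣_∣ (D-⊛-zero f)) (ℚ.0≤p⇒∣p∣≡p (f≥0 0)))
     rising (suc k) p = trans (S-last (abs (D ⊛ f)) (suc k)) (trans
       (cong₂ _+_ (rising k (ℕ.<⇒≤ p)) (trans (cong ∣_∣ (D-⊛-suc f k)) (∣Δ∣-up (up k p))))
       (r₁ (f k) (f (suc k))))
     falling : ∀ j → S (abs (D ⊛ f)) (suc h ℕ.+ j) + f (h ℕ.+ j) ≡ f h + f h
     falling zero    = cong₂ _+_ (trans (cong (S (abs (D ⊛ f))) (ℕ.+-identityʳ (suc h))) (rising h ℕ.≤-refl)) (cong f (ℕ.+-identityʳ h))
     falling (suc j) = trans (cong₂ (λ u v → S (abs (D ⊛ f)) u + f v) (ℕ.+-suc (suc h) j) (ℕ.+-suc h j))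
       (trans (cong (_+ f (suc (h ℕ.+ j))) (trans (S-last (abs (D ⊛ f)) (suc h ℕ.+ j))
         (cong (λ z → S (abs (D ⊛ f)) (suc h ℕ.+ j) + z) (trans (cong ∣_∣ (D-⊛-suc f (h ℕ.+ j))) (∣Δ∣-down (down (h ℕ.+ j) (ℕ.m≤m+n h j)))))))
       (trans (r₂ (S (abs (D ⊛ f)) (suc h ℕ.+ j)) (f (h ℕ.+ j)) (f (suc (h ℕ.+ j)))) (falling j)))

   -- A unimodal sequence rises from 0 to its maximum and then falls, so its total variation is at
   -- most twice the maximum. `rising` telescopes up to the mode; beyond it, `falling` keeps the
   -- variation so far plus the current value constant.
   L1-difference : L1 (D ⊛ f) (f h + f h)
   L1-difference n = ≤-trans (S-mono-n (Nonneg-abs (D ⊛ f)) (ℕ.m≤n+m n (suc h)))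
     (subst (S (abs (D ⊛ f)) (suc h ℕ.+ n) ≤_) (falling n)
       (subst (_≤ S (abs (D ⊛ f)) (suc h ℕ.+ n) + f (h ℕ.+ n)) (+-identityʳ _) (+-monoʳ-≤ (S (abs (D ⊛ f)) (suc h ℕ.+ n)) (f≥0 (h ℕ.+ n)))))

 central : ℕ → ℚ
 central a = coin (a ℕ.+ a) a

 -- ⌈t/2⌉ is used because coin (2a - 1) and coin (2a) have the same maximum.
 peak : ℕ → ℚ
 peak t = central ⌈ t /2⌉

 parity : ∀ t → (∃[ a ] t ≡ a ℕ.+ a) ⊎ (∃[ a ] t ≡ suc (a ℕ.+ a))
 parity zero = inj₁ (0 , refl)
 parity (suc t) with parity t
 ... | inj₁ (a , e) = inj₂ (a , cong suc e)
 ... | inj₂ (a , e) = inj₁ (suc a , trans (cong suc e) (cong suc (sym (ℕ.+-suc a a))))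

 ⌊a+a/2⌋ : ∀ a → ⌊ a ℕ.+ a /2⌋ ≡ a
 ⌊a+a/2⌋ zero    = refl
 ⌊a+a/2⌋ (suc a) = trans (cong (λ z → ⌊ suc z /2⌋) (ℕ.+-suc a a)) (cong suc (⌊a+a/2⌋ a))

 ⌊1+a+a/2⌋ : ∀ a → ⌊ suc (a ℕ.+ a) /2⌋ ≡ a
 ⌊1+a+a/2⌋ zero    = refl
 ⌊1+a+a/2⌋ (suc a) = trans (cong (λ z → ⌊ suc (suc z) /2⌋) (ℕ.+-suc a a)) (cong suc (⌊1+a+a/2⌋ a))

 private
   coin-odd : ∀ a → coin (suc (a ℕ.+ a)) (suc a) ≡ coin (suc (a ℕ.+ a)) a
   coin-odd a = ℚ.≤-antisym (coin-decreasing (suc (a ℕ.+ a)) a ℕ.≤-refl) (coin-increasing (suc (a ℕ.+ a)) a ℕ.≤-refl)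
   half-double : ∀ x → ½ * (x + x) ≡ x
   half-double = solve-∀ ℚ-ring

 -- One more coin averages the two equal middle values of 2a + 1 coins, so the maxima for 2a + 1 and
 -- 2a + 2 coins agree.
 central-suc : ∀ a → central (suc a) ≡ coin (suc (a ℕ.+ a)) a
 central-suc a = trans (cong (λ z → coin z (suc a)) (cong suc (ℕ.+-suc a a)))
   (trans (B-⊛-suc (coin (suc (a ℕ.+ a))) a)
     (trans (cong (λ z → ½ * (coin (suc (a ℕ.+ a)) a + z)) (coin-odd a)) (half-double (coin (suc (a ℕ.+ a)) a))))

 private
   2* : ℚ → ℚ
   2* x = x + x
   r-ratio : ∀ a x y → (a + 1ℚ) * y ≡ (a + a - a) * x → 2* (a + 1ℚ) * (½ * (x + y)) ≡ (2* a + 1ℚ) * x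
   r-ratio a x y e = trans (r₁ a x y) (trans (cong (λ z → (a + 1ℚ) * x + z) e) (r₂ a x))
     where
     r₁ : ∀ a x y → ((a + 1ℚ) + (a + 1ℚ)) * (½ * (x + y)) ≡ (a + 1ℚ) * x + (a + 1ℚ) * y
     r₁ = solve-∀ ℚ-ring
     r₂ : ∀ a x → (a + 1ℚ) * x + (a + a - a) * x ≡ (a + a + 1ℚ) * x
     r₂ = solve-∀ ℚ-ring

 central-ratio : ∀ a → (ι a + 1ℚ + (ι a + 1ℚ)) * central (suc a) ≡ (ι a + ι a + 1ℚ) * central a
 central-ratio a = trans
   (cong ((ι a + 1ℚ + (ι a + 1ℚ)) *_) (trans (central-suc a) (trans (sym (coin-odd a)) (B-⊛-suc (coin (a ℕ.+ a)) a))))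
   (r-ratio (ι a) (central a) (coin (a ℕ.+ a) (suc a))
     (subst₂ (λ u v → u * coin (a ℕ.+ a) (suc a) ≡ (v - ι a) * central a) (ι-suc a) (ι-+ a a) (coin-step (a ℕ.+ a) a)))

 Nonneg-central : ∀ a → 0ℚ ≤ central a
 Nonneg-central a = Nonneg-coin (a ℕ.+ a) a

 central²-ratio : ∀ a → (ι a + 1ℚ) * (ι a + 1ℚ) * (+ 4 / 1) * (central (suc a) * central (suc a))
     ≡ (ι a + ι a + 1ℚ) * (ι a + ι a + 1ℚ) * (central a * central a)
 central²-ratio a = trans (r₁ (ι a) (central (suc a))) (trans (cong (λ z → z * z) (central-ratio a)) (r₂ (ι a) (central a)))
   where
   r₁ : ∀ a c → (a + 1ℚ) * (a + 1ℚ) * (+ 4 / 1) * (c * c) ≡ ((a + 1ℚ + (a + 1ℚ)) * c) * ((a + 1ℚ + (a + 1ℚ)) * c)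
   r₁ = solve-∀ ℚ-ring
   r₂ : ∀ a c → ((a + a + 1ℚ) * c) * ((a + a + 1ℚ) * c) ≡ (a + a + 1ℚ) * (a + a + 1ℚ) * (c * c)
   r₂ = solve-∀ ℚ-ring

 -- Monotonicity of w(a) c_a² follows from that of the weights times the squared ratio.
 central²-scaled : ∀ a u v → 0ℚ ≤ v →
   u * ((ι a + ι a + 1ℚ) * (ι a + ι a + 1ℚ)) ≤ v * ((ι a + 1ℚ) * (ι a + 1ℚ) * (+ 4 / 1)) →
   u * (central (suc a) * central (suc a)) ≤ v * (central a * central a)
 central²-scaled a u v 0≤v h = *-cancelˡ-≤ 0<P (begin
   P * (u * y) ≡⟨ r P u y ⟩
   u * (P * y) ≡⟨ cong (u *_) (central²-ratio a) ⟩
   u * (Q * x) ≡⟨ *-assoc u Q x ⟨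
   u * Q * x ≤⟨ *-monoʳ (0≤sq (central a)) h ⟩
   v * P * x ≡⟨ r′ P v x ⟩
   P * (v * x) ∎)
   where
   open ≤-Reasoning
   x = central a * central a
   y = central (suc a) * central (suc a)
   P = (ι a + 1ℚ) * (ι a + 1ℚ) * (+ 4 / 1)
   Q = (ι a + ι a + 1ℚ) * (ι a + ι a + 1ℚ)
   0<a+1 : 0ℚ < ι a + 1ℚ
   0<a+1 = ℚ.+-mono-≤-< (0≤ι a) 0<1
   0<P : 0ℚ < P
   0<P = 0<* (0<* 0<a+1 0<a+1) (>0 (+ 4 / 1))
   r : ∀ p u y → p * (u * y) ≡ u * (p * y)
   r = solve-∀ ℚ-ring
   r′ : ∀ p v x → v * p * x ≡ p * (v * x)
   r′ = solve-∀ ℚ-ring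

 central²-scaled′ : ∀ a u v →
   u * ((ι a + 1ℚ) * (ι a + 1ℚ) * (+ 4 / 1)) ≤ v * ((ι a + ι a + 1ℚ) * (ι a + ι a + 1ℚ)) →
   u * (central a * central a) ≤ v * (central (suc a) * central (suc a))
 central²-scaled′ a u v h = *-cancelˡ-≤ 0<P (begin
   P * (u * x) ≡⟨ r′ P u x ⟨
   u * P * x ≤⟨ *-monoʳ (0≤sq (central a)) h ⟩
   v * Q * x ≡⟨ *-assoc v Q x ⟩
   v * (Q * x) ≡⟨ cong (v *_) (central²-ratio a) ⟨
   v * (P * y) ≡⟨ r P v y ⟨
   P * (v * y) ∎)
   where
   open ≤-Reasoning
   x = central a * central a
   y = central (suc a) * central (suc a)
   P = (ι a + 1ℚ) * (ι a + 1ℚ) * (+ 4 / 1)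
   Q = (ι a + ι a + 1ℚ) * (ι a + ι a + 1ℚ)
   0<a+1 : 0ℚ < ι a + 1ℚ
   0<a+1 = ℚ.+-mono-≤-< (0≤ι a) 0<1
   0<P : 0ℚ < P
   0<P = 0<* (0<* 0<a+1 0<a+1) (>0 (+ 4 / 1))
   r : ∀ p u y → p * (u * y) ≡ u * (p * y)
   r = solve-∀ ℚ-ring
   r′ : ∀ p v x → v * p * x ≡ p * (v * x)
   r′ = solve-∀ ℚ-ring

 -- The left side is 1 at `a = 0` and decreases, because (2a + 1)(2a + 3) ≤ 4(a + 1)².
 central²-≤ : ∀ a → (ι a + ι a + 1ℚ) * (central a * central a) ≤ 1ℚ
 central²-≤ zero    = ≤-reflexive (trans (cong (λ z → (z + z + 1ℚ) * 1ℚ) ι-0) refl)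
 central²-≤ (suc a) = ≤-trans (central²-scaled a (ι (suc a) + ι (suc a) + 1ℚ) (ι a + ι a + 1ℚ) (0≤+ (0≤+ (0≤ι a) (0≤ι a)) 0≤1)
   (subst (λ z → (z + z + 1ℚ) * ((ι a + ι a + 1ℚ) * (ι a + ι a + 1ℚ)) ≤ (ι a + ι a + 1ℚ) * ((ι a + 1ℚ) * (ι a + 1ℚ) * (+ 4 / 1))) (sym (ι-suc a))
     (≤-cert (0≤+ (0≤+ (0≤ι a) (0≤ι a)) 0≤1) (r (ι a)))))
   (central²-≤ a)
   where
   r : ∀ a → a + a + 1ℚ ≡ (a + a + 1ℚ) * ((a + 1ℚ) * (a + 1ℚ) * (+ 4 / 1)) - (a + 1ℚ + (a + 1ℚ) + 1ℚ) * ((a + a + 1ℚ) * (a + a + 1ℚ))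
   r = solve-∀ ℚ-ring

 peak≡mode : ∀ t → peak t ≡ coin t ⌊ t /2⌋
 peak≡mode t with parity t
 ... | inj₁ (a , refl) = cong₂ (λ u v → coin (u ℕ.+ u) v) e (trans e (sym (⌊a+a/2⌋ a)))
   where e = trans (cong ⌊_/2⌋ refl) (⌊1+a+a/2⌋ a)
 ... | inj₂ (a , refl) = trans (cong central (cong suc (⌊a+a/2⌋ a))) (trans (central-suc a) (cong (coin (suc (a ℕ.+ a))) (sym (⌊1+a+a/2⌋ a))))

 mode-increasing : ∀ t k → k ℕ.< ⌊ t /2⌋ → coin t k ≤ coin t (suc k)
 mode-increasing t k h = coin-increasing t k (ℕ.≤-trans (ℕ.≤-trans (ℕ.n≤1+n _) (subst (ℕ._≤ ⌊ t /2⌋ ℕ.+ ⌊ t /2⌋) (cong suc (ℕ.+-suc k k)) (ℕ.+-mono-≤ h h)))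
   (subst (⌊ t /2⌋ ℕ.+ ⌊ t /2⌋ ℕ.≤_) (ℕ.⌊n/2⌋+⌈n/2⌉≡n t) (ℕ.+-monoʳ-≤ ⌊ t /2⌋ (ℕ.⌊n/2⌋≤⌈n/2⌉ t))))

 mode-decreasing : ∀ t k → ⌊ t /2⌋ ℕ.≤ k → coin t (suc k) ≤ coin t k
 mode-decreasing t k h = coin-decreasing t k (subst (ℕ._≤ suc (k ℕ.+ k)) (ℕ.⌊n/2⌋+⌈n/2⌉≡n t)
   (subst (⌊ t /2⌋ ℕ.+ ⌈ t /2⌉ ℕ.≤_) (ℕ.+-suc k k) (ℕ.+-mono-≤ h (ℕ.≤-trans (⌈/2⌉≤ t) (s≤s h)))))
   where
   ⌈/2⌉≤ : ∀ t → ⌈ t /2⌉ ℕ.≤ suc ⌊ t /2⌋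
   ⌈/2⌉≤ zero          = z≤n
   ⌈/2⌉≤ (suc zero)    = s≤s z≤n
   ⌈/2⌉≤ (suc (suc t)) = s≤s (⌈/2⌉≤ t)

 module CoinUnimodal t = Unimodal (coin t) ⌊ t /2⌋ (Nonneg-coin t) (mode-increasing t) (mode-decreasing t)

 Sup-coin : ∀ t → Sup (coin t) (peak t)
 Sup-coin t = subst (Sup (coin t)) (sym (peak≡mode t)) (CoinUnimodal.Sup-mode t)

 L1-D-coin : ∀ t → L1 (D ⊛ coin t) (peak t + peak t)
 L1-D-coin t = subst (λ z → L1 (D ⊛ coin t) (z + z)) (sym (peak≡mode t)) (CoinUnimodal.L1-difference t)

 Nonneg-peak : ∀ t → 0ℚ ≤ peak t
 Nonneg-peak t = Nonneg-central ⌈ t /2⌉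

 peak²-≤ : ∀ t → ι (suc t) * (peak t * peak t) ≤ 1ℚ
 peak²-≤ t = ≤-trans (*-monoʳ (0≤sq (peak t)) (subst (ι (suc t) ≤_)
     (trans (ι-suc (⌈ t /2⌉ ℕ.+ ⌈ t /2⌉)) (cong (_+ 1ℚ) (ι-+ ⌈ t /2⌉ ⌈ t /2⌉)))
     (ι-mono (s≤s (subst (ℕ._≤ ⌈ t /2⌉ ℕ.+ ⌈ t /2⌉) (ℕ.⌊n/2⌋+⌈n/2⌉≡n t) (ℕ.+-monoˡ-≤ ⌈ t /2⌉ (ℕ.⌊n/2⌋≤⌈n/2⌉ t)))))))
   (central²-≤ ⌈ t /2⌉)

-- Wallis' limit for central binomial probabilities, with explicit rates

module Wallis where

 open RationalArithmetic
 open Coins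

 -- c_a² (a + 1/4) increases to 1/π, and c_a² (a + 1/4 + 1/(32 a)) decreases to it.
 wal : ℕ → ℚ
 wal a = (ι a + + 1 / 4) * (central a * central a)

 wal-gap : ℕ → ℚ
 wal-gap a = central a * central a * (+ 1 / 32 * ι a ⁻¹)

 wal-suc : ∀ a → wal a ≤ wal (suc a)
 wal-suc a = central²-scaled′ a (ι a + + 1 / 4) (ι (suc a) + + 1 / 4)
   (subst (λ z → (ι a + + 1 / 4) * ((ι a + 1ℚ) * (ι a + 1ℚ) * (+ 4 / 1)) ≤ (z + + 1 / 4) * ((ι a + ι a + 1ℚ) * (ι a + ι a + 1ℚ))) (sym (ι-suc a))
     (≤-cert (≥0 (+ 1 / 4)) (r (ι a))))
   where
   r : ∀ a → + 1 / 4 ≡ (a + 1ℚ + + 1 / 4) * ((a + a + 1ℚ) * (a + a + 1ℚ)) - (a + + 1 / 4) * ((a + 1ℚ) * (a + 1ℚ) * (+ 4 / 1))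
   r = solve-∀ ℚ-ring

 wal-mono : ∀ {a b} → a ℕ.≤ b → wal a ≤ wal b
 wal-mono {a} h = go (ℕ.m≤n⇒∃[o]m+o≡n h)
   where
   chain : ∀ o → wal a ≤ wal (a ℕ.+ o)
   chain zero    = ≤-reflexive (cong wal (sym (ℕ.+-identityʳ a)))
   chain (suc o) = ≤-trans (chain o) (≤-trans (wal-suc (a ℕ.+ o)) (≤-reflexive (cong wal (sym (ℕ.+-suc a o)))))
   go : ∀ {b} → (∃[ o ] a ℕ.+ o ≡ b) → wal a ≤ wal b
   go (o , refl) = chain o

 private
   -- The decreasing companion of `wal`, indexed from `suc a` so that only positive numbers are
   -- inverted.
   upper : ℕ → ℚ
   upper a = (ι (suc a) + + 1 / 4 + + 1 / 32 * ι (suc a) ⁻¹) * (central (suc a) * central (suc a))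

   upper-suc : ∀ a → upper (suc a) ≤ upper a
   upper-suc a = central²-scaled (suc a) (ι (suc (suc a)) + + 1 / 4 + + 1 / 32 * j) (p + + 1 / 4 + + 1 / 32 * i)
     (0≤+ (0≤+ (0≤ι (suc a)) (≥0 (+ 1 / 4))) (0≤* (≥0 (+ 1 / 32)) 0≤i))
     (subst (λ z → (z + + 1 / 4 + + 1 / 32 * j) * ((p + p + 1ℚ) * (p + p + 1ℚ)) ≤ (p + + 1 / 4 + + 1 / 32 * i) * ((p + 1ℚ) * (p + 1ℚ) * (+ 4 / 1))) (sym (ι-suc (suc a)))
       (≤-cert {e = + 3 / 32 * i + + 1 / 32 * (i - j)} (0≤+ (0≤* (≥0 (+ 3 / 32)) 0≤i) (0≤* (≥0 (+ 1 / 32)) (0≤-diff (⁻¹-anti (0<ι a) (ι-mono (ℕ.n≤1+n (suc a)))))))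
         (trans (r₁ p i j) (trans (sym (cong₂ (λ u v → F p i j u v) (*-⁻¹ (0<ι a)) pj)) (r₂ p i j)))))
     where
     p = ι (suc a)
     i = ι (suc a) ⁻¹
     j = ι (suc (suc a)) ⁻¹
     0≤i = 0≤⁻¹ (0<ι a)
     pj : (p + 1ℚ) * j ≡ 1ℚ
     pj = trans (cong (_* j) (sym (ι-suc (suc a)))) (*-⁻¹ (0<ι (suc a)))
     -- The difference of the two sides, with u and v standing for p i = 1 and (p + 1) j = 1.
     F : ℚ → ℚ → ℚ → ℚ → ℚ → ℚ
     F p i j u v = (p + + 1 / 4) * ((p + 1ℚ) * (p + 1ℚ) * (+ 4 / 1)) + + 1 / 8 * (u * p + + 2 / 1 * u + i)
       - ((p + 1ℚ + + 1 / 4) * ((p + p + 1ℚ) * (p + p + 1ℚ)) + + 1 / 32 * (+ 4 / 1 * (v * (p + 1ℚ)) - + 4 / 1 * v + j))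
     r₁ : ∀ p i j → + 3 / 32 * i + + 1 / 32 * (i - j) ≡ (p + + 1 / 4) * ((p + 1ℚ) * (p + 1ℚ) * (+ 4 / 1)) + + 1 / 8 * (1ℚ * p + + 2 / 1 * 1ℚ + i)
       - ((p + 1ℚ + + 1 / 4) * ((p + p + 1ℚ) * (p + p + 1ℚ)) + + 1 / 32 * (+ 4 / 1 * (1ℚ * (p + 1ℚ)) - + 4 / 1 * 1ℚ + j))
     r₁ = solve-∀ ℚ-ring
     r₂ : ∀ p i j → (p + + 1 / 4) * ((p + 1ℚ) * (p + 1ℚ) * (+ 4 / 1)) + + 1 / 8 * (p * i * p + + 2 / 1 * (p * i) + i)
       - ((p + 1ℚ + + 1 / 4) * ((p + p + 1ℚ) * (p + p + 1ℚ)) + + 1 / 32 * (+ 4 / 1 * ((p + 1ℚ) * j * (p + 1ℚ)) - + 4 / 1 * ((p + 1ℚ) * j) + j))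
       ≡ (p + + 1 / 4 + + 1 / 32 * i) * ((p + 1ℚ) * (p + 1ℚ) * (+ 4 / 1)) - (p + 1ℚ + + 1 / 4 + + 1 / 32 * j) * ((p + p + 1ℚ) * (p + p + 1ℚ))
     r₂ = solve-∀ ℚ-ring

   upper-mono : ∀ a o → upper (a ℕ.+ o) ≤ upper a
   upper-mono a zero    = ≤-reflexive (cong upper (ℕ.+-identityʳ a))
   upper-mono a (suc o) = ≤-trans (≤-reflexive (cong upper (ℕ.+-suc a o))) (≤-trans (upper-suc (a ℕ.+ o)) (upper-mono a o))

   upper≡ : ∀ a → upper a ≡ wal (suc a) + wal-gap (suc a)
   upper≡ a = r (ι (suc a)) (ι (suc a) ⁻¹) (central (suc a) * central (suc a))
     where
     r : ∀ a i c → (a + + 1 / 4 + + 1 / 32 * i) * c ≡ (a + + 1 / 4) * c + c * (+ 1 / 32 * i)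
     r = solve-∀ ℚ-ring

 wal-gap-nonneg : ∀ a → 0ℚ ≤ wal-gap (suc a)
 wal-gap-nonneg a = 0≤* (0≤sq (central (suc a))) (0≤* (≥0 (+ 1 / 32)) (0≤⁻¹ (0<ι a)))

 wal-upper : ∀ {a b} → suc a ℕ.≤ b → wal b ≤ wal (suc a) + wal-gap (suc a)
 wal-upper {a} h = go (ℕ.m≤n⇒∃[o]m+o≡n h)
   where
   go : ∀ {b} → (∃[ o ] suc a ℕ.+ o ≡ b) → wal b ≤ wal (suc a) + wal-gap (suc a)
   go (o , refl) = ≤-trans (subst (_≤ wal (suc a ℕ.+ o) + wal-gap (suc a ℕ.+ o)) (+-identityʳ (wal (suc a ℕ.+ o))) (+-monoʳ-≤ (wal (suc a ℕ.+ o)) (wal-gap-nonneg (a ℕ.+ o))))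
     (≤-trans (≤-reflexive (sym (upper≡ (a ℕ.+ o)))) (≤-trans (upper-mono a o) (≤-reflexive (upper≡ a))))

 central²≤1 : ∀ a → central a * central a ≤ 1ℚ
 central²≤1 a = ≤-trans (≤*⇒≤ (0≤sq (central a)) (subst (_≤ ι a + ι a + 1ℚ) (+-identityˡ 1ℚ) (+-monoˡ-≤ 1ℚ (0≤+ (0≤ι a) (0≤ι a))))) (central²-≤ a)

 wal-gap≤ : ∀ a → wal-gap (suc a) ≤ ι (suc a) ⁻¹
 wal-gap≤ a = ≤-trans (*-mono-≤ (0≤sq (central (suc a))) (0≤* (≥0 (+ 1 / 32)) 0≤i) (central²≤1 (suc a)) (*-monoʳ 0≤i (≤ᵇ⇒≤ {+ 1 / 32} {1ℚ} _)))
   (≤-reflexive (trans (*-identityˡ (1ℚ * ι (suc a) ⁻¹)) (*-identityˡ (ι (suc a) ⁻¹))))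
   where 0≤i = 0≤⁻¹ (0<ι a)

 -- Both values lie between `wal (suc m)` and `wal (suc m) + wal-gap (suc m)`. The limit 1/π is
 -- never formed: different numbers of coins are compared through this estimate and `wal-mono`.
 wal-close : ∀ m {a b} → suc m ℕ.≤ a → suc m ℕ.≤ b → wal a ≤ wal b + ι (suc m) ⁻¹
 wal-close m {a} {b} ha hb = ≤-trans (wal-upper ha) (+-mono-≤ (wal-mono hb) (wal-gap≤ m))

 wal≤½ : ∀ a → wal a ≤ ½
 wal≤½ a = ≤-cert (0≤+ (0≤* (≥0 ½) (0≤-diff (central²-≤ a))) (0≤* (≥0 (+ 1 / 4)) (0≤sq (central a)))) (r (ι a) (central a * central a))
   where
   r : ∀ a c → ½ * (1ℚ - (a + a + 1ℚ) * c) + + 1 / 4 * c ≡ ½ - (a + + 1 / 4) * c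
   r = solve-∀ ℚ-ring

 ¼≤wal : ∀ a → + 1 / 4 ≤ wal a
 ¼≤wal a = ≤-trans (≤-reflexive (sym (trans (cong (λ z → (z + + 1 / 4) * (1ℚ * 1ℚ)) ι-0) refl))) (wal-mono (z≤n {a}))

-- Differences of products of coins and of laws containing coins

module Smoothing where

 import Data.Nat.DivMod as ℕ
 open RationalArithmetic
 open PowerSeries
 open Coins
 open PS-Solver using (_:+_; _:*_; :-_; _:=_; con) renaming (solve to PS-solve)

 D³ : PS
 D³ = D ⊛ (D ⊛ D)

 -- The decay rate of third differences: 36000 / ((Y + 15)(Y + 30)), where every
 -- coin counts 15 and every step of the law counts 1.
 decay : ℕ → ℚ
 decay Y = + 36000 / 1 * ((ι Y + + 15 / 1) ⁻¹ * (ι Y + + 30 / 1) ⁻¹)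

 private
   15>0 : 0ℚ < + 15 / 1
   15>0 = >0 (+ 15 / 1)
   30>0 : 0ℚ < + 30 / 1
   30>0 = >0 (+ 30 / 1)

   ι+>0 : ∀ Y {a} → 0ℚ < a → 0ℚ < ι Y + a
   ι+>0 Y h = ℚ.+-mono-≤-< (0≤ι Y) h

 decay-nonneg : ∀ Y → 0ℚ ≤ decay Y
 decay-nonneg Y = 0≤* (≥0 (+ 36000 / 1)) (0≤* (0≤⁻¹ (ι+>0 Y 15>0)) (0≤⁻¹ (ι+>0 Y 30>0)))

 decay-anti : ∀ {Y Z} → Y ℕ.≤ Z → decay Z ≤ decay Y
 decay-anti {Y} {Z} h = *-monoˡ (≥0 (+ 36000 / 1)) (*-mono-≤
   (0≤⁻¹ (ι+>0 Z 15>0)) (0≤⁻¹ (ι+>0 Z 30>0))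
   (⁻¹-anti (ι+>0 Y 15>0) (+-monoˡ-≤ (+ 15 / 1) (ι-mono h)))
   (⁻¹-anti (ι+>0 Y 30>0) (+-monoˡ-≤ (+ 30 / 1) (ι-mono h))))

 ≤-decay : ∀ {x} Y → x * ((ι Y + + 15 / 1) * (ι Y + + 30 / 1)) ≤ + 36000 / 1 → x ≤ decay Y
 ≤-decay {x} Y h = ≤-trans (≤-÷ {a = x * p * q ÷′ p} 0<q (≤-reflexive (sym (trans (cong (_* p ⁻¹) (sym (trans (*-assoc x q p) (trans (cong (x *_) (*-comm q p)) (sym (*-assoc x p q)))))) (trans (*-assoc (x * q) p (p ⁻¹)) (trans (cong (x * q *_) (*-⁻¹ 0<p)) (*-identityʳ (x * q))))))))
   (≤-trans (≤-reflexive (r x p q (p ⁻¹) (q ⁻¹))) (*-monoʳ (0≤* (0≤⁻¹ 0<p) (0≤⁻¹ 0<q)) h))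
   where
   p = ι Y + + 15 / 1
   q = ι Y + + 30 / 1
   0<p = ι+>0 Y 15>0
   0<q = ι+>0 Y 30>0
   r : ∀ x p q p′ q′ → x * p * q * p′ * q′ ≡ x * (p * q) * (p′ * q′)
   r = solve-∀ ℚ-ring

 -- One exchange therefore costs O(n^(-2)), and n of them O(1/n), less than the order n^(-1/2) of
 -- the law itself.
 ι*decay : ∀ n → ι (suc n) * (ι (suc n) * decay n) ≤ + 36000 / 1
 ι*decay n = ≤-trans (≤-reflexive (r (ι (suc n)) (+ 36000 / 1) (p ⁻¹) (q ⁻¹)))
   (≤-trans (*-monoˡ (≥0 (+ 36000 / 1)) (*-mono-≤ (0≤* (0≤ι (suc n)) (0≤⁻¹ 0<p)) (0≤* (0≤ι (suc n)) (0≤⁻¹ 0<q))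
     (÷-≤ {c = 1ℚ} 0<p (bound (+ 14 / 1) (≥0 (+ 14 / 1)) refl)) (÷-≤ {c = 1ℚ} 0<q (bound (+ 29 / 1) (≥0 (+ 29 / 1)) refl))))
     ≤-refl)
   where
   p = ι n + + 15 / 1
   q = ι n + + 30 / 1
   0<p = ι+>0 n 15>0
   0<q = ι+>0 n 30>0
   r : ∀ s c p q → s * (s * (c * (p * q))) ≡ c * ((s * p) * (s * q))
   r = solve-∀ ℚ-ring
   bound : ∀ a {b} → 0ℚ ≤ a → 1ℚ + a ≡ b → ι (suc n) ≤ 1ℚ * (ι n + b)
   bound a {b} h refl = ≤-cert h (trans (r′ a (ι n)) (cong (λ z → 1ℚ * (ι n + (1ℚ + a)) - z) (sym (ι-suc n))))
     where
     r′ : ∀ a n → a ≡ 1ℚ * (n + (1ℚ + a)) - (n + 1ℚ)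
     r′ = solve-∀ ℚ-ring

 private
   three-inverses : ∀ c p q r M {p′ q′ r′} → p * p′ ≡ 1ℚ → q * q′ ≡ 1ℚ → r * r′ ≡ 1ℚ →
     0ℚ ≤ c → 0ℚ ≤ p′ → 0ℚ ≤ q′ → 0ℚ ≤ r′ → (+ 1 / 5 * p + + 4 / 5 * r) * M ≤ p * (q * r) →
     (+ 1 / 5 * (c * (q′ * r′)) + + 4 / 5 * (c * (p′ * q′))) * M ≤ c
   three-inverses c p q r M {p′} {q′} {r′} ep eq er 0≤c 0≤p 0≤q 0≤r h = begin
     (+ 1 / 5 * (c * (q′ * r′)) + + 4 / 5 * (c * (p′ * q′))) * M
       ≡⟨ r₁ c p′ q′ r′ M ⟩
     (+ 1 / 5 * (c * (q′ * r′)) * 1ℚ + + 4 / 5 * (c * (p′ * q′)) * 1ℚ) * M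
       ≡⟨ cong₂ (λ u v → (+ 1 / 5 * (c * (q′ * r′)) * u + + 4 / 5 * (c * (p′ * q′)) * v) * M) ep er ⟨
     (+ 1 / 5 * (c * (q′ * r′)) * (p * p′) + + 4 / 5 * (c * (p′ * q′)) * (r * r′)) * M
       ≡⟨ r₂ c p r p′ q′ r′ M ⟩
     c * (p′ * (q′ * r′)) * ((+ 1 / 5 * p + + 4 / 5 * r) * M)
       ≤⟨ *-monoˡ (0≤* 0≤c (0≤* 0≤p (0≤* 0≤q 0≤r))) h ⟩
     c * (p′ * (q′ * r′)) * (p * (q * r))
       ≡⟨ r₃ c p q r p′ q′ r′ ⟩
     c * ((p * p′) * ((q * q′) * (r * r′)))
       ≡⟨ cong₂ (λ u v → c * (u * v)) ep (cong₂ _*_ eq er) ⟩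
     c * (1ℚ * (1ℚ * 1ℚ))
       ≡⟨ *-identityʳ c ⟩
     c ∎
     where
     open ≤-Reasoning
     r₁ : ∀ c p′ q′ r′ M → (+ 1 / 5 * (c * (q′ * r′)) + + 4 / 5 * (c * (p′ * q′))) * M ≡ (+ 1 / 5 * (c * (q′ * r′)) * 1ℚ + + 4 / 5 * (c * (p′ * q′)) * 1ℚ) * M
     r₁ = solve-∀ ℚ-ring
     r₂ : ∀ c p r p′ q′ r′ M → (+ 1 / 5 * (c * (q′ * r′)) * (p * p′) + + 4 / 5 * (c * (p′ * q′)) * (r * r′)) * M ≡ c * (p′ * (q′ * r′)) * ((+ 1 / 5 * p + + 4 / 5 * r) * M)
     r₂ = solve-∀ ℚ-ring
     r₃ : ∀ c p q r p′ q′ r′ → c * (p′ * (q′ * r′)) * (p * (q * r)) ≡ c * ((p * p′) * ((q * q′) * (r * r′)))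
     r₃ = solve-∀ ℚ-ring

 -- A step of the law is a coin, worth 15, with probability 1/5 and otherwise counts nothing. The
 -- mean gain 3 exceeds the credited 1, and the surplus pays for the convexity of `decay`. With
 -- denominators cleared the slack is the polynomial 4y² + 146y + 906.
 decay-convex : ∀ Y → + 1 / 5 * decay (15 ℕ.+ Y) + + 4 / 5 * decay Y ≤ decay (suc Y)
 decay-convex Y = ≤-decay (suc Y) (begin
   (+ 1 / 5 * decay (15 ℕ.+ Y) + + 4 / 5 * decay Y) * ((ι (suc Y) + + 15 / 1) * (ι (suc Y) + + 30 / 1))
     ≡⟨ cong₂ (λ u v → (+ 1 / 5 * (+ 36000 / 1 * ((u + + 15 / 1) ⁻¹ * (u + + 30 / 1) ⁻¹)) + + 4 / 5 * decay Y) * ((v + + 15 / 1) * (v + + 30 / 1)))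
          (trans (ι-+ 15 Y) (trans (cong (_+ y) (ι≡ 15)) (+-comm (+ 15 / 1) y))) (ι-suc Y) ⟩
   (+ 1 / 5 * (+ 36000 / 1 * ((y + + 15 / 1 + + 15 / 1) ⁻¹ * (y + + 15 / 1 + + 30 / 1) ⁻¹)) + + 4 / 5 * decay Y) * M
     ≡⟨ cong₂ (λ u v → (+ 1 / 5 * (+ 36000 / 1 * (u ⁻¹ * v ⁻¹)) + + 4 / 5 * decay Y) * M) (r₃₀ y) (r₄₅ y) ⟩
   (+ 1 / 5 * (+ 36000 / 1 * ((y + + 30 / 1) ⁻¹ * (y + + 45 / 1) ⁻¹)) + + 4 / 5 * decay Y) * M
     ≤⟨ three-inverses (+ 36000 / 1) (y + + 15 / 1) (y + + 30 / 1) (y + + 45 / 1) M (*-⁻¹ 0<15) (*-⁻¹ 0<30) (*-⁻¹ 0<45)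
          (≥0 (+ 36000 / 1)) (0≤⁻¹ 0<15) (0≤⁻¹ 0<30) (0≤⁻¹ 0<45)
          (≤-cert (0≤+ (0≤+ (0≤* (≥0 (+ 4 / 1)) (0≤* (0≤ι Y) (0≤ι Y))) (0≤* (≥0 (+ 146 / 1)) (0≤ι Y))) (≥0 (+ 906 / 1))) (poly y)) ⟩
   + 36000 / 1 ∎)
   where
   open ≤-Reasoning
   y = ι Y
   M = (y + 1ℚ + + 15 / 1) * (y + 1ℚ + + 30 / 1)
   0<15 = ι+>0 Y 15>0
   0<30 = ι+>0 Y 30>0
   0<45 = ι+>0 Y (>0 (+ 45 / 1))
   r₃₀ : ∀ y → y + + 15 / 1 + + 15 / 1 ≡ y + + 30 / 1
   r₃₀ = solve-∀ ℚ-ring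
   r₄₅ : ∀ y → y + + 15 / 1 + + 30 / 1 ≡ y + + 45 / 1
   r₄₅ = solve-∀ ℚ-ring
   poly : ∀ y → + 4 / 1 * (y * y) + + 146 / 1 * y + + 906 / 1
     ≡ (y + + 15 / 1) * ((y + + 30 / 1) * (y + + 45 / 1)) - (+ 1 / 5 * (y + + 15 / 1) + + 4 / 5 * (y + + 45 / 1)) * ((y + 1ℚ + + 15 / 1) * (y + 1ℚ + + 30 / 1))
   poly = solve-∀ ℚ-ring

 private
   quarters : ∀ k → ∃[ m ] ∃[ r ] (k ≡ r ℕ.+ (m ℕ.+ (m ℕ.+ (m ℕ.+ m))) × r ℕ.≤ 3)
   quarters k = k ℕ./ 4 , k ℕ.% 4 , trans (ℕ.m≡m%n+[m/n]*n k 4) (cong (k ℕ.% 4 ℕ.+_) (e (k ℕ./ 4))) , ℕ.≤-pred (ℕ.m%n<n k 4)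
     where
     e : ∀ m → m ℕ.* 4 ≡ m ℕ.+ (m ℕ.+ (m ℕ.+ m))
     e = ℕ-Solver.solve-∀

 private
   -- Of four blocks of `m` coins, three take one `D` each, with L1 norm at most twice the peak `b`,
   -- and the fourth contributes its maximum `b`. This gives 8b⁴ ≤ 8/(m + 1)². Since `Y + 15` is at
   -- most 60(m + 1) and `Y + 30` at most 75(m + 1), the constant of `decay` is 8 · 60 · 75 = 36000.
   Sup-D³-coin-quarters : ∀ m r → r ℕ.≤ 3 → let k = r ℕ.+ (m ℕ.+ (m ℕ.+ (m ℕ.+ m))) in Sup (D³ ⊛ coin k) (decay (15 ℕ.* k))
   Sup-D³-coin-quarters m r r≤3 = Sup-mono (≤-decay Y bound)
     (Sup-cong (≗-sym split) (Sup-⊛ (L1-D-coin m) (Sup-⊛ (L1-D-coin m) (Sup-⊛ (L1-D-coin m) (Sup-⊛ (L1-pow1 r L1-B) (Sup-coin m))))))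
     where
     b = peak m
     Y = 15 ℕ.* (r ℕ.+ (m ℕ.+ (m ℕ.+ (m ℕ.+ m))))
     split : D³ ⊛ coin (r ℕ.+ (m ℕ.+ (m ℕ.+ (m ℕ.+ m)))) ≗ (D ⊛ coin m) ⊛ ((D ⊛ coin m) ⊛ ((D ⊛ coin m) ⊛ (coin r ⊛ coin m)))
     split = ≗-trans (⊛-cong (≗-refl {D³}) (≗-trans (pow-+ B r (m ℕ.+ (m ℕ.+ (m ℕ.+ m))))
         (⊛-cong (≗-refl {coin r}) (≗-trans (pow-+ B m (m ℕ.+ (m ℕ.+ m)))
           (⊛-cong (≗-refl {coin m}) (≗-trans (pow-+ B m (m ℕ.+ m)) (⊛-cong (≗-refl {coin m}) (pow-+ B m m))))))))
       (PS-solve 3 (λ d p q → (d :* (d :* d)) :* (q :* (p :* (p :* (p :* p)))) := (d :* p) :* ((d :* p) :* ((d :* p) :* (q :* p)))) ≗-refl D (coin m) (coin r))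
     ιY : ι Y ≤ + 60 / 1 * ι m + + 45 / 1
     ιY = subst (ι Y ≤_) (trans (ι-+ (60 ℕ.* m) 45) (cong₂ _+_ (trans (ι-* 60 m) (cong (_* ι m) (ι≡ 60))) (ι≡ 45)))
       (ι-mono (ℕ.≤-trans (ℕ.*-monoʳ-≤ 15 (ℕ.+-monoˡ-≤ (m ℕ.+ (m ℕ.+ (m ℕ.+ m))) r≤3)) (ℕ.≤-reflexive (e m))))
       where
       e : ∀ m → 15 ℕ.* (3 ℕ.+ (m ℕ.+ (m ℕ.+ (m ℕ.+ m)))) ≡ 60 ℕ.* m ℕ.+ 45
       e = ℕ-Solver.solve-∀
     bound : (b + b) * ((b + b) * ((b + b) * (1ℚ * b))) * ((ι Y + + 15 / 1) * (ι Y + + 30 / 1)) ≤ + 36000 / 1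
     bound = begin
       (b + b) * ((b + b) * ((b + b) * (1ℚ * b))) * ((ι Y + + 15 / 1) * (ι Y + + 30 / 1))
         ≤⟨ *-monoˡ 0≤b⁴ (*-mono-≤ (0≤+ (0≤ι Y) (<⇒≤ 15>0)) (0≤+ (0≤ι Y) (<⇒≤ 30>0))
              (+-monoˡ-≤ (+ 15 / 1) ιY) (≤-trans (+-monoˡ-≤ (+ 30 / 1) ιY) (≤-cert (0≤* (≥0 (+ 15 / 1)) (0≤ι m)) (r₀ (ι m))))) ⟩
       (b + b) * ((b + b) * ((b + b) * (1ℚ * b))) * ((+ 60 / 1 * ι m + + 45 / 1 + + 15 / 1) * (+ 75 / 1 * ι m + + 75 / 1))
         ≡⟨ r₁ b (ι m) ⟩
       + 36000 / 1 * (((ι m + 1ℚ) * (b * b)) * ((ι m + 1ℚ) * (b * b)))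
         ≤⟨ *-monoˡ (≥0 (+ 36000 / 1)) (*-mono-≤ 0≤u 0≤u u≤1 u≤1) ⟩
       + 36000 / 1 ∎
       where
       open ≤-Reasoning
       0≤b = Nonneg-peak m
       0≤b⁴ : 0ℚ ≤ (b + b) * ((b + b) * ((b + b) * (1ℚ * b)))
       0≤b⁴ = 0≤* (0≤+ 0≤b 0≤b) (0≤* (0≤+ 0≤b 0≤b) (0≤* (0≤+ 0≤b 0≤b) (0≤* 0≤1 0≤b)))
       u≤1 : (ι m + 1ℚ) * (b * b) ≤ 1ℚ
       u≤1 = subst (λ z → z * (b * b) ≤ 1ℚ) (ι-suc m) (peak²-≤ m)
       0≤u : 0ℚ ≤ (ι m + 1ℚ) * (b * b)
       0≤u = 0≤* (0≤+ (0≤ι m) 0≤1) (0≤sq b)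
       r₀ : ∀ m → + 15 / 1 * m ≡ (+ 75 / 1 * m + + 75 / 1) - (+ 60 / 1 * m + + 45 / 1 + + 30 / 1)
       r₀ = solve-∀ ℚ-ring
       r₁ : ∀ b m → (b + b) * ((b + b) * ((b + b) * (1ℚ * b))) * ((+ 60 / 1 * m + + 45 / 1 + + 15 / 1) * (+ 75 / 1 * m + + 75 / 1))
         ≡ + 36000 / 1 * (((m + 1ℚ) * (b * b)) * ((m + 1ℚ) * (b * b)))
       r₁ = solve-∀ ℚ-ring

 Sup-D³-coin : ∀ k → Sup (D³ ⊛ coin k) (decay (15 ℕ.* k))
 Sup-D³-coin k = let m , r , k≡ , r≤3 = quarters k in
   subst (λ z → Sup (D³ ⊛ coin z) (decay (15 ℕ.* z))) (sym k≡) (Sup-D³-coin-quarters m r r≤3)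

 -- The coins are halved: one half takes the difference, with L1 norm at most 2b, the other
 -- contributes its maximum b. Then 2b² ≤ 2/(m + 1), and t + 1 ≤ 2(m + 1).
 ι*Sup-D-coin : ∀ t → Sup (D ⊛ coin t) (+ 4 / 1 * (ι (suc t)) ⁻¹)
 ι*Sup-D-coin t = helper (parity t)
   where
   core : ∀ r m → r ℕ.≤ 1 → t ≡ r ℕ.+ (m ℕ.+ m) → Sup (D ⊛ coin t) (+ 4 / 1 * (ι (suc t)) ⁻¹)
   core r m r≤1 refl = Sup-mono bound (Sup-cong (≗-sym split) (Sup-⊛ (L1-D-coin m) (Sup-⊛ (L1-pow1 r L1-B) (Sup-coin m))))
     where
     b = peak m
     split : D ⊛ coin (r ℕ.+ (m ℕ.+ m)) ≗ (D ⊛ coin m) ⊛ (coin r ⊛ coin m)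
     split = ≗-trans (⊛-cong (≗-refl {D}) (≗-trans (pow-+ B r (m ℕ.+ m)) (⊛-cong (≗-refl {coin r}) (pow-+ B m m))))
       (PS-solve 3 (λ d p q → d :* (q :* (p :* p)) := (d :* p) :* (q :* p)) ≗-refl D (coin m) (coin r))
     ιt : ι (suc t) ≤ + 2 / 1 * ι (suc m)
     ιt = subst (ι (suc t) ≤_) (trans (ι-* 2 (suc m)) (cong (_* ι (suc m)) (ι≡ 2))) (ι-mono (ℕ.≤-trans (s≤s (ℕ.+-monoˡ-≤ (m ℕ.+ m) r≤1)) (ℕ.≤-reflexive (e m))))
       where
       e : ∀ m → suc (1 ℕ.+ (m ℕ.+ m)) ≡ 2 ℕ.* suc m
       e = ℕ-Solver.solve-∀
     bound : (b + b) * (1ℚ * b) ≤ + 4 / 1 * (ι (suc t)) ⁻¹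
     bound = ≤-÷ (0<ι t) (begin
       (b + b) * (1ℚ * b) * ι (suc t) ≤⟨ *-monoˡ (0≤* (0≤+ (Nonneg-peak m) (Nonneg-peak m)) (0≤* 0≤1 (Nonneg-peak m))) ιt ⟩
       (b + b) * (1ℚ * b) * (+ 2 / 1 * ι (suc m)) ≡⟨ r₁ b (ι (suc m)) ⟩
       + 4 / 1 * (ι (suc m) * (b * b)) ≤⟨ *-monoˡ (≥0 (+ 4 / 1)) (peak²-≤ m) ⟩
       + 4 / 1 * 1ℚ ≡⟨⟩
       + 4 / 1 ∎)
       where
       open ≤-Reasoning
       r₁ : ∀ b m → (b + b) * (1ℚ * b) * (+ 2 / 1 * m) ≡ + 4 / 1 * (m * (b * b))
       r₁ = solve-∀ ℚ-ring
   helper : (∃[ a ] t ≡ a ℕ.+ a) ⊎ (∃[ a ] t ≡ suc (a ℕ.+ a)) → Sup (D ⊛ coin t) (+ 4 / 1 * (ι (suc t)) ⁻¹)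
   helper (inj₁ (a , e)) = core 0 a z≤n e
   helper (inj₂ (a , e)) = core 1 a (s≤s z≤n) e

 -- A law with atoms of mass at least 1/10 at two neighbouring points contains a
 -- fair coin with probability 1/5.
 module Smooth (A G : PS) (j : ℕ) (A≗ : A ≗ C (+ 1 / 5) ⊛ (pow X j ⊛ B) ⊕ G) (G-small : L1 G (+ 4 / 5)) where

   -- Expanding one factor `A` into its coin and its rest leads to one law fewer, with one coin more
   -- or the same number of coins; `decay-convex` closes the induction.
   Sup-D³-law : ∀ i k → Sup (D³ ⊛ (pow A i ⊛ coin k)) (decay (i ℕ.+ 15 ℕ.* k))
   Sup-D³-law zero    k = Sup-cong (⊛-cong (≗-refl {D³}) (≗-sym (⊛-identityˡ (coin k)))) (Sup-D³-coin k)
   Sup-D³-law (suc i) k = Sup-mono (≤-trans (≤-reflexive eq) (decay-convex (i ℕ.+ 15 ℕ.* k)))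
     (Sup-cong (≗-sym split) (Sup-⊕
       (Sup-⊛ (L1-C (+ 1 / 5)) (Sup-⊛ (L1-pow1 j L1-X) (Sup-D³-law i (suc k))))
       (Sup-⊛ G-small (Sup-D³-law i k))))
     where
     split : D³ ⊛ (pow A (suc i) ⊛ coin k) ≗ C (+ 1 / 5) ⊛ (pow X j ⊛ (D³ ⊛ (pow A i ⊛ coin (suc k)))) ⊕ G ⊛ (D³ ⊛ (pow A i ⊛ coin k))
     split = ≗-trans (⊛-cong (≗-refl {D³}) (⊛-cong (⊛-cong A≗ (≗-refl {pow A i})) (≗-refl {coin k})))
       (PS-solve 7 (λ d c x b g a k → d :* (((c :* (x :* b) :+ g) :* a) :* k) := c :* (x :* (d :* (a :* (b :* k)))) :+ g :* (d :* (a :* k)))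
         ≗-refl D³ (C (+ 1 / 5)) (pow X j) B G (pow A i) (coin k))
     e : ∀ i k → i ℕ.+ 15 ℕ.* suc k ≡ 15 ℕ.+ (i ℕ.+ 15 ℕ.* k)
     e = ℕ-Solver.solve-∀
     eq : + 1 / 5 * (1ℚ * decay (i ℕ.+ 15 ℕ.* suc k)) + + 4 / 5 * decay (i ℕ.+ 15 ℕ.* k) ≡ + 1 / 5 * decay (15 ℕ.+ (i ℕ.+ 15 ℕ.* k)) + + 4 / 5 * decay (i ℕ.+ 15 ℕ.* k)
     eq = cong (λ z → + 1 / 5 * z + + 4 / 5 * decay (i ℕ.+ 15 ℕ.* k)) (trans (*-identityˡ _) (cong decay (e i k)))

-- The local limit theorem by exchanging summands for coins

module LocalLimit where

 open RationalArithmetic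
 open PowerSeries
 open Coins
 open Smoothing
 open PS-Solver using (_:+_; _:*_; :-_; _:=_; con) renaming (solve to PS-solve)

 -- X^ε has the expansion 1 - ε D + (ε² - ε)/2 D² + O(D³), and additional variance v adds v/2 D².
 second : ℚ → ℚ → ℚ
 second ε v = ½ * (v + ε * ε - ε)

 -- A formal factor with mean ε and variance v (up to third order in D = 1 - X).
 K : ℚ → ℚ → PS
 K ε v = C 1ℚ ⊕ ⊖ (C ε ⊛ D) ⊕ C (second ε v) ⊛ (D ⊛ D)

 -- A Taylor expansion at `X = 1`. Mean and variance determine the quadratic part, and the remainder
 -- is bounded in L1 so that it can multiply a third difference.
 record Moments (f : PS) (m s ρ : ℚ) : Set where
   field
     R        : PS
     expand   : f ≗ K m s ⊕ ⊖ (D³ ⊛ R)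
     R-bound  : L1 R ρ

 -- The third-order part of a product under the bounds 13, 88, 12 and 70 of `K-⊛`: 13 · 70 + 88 · 12
 -- + 2 · 88 · 70 = 14286 and 1 + 2 · 13 + 4 · 88 = 379.
 remainder-bound : ℚ → ℚ
 remainder-bound ρ = + 14286 / 1 + + 379 / 1 * ρ

 private
   second-+ : ∀ ε v m s → second (ε + m) (v + s) ≡ second ε v + second m s + ε * m
   second-+ = lem
     where
     lem : ∀ ε v m s → ½ * ((v + s) + (ε + m) * (ε + m) - (ε + m)) ≡ ½ * (v + ε * ε - ε) + ½ * (s + m * m - m) + ε * m
     lem = solve-∀ ℚ-ring

   C-+ : ∀ p q → C (p + q) ≗ C p ⊕ C q
   C-+ p q zero    = refl
   C-+ p q (suc n) = refl

   L1-K : ∀ ε v → L1 (K ε v) (1ℚ + ∣ ε ∣ * (+ 2 / 1) + ∣ second ε v ∣ * (+ 2 / 1 * (+ 2 / 1)))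
   L1-K ε v = L1-⊕ (L1-⊕ (L1-C 1ℚ) (L1-⊖ (L1-⊛ (L1-C ε) L1-D))) (L1-⊛ (L1-C (second ε v)) (L1-⊛ L1-D L1-D))

 -- Multiplying by a law adds its mean and variance, up to a third difference.
 K-⊛ : ∀ {f m s ρf} ρ ε v → Moments f m s ρf → 0ℚ ≤ ρf → ρf ≤ ρ → ∣ ε ∣ ≤ + 13 / 1 → ∣ second ε v ∣ ≤ + 88 / 1 →
       ∣ m ∣ ≤ + 12 / 1 → ∣ second m s ∣ ≤ + 70 / 1 →
       ∃[ R ] (L1 R (remainder-bound ρ) × K ε v ⊛ f ≗ K (ε + m) (v + s) ⊕ R ⊛ D³)
 K-⊛ {f} {m} {s} {ρf} ρ ε v M 0≤ρf ρf≤ρ ε≤ e≤ m≤ q≤ = R′ , L1-mono bound L1-R′ , eq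
   where
   open Moments M
   e = second ε v
   q = second m s
   R′ = ⊖ ((C ε ⊛ C q ⊕ C e ⊛ C m) ⊕ ⊖ (C e ⊛ C q ⊛ D) ⊕ K ε v ⊛ R)
   eq : K ε v ⊛ f ≗ K (ε + m) (v + s) ⊕ R′ ⊛ D³
   eq = ≗-trans (⊛-cong (≗-refl {K ε v}) expand) (≗-trans
     (PS-solve 6 (λ ε e m q d r →
         (con 1ℚ :+ :- (ε :* d) :+ e :* (d :* d)) :* ((con 1ℚ :+ :- (m :* d) :+ q :* (d :* d)) :+ :- ((d :* (d :* d)) :* r))
         := (con 1ℚ :+ :- ((ε :+ m) :* d) :+ (e :+ q :+ ε :* m) :* (d :* d))
            :+ (:- ((ε :* q :+ e :* m) :+ :- (e :* q :* d) :+ (con 1ℚ :+ :- (ε :* d) :+ e :* (d :* d)) :* r)) :* (d :* (d :* d)))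
       ≗-refl (C ε) (C e) (C m) (C q) D R)
     (⊕-cong (≗-sym new) (≗-refl {R′ ⊛ D³})))
     where
     new : K (ε + m) (v + s) ≗ C 1ℚ ⊕ ⊖ ((C ε ⊕ C m) ⊛ D) ⊕ (C e ⊕ C q ⊕ C ε ⊛ C m) ⊛ (D ⊛ D)
     new n = cong₂ (λ a b → C 1ℚ n + - a + b) (⊛-cong (C-+ ε m) (≗-refl {D}) n)
       (⊛-cong (λ i → trans (cong (λ z → C z i) (second-+ ε v m s)) (trans (C-+ (e + q) (ε * m) i)
         (cong₂ _+_ (C-+ e q i) (C-homo-* ε m i)))) (≗-refl {D ⊛ D}) n)
   L1-R′ = L1-⊖ (L1-⊕ (L1-⊕ (L1-⊕ (L1-⊛ (L1-C ε) (L1-C q)) (L1-⊛ (L1-C e) (L1-C m))) (L1-⊖ (L1-⊛ (L1-⊛ (L1-C e) (L1-C q)) L1-D))) (L1-⊛ (L1-K ε v) R-bound))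
   nn : ∀ {a} → 0ℚ ≤ ∣ a ∣
   nn {a} = ℚ.0≤∣p∣ a
   2≥0 = ≥0 (+ 2 / 1)
   4≥0 = ≥0 (+ 2 / 1 * (+ 2 / 1))
   bound : ∣ ε ∣ * ∣ q ∣ + ∣ e ∣ * ∣ m ∣ + ∣ e ∣ * ∣ q ∣ * (+ 2 / 1) + (1ℚ + ∣ ε ∣ * (+ 2 / 1) + ∣ e ∣ * (+ 2 / 1 * (+ 2 / 1))) * ρf ≤ remainder-bound ρ
   bound = ≤-trans
     (+-mono-≤ (+-mono-≤ (+-mono-≤ (*-mono-≤ (nn {ε}) (nn {q}) ε≤ q≤) (*-mono-≤ (nn {e}) (nn {m}) e≤ m≤))
         (*-monoʳ 2≥0 (*-mono-≤ (nn {e}) (nn {q}) e≤ q≤)))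
       (*-mono-≤ (0≤+ (0≤+ 0≤1 (0≤* (nn {ε}) 2≥0)) (0≤* (nn {e}) 4≥0)) 0≤ρf
         (+-mono-≤ (+-monoʳ-≤ 1ℚ (*-monoʳ 2≥0 ε≤)) (*-monoʳ 4≥0 e≤)) ρf≤ρ))
     (≤-reflexive (r ρ))
     where
     r : ∀ ρ → + 13 / 1 * (+ 70 / 1) + + 88 / 1 * (+ 12 / 1) + + 88 / 1 * (+ 70 / 1) * (+ 2 / 1)
         + (1ℚ + + 13 / 1 * (+ 2 / 1) + + 88 / 1 * (+ 2 / 1 * (+ 2 / 1))) * ρ ≡ + 14286 / 1 + + 379 / 1 * ρ
     r = solve-∀ ℚ-ring

 L1-0 : L1 (C 0ℚ) 0ℚ
 L1-0 = L1-C 0ℚ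

 Moments-B : Moments B ½ (+ 1 / 4) 0ℚ
 Moments-B = record { R = C 0ℚ ; R-bound = L1-0 ; expand =
   PS-solve 1 (λ x → con ½ :* (con 1ℚ :+ x) := (con 1ℚ :+ :- (con ½ :* (con 1ℚ :+ :- x)) :+ con 0ℚ :* ((con 1ℚ :+ :- x) :* (con 1ℚ :+ :- x)))
     :+ :- (((con 1ℚ :+ :- x) :* ((con 1ℚ :+ :- x) :* (con 1ℚ :+ :- x))) :* con 0ℚ)) ≗-refl X }

 Moments-X : Moments X 1ℚ 0ℚ 0ℚ
 Moments-X = record { R = C 0ℚ ; R-bound = L1-0 ; expand =
   PS-solve 1 (λ x → x := (con 1ℚ :+ :- (con 1ℚ :* (con 1ℚ :+ :- x)) :+ con 0ℚ :* ((con 1ℚ :+ :- x) :* (con 1ℚ :+ :- x)))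
     :+ :- (((con 1ℚ :+ :- x) :* ((con 1ℚ :+ :- x) :* (con 1ℚ :+ :- x))) :* con 0ℚ)) ≗-refl X }

 -- The states within one exchange: a law of mean at most 12 and variance at most 5 has been added
 -- to a reduced state and is then paid out in coins and shifts.
 record InRange (ε v : ℚ) : Set where
   constructor range
   field
     0≤ε : 0ℚ ≤ ε
     ε≤  : ε ≤ + 13 / 1
     0≤v : 0ℚ ≤ v
     v≤  : v ≤ + 6 / 1

   ∣ε∣≤ : ∣ ε ∣ ≤ + 13 / 1
   ∣ε∣≤ = subst (_≤ + 13 / 1) (sym (ℚ.0≤p⇒∣p∣≡p 0≤ε)) ε≤

   ∣second∣≤ : ∣ second ε v ∣ ≤ + 88 / 1
   ∣second∣≤ = ∣∣≤
     (≤-trans (*-monoˡ {a = v + ε * ε - ε} {b = + 6 / 1 + + 13 / 1 * (+ 13 / 1) - 0ℚ} (≥0 ½)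
       (+-mono-≤ (+-mono-≤ v≤ (*-mono-≤ 0≤ε 0≤ε ε≤ ε≤)) (neg-antimono-≤ 0≤ε)))
       (≤-trans (≤-reflexive {½ * (+ 6 / 1 + + 13 / 1 * (+ 13 / 1) - 0ℚ)} {+ 175 / 2} refl) (≤ᵇ⇒≤ _)))
     (≤-trans (≤-trans (≤-cert {a = - second ε v} {b = ½ * ε} (0≤* (≥0 ½) (0≤+ 0≤v (0≤sq ε))) (r ε v)) (*-monoˡ (≥0 ½) ε≤)) (≤ᵇ⇒≤ _))
     where
     r : ∀ ε v → ½ * (v + ε * ε) ≡ ½ * ε - - (½ * (v + ε * ε - ε))
     r = solve-∀ ℚ-ring

 -- What may be left between exchanges: less than the mean of a shift and less than the variance of
 -- a coin.
 record Reduced (ε v : ℚ) : Set where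
   constructor reduced
   field
     0≤ε : 0ℚ ≤ ε
     ε<1 : ε < 1ℚ
     0≤v : 0ℚ ≤ v
     v<¼ : v < + 1 / 4

 -- `d` shifts and `t` coins match the mean and the variance up to a reduced rest. `Close` is a
 -- parameter because powers of the law and tilted coefficients are compared with the coins in
 -- different forms.
 record CoinApproximation (m s² : ℚ) (Close : ℕ → ℕ → Set) : Set where
   field
     ε v : ℚ
     d t : ℕ
     is-reduced : Reduced ε v
     mean       : ι d + ½ * ι t + ε ≡ m
     variance   : + 1 / 4 * ι t + v ≡ s²
     close      : Close d t

 module Interpolation (A G : PS) (j : ℕ) (A≗ : A ≗ C (+ 1 / 5) ⊛ (pow X j ⊛ B) ⊕ G) (G-small : L1 G (+ 4 / 5))
   (μ σ² ρ : ℚ) (A-moments : Moments A μ σ² ρ)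
   (μ≥ : + 11 / 1 ≤ μ) (μ≤ : μ ≤ + 12 / 1) (σ²≥ : + 4 / 1 ≤ σ²) (σ²≤ : σ² ≤ + 5 / 1) where

   open Smooth A G j A≗ G-small

   N : ℚ
   N = remainder-bound ρ

   0≤ρ : 0ℚ ≤ ρ
   0≤ρ = L1-≥0 {Moments.R A-moments} (Moments.R-bound A-moments)

   0≤N : 0ℚ ≤ N
   0≤N = 0≤+ (≥0 (+ 14286 / 1)) (0≤* (≥0 (+ 379 / 1)) 0≤ρ)

   body : ℕ → ℕ → ℕ → PS
   body i d t = pow A i ⊛ (pow X d ⊛ coin t)

   -- An intermediate stage of the exchange: `i` laws, `d` shifts and `t` coins, with `K` carrying
   -- the mean and variance not yet matched. Every move preserves the total mean and the total
   -- variance.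
   T : ℚ → ℚ → ℕ → ℕ → ℕ → PS
   T ε v i d t = K ε v ⊛ body i d t

   Sup-D³-body : ∀ i d t → Sup (D³ ⊛ body i d t) (decay (i ℕ.+ 15 ℕ.* t))
   Sup-D³-body i d t = Sup-mono (≤-reflexive (*-identityˡ (decay (i ℕ.+ 15 ℕ.* t))))
     (Sup-cong (PS-solve 4 (λ x d a b → x :* (d :* (a :* b)) := d :* (a :* (x :* b))) ≗-refl (pow X d) D³ (pow A i) (coin t))
       (Sup-⊛ (L1-pow1 d L1-X) (Sup-D³-law i t)))

   private
     -- Absorbing `f` into the formal factor is exact up to `R ⊛ D³`, so the error is a third
     -- difference of the remaining factors. Laws are moved in this direction, coins and shifts in
     -- the opposite one.
     move : ∀ {f m s ρf} ε v i d t → Moments f m s ρf → 0ℚ ≤ ρf → ρf ≤ ρ → InRange ε v → ∣ m ∣ ≤ + 12 / 1 → ∣ second m s ∣ ≤ + 70 / 1 →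
            ∀ n → ∣ (K ε v ⊛ (f ⊛ body i d t)) n - (K (ε + m) (v + s) ⊛ body i d t) n ∣ ≤ N * decay (i ℕ.+ 15 ℕ.* t)
     move {f} {m} {s} ε v i d t M 0≤ρf ρf≤ r m≤ q≤ n = subst (λ z → ∣ z ∣ ≤ N * decay (i ℕ.+ 15 ℕ.* t)) (sym diff)
       (Sup-⊛ R-bound (Sup-D³-body i d t) n)
       where
       g = body i d t
       expansion = K-⊛ ρ ε v M 0≤ρf ρf≤ (InRange.∣ε∣≤ r) (InRange.∣second∣≤ r) m≤ q≤
       R = proj₁ expansion
       R-bound = proj₁ (proj₂ expansion)
       cancel : ∀ a b → a + b - a ≡ b
       cancel = solve-∀ ℚ-ring
       diff : (K ε v ⊛ (f ⊛ g)) n - (K (ε + m) (v + s) ⊛ g) n ≡ (R ⊛ (D³ ⊛ g)) n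
       diff = trans (cong (_- (K (ε + m) (v + s) ⊛ g) n) (trans (sym (⊛-assoc (K ε v) f g n))
         (trans (⊛-cong (proj₂ (proj₂ expansion)) (≗-refl {g}) n)
           (trans (⊛-distribʳ g (K (ε + m) (v + s)) (R ⊛ D³) n) (cong (λ z → (K (ε + m) (v + s) ⊛ g) n + z) (⊛-assoc R D³ g n))))))
         (cancel ((K (ε + m) (v + s) ⊛ g) n) ((R ⊛ (D³ ⊛ g)) n))

     ∣μ∣≤ : ∣ μ ∣ ≤ + 12 / 1
     ∣μ∣≤ = subst (_≤ + 12 / 1) (sym (ℚ.0≤p⇒∣p∣≡p (≤-trans (≥0 (+ 11 / 1)) μ≥))) μ≤

     0≤μ : 0ℚ ≤ μ
     0≤μ = ≤-trans (≥0 (+ 11 / 1)) μ≥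

     0≤σ² : 0ℚ ≤ σ²
     0≤σ² = ≤-trans (≥0 (+ 4 / 1)) σ²≥

     ∣second-μ∣≤ : ∣ second μ σ² ∣ ≤ + 70 / 1
     ∣second-μ∣≤ = ∣∣≤
       (≤-trans (*-monoˡ {a = σ² + μ * μ - μ} {b = + 5 / 1 + + 12 / 1 * (+ 12 / 1) - + 11 / 1} (≥0 ½)
         (+-mono-≤ (+-mono-≤ σ²≤ (*-mono-≤ 0≤μ 0≤μ μ≤ μ≤)) (neg-antimono-≤ μ≥))) (≤ᵇ⇒≤ _))
       (≤-trans (≤-trans (≤-cert {a = - second μ σ²} {b = ½ * μ} (0≤* (≥0 ½) (0≤+ 0≤σ² (0≤sq μ))) (r μ σ²)) (*-monoˡ (≥0 ½) μ≤)) (≤ᵇ⇒≤ _))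
       where
       r : ∀ ε v → ½ * (v + ε * ε) ≡ ½ * ε - - (½ * (v + ε * ε - ε))
       r = solve-∀ ℚ-ring

   move-law : ∀ ε v i d t → InRange ε v → ∀ n → ∣ T ε v (suc i) d t n - T (ε + μ) (v + σ²) i d t n ∣ ≤ N * decay (i ℕ.+ 15 ℕ.* t)
   move-law ε v i d t r n = subst (λ z → ∣ z - T (ε + μ) (v + σ²) i d t n ∣ ≤ N * decay (i ℕ.+ 15 ℕ.* t))
     (⊛-cong (≗-refl {K ε v}) (≗-sym (⊛-assoc A (pow A i) (pow X d ⊛ coin t))) n)
     (move ε v i d t A-moments 0≤ρ ≤-refl r ∣μ∣≤ ∣second-μ∣≤ n)

   move-coin : ∀ ε v i d t → InRange ε v → ∀ n → ∣ T (ε + ½) (v + + 1 / 4) i d t n - T ε v i d (suc t) n ∣ ≤ N * decay (i ℕ.+ 15 ℕ.* t)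
   move-coin ε v i d t r n = subst (_≤ N * decay (i ℕ.+ 15 ℕ.* t)) (∣-∣-sym (T ε v i d (suc t) n) (T (ε + ½) (v + + 1 / 4) i d t n))
     (subst (λ z → ∣ z - T (ε + ½) (v + + 1 / 4) i d t n ∣ ≤ N * decay (i ℕ.+ 15 ℕ.* t))
       (⊛-cong (≗-refl {K ε v}) (PS-solve 4 (λ b a x c → b :* (a :* (x :* c)) := a :* (x :* (b :* c))) ≗-refl B (pow A i) (pow X d) (coin t)) n)
       (move ε v i d t Moments-B ≤-refl 0≤ρ r (≤ᵇ⇒≤ _) (≤ᵇ⇒≤ _) n))

   move-shift : ∀ ε v i d t → InRange ε v → ∀ n → ∣ T (ε + 1ℚ) (v + 0ℚ) i d t n - T ε v i (suc d) t n ∣ ≤ N * decay (i ℕ.+ 15 ℕ.* t)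
   move-shift ε v i d t r n = subst (_≤ N * decay (i ℕ.+ 15 ℕ.* t)) (∣-∣-sym (T ε v i (suc d) t n) (T (ε + 1ℚ) (v + 0ℚ) i d t n))
     (subst (λ z → ∣ z - T (ε + 1ℚ) (v + 0ℚ) i d t n ∣ ≤ N * decay (i ℕ.+ 15 ℕ.* t))
       (⊛-cong (≗-refl {K ε v}) (PS-solve 4 (λ b a x c → b :* (a :* (x :* c)) := a :* ((b :* x) :* c)) ≗-refl X (pow A i) (pow X d) (coin t)) n)
       (move ε v i d t Moments-X ≤-refl 0≤ρ r (≤ᵇ⇒≤ _) (≤ᵇ⇒≤ _) n))

   private
     weaken : ∀ {x Y Z} → Y ℕ.≤ Z → x ≤ N * decay Z → x ≤ N * decay Y
     weaken h p = ≤-trans p (*-monoˡ 0≤N (decay-anti h))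

     first-plus : ∀ {x y c} {b : ℚ} → x ≤ b → y ≤ ι c * b → x + y ≤ ι (suc c) * b
     first-plus {x} {y} {c} {b} p q = ≤-trans (+-mono-≤ p q)
       (≤-reflexive (trans (r b (ι c)) (cong (_* b) (sym (ι-suc c)))))
       where
       r : ∀ b c → b + c * b ≡ (c + 1ℚ) * b
       r = solve-∀ ℚ-ring

     a≤a+ : ∀ {a b} → 0ℚ ≤ b → a ≤ a + b
     a≤a+ {a} h = subst (_≤ a + _) (+-identityʳ a) (+-monoʳ-≤ a h)

   move-coins : ∀ c ε v i d t Y → Y ℕ.≤ i ℕ.+ 15 ℕ.* t → 0ℚ ≤ ε → 0ℚ ≤ v → ε + ½ * ι c ≤ + 13 / 1 → v + + 1 / 4 * ι c ≤ + 6 / 1 →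
     ∀ n → ∣ T (ε + ½ * ι c) (v + + 1 / 4 * ι c) i d t n - T ε v i d (c ℕ.+ t) n ∣ ≤ ι c * (N * decay Y)
   move-coins zero ε v i d t Y Y≤ 0≤ε 0≤v _ _ n = ≤-reflexive (trans
     (cong ∣_∣ (trans (cong₂ (λ a b → T a b i d t n - T ε v i d t n) (r½ ε) (r¼ v)) (+-inverseʳ (T ε v i d t n))))
     (sym (trans (cong (_* (N * decay Y)) ι-0) (*-zeroˡ (N * decay Y)))))
     where
     r½ : ∀ ε → ε + ½ * ι 0 ≡ ε
     r½ ε = trans (cong (λ z → ε + ½ * z) ι-0) (+-identityʳ ε)
     r¼ : ∀ v → v + + 1 / 4 * ι 0 ≡ v
     r¼ v = trans (cong (λ z → v + + 1 / 4 * z) ι-0) (+-identityʳ v)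
   move-coins (suc c) ε v i d t Y Y≤ 0≤ε 0≤v ε≤ v≤ n = ≤-trans
     (∣∣-tri (T (ε + ½ * ι (suc c)) (v + + 1 / 4 * ι (suc c)) i d t n) (T (ε + ½ * ι c) (v + + 1 / 4 * ι c) i d (suc t) n) (T ε v i d (suc c ℕ.+ t) n))
     (first-plus {c = c} {b = N * decay Y}
       (weaken Y≤ (subst₂ (λ a b → ∣ T a b i d t n - T (ε + ½ * ι c) (v + + 1 / 4 * ι c) i d (suc t) n ∣ ≤ N * decay (i ℕ.+ 15 ℕ.* t)) (sym e½) (sym e¼)
         (move-coin (ε + ½ * ι c) (v + + 1 / 4 * ι c) i d t in-range n)))
       (subst (λ z → ∣ T (ε + ½ * ι c) (v + + 1 / 4 * ι c) i d (suc t) n - T ε v i d z n ∣ ≤ ι c * (N * decay Y)) (ℕ.+-suc c t)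
         (move-coins c ε v i d (suc t) Y (ℕ.≤-trans Y≤ (ℕ.+-monoʳ-≤ i (ℕ.*-monoʳ-≤ 15 (ℕ.n≤1+n t)))) 0≤ε 0≤v (InRange.ε≤ in-range) (InRange.v≤ in-range) n)))
     where
     e½ : ε + ½ * ι (suc c) ≡ ε + ½ * ι c + ½
     e½ = trans (cong (λ z → ε + ½ * z) (ι-suc c)) (r ε (ι c))
       where
       r : ∀ ε c → ε + ½ * (c + 1ℚ) ≡ ε + ½ * c + ½
       r = solve-∀ ℚ-ring
     e¼ : v + + 1 / 4 * ι (suc c) ≡ v + + 1 / 4 * ι c + + 1 / 4
     e¼ = trans (cong (λ z → v + + 1 / 4 * z) (ι-suc c)) (r v (ι c))
       where
       r : ∀ ε c → ε + + 1 / 4 * (c + 1ℚ) ≡ ε + + 1 / 4 * c + + 1 / 4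
       r = solve-∀ ℚ-ring
     in-range : InRange (ε + ½ * ι c) (v + + 1 / 4 * ι c)
     in-range = range (0≤+ 0≤ε (0≤* (≥0 ½) (0≤ι c)))
       (≤-trans (≤-trans (a≤a+ (≥0 ½)) (≤-reflexive (sym e½))) ε≤)
       (0≤+ 0≤v (0≤* (≥0 (+ 1 / 4)) (0≤ι c)))
       (≤-trans (≤-trans (a≤a+ (≥0 (+ 1 / 4))) (≤-reflexive (sym e¼))) v≤)

   move-shifts : ∀ h ε v i d t Y → Y ℕ.≤ i ℕ.+ 15 ℕ.* t → 0ℚ ≤ ε → 0ℚ ≤ v → ε + ι h ≤ + 13 / 1 → v ≤ + 6 / 1 →
     ∀ n → ∣ T (ε + ι h) v i d t n - T ε v i (h ℕ.+ d) t n ∣ ≤ ι h * (N * decay Y)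
   move-shifts zero ε v i d t Y Y≤ 0≤ε 0≤v _ _ n = ≤-reflexive (trans
     (cong ∣_∣ (trans (cong (λ a → T a v i d t n - T ε v i d t n) (trans (cong (λ z → ε + z) ι-0) (+-identityʳ ε))) (+-inverseʳ (T ε v i d t n))))
     (sym (trans (cong (_* (N * decay Y)) ι-0) (*-zeroˡ (N * decay Y)))))
   move-shifts (suc h) ε v i d t Y Y≤ 0≤ε 0≤v ε≤ v≤ n = ≤-trans
     (∣∣-tri (T (ε + ι (suc h)) v i d t n) (T (ε + ι h) v i (suc d) t n) (T ε v i (suc h ℕ.+ d) t n))
     (first-plus {c = h} {b = N * decay Y}
       (weaken Y≤ (subst₂ (λ a b → ∣ T a b i d t n - T (ε + ι h) v i (suc d) t n ∣ ≤ N * decay (i ℕ.+ 15 ℕ.* t)) (sym e₁) (+-identityʳ v)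
         (move-shift (ε + ι h) v i d t in-range n)))
       (subst (λ z → ∣ T (ε + ι h) v i (suc d) t n - T ε v i z t n ∣ ≤ ι h * (N * decay Y)) (ℕ.+-suc h d)
         (move-shifts h ε v i (suc d) t Y Y≤ 0≤ε 0≤v (InRange.ε≤ in-range) v≤ n)))
     where
     e₁ : ε + ι (suc h) ≡ ε + ι h + 1ℚ
     e₁ = trans (cong (λ z → ε + z) (ι-suc h)) (sym (+-assoc ε (ι h) 1ℚ))
     in-range : InRange (ε + ι h) v
     in-range = range (0≤+ 0≤ε (0≤ι h)) (≤-trans (≤-trans (a≤a+ 0≤1) (≤-reflexive (sym e₁))) ε≤) 0≤v v≤

   record Target (i : ℕ) (ε v : ℚ) (d t : ℕ) (start : PS) (e : ℚ) : Set where
     field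
       ε′ v′ : ℚ
       d′ t′ : ℕ
       is-reduced : Reduced ε′ v′
       mean       : ι d′ + ½ * ι t′ + ε′ ≡ ι d + ½ * ι t + ε + ι i * μ
       variance   : + 1 / 4 * ι t′ + v′ ≡ + 1 / 4 * ι t + v + ι i * σ²
       close      : ∀ n → ∣ start n - T ε′ v′ 0 d′ t′ n ∣ ≤ e

   private
     module Step (ε v : ℚ) (r : Reduced ε v) where
       open Reduced r
       v₁ = v + σ²
       ε₁ = ε + μ
       0≤4v₁ : 0ℚ ≤ + 4 / 1 * v₁
       0≤4v₁ = 0≤* (≥0 (+ 4 / 1)) (0≤+ 0≤v 0≤σ²)
       abstract
         c-floor : ∃[ n ] (ι n ≤ + 4 / 1 * v₁ × + 4 / 1 * v₁ < ι n + 1ℚ)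
         c-floor = nat-floor (+ 4 / 1 * v₁) 0≤4v₁
       -- These coins match all but less than 1/4 of the variance. Their number is at most 4(1/4 +
       -- 5) = 21.
       c = proj₁ c-floor
       c≤ = proj₁ (proj₂ c-floor)
       <c+1 = proj₂ (proj₂ c-floor)
       v₂ = v₁ - + 1 / 4 * ι c
       ε₂ = ε₁ - ½ * ι c
       c≤21 : ι c ≤ + 21 / 1
       c≤21 = ≤-trans c≤ (≤-trans (*-monoˡ {a = v₁} {b = + 1 / 4 + + 5 / 1} (≥0 (+ 4 / 1)) (+-mono-≤ (<⇒≤ v<¼) σ²≤)) (≤ᵇ⇒≤ _))
       0≤v₂ : 0ℚ ≤ v₂
       0≤v₂ = subst (0ℚ ≤_) (e v₁ (ι c)) (0≤* (≥0 (+ 1 / 4)) (0≤-diff c≤))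
         where
         e : ∀ v c → + 1 / 4 * (+ 4 / 1 * v - c) ≡ v - + 1 / 4 * c
         e = solve-∀ ℚ-ring
       v₂<¼ : v₂ < + 1 / 4
       v₂<¼ = <-cert (0<* (>0 (+ 1 / 4)) (0<-diff <c+1)) (e v₁ (ι c))
         where
         e : ∀ v c → + 1 / 4 * (c + 1ℚ - + 4 / 1 * v) ≡ + 1 / 4 - (v - + 1 / 4 * c)
         e = solve-∀ ℚ-ring
       -- The coins use up mean at most 21/2, which the lower bound 11 for the mean of the law
       -- covers.
       0≤ε₂ : 0ℚ ≤ ε₂
       0≤ε₂ = ≤-trans (≥0 ½) (≤-cert {a = ½} {b = ε₂} (0≤+ (0≤+ 0≤ε (0≤-diff μ≥)) (0≤* (≥0 ½) (0≤-diff c≤21))) (e ε μ (ι c)))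
         where
         e : ∀ ε μ c → ε + (μ - + 11 / 1) + ½ * (+ 21 / 1 - c) ≡ ε + μ - ½ * c - ½
         e = solve-∀ ℚ-ring
       abstract
         h-floor : ∃[ n ] (ι n ≤ ε₂ × ε₂ < ι n + 1ℚ)
         h-floor = nat-floor ε₂ 0≤ε₂
       h = proj₁ h-floor
       h≤ = proj₁ (proj₂ h-floor)
       <h+1 = proj₂ (proj₂ h-floor)
       ε₃ = ε₂ - ι h
       0≤ε₃ : 0ℚ ≤ ε₃
       0≤ε₃ = 0≤-diff h≤
       ε₃<1 : ε₃ < 1ℚ
       ε₃<1 = <-cert (0<-diff <h+1) (e ε₂ (ι h))
         where
         e : ∀ a b → b + 1ℚ - a ≡ 1ℚ - (a - b)
         e = solve-∀ ℚ-ring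
       reduced₃ : Reduced ε₃ v₂
       reduced₃ = reduced 0≤ε₃ ε₃<1 0≤v₂ v₂<¼
       ε₁≤13 : ε₁ ≤ + 13 / 1
       ε₁≤13 = +-mono-≤ {ε} {1ℚ} {μ} {+ 12 / 1} (<⇒≤ ε<1) μ≤
       v₁≤6 : v₁ ≤ + 6 / 1
       v₁≤6 = ≤-trans (+-mono-≤ {v} {+ 1 / 4} {σ²} {+ 5 / 1} (<⇒≤ v<¼) σ²≤) (≤ᵇ⇒≤ _)
       ε₂+ : ε₂ + ½ * ι c ≡ ε₁
       ε₂+ = sub-add ε₁ (½ * ι c)
         where
         sub-add : ∀ a b → a - b + b ≡ a
         sub-add = solve-∀ ℚ-ring
       v₂+ : v₂ + + 1 / 4 * ι c ≡ v₁
       v₂+ = sub-add v₁ (+ 1 / 4 * ι c)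
         where
         sub-add : ∀ a b → a - b + b ≡ a
         sub-add = solve-∀ ℚ-ring
       ε₃+ : ε₃ + ι h ≡ ε₂
       ε₃+ = sub-add ε₂ (ι h)
         where
         sub-add : ∀ a b → a - b + b ≡ a
         sub-add = solve-∀ ℚ-ring
       ε₂≤ε₁ : ε₂ ≤ ε₁
       ε₂≤ε₁ = ≤-trans (a≤a+ (0≤* (≥0 ½) (0≤ι c))) (≤-reflexive ε₂+)
       v₂≤v₁ : v₂ ≤ v₁
       v₂≤v₁ = ≤-trans (a≤a+ (0≤* (≥0 (+ 1 / 4)) (0≤ι c))) (≤-reflexive v₂+)
       -- A law, worth 1 in the argument of `decay`, is traded for at least one coin, worth 15; so
       -- smoothness is not lost in the course of the exchanges.
       1≤c : 1 ℕ.≤ c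
       1≤c = ι-cancel-< {0} {c} (subst (_< ι c) (sym ι-0) (<-cert {a = 0ℚ} {b = ι c}
         (0<+ (0<+ (0<-diff <c+1) (0≤* (≥0 (+ 4 / 1)) (0≤+ 0≤v (0≤-diff σ²≥)))) (≥0 (+ 15 / 1))) (e v σ² (ι c))))
         where
         e : ∀ v s c → (c + 1ℚ - + 4 / 1 * (v + s)) + + 4 / 1 * (v + (s - + 4 / 1)) + + 15 / 1 ≡ c - 0ℚ
         e = solve-∀ ℚ-ring
       -- One law, at most 21 coins and at most 13 shifts.
       moves≤35 : 1ℚ + ι c + ι h ≤ + 35 / 1
       moves≤35 = ≤-trans (+-mono-≤ {1ℚ + ι c} {1ℚ + + 21 / 1} (+-monoʳ-≤ 1ℚ c≤21) (≤-trans h≤ (≤-trans ε₂≤ε₁ ε₁≤13))) (≤ᵇ⇒≤ _)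

       one-law : ∀ i d t Y → Y ℕ.≤ i ℕ.+ 15 ℕ.* t → ∀ n →
         ∣ T ε v (suc i) d t n - T ε₃ v₂ i (h ℕ.+ d) (c ℕ.+ t) n ∣ ≤ + 35 / 1 * (N * decay Y)
       one-law i d t Y Y≤ n = ≤-trans (∣∣-tri (T ε v (suc i) d t n) (T ε₁ v₁ i d t n) (T ε₃ v₂ i (h ℕ.+ d) (c ℕ.+ t) n))
         (≤-trans (+-monoʳ-≤ ∣ T ε v (suc i) d t n - T ε₁ v₁ i d t n ∣
           (∣∣-tri (T ε₁ v₁ i d t n) (T ε₂ v₂ i d (c ℕ.+ t) n) (T ε₃ v₂ i (h ℕ.+ d) (c ℕ.+ t) n)))
         (≤-trans (+-mono-≤
           (weaken Y≤ (move-law ε v i d t (range 0≤ε (≤-trans (<⇒≤ ε<1) (≤ᵇ⇒≤ _)) 0≤v (≤-trans (<⇒≤ v<¼) (≤ᵇ⇒≤ _))) n))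
           (+-mono-≤
             (subst₂ (λ a b → ∣ T a b i d t n - T ε₂ v₂ i d (c ℕ.+ t) n ∣ ≤ ι c * (N * decay Y)) ε₂+ v₂+
               (move-coins c ε₂ v₂ i d t Y Y≤ 0≤ε₂ 0≤v₂ (subst (_≤ + 13 / 1) (sym ε₂+) ε₁≤13) (subst (_≤ + 6 / 1) (sym v₂+) v₁≤6) n))
             (subst (λ a → ∣ T a v₂ i d (c ℕ.+ t) n - T ε₃ v₂ i (h ℕ.+ d) (c ℕ.+ t) n ∣ ≤ ι h * (N * decay Y)) ε₃+
               (move-shifts h ε₃ v₂ i d (c ℕ.+ t) Y (ℕ.≤-trans Y≤ (ℕ.+-monoʳ-≤ i (ℕ.*-monoʳ-≤ 15 (ℕ.m≤n+m t c)))) 0≤ε₃ 0≤v₂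
                 (subst (_≤ + 13 / 1) (sym ε₃+) (≤-trans ε₂≤ε₁ ε₁≤13)) (≤-trans v₂≤v₁ v₁≤6) n))))
         (≤-trans (≤-reflexive (e (N * decay Y) (ι c) (ι h))) (*-monoʳ (0≤* 0≤N (decay-nonneg Y)) moves≤35))))
         where
         e : ∀ b c h → b + (c * b + h * b) ≡ (1ℚ + c + h) * b
         e = solve-∀ ℚ-ring

   -- The bound is `suc Y` before an exchange and `Y` during it, because a move is charged to a
   -- third difference of the factors that remain once the law has been taken out.
   interpolate : ∀ Y i ε v d t → Reduced ε v → suc Y ℕ.≤ i ℕ.+ 15 ℕ.* t → Target i ε v d t (T ε v i d t) (ι i * (+ 35 / 1 * (N * decay Y)))
   interpolate Y zero ε v d t r h = record
     { ε′ = ε ; v′ = v ; d′ = d ; t′ = t ; is-reduced = r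
     ; mean = e (ι d + ½ * ι t + ε) μ ; variance = e (+ 1 / 4 * ι t + v) σ²
     ; close = λ n → ≤-reflexive (trans (cong ∣_∣ (+-inverseʳ (T ε v 0 d t n)))
         (sym (trans (cong (_* (+ 35 / 1 * (N * decay Y))) ι-0) (*-zeroˡ (+ 35 / 1 * (N * decay Y)))))) }
     where
     e : ∀ a m → a ≡ a + ι 0 * m
     e a m = sym (trans (cong (λ z → a + z) (trans (cong (_* m) ι-0) (*-zeroˡ m))) (+-identityʳ a))
   interpolate Y (suc i) ε v d t r Y≤ = record
     { ε′ = Target.ε′ rest ; v′ = Target.v′ rest ; d′ = Target.d′ rest ; t′ = Target.t′ rest ; is-reduced = Target.is-reduced rest
     ; mean = trans (Target.mean rest) (trans (cong₂ (λ a b → a + ½ * b + ε₃ + ι i * μ) (ι-+ h d) (ι-+ c t))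
         (trans (e₁ (ι h) (ι d) (ι c) (ι t) ε μ (ι i)) (cong (λ z → ι d + ½ * ι t + ε + z * μ) (sym (ι-suc i)))))
     ; variance = trans (Target.variance rest) (trans (cong (λ b → + 1 / 4 * b + v₂ + ι i * σ²) (ι-+ c t))
         (trans (e₂ (ι c) (ι t) v σ² (ι i)) (cong (λ z → + 1 / 4 * ι t + v + z * σ²) (sym (ι-suc i)))))
     ; close = λ n → ≤-trans (∣∣-tri (T ε v (suc i) d t n) (T ε₃ v₂ i (h ℕ.+ d) (c ℕ.+ t) n) (T (Target.ε′ rest) (Target.v′ rest) 0 (Target.d′ rest) (Target.t′ rest) n))
         (first-plus {c = i} {b = + 35 / 1 * (N * decay Y)} (one-law i d t Y (ℕ.≤-pred Y≤) n) (Target.close rest n)) }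
     where
     open Step ε v r
     rest : Target i ε₃ v₂ (h ℕ.+ d) (c ℕ.+ t) (T ε₃ v₂ i (h ℕ.+ d) (c ℕ.+ t)) (ι i * (+ 35 / 1 * (N * decay Y)))
     rest = interpolate Y i ε₃ v₂ (h ℕ.+ d) (c ℕ.+ t) reduced₃ (ℕ.≤-trans Y≤ (ℕ.≤-trans (ℕ.m≤n+m (suc i ℕ.+ 15 ℕ.* t) 14)
       (ℕ.≤-trans (ℕ.≤-reflexive (e i t)) (ℕ.+-monoʳ-≤ i (ℕ.*-monoʳ-≤ 15 (ℕ.+-monoˡ-≤ t 1≤c))))))
       where
       e : ∀ i t → 14 ℕ.+ (suc i ℕ.+ 15 ℕ.* t) ≡ i ℕ.+ 15 ℕ.* (1 ℕ.+ t)
       e = ℕ-Solver.solve-∀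
     e₁ : ∀ h d c t ε μ i → (h + d) + ½ * (c + t) + ((ε + μ) - ½ * c - h) + i * μ ≡ d + ½ * t + ε + (i + 1ℚ) * μ
     e₁ = solve-∀ ℚ-ring
     e₂ : ∀ c t v s i → + 1 / 4 * (c + t) + ((v + s) - + 1 / 4 * c) + i * s ≡ + 1 / 4 * t + v + (i + 1ℚ) * s
     e₂ = solve-∀ ℚ-ring

   private
     K-start : K 0ℚ 0ℚ ≗ C 1ℚ
     K-start = PS-solve 1 (λ d → con 1ℚ :+ :- (con 0ℚ :* d) :+ con 0ℚ :* (d :* d) := con 1ℚ) ≗-refl D

     T-start : ∀ i → T 0ℚ 0ℚ i 0 0 ≗ pow A i
     T-start i = ≗-trans (⊛-cong K-start (≗-refl {body i 0 0}))
       (PS-solve 1 (λ a → con 1ℚ :* (a :* (con 1ℚ :* con 1ℚ)) := a) ≗-refl (pow A i))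

     T-end : ∀ ε v d t → T ε v 0 d t ≗ (pow X d ⊛ coin t) ⊕ (⊖ C ε ⊕ C (second ε v) ⊛ D) ⊛ (pow X d ⊛ (D ⊛ coin t))
     T-end ε v d t = PS-solve 5 (λ ε e d x c → (con 1ℚ :+ :- (ε :* d) :+ e :* (d :* d)) :* (con 1ℚ :* (x :* c))
         := x :* c :+ (:- ε :+ e :* d) :* (x :* (d :* c))) ≗-refl (C ε) (C (second ε v)) D (pow X d) (coin t)

     -- At the end `K` differs from 1 by a multiple of `D`. That `D` falls on the coins and gives
     -- 4/(t + 1); the cofactor has L1 norm at most 1 + 2 = 3.
     end-close : ∀ ε v d t → Reduced ε v → ∀ n → ∣ T ε v 0 d t n - (pow X d ⊛ coin t) n ∣ ≤ + 12 / 1 * ι (suc t) ⁻¹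
     end-close ε v d t r n = subst (λ z → ∣ z ∣ ≤ + 12 / 1 * ι (suc t) ⁻¹) (sym (trans (cong (_- (pow X d ⊛ coin t) n) (T-end ε v d t n)) (cancel ((pow X d ⊛ coin t) n) (((⊖ C ε ⊕ C (second ε v) ⊛ D) ⊛ (pow X d ⊛ (D ⊛ coin t))) n))))
       (≤-trans (Sup-⊛ (L1-mono small (L1-⊕ (L1-⊖ (L1-C ε)) (L1-⊛ (L1-C (second ε v)) L1-D))) (Sup-⊛ (L1-pow1 d L1-X) (ι*Sup-D-coin t)) n)
         (≤-reflexive (r₁ (ι (suc t) ⁻¹))))
       where
       open Reduced r
       cancel : ∀ a b → a + b - a ≡ b
       cancel = solve-∀ ℚ-ring
       r₁ : ∀ x → + 3 / 1 * (1ℚ * (+ 4 / 1 * x)) ≡ + 12 / 1 * x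
       r₁ = solve-∀ ℚ-ring
       ε²≤1 : ε * ε ≤ 1ℚ
       ε²≤1 = *-mono-≤ 0≤ε 0≤ε (<⇒≤ ε<1) (<⇒≤ ε<1)
       ∣e∣≤1 : ∣ second ε v ∣ ≤ 1ℚ
       ∣e∣≤1 = ∣∣≤
         (≤-cert {a = second ε v} {b = 1ℚ} (0≤+ (0≤+ (0≤+ (0≤* (≥0 ½) 0≤ε) (0≤* (≥0 ½) (0≤-diff (<⇒≤ v<¼)))) (0≤* (≥0 ½) (0≤-diff ε²≤1))) (≥0 (+ 3 / 8))) (q₁ ε v))
         (≤-cert {a = - second ε v} {b = 1ℚ} (0≤+ (0≤+ (0≤* (≥0 ½) (0≤+ 0≤v (0≤sq ε))) (0≤* (≥0 ½) (0≤-diff (<⇒≤ ε<1)))) (≥0 ½)) (q₂ ε v))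
         where
         q₁ : ∀ ε v → ½ * ε + ½ * (+ 1 / 4 - v) + ½ * (1ℚ - ε * ε) + + 3 / 8 ≡ 1ℚ - ½ * (v + ε * ε - ε)
         q₁ = solve-∀ ℚ-ring
         q₂ : ∀ ε v → ½ * (v + ε * ε) + ½ * (1ℚ - ε) + ½ ≡ 1ℚ - - (½ * (v + ε * ε - ε))
         q₂ = solve-∀ ℚ-ring
       small : ∣ ε ∣ + ∣ second ε v ∣ * (+ 2 / 1) ≤ + 3 / 1
       small = +-mono-≤ {∣ ε ∣} {1ℚ} {∣ second ε v ∣ * (+ 2 / 1)} {1ℚ * (+ 2 / 1)}
         (≤-trans (≤-reflexive (ℚ.0≤p⇒∣p∣≡p 0≤ε)) (<⇒≤ ε<1))
         (*-monoʳ (≥0 (+ 2 / 1)) ∣e∣≤1)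

   -- After multiplication by `s`: there are `s` exchanges of at most 35 moves, and `s²` times a
   -- third difference is at most 36000, which makes 35 · 36000 = 1260000; the final `K` adds 12.
   error : ℚ
   error = + 1260000 / 1 * N + + 12 / 1

   LocalLimit : ℕ → Set
   LocalLimit s = CoinApproximation (ι s * μ) (ι s * σ²) (λ d t → ∀ n → ι s * ∣ pow A s n - (pow X d ⊛ coin t) n ∣ ≤ error)

   private
     -- About 4σ² ≥ 16 coins replace each law, so an error of order 1/t is also one of order 1/s.
     steps≤coins : ∀ s t v → v < + 1 / 4 → + 1 / 4 * ι t + v ≡ ι s * σ² → ι s ≤ ι (suc t)
     steps≤coins s t v v<¼ eq = ≤-cert {a = ι s} {b = ι (suc t)}
       (0≤+ (0≤+ (0≤* (≥0 (+ 4 / 1)) (0≤* (0≤ι s) (0≤-diff σ²≥))) (0≤* (≥0 (+ 15 / 1)) (0≤ι s)))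
         (0≤* (≥0 (+ 4 / 1)) (0≤-diff (<⇒≤ v<¼))))
       (trans (e₁ (ι s) σ² v) (trans (cong (λ z → + 4 / 1 * z + 1ℚ - + 4 / 1 * v - ι s) (sym eq))
         (trans (e₂ (ι s) v (ι t)) (cong (_- ι s) (sym (ι-suc t))))))
       where
       e₁ : ∀ s σ v → + 4 / 1 * (s * (σ - + 4 / 1)) + + 15 / 1 * s + + 4 / 1 * (+ 1 / 4 - v) ≡ + 4 / 1 * (s * σ) + 1ℚ - + 4 / 1 * v - s
       e₁ = solve-∀ ℚ-ring
       e₂ : ∀ s v t → + 4 / 1 * (+ 1 / 4 * t + v) + 1ℚ - + 4 / 1 * v - s ≡ t + 1ℚ - s
       e₂ = solve-∀ ℚ-ring

     collect-error : ∀ {s D t x y} → 0ℚ ≤ s → s * (s * D) ≤ + 36000 / 1 → s * t ≤ 1ℚ →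
       x ≤ s * (+ 35 / 1 * (N * D)) → y ≤ + 12 / 1 * t → s * (x + y) ≤ error
     collect-error {s} {D} {t} {x} {y} 0≤s h₁ h₂ x≤ y≤ = begin
       s * (x + y)
         ≤⟨ *-monoˡ 0≤s (+-mono-≤ x≤ y≤) ⟩
       s * (s * (+ 35 / 1 * (N * D)) + + 12 / 1 * t)
         ≡⟨ e₁ s N D t ⟩
       + 35 / 1 * N * (s * (s * D)) + + 12 / 1 * (s * t)
         ≤⟨ +-mono-≤ (*-monoˡ (0≤* (≥0 (+ 35 / 1)) 0≤N) h₁) (*-monoˡ (≥0 (+ 12 / 1)) h₂) ⟩
       + 35 / 1 * N * (+ 36000 / 1) + + 12 / 1 * 1ℚ
         ≡⟨ e₂ N ⟩
       error ∎
       where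
       open ≤-Reasoning
       e₁ : ∀ s N d t → s * (s * (+ 35 / 1 * (N * d)) + + 12 / 1 * t) ≡ + 35 / 1 * N * (s * (s * d)) + + 12 / 1 * (s * t)
       e₁ = solve-∀ ℚ-ring
       e₂ : ∀ N → + 35 / 1 * N * (+ 36000 / 1) + + 12 / 1 * 1ℚ ≡ + 1260000 / 1 * N + + 12 / 1
       e₂ = solve-∀ ℚ-ring

   private abstract
     interpolation : ∀ s → Target (suc s) 0ℚ 0ℚ 0 0 (T 0ℚ 0ℚ (suc s) 0 0) (ι (suc s) * (+ 35 / 1 * (N * decay s)))
     interpolation s = interpolate s (suc s) 0ℚ 0ℚ 0 0 (reduced ≤-refl 0<1 ≤-refl (>0 (+ 1 / 4)))
       (ℕ.≤-reflexive (sym (ℕ.+-identityʳ (suc s))))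

   abstract
     -- The maximum of the law has order s^(-1/2), so an error O(1/s), uniform in the place, leaves
     -- it intact to leading order.
     local-limit : ∀ s → LocalLimit (suc s)
     local-limit s = record
       { ε = ε′ ; v = v′ ; d = d′ ; t = t′ ; is-reduced = is-reduced
       ; mean = trans mean (trans (cong (λ z → z + ½ * z + 0ℚ + ι (suc s) * μ) ι-0) (+-identityˡ (ι (suc s) * μ)))
       ; variance = variance′
       ; close = close′ }
       where
       open Target (interpolation s)
       variance′ : + 1 / 4 * ι t′ + v′ ≡ ι (suc s) * σ²
       variance′ = trans variance (trans (cong (λ z → + 1 / 4 * z + 0ℚ + ι (suc s) * σ²) ι-0) (+-identityˡ (ι (suc s) * σ²)))
       s≤t : ι (suc s) ≤ ι (suc t′)
       s≤t = steps≤coins (suc s) t′ v′ (Reduced.v<¼ is-reduced) variance′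
       close′ : ∀ n → ι (suc s) * ∣ pow A (suc s) n - (pow X d′ ⊛ coin t′) n ∣ ≤ error
       close′ n = ≤-trans
         (*-monoˡ (0≤ι (suc s)) (∣∣-tri (pow A (suc s) n) (T ε′ v′ 0 d′ t′ n) ((pow X d′ ⊛ coin t′) n)))
         (collect-error {s = ι (suc s)} {D = decay s} {t = ι (suc t′) ⁻¹} {x = ∣ pow A (suc s) n - T ε′ v′ 0 d′ t′ n ∣} {y = ∣ T ε′ v′ 0 d′ t′ n - (pow X d′ ⊛ coin t′) n ∣} (0≤ι (suc s)) (ι*decay s)
           (÷-≤ {c = 1ℚ} (0<ι t′) (subst (ι (suc s) ≤_) (sym (*-identityˡ (ι (suc t′)))) s≤t))
           (subst (λ z → ∣ z - T ε′ v′ 0 d′ t′ n ∣ ≤ ι (suc s) * (+ 35 / 1 * (N * decay s))) (T-start (suc s) n) (close n))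
           (end-close ε′ v′ d′ t′ is-reduced n))

-- Finitely supported laws: Taylor expansion, Chebyshev's inequality, the coin inside

module Laws where

 open RationalArithmetic
 open PowerSeries
 open Coins
 open Smoothing
 open LocalLimit
 open PS-Solver using (_:+_; _:*_; :-_; _:=_; con) renaming (solve to PS-solve)

 -- Σ_{k < L} p k X^{k + o}
 poly : PS → ℕ → ℕ → PS
 poly p zero    o = C 0ℚ
 poly p (suc L) o = poly p L o ⊕ C (p L) ⊛ pow X (L ℕ.+ o)

 module Taylor where

   -- Repeated division by 1 - X: `E₁ k` is (1 - Xᵏ)/(1 - X), `E₂ k` is (k - E₁)/(1 - X), and `E₃ k`
   -- is (k(k - 1)/2 - E₂)/(1 - X).
   E₁ E₂ E₃ : ℕ → PS
   E₁ zero    = C 0ℚ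
   E₁ (suc k) = E₁ k ⊕ pow X k
   E₂ zero    = C 0ℚ
   E₂ (suc k) = E₂ k ⊕ E₁ k
   E₃ zero    = C 0ℚ
   E₃ (suc k) = E₃ k ⊕ E₂ k

   private
     C-+ : ∀ p q → C (p + q) ≗ C p ⊕ C q
     C-+ p q zero    = refl
     C-+ p q (suc n) = refl
     C-eq : ∀ {p q} → p ≡ q → C p ≗ C q
     C-eq refl _ = refl

   choose₂ : ℕ → ℚ
   choose₂ k = ½ * (ι k * ι k - ι k)

   D-E₁ : ∀ k → D ⊛ E₁ k ≗ C 1ℚ ⊕ ⊖ pow X k
   D-E₁ zero    = PS-solve 1 (λ d → d :* con 0ℚ := con 1ℚ :+ :- con 1ℚ) ≗-refl D
   D-E₁ (suc k) = ≗-trans (⊛-distribˡ D (E₁ k) (pow X k)) (≗-trans (⊕-cong (D-E₁ k) (≗-refl {D ⊛ pow X k}))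
     (PS-solve 2 (λ x y → con 1ℚ :+ :- y :+ (con 1ℚ :+ :- x) :* y := con 1ℚ :+ :- (x :* y)) ≗-refl X (pow X k)))

   D-E₂ : ∀ k → D ⊛ E₂ k ≗ C (ι k) ⊕ ⊖ E₁ k
   D-E₂ zero    = ≗-trans (PS-solve 1 (λ d → d :* con 0ℚ := con 0ℚ :+ :- con 0ℚ) ≗-refl D) (⊕-cong (C-eq (sym ι-0)) (≗-refl {⊖ C 0ℚ}))
   D-E₂ (suc k) = ≗-trans (⊛-distribˡ D (E₂ k) (E₁ k)) (≗-trans (⊕-cong (D-E₂ k) (D-E₁ k))
     (≗-trans (PS-solve 3 (λ c e x → c :+ :- e :+ (con 1ℚ :+ :- x) := (c :+ con 1ℚ) :+ :- (e :+ x)) ≗-refl (C (ι k)) (E₁ k) (pow X k))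
       (⊕-cong (≗-trans (≗-sym (C-+ (ι k) 1ℚ)) (C-eq (sym (ι-suc k)))) (≗-refl {⊖ (E₁ k ⊕ pow X k)}))))

   choose₂-suc : ∀ k → choose₂ (suc k) ≡ choose₂ k + ι k
   choose₂-suc k = trans (cong (λ z → ½ * (z * z - z)) (ι-suc k)) (r (ι k))
     where
     r : ∀ k → ½ * ((k + 1ℚ) * (k + 1ℚ) - (k + 1ℚ)) ≡ ½ * (k * k - k) + k
     r = solve-∀ ℚ-ring

   D-E₃ : ∀ k → D ⊛ E₃ k ≗ C (choose₂ k) ⊕ ⊖ E₂ k
   D-E₃ zero    = ≗-trans (PS-solve 1 (λ d → d :* con 0ℚ := con 0ℚ :+ :- con 0ℚ) ≗-refl D)
     (⊕-cong (C-eq (sym (cong (λ z → ½ * (z * z - z)) ι-0))) (≗-refl {⊖ C 0ℚ}))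
   D-E₃ (suc k) = ≗-trans (⊛-distribˡ D (E₃ k) (E₂ k)) (≗-trans (⊕-cong (D-E₃ k) (D-E₂ k))
     (≗-trans (PS-solve 4 (λ c e m x → c :+ :- e :+ (m :+ :- x) := (c :+ m) :+ :- (e :+ x)) ≗-refl (C (choose₂ k)) (E₂ k) (C (ι k)) (E₁ k))
       (⊕-cong (≗-trans (≗-sym (C-+ (choose₂ k) (ι k))) (C-eq (sym (choose₂-suc k)))) (≗-refl {⊖ (E₂ k ⊕ E₁ k)}))))

   -- The three division identities are solved for the undivided series and substituted into each
   -- other.
   expansion : ∀ k → pow X k ≗ C 1ℚ ⊕ ⊖ (C (ι k) ⊛ D) ⊕ C (choose₂ k) ⊛ (D ⊛ D) ⊕ ⊖ (D³ ⊛ E₃ k)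
   expansion k = ≗-trans (solve-for (C 1ℚ) (pow X k) (D ⊛ E₁ k) (D-E₁ k))
     (≗-trans (⊕-cong (≗-refl {C 1ℚ}) (λ n → cong -_ (⊛-cong (≗-refl {D}) (≗-trans (solve-for (C (ι k)) (E₁ k) (D ⊛ E₂ k) (D-E₂ k))
         (⊕-cong (≗-refl {C (ι k)}) (λ n → cong -_ (⊛-cong (≗-refl {D}) (solve-for (C (choose₂ k)) (E₂ k) (D ⊛ E₃ k) (D-E₃ k)) n)))) n)))
       (PS-solve 4 (λ d m c e → con 1ℚ :+ :- (d :* (m :+ :- (d :* (c :+ :- (d :* e)))))
           := con 1ℚ :+ :- (m :* d) :+ c :* (d :* d) :+ :- ((d :* (d :* d)) :* e)) ≗-refl D (C (ι k)) (C (choose₂ k)) (E₃ k)))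
     where
     solve-for : ∀ c f g → g ≗ c ⊕ ⊖ f → f ≗ c ⊕ ⊖ g
     solve-for c f g e n = trans (PS-solve 2 (λ c f → f := c :+ :- (c :+ :- f)) ≗-refl c f n) (cong (λ z → c n + - z) (sym (e n)))

   L1-E₁ : ∀ k → L1 (E₁ k) (ι k)
   L1-E₁ zero    = L1-mono (0≤ι 0) (L1-C 0ℚ)
   L1-E₁ (suc k) = subst (L1 (E₁ (suc k))) (sym (ι-suc k)) (L1-⊕ (L1-E₁ k) (L1-pow1 k L1-X))

   L1-E₂ : ∀ k → L1 (E₂ k) (ι k * ι k)
   L1-E₂ zero    = L1-mono (0≤sq (ι 0)) (L1-C 0ℚ)
   L1-E₂ (suc k) = L1-mono (≤-trans (≤-reflexive (r (ι k))) (≤-trans (*-monoˡ (0≤+ (0≤ι k) 0≤1) (≤-cert {a = ι k} {b = ι k + 1ℚ} 0≤1 (r′ (ι k))))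
       (≤-reflexive (cong (λ z → z * z) (sym (ι-suc k)))))) (L1-⊕ (L1-E₂ k) (L1-E₁ k))
     where
     r : ∀ k → k * k + k ≡ (k + 1ℚ) * k
     r = solve-∀ ℚ-ring
     r′ : ∀ k → 1ℚ ≡ k + 1ℚ - k
     r′ = solve-∀ ℚ-ring

   L1-E₃ : ∀ k → L1 (E₃ k) (ι k ^ 3)
   L1-E₃ zero    = L1-mono (^-nonneg 3 (0≤ι 0)) (L1-C 0ℚ)
   L1-E₃ (suc k) = L1-mono (≤-cert {a = ι k ^ 3 + ι k * ι k} {b = ι (suc k) ^ 3}
       (0≤+ (0≤+ (0≤* (≥0 (+ 2 / 1)) (0≤* (0≤ι k) (0≤ι k))) (0≤* (≥0 (+ 3 / 1)) (0≤ι k))) 0≤1)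
       (trans (r (ι k)) (cong (λ z → z ^ 3 - (ι k ^ 3 + ι k * ι k)) (sym (ι-suc k))))) (L1-⊕ (L1-E₃ k) (L1-E₂ k))
     where
     r : ∀ k → + 2 / 1 * (k * k) + + 3 / 1 * k + 1ℚ ≡ (k + 1ℚ) * ((k + 1ℚ) * ((k + 1ℚ) * 1ℚ)) - (k * (k * (k * 1ℚ)) + k * k)
     r = solve-∀ ℚ-ring

 Σ₁ Σ₂ Σ₃ : PS → ℕ → ℕ → ℚ
 Σ₁ p L o = S (λ k → p k * ι (k ℕ.+ o)) L
 Σ₂ p L o = S (λ k → p k * Taylor.choose₂ (k ℕ.+ o)) L
 Σ₃ p L o = S (λ k → p k * ι (k ℕ.+ o) ^ 3) L

 module _ (p : PS) (o : ℕ) where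

   open Taylor

   private
     R : ℕ → PS
     R zero    = C 0ℚ
     R (suc L) = R L ⊕ C (p L) ⊛ E₃ (L ℕ.+ o)
     C-+ : ∀ p q → C (p + q) ≗ C p ⊕ C q
     C-+ p q zero    = refl
     C-+ p q (suc n) = refl
     C-cong : ∀ {p q} → p ≡ q → C p ≗ C q
     C-cong refl _ = refl

   poly-expansion : ∀ L → poly p L o ≗ C (S p L) ⊕ ⊖ (C (Σ₁ p L o) ⊛ D) ⊕ C (Σ₂ p L o) ⊛ (D ⊛ D) ⊕ ⊖ (D³ ⊛ R L)
   poly-expansion zero    = PS-solve 2 (λ d d³ → con 0ℚ := con 0ℚ :+ :- (con 0ℚ :* d) :+ con 0ℚ :* (d :* d) :+ :- (d³ :* con 0ℚ)) ≗-refl D D³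
   poly-expansion (suc L) = ≗-trans (⊕-cong (poly-expansion L) (⊛-cong (≗-refl {C (p L)}) (expansion (L ℕ.+ o))))
     (≗-trans (PS-solve 10 (λ d d³ a b c r q m x e →
         (a :+ :- (b :* d) :+ c :* (d :* d) :+ :- (d³ :* r)) :+ q :* (con 1ℚ :+ :- (m :* d) :+ x :* (d :* d) :+ :- (d³ :* e))
         := (a :+ q) :+ :- ((b :+ q :* m) :* d) :+ (c :+ q :* x) :* (d :* d) :+ :- (d³ :* (r :+ q :* e)))
         ≗-refl D D³ (C (S p L)) (C (Σ₁ p L o)) (C (Σ₂ p L o)) (R L) (C (p L)) (C (ι (L ℕ.+ o))) (C (choose₂ (L ℕ.+ o))) (E₃ (L ℕ.+ o)))
       (⊕-cong (⊕-cong (⊕-cong (≗-trans (≗-sym (C-+ (S p L) (p L))) (C-cong (sym (S-last p L))))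
           (λ n → cong -_ (⊛-cong (merge (λ k → p k * ι (k ℕ.+ o)) (ι (L ℕ.+ o)) refl) (≗-refl {D}) n)))
           (⊛-cong (merge (λ k → p k * choose₂ (k ℕ.+ o)) (choose₂ (L ℕ.+ o)) refl) (≗-refl {D ⊛ D})))
         (≗-refl {⊖ (D³ ⊛ R (suc L))})))
     where
     merge : ∀ f y → f L ≡ p L * y → C (S f L) ⊕ C (p L) ⊛ C y ≗ C (S f (suc L))
     merge f y e n = trans (cong (λ z → C (S f L) n + z) (sym (C-homo-* (p L) y n)))
       (trans (sym (C-+ (S f L) (p L * y) n)) (cong (λ z → C z n) (trans (cong (λ z → S f L + z) (sym e)) (sym (S-last f L)))))

   L1-R : Nonneg p → ∀ L → L1 (R L) (Σ₃ p L o)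
   L1-R p≥0 zero    = L1-C 0ℚ
   L1-R p≥0 (suc L) = L1-mono (≤-reflexive (trans (cong (λ z → Σ₃ p L o + z * ι (L ℕ.+ o) ^ 3) (ℚ.0≤p⇒∣p∣≡p (p≥0 L)))
       (sym (S-last (λ k → p k * ι (k ℕ.+ o) ^ 3) L))))
     (L1-⊕ (L1-R p≥0 L) (L1-⊛ (L1-C (p L)) (L1-E₃ (L ℕ.+ o))))

   -- The sums `S`, `Σ₁` and `Σ₂` are the total mass and the first two factorial moments, hence the
   -- Taylor coefficients at 1 up to sign. The third moment bounds the remainder because `E₃ k` has
   -- L1 norm at most k³.
   poly-Moments : Nonneg p → ∀ L σ² → S p L ≡ 1ℚ → second (Σ₁ p L o) σ² ≡ Σ₂ p L o → Moments (poly p L o) (Σ₁ p L o) σ² (Σ₃ p L o)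
   poly-Moments p≥0 L σ² total e = record
     { R = R L ; R-bound = L1-R p≥0 L
     ; expand = ≗-trans (poly-expansion L) (⊕-cong (⊕-cong (⊕-cong (C-cong total) (≗-refl {⊖ (C (Σ₁ p L o) ⊛ D)})) (⊛-cong (C-cong (sym e)) (≗-refl {D ⊛ D}))) (≗-refl {⊖ (D³ ⊛ R L)})) }

   L1-poly : ∀ L → L1 (poly p L o) (S (abs p) L)
   L1-poly zero    = L1-C 0ℚ
   L1-poly (suc L) = L1-mono (≤-reflexive (trans (cong (λ z → S (abs p) L + z) (*-identityʳ ∣ p L ∣)) (sym (S-last (abs p) L))))
     (L1-⊕ (L1-poly L) (L1-⊛ (L1-C (p L)) (L1-pow1 (L ℕ.+ o) L1-X)))

 poly-shift : ∀ p L o → poly p L o ≗ pow X o ⊛ poly p L 0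
 poly-shift p zero    o = PS-solve 1 (λ x → con 0ℚ := x :* con 0ℚ) ≗-refl (pow X o)
 poly-shift p (suc L) o = ≗-trans (⊕-cong (poly-shift p L o) (⊛-cong (≗-refl {C (p L)}) (pow-+ X L o)))
   (≗-trans (⊕-cong (≗-refl {pow X o ⊛ poly p L 0}) (λ n → trans (⊛-cong (≗-refl {C (p L)}) (⊛-cong (λ i → cong (λ z → pow X z i) (sym (ℕ.+-identityʳ L))) (≗-refl {pow X o})) n) refl))
     (PS-solve 4 (λ x a c y → x :* a :+ c :* (y :* x) := x :* (a :+ c :* y)) ≗-refl (pow X o) (poly p L 0) (C (p L)) (pow X (L ℕ.+ 0))))

 pow-⊛ : ∀ f g n → pow (f ⊛ g) n ≗ pow f n ⊛ pow g n
 pow-⊛ f g zero    = ≗-sym (⊛-identityˡ (C 1ℚ))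
 pow-⊛ f g (suc n) = ≗-trans (⊛-cong (≗-refl {f ⊛ g}) (pow-⊛ f g n))
   (PS-solve 4 (λ f g a b → (f :* g) :* (a :* b) := (f :* a) :* (g :* b)) ≗-refl f g (pow f n) (pow g n))

 pow-pow-X : ∀ o s → pow (pow X o) s ≗ pow X (s ℕ.* o)
 pow-pow-X o zero    = ≗-refl {C 1ℚ}
 pow-pow-X o (suc s) = ≗-trans (⊛-cong (≗-refl {pow X o}) (pow-pow-X o s)) (≗-sym (pow-+ X o (s ℕ.* o)))

 -- The shift that makes room for the coins only moves the coefficients of the power, so it can be
 -- undone at the end.
 shifted-power : ∀ p L o s n → pow (poly p L o) s (s ℕ.* o ℕ.+ n) ≡ pow (poly p L 0) s n
 shifted-power p L o s n = trans (pow-cong s (poly-shift p L o) (s ℕ.* o ℕ.+ n))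
   (trans (pow-⊛ (pow X o) (poly p L 0) s (s ℕ.* o ℕ.+ n))
     (trans (⊛-cong (pow-pow-X o s) (≗-refl {pow (poly p L 0) s}) (s ℕ.* o ℕ.+ n)) (powX-⊛ (s ℕ.* o) (pow (poly p L 0) s) n)))

 poly-⊛ : ∀ p L f n → (poly p L 0 ⊛ f) n ≡ S (λ k → p k * (pow X k ⊛ f) n) L
 poly-⊛ p zero    f n = trans (C-⊛ 0ℚ f n) (*-zeroˡ (f n))
 poly-⊛ p (suc L) f n = trans (⊛-distribʳ f (poly p L 0) (C (p L) ⊛ pow X (L ℕ.+ 0)) n)
   (trans (cong₂ _+_ (poly-⊛ p L f n) (trans (⊛-assoc (C (p L)) (pow X (L ℕ.+ 0)) f n) (trans (C-⊛ (p L) (pow X (L ℕ.+ 0) ⊛ f) n)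
       (cong (λ z → p L * (pow X z ⊛ f) n) (ℕ.+-identityʳ L)))))
     (sym (S-last (λ k → p k * (pow X k ⊛ f) n) L)))

 private
   powX-diag : ∀ k → pow X k k ≡ 1ℚ
   powX-diag k = trans (sym (⊛-identityˡ-at k)) (powX-⊛′ k)
     where
     ⊛-identityˡ-at : ∀ k → (pow X k ⊛ C 1ℚ) k ≡ pow X k k
     ⊛-identityˡ-at k = PS-solve 1 (λ x → x :* con 1ℚ := x) ≗-refl (pow X k) k
     powX-⊛′ : ∀ k → (pow X k ⊛ C 1ℚ) k ≡ 1ℚ
     powX-⊛′ k = trans (cong (pow X k ⊛ C 1ℚ) (sym (ℕ.+-identityʳ k))) (powX-⊛ k (C 1ℚ) 0)
   powX-above : ∀ k i → pow X k (k ℕ.+ suc i) ≡ 0ℚ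
   powX-above k i = trans (sym (PS-solve 1 (λ x → x :* con 1ℚ := x) ≗-refl (pow X k) (k ℕ.+ suc i))) (powX-⊛ k (C 1ℚ) (suc i))
   powX-below : ∀ k n → n ℕ.< k → pow X k n ≡ 0ℚ
   powX-below k n h = trans (sym (PS-solve 1 (λ x → x :* con 1ℚ := x) ≗-refl (pow X k) n)) (powX-⊛-< k (C 1ℚ) n h)

 poly-outside : ∀ p L n → L ℕ.≤ n → poly p L 0 n ≡ 0ℚ
 poly-outside p zero    zero    _ = refl
 poly-outside p zero    (suc n) _ = refl
 poly-outside p (suc L) n h = trans (cong₂ _+_ (poly-outside p L n (ℕ.<⇒≤ h)) (trans (C-⊛ (p L) (pow X (L ℕ.+ 0)) n)
     (trans (cong (p L *_) (trans (cong (λ z → pow X z n) (ℕ.+-identityʳ L)) above)) (*-zeroʳ (p L)))))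
   (+-identityʳ 0ℚ)
   where
   above : pow X L n ≡ 0ℚ
   above with ℕ.m≤n⇒∃[o]m+o≡n h
   ... | o , refl = trans (cong (pow X L) (sym (ℕ.+-suc L o))) (powX-above L o)

 poly-inside : ∀ p L n → n ℕ.< L → poly p L 0 n ≡ p n
 poly-inside p (suc L) n (s≤s n≤L) with ℕ.m≤n⇒m<n∨m≡n n≤L
 ... | inj₁ n<L = trans (cong₂ _+_ (poly-inside p L n n<L) (trans (C-⊛ (p L) (pow X (L ℕ.+ 0)) n)
     (trans (cong (p L *_) (trans (cong (λ z → pow X z n) (ℕ.+-identityʳ L)) (powX-below L n n<L))) (*-zeroʳ (p L)))))
   (+-identityʳ (p n))
 ... | inj₂ refl = trans (cong₂ _+_ (poly-outside p n n ℕ.≤-refl) (trans (C-⊛ (p n) (pow X (n ℕ.+ 0)) n)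
     (trans (cong (p n *_) (trans (cong (λ z → pow X z n) (ℕ.+-identityʳ n)) (powX-diag n))) (*-identityʳ (p n)))))
   (+-identityˡ (p n))

 module Expectation (p : PS) (L : ℕ) (p≥0 : Nonneg p) (total : S p L ≡ 1ℚ) where

   -- The expectation of `φ` at a sum of `s` independent variables with law `p`, conditioned on one
   -- variable at a time.
   expect : ℕ → PS → ℚ
   expect zero    φ = φ 0
   expect (suc s) φ = S (λ k → p k * expect s (λ i → φ (k ℕ.+ i))) L

   expect-nonneg : ∀ s {φ} → Nonneg φ → 0ℚ ≤ expect s φ
   expect-nonneg zero    h = h 0
   expect-nonneg (suc s) h = S-nonneg L (λ k → 0≤* (p≥0 k) (expect-nonneg s (λ i → h (k ℕ.+ i))))

   expect-cong : ∀ s {φ χ} → φ ≗ χ → expect s φ ≡ expect s χ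
   expect-cong zero    h = h 0
   expect-cong (suc s) h = S-cong L (λ k → cong (p k *_) (expect-cong s (λ i → h (k ℕ.+ i))))

   -- Markov's inequality for a single atom. Conditioning on the first variable, places below its
   -- value contribute 0 to the left side.
   atom≤expect : ∀ s {φ} → Nonneg φ → ∀ n → pow (poly p L 0) s n * φ n ≤ expect s φ
   atom≤expect zero    {φ} h zero    = ≤-reflexive (*-identityˡ (φ 0))
   atom≤expect zero    {φ} h (suc n) = ≤-trans (≤-reflexive (*-zeroˡ (φ (suc n)))) (h 0)
   atom≤expect (suc s) {φ} h n = begin
     (poly p L 0 ⊛ A^s) n * φ n ≡⟨ cong (_* φ n) (poly-⊛ p L A^s n) ⟩
     S (λ k → p k * (pow X k ⊛ A^s) n) L * φ n ≡⟨ *-comm _ (φ n) ⟩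
     φ n * S (λ k → p k * (pow X k ⊛ A^s) n) L ≡⟨ S-scale (φ n) _ L ⟨
     S (λ k → φ n * (p k * (pow X k ⊛ A^s) n)) L ≤⟨ S-mono L (λ k → ≤-trans (≤-reflexive (r (φ n) (p k) ((pow X k ⊛ A^s) n))) (*-monoˡ (p≥0 k) (shifted k))) ⟩
     expect (suc s) φ ∎
     where
     open ≤-Reasoning
     A^s = pow (poly p L 0) s
     r : ∀ f p x → f * (p * x) ≡ p * (x * f)
     r = solve-∀ ℚ-ring
     shifted : ∀ k → (pow X k ⊛ A^s) n * φ n ≤ expect s (λ i → φ (k ℕ.+ i))
     shifted k = by (ℕ.<-≤-connex n k)
       where
       by : n ℕ.< k ⊎ k ℕ.≤ n → (pow X k ⊛ A^s) n * φ n ≤ expect s (λ i → φ (k ℕ.+ i))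
       by (inj₁ n<k) = ≤-trans (≤-reflexive (trans (cong (_* φ n) (powX-⊛-< k A^s n n<k)) (*-zeroˡ (φ n)))) (expect-nonneg s (λ i → h (k ℕ.+ i)))
       by (inj₂ k≤n) = let m , k+m≡n = ℕ.m≤n⇒∃[o]m+o≡n k≤n in
         subst (λ n → (pow X k ⊛ A^s) n * φ n ≤ expect s (λ i → φ (k ℕ.+ i))) k+m≡n
           (≤-trans (≤-reflexive (cong (_* φ (k ℕ.+ m)) (powX-⊛ k A^s m))) (atom≤expect s (λ i → h (k ℕ.+ i)) m))

   private
     m₁ = S (λ k → p k * ι k) L
     m₂ = S (λ k → p k * (ι k * ι k)) L

   S-quadratic : ∀ c b → S (λ k → p k * (c + (b + ι k) * (b + ι k))) L ≡ c + b * b + + 2 / 1 * b * m₁ + m₂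
   S-quadratic c b = begin
     S (λ k → p k * (c + (b + ι k) * (b + ι k))) L
       ≡⟨ S-cong L (λ k → r (p k) c b (ι k)) ⟩
     S ((λ k → (c + b * b) * p k) ⊕ (λ k → + 2 / 1 * b * (p k * ι k)) ⊕ (λ k → p k * (ι k * ι k))) L
       ≡⟨ S-⊕ ((λ k → (c + b * b) * p k) ⊕ (λ k → + 2 / 1 * b * (p k * ι k))) (λ k → p k * (ι k * ι k)) L ⟩
     S ((λ k → (c + b * b) * p k) ⊕ (λ k → + 2 / 1 * b * (p k * ι k))) L + m₂
       ≡⟨ cong (_+ m₂) (S-⊕ (λ k → (c + b * b) * p k) (λ k → + 2 / 1 * b * (p k * ι k)) L) ⟩
     S (λ k → (c + b * b) * p k) L + S (λ k → + 2 / 1 * b * (p k * ι k)) L + m₂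
       ≡⟨ cong (_+ m₂) (cong₂ _+_ (S-scale (c + b * b) p L) (S-scale (+ 2 / 1 * b) (λ k → p k * ι k) L)) ⟩
     (c + b * b) * S p L + + 2 / 1 * b * m₁ + m₂
       ≡⟨ cong (λ z → (c + b * b) * z + + 2 / 1 * b * m₁ + m₂) total ⟩
     (c + b * b) * 1ℚ + + 2 / 1 * b * m₁ + m₂
       ≡⟨ cong (λ z → z + + 2 / 1 * b * m₁ + m₂) (*-identityʳ (c + b * b)) ⟩
     c + b * b + + 2 / 1 * b * m₁ + m₂ ∎
     where
     open ≡-Reasoning
     r : ∀ p c b k → p * (c + (b + k) * (b + k)) ≡ (c + b * b) * p + + 2 / 1 * b * (p * k) + p * (k * k)
     r = solve-∀ ℚ-ring

   variance : ℚ
   variance = m₂ - m₁ * m₁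

   -- The offset `a` is general because conditioning on the first variable moves it.
   expect-square : ∀ s a → expect s (λ i → (a + ι i) * (a + ι i)) ≡ ι s * variance + (ι s * m₁ + a) * (ι s * m₁ + a)
   expect-square zero    a = subst (λ z → (a + z) * (a + z) ≡ z * variance + (z * m₁ + a) * (z * m₁ + a)) (sym ι-0) (r a variance m₁)
     where
     r : ∀ a v m → (a + 0ℚ) * (a + 0ℚ) ≡ 0ℚ * v + (0ℚ * m + a) * (0ℚ * m + a)
     r = solve-∀ ℚ-ring
   expect-square (suc s) a = begin
     S (λ k → p k * expect s (λ i → (a + ι (k ℕ.+ i)) * (a + ι (k ℕ.+ i)))) L
       ≡⟨ S-cong L (λ k → cong (p k *_) (trans
            (expect-cong s (λ i → cong (λ z → z * z) (trans (cong (λ z → a + z) (ι-+ k i)) (sym (+-assoc a (ι k) (ι i))))))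
            (trans (expect-square s (a + ι k)) (cong (λ z → ι s * variance + z * z) (sym (+-assoc (ι s * m₁) a (ι k))))))) ⟩
     S (λ k → p k * (ι s * variance + (ι s * m₁ + a + ι k) * (ι s * m₁ + a + ι k))) L
       ≡⟨ S-quadratic (ι s * variance) (ι s * m₁ + a) ⟩
     ι s * variance + (ι s * m₁ + a) * (ι s * m₁ + a) + + 2 / 1 * (ι s * m₁ + a) * m₁ + m₂
       ≡⟨ r (ι s) a m₁ m₂ ⟩
     (ι s + 1ℚ) * variance + ((ι s + 1ℚ) * m₁ + a) * ((ι s + 1ℚ) * m₁ + a)
       ≡⟨ cong (λ z → z * variance + (z * m₁ + a) * (z * m₁ + a)) (sym (ι-suc s)) ⟩
     ι (suc s) * variance + (ι (suc s) * m₁ + a) * (ι (suc s) * m₁ + a) ∎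
     where
     open ≡-Reasoning
     r : ∀ s a m q → s * (q - m * m) + (s * m + a) * (s * m + a) + + 2 / 1 * (s * m + a) * m + q
       ≡ (s + 1ℚ) * (q - m * m) + ((s + 1ℚ) * m + a) * ((s + 1ℚ) * m + a)
     r = solve-∀ ℚ-ring

   -- `atom≤expect` for the squared distance from the mean.
   chebyshev : ∀ s n → pow (poly p L 0) s n * ((ι n - ι s * m₁) * (ι n - ι s * m₁)) ≤ ι s * variance
   chebyshev s n = begin
     pow (poly p L 0) s n * ((ι n - ι s * m₁) * (ι n - ι s * m₁))
       ≡⟨ cong (λ z → pow (poly p L 0) s n * (z * z)) (+-comm (ι n) (- (ι s * m₁))) ⟩
     pow (poly p L 0) s n * ((- (ι s * m₁) + ι n) * (- (ι s * m₁) + ι n))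
       ≤⟨ atom≤expect s (λ i → 0≤sq (- (ι s * m₁) + ι i)) n ⟩
     expect s (λ i → (- (ι s * m₁) + ι i) * (- (ι s * m₁) + ι i))
       ≡⟨ expect-square s (- (ι s * m₁)) ⟩
     ι s * variance + (ι s * m₁ + - (ι s * m₁)) * (ι s * m₁ + - (ι s * m₁))
       ≡⟨ r (ι s * variance) (ι s * m₁) ⟩
     ι s * variance ∎
     where
     open ≤-Reasoning
     r : ∀ a b → a + (b + - b) * (b + - b) ≡ a
     r = solve-∀ ℚ-ring

 -- One fifth of a coin with faces 1 and 2. This part is split off from a law in `CoinInside`, which
 -- leaves mass 4/5.
 tenths : PS
 tenths (suc zero)       = + 1 / 10
 tenths (suc (suc zero)) = + 1 / 10
 tenths _                = 0ℚ

 private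
   C-neg : ∀ q → C (- q) ≗ ⊖ C q
   C-neg q zero    = refl
   C-neg q (suc n) = refl
   C-+ : ∀ p q → C (p + q) ≗ C p ⊕ C q
   C-+ p q zero    = refl
   C-+ p q (suc n) = refl

 poly-sub : ∀ p q L o → poly (λ k → p k - q k) L o ≗ poly p L o ⊕ ⊖ poly q L o
 poly-sub p q zero    o = PS-solve 0 (con 0ℚ := con 0ℚ :+ :- con 0ℚ) ≗-refl
 poly-sub p q (suc L) o = ≗-trans (⊕-cong (poly-sub p q L o) (⊛-cong (≗-trans (C-+ (p L) (- q L)) (⊕-cong (≗-refl {C (p L)}) (C-neg (q L)))) (≗-refl {pow X (L ℕ.+ o)})))
   (PS-solve 5 (λ a b c d x → a :+ :- b :+ (c :+ :- d) :* x := (a :+ c :* x) :+ :- (b :+ d :* x)) ≗-refl (poly p L o) (poly q L o) (C (p L)) (C (q L)) (pow X (L ℕ.+ o)))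

 poly-tenths : ∀ L o → poly tenths (3 ℕ.+ L) o ≗ C (+ 1 / 5) ⊛ (pow X (suc o) ⊛ B)
 poly-tenths zero    o = PS-solve 2 (λ y x → con 0ℚ :+ con 0ℚ :* y :+ con (+ 1 / 10) :* (x :* y) :+ con (+ 1 / 10) :* (x :* (x :* y))
   := con (+ 1 / 5) :* ((x :* y) :* (con ½ :* (con 1ℚ :+ x)))) ≗-refl (pow X o) X
 poly-tenths (suc L) o = ≗-trans (⊕-cong (poly-tenths L o) (≗-refl {C 0ℚ ⊛ pow X (3 ℕ.+ L ℕ.+ o)}))
   (PS-solve 2 (λ a b → a :+ con 0ℚ :* b := a) ≗-refl (C (+ 1 / 5) ⊛ (pow X (suc o) ⊛ B)) (pow X (3 ℕ.+ L ℕ.+ o)))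

 S-tenths : ∀ L → S tenths (3 ℕ.+ L) ≡ + 1 / 5
 S-tenths zero    = refl
 S-tenths (suc L) = trans (S-last tenths (3 ℕ.+ L)) (trans (+-identityʳ (S tenths (3 ℕ.+ L))) (S-tenths L))

 module CoinInside (p : PS) (L : ℕ) (o : ℕ) (p≥0 : Nonneg p) (total : S p (3 ℕ.+ L) ≡ 1ℚ)
   (p₁≥ : + 1 / 10 ≤ p 1) (p₂≥ : + 1 / 10 ≤ p 2) where

   rest : PS
   rest k = p k - tenths k

   Nonneg-rest : Nonneg rest
   Nonneg-rest zero                = 0≤-diff (p≥0 0)
   Nonneg-rest (suc zero)          = 0≤-diff p₁≥
   Nonneg-rest (suc (suc zero))    = 0≤-diff p₂≥
   Nonneg-rest (suc (suc (suc k))) = 0≤-diff (p≥0 (suc (suc (suc k))))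

   G : PS
   G = poly rest (3 ℕ.+ L) o

   decompose : poly p (3 ℕ.+ L) o ≗ C (+ 1 / 5) ⊛ (pow X (suc o) ⊛ B) ⊕ G
   decompose = ≗-trans (PS-solve 2 (λ a b → a := b :+ (a :+ :- b)) ≗-refl (poly p (3 ℕ.+ L) o) (poly tenths (3 ℕ.+ L) o))
     (⊕-cong (poly-tenths L o) (≗-sym (poly-sub p tenths (3 ℕ.+ L) o)))

   G-small : L1 G (+ 4 / 5)
   G-small = L1-mono (≤-reflexive (trans (S-cong (3 ℕ.+ L) (abs-nonneg Nonneg-rest)) sum)) (L1-poly rest o (3 ℕ.+ L))
     where
     S-neg : ∀ f n → S (λ k → - f k) n ≡ - S f n
     S-neg f zero    = refl
     S-neg f (suc n) = trans (cong (λ z → - f 0 + z) (S-neg (tl f) n)) (sym (ℚ.neg-distrib-+ (f 0) (S (tl f) n)))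
     sum : S rest (3 ℕ.+ L) ≡ + 4 / 5
     sum = trans (S-⊕ p (λ k → - tenths k) (3 ℕ.+ L)) (cong₂ _+_ total (trans (S-neg tenths (3 ℕ.+ L)) (cong -_ (S-tenths L))))

-- Exponential generating functions of representations by powers of 2

module Representations where

 open import Data.Bool.Base using (true; false)
 open import Data.List.Base as List using (List; []; _∷_; length; filter; applyUpTo; map; _++_; cartesianProductWith)
 import Data.List.Properties as List
 open import Data.Nat.Base using (_!; ⌊_/2⌋)
 open import Data.Vec.Base as Vec using (Vec; []; _∷_)
 open import Function using (id; _∘_)
 open import Relation.Nullary using (does)
 open import Defs using (value; tuplesBelow)
 open RationalArithmetic
 open PowerSeries
 open Coins using (parity; ⌊a+a/2⌋; ⌊1+a+a/2⌋)
 open PS-Solver using (_:+_; _:*_; :-_; _:=_; con) renaming (solve to PS-solve)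

 -- The series xʲ/j!

 inv! : ℕ → ℚ
 inv! j = ι (j !) ⁻¹

 0<ι! : ∀ n → 0ℚ < ι (n !)
 0<ι! n = ℚ.<-respˡ-≡ ι-0 (ι-mono-< (ℕ.>-nonZero⁻¹ (n !) ⦃ ℕ._!≢0 n ⦄))

 0≤inv! : ∀ n → 0ℚ ≤ inv! n
 0≤inv! n = 0≤⁻¹ (0<ι! n)

 m!*n!≤ : ∀ m n → m ! ℕ.* n ! ℕ.≤ (m ℕ.+ n) !
 m!*n!≤ zero    n = ℕ.≤-reflexive (ℕ.*-identityˡ (n !))
 m!*n!≤ (suc m) n = ℕ.≤-trans (ℕ.≤-reflexive (ℕ.*-assoc (suc m) (m !) (n !))) (ℕ.*-mono-≤ (s≤s (ℕ.m≤m+n m n)) (m!*n!≤ m n))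

 inv!-* : ∀ m n → inv! (m ℕ.+ n) ≤ inv! m * inv! n
 inv!-* m n = subst (inv! (m ℕ.+ n) ≤_) (sym (⁻¹-unique 0<mn e))
   (⁻¹-anti 0<mn (subst (_≤ ι ((m ℕ.+ n) !)) (ι-* (m !) (n !)) (ι-mono (m!*n!≤ m n))))
   where
   0<mn : 0ℚ < ι (m !) * ι (n !)
   0<mn = 0<* (0<ι! m) (0<ι! n)
   r : ∀ a b c d → a * b * (c * d) ≡ (a * c) * (b * d)
   r = solve-∀ ℚ-ring
   e : ι (m !) * ι (n !) * (inv! m * inv! n) ≡ 1ℚ
   e = trans (r (ι (m !)) (ι (n !)) (inv! m) (inv! n)) (cong₂ _*_ (*-⁻¹ (0<ι! m)) (*-⁻¹ (0<ι! n)))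

 inv!-suc : ∀ n → ι (suc n) * inv! (suc n) ≡ inv! n
 inv!-suc n = ⁻¹-unique (0<ι! n) (trans (r (ι (n !)) (ι (suc n)) (inv! (suc n)))
   (trans (cong (_* inv! (suc n)) (sym (ι-* (suc n) (n !)))) (*-⁻¹ (0<ι! (suc n)))))
   where
   r : ∀ a b c → a * (b * c) ≡ b * a * c
   r = solve-∀ ℚ-ring

 E : ℕ → PS
 E j = C (inv! j) ⊛ pow X j

 inv!-0 : inv! 0 ≡ 1ℚ
 inv!-0 = trans (cong _⁻¹ ι-1) (sym (⁻¹-unique 0<1 refl))

 E-0 : E 0 ≗ C 1ℚ
 E-0 = ≗-trans (⊛-cong (λ i → cong (λ z → C z i) inv!-0) (≗-refl {C 1ℚ})) (⊛-identityˡ (C 1ℚ))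

 Nonneg-E : ∀ j → Nonneg (E j)
 Nonneg-E j = Nonneg-⊛ (Nonneg-C (0≤inv! j)) (Nonneg-pow j Nonneg-X)

 C-mono : ∀ {p q} → p ≤ q → C p ≤̇ C q
 C-mono h zero    = h
 C-mono h (suc n) = ≤-refl

 -- Coefficientwise this says that the binomial coefficient of i + j over i is at least 1.
 E-* : ∀ i j → E (i ℕ.+ j) ≤̇ E i ⊛ E j
 E-* i j n = ≤-trans
   (⊛-mono (Nonneg-C (0≤inv! (i ℕ.+ j))) (Nonneg-pow (i ℕ.+ j) Nonneg-X) (C-mono (inv!-* i j)) (λ k → ≤-reflexive (pow-+ X i j k)) n)
   (≤-reflexive (≗-trans (⊛-cong (C-homo-* (inv! i) (inv! j)) (≗-refl {pow X i ⊛ pow X j}))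
     (PS-solve 4 (λ a b c d → (a :* b) :* (c :* d) := (a :* c) :* (b :* d)) ≗-refl (C (inv! i)) (C (inv! j)) (pow X i) (pow X j)) n))

 E-⊛-below : ∀ j f n → n ℕ.< j → (E j ⊛ f) n ≡ 0ℚ
 E-⊛-below j f n h = trans (⊛-assoc (C (inv! j)) (pow X j) f n) (trans (C-⊛ (inv! j) (pow X j ⊛ f) n)
   (trans (cong (inv! j *_) (powX-⊛-< j f n h)) (*-zeroʳ (inv! j))))

 E-⊛-at : ∀ j f n → (E j ⊛ f) (j ℕ.+ n) ≡ inv! j * f n
 E-⊛-at j f n = trans (⊛-assoc (C (inv! j)) (pow X j) f (j ℕ.+ n)) (trans (C-⊛ (inv! j) (pow X j ⊛ f) (j ℕ.+ n)) (cong (inv! j *_) (powX-⊛ j f n)))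

 private
   θ-C : ∀ q n → θ (C q) n ≡ 0ℚ
   θ-C q zero    = trans (cong (_* q) ι-0) (*-zeroˡ q)
   θ-C q (suc n) = *-zeroʳ (ι (suc n))

   θ-X : θ X ≗ X
   θ-X zero          = trans (cong (_* 0ℚ) ι-0) refl
   θ-X (suc zero)    = trans (cong (_* 1ℚ) ι-1) refl
   θ-X (suc (suc n)) = *-zeroʳ (ι (suc (suc n)))

   θ-powX : ∀ j → θ (pow X j) ≗ C (ι j) ⊛ pow X j
   θ-powX zero    n = trans (θ-C 1ℚ n) (sym (trans (C-⊛ (ι 0) (C 1ℚ) n) (trans (cong (_* C 1ℚ n) ι-0) (*-zeroˡ (C 1ℚ n)))))
   θ-powX (suc j) = ≗-trans (θ-⊛ X (pow X j)) (≗-trans (⊕-cong (⊛-cong θ-X (≗-refl {pow X j})) (⊛-cong (≗-refl {X}) (θ-powX j)))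
     (≗-trans (PS-solve 3 (λ x p c → x :* p :+ x :* (c :* p) := (c :+ con 1ℚ) :* (x :* p)) ≗-refl X (pow X j) (C (ι j)))
       (⊛-cong (λ i → trans (C-+ (ι j) 1ℚ i) (cong (λ z → C z i) (sym (ι-suc j)))) (≗-refl {X ⊛ pow X j}))))
     where
     C-+ : ∀ p q → C p ⊕ C q ≗ C (p + q)
     C-+ p q zero    = refl
     C-+ p q (suc n) = refl

 θ-E-suc : ∀ j → θ (E (suc j)) ≗ X ⊛ E j
 θ-E-suc j = ≗-trans (θ-⊛ (C (inv! (suc j))) (pow X (suc j))) (≗-trans (⊕-cong (λ n → ⊛-zeroˡ (θ (C (inv! (suc j)))) (pow X (suc j)) (θ-C (inv! (suc j))) n)
     (⊛-cong (≗-refl {C (inv! (suc j))}) (θ-powX (suc j))))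
   (λ n → trans (+-identityˡ _) (≗-trans (≗-trans (≗-sym (⊛-assoc (C (inv! (suc j))) (C (ι (suc j))) (pow X (suc j))))
       (⊛-cong (λ i → trans (sym (C-homo-* (inv! (suc j)) (ι (suc j)) i)) (cong (λ z → C z i) (trans (*-comm (inv! (suc j)) (ι (suc j))) (inv!-suc j)))) (≗-refl {pow X (suc j)})))
     (PS-solve 3 (λ c x p → c :* (x :* p) := x :* (c :* p)) ≗-refl (C (inv! j)) X (pow X j)) n)))

 θ-E-0 : ∀ n → θ (E 0) n ≡ 0ℚ
 θ-E-0 n = trans (cong (ι n *_) (E-0 n)) (θ-C 1ℚ n)

 ΣP : (ℕ → PS) → ℕ → PS
 ΣP F n k = S (λ l → F l k) n

 ΣP-cong : ∀ {F G} n → (∀ l → l ℕ.< n → F l ≗ G l) → ΣP F n ≗ ΣP G n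
 ΣP-cong zero    h k = refl
 ΣP-cong (suc n) h k = cong₂ _+_ (h 0 (s≤s z≤n) k) (ΣP-cong n (λ l l< → h (suc l) (s≤s l<)) k)

 ΣP-mono : ∀ {F G} n → (∀ l → l ℕ.< n → F l ≤̇ G l) → ΣP F n ≤̇ ΣP G n
 ΣP-mono zero    h k = ≤-refl
 ΣP-mono (suc n) h k = +-mono-≤ (h 0 (s≤s z≤n) k) (ΣP-mono n (λ l l< → h (suc l) (s≤s l<)) k)

 Nonneg-ΣP : ∀ {F} n → (∀ l → Nonneg (F l)) → Nonneg (ΣP F n)
 Nonneg-ΣP n h k = S-nonneg n (λ l → h l k)

 ΣP-⊛ʳ : ∀ F n g → ΣP F n ⊛ g ≗ ΣP (λ l → F l ⊛ g) n
 ΣP-⊛ʳ F zero    g = λ k → ⊛-zeroˡ (ΣP F zero) g (λ _ → refl) k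
 ΣP-⊛ʳ F (suc n) g k = trans (⊛-distribʳ g (F 0) (ΣP (λ l → F (suc l)) n) k) (cong (λ z → (F 0 ⊛ g) k + z) (ΣP-⊛ʳ (λ l → F (suc l)) n g k))

 ΣP-⊛ˡ : ∀ F n g → g ⊛ ΣP F n ≗ ΣP (λ l → g ⊛ F l) n
 ΣP-⊛ˡ F n g = ≗-trans (⊛-comm g (ΣP F n)) (≗-trans (ΣP-⊛ʳ F n g) (ΣP-cong n (λ l _ → ⊛-comm (F l) g)))

 θ-ΣP : ∀ F n → θ (ΣP F n) ≗ ΣP (λ l → θ (F l)) n
 θ-ΣP F n k = sym (S-scale (ι k) (λ l → F l k) n)

 ΣP-⊕ : ∀ F G n → ΣP (λ l → F l ⊕ G l) n ≗ ΣP F n ⊕ ΣP G n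
 ΣP-⊕ F G n k = S-⊕ (λ l → F l k) (λ l → G l k) n

 S-swap : ∀ (f : ℕ → ℕ → ℚ) m n → S (λ i → S (f i) n) m ≡ S (λ j → S (λ i → f i j) m) n
 S-swap f zero    n = sym (S-zero (λ _ → 0ℚ) n (λ _ → refl))
 S-swap f (suc m) n = trans (cong (λ z → S (f 0) n + z) (S-swap (λ i → f (suc i)) m n)) (sym (S-⊕ (f 0) (λ j → S (λ i → f (suc i) j) m) n))

 bit : ℕ → ℕ
 bit zero          = 0
 bit (suc zero)    = 1
 bit (suc (suc n)) = bit n

 bit-even : ∀ m → bit (m ℕ.+ m) ≡ 0
 bit-even zero    = refl
 bit-even (suc m) = trans (cong (bit ∘ suc) (ℕ.+-suc m m)) (bit-even m)

 bit-odd : ∀ m → bit (suc (m ℕ.+ m)) ≡ 1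
 bit-odd zero    = refl
 bit-odd (suc m) = trans (cong (λ z → bit (suc (suc z))) (ℕ.+-suc m m)) (bit-odd m)

 -- repr K ℓ is the exponential generating function, in the number of summands, of
 -- the representations of ℓ by powers 2ᵃ with a < K: if j exponents are zero,
 -- the others represent (ℓ - j)/2.
 repr : ℕ → ℕ → PS
 repr zero    zero    = C 1ℚ
 repr zero    (suc ℓ) = C 0ℚ
 repr (suc K) ℓ       = ΣP (λ l → E (bit ℓ ℕ.+ (l ℕ.+ l)) ⊛ repr K (⌊ ℓ /2⌋ ℕ.∸ l)) (suc ⌊ ℓ /2⌋)

 -- The recursion step of `repr` as an operator on families, with the parity and the half of the
 -- number as separate arguments; so it can be commuted with shifts and applied to other families.
 layer : ℕ → (ℕ → PS) → ℕ → PS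
 layer e F m = ΣP (λ l → E (e ℕ.+ (l ℕ.+ l)) ⊛ F (m ℕ.∸ l)) (suc m)

 repr-even : ∀ K m → repr (suc K) (m ℕ.+ m) ≡ layer 0 (repr K) m
 repr-even K m = cong₂ (λ e h → layer e (repr K) h) (bit-even m) (⌊a+a/2⌋ m)

 repr-odd : ∀ K m → repr (suc K) (suc (m ℕ.+ m)) ≡ layer 1 (repr K) m
 repr-odd K m = cong₂ (λ e h → layer e (repr K) h) (bit-odd m) (⌊1+a+a/2⌋ m)

 -- `F (ℓ - m)`, with the default `z` where `ℓ < m`; truncated subtraction would give `F 0` there.
 shift : {A : Set} → A → ℕ → (ℕ → A) → ℕ → A
 shift z zero    F ℓ       = F ℓ
 shift z (suc m) F zero    = z
 shift z (suc m) F (suc ℓ) = shift z m F ℓ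

 shiftP : ℕ → (ℕ → PS) → ℕ → PS
 shiftP = shift (C 0ℚ)

 private
   ⊛-C0 : ∀ f → f ⊛ C 0ℚ ≗ C 0ℚ
   ⊛-C0 f = PS-solve 1 (λ f → f :* con 0ℚ := con 0ℚ) ≗-refl f
   C0 : ∀ n → C 0ℚ n ≡ 0ℚ
   C0 zero    = refl
   C0 (suc n) = refl

 layer-last : ∀ e F m → layer e F (suc m) ≗ ΣP (λ l → E (e ℕ.+ (l ℕ.+ l)) ⊛ F (suc m ℕ.∸ l)) (suc m) ⊕ E (e ℕ.+ (suc m ℕ.+ suc m)) ⊛ F 0
 layer-last e F m k = trans (S-last (λ l → (E (e ℕ.+ (l ℕ.+ l)) ⊛ F (suc m ℕ.∸ l)) k) (suc m))
   (cong (λ z → ΣP (λ l → E (e ℕ.+ (l ℕ.+ l)) ⊛ F (suc m ℕ.∸ l)) (suc m) k + (E (e ℕ.+ (suc m ℕ.+ suc m)) ⊛ F z) k) (ℕ.n∸n≡0 m))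

 layer-cong : ∀ e {F G} m → (∀ i → i ℕ.≤ m → F i ≗ G i) → layer e F m ≗ layer e G m
 layer-cong e m h = ΣP-cong (suc m) (λ l _ → ⊛-cong (≗-refl {E (e ℕ.+ (l ℕ.+ l))}) (h (m ℕ.∸ l) (ℕ.m∸n≤m m l)))

 layer-shift : ∀ e c F m → layer e (shiftP c F) m ≗ shiftP c (layer e F) m
 layer-shift e zero    F m       = ≗-refl {layer e F m}
 layer-shift e (suc c) F zero    = λ k → trans (+-identityʳ _) (⊛-C0 (E (e ℕ.+ 0)) k)
 layer-shift e (suc c) F (suc m) = λ k → trans (layer-last e (shiftP (suc c) F) m k)
   (trans (cong₂ _+_ (ΣP-cong (suc m) (λ { l (s≤s l≤m) i → cong (λ z → (E (e ℕ.+ (l ℕ.+ l)) ⊛ shiftP (suc c) F z) i) (ℕ.+-∸-assoc 1 l≤m) }) k)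
       (trans (⊛-C0 (E (e ℕ.+ (suc m ℕ.+ suc m))) k) (C0 k)))
     (trans (+-identityʳ _) (layer-shift e c F m k)))

 private
   shift-even : ∀ c K m → shiftP c (layer 0 (repr K)) m ≗ shiftP (c ℕ.+ c) (repr (suc K)) (m ℕ.+ m)
   shift-even zero    K m       n = cong (λ f → f n) (sym (repr-even K m))
   shift-even (suc c) K zero    n = refl
   shift-even (suc c) K (suc m) n = trans (shift-even c K m n)
     (cong₂ (λ u v → shiftP u (repr (suc K)) v n) (sym (ℕ.+-suc c c)) (sym (ℕ.+-suc m m)))

   shift-odd : ∀ c K m → shiftP c (layer 1 (repr K)) m ≗ shiftP (c ℕ.+ c) (repr (suc K)) (suc (m ℕ.+ m))
   shift-odd zero    K m       n = cong (λ f → f n) (sym (repr-odd K m))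
   shift-odd (suc c) K zero    n = cong (λ u → shiftP u (repr (suc K)) 0 n) (sym (ℕ.+-suc c c))
   shift-odd (suc c) K (suc m) n = trans (shift-odd c K m n)
     (cong₂ (λ u v → shiftP u (repr (suc K)) v n) (sym (ℕ.+-suc c c)) (cong suc (sym (ℕ.+-suc m m))))

   -- The part of the derivative that marks a zero exponent. Removing a summand 1 from an even
   -- number leaves an odd one, whose layers have one zero exponent fewer.
   drop-zero-even : ∀ K m → ΣP (λ l → θ (E (l ℕ.+ l)) ⊛ repr K (m ℕ.∸ l)) (suc m) ≗ X ⊛ shiftP 1 (repr (suc K)) (m ℕ.+ m)
   drop-zero-even K zero    n = trans (cong₂ _+_ (⊛-zeroˡ (θ (E 0)) (repr K 0) θ-E-0 n) refl) (sym (trans (⊛-C0 X n) (C0 n)))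
   drop-zero-even K (suc m) n = trans
     (cong₂ _+_ (⊛-zeroˡ (θ (E 0)) (repr K (suc m)) θ-E-0 n)
       (trans (ΣP-cong (suc m) (λ l _ → ≗-trans (⊛-cong (θ-E-suc (l ℕ.+ suc l)) (≗-refl {repr K (m ℕ.∸ l)})) (⊛-assoc X (E (l ℕ.+ suc l)) (repr K (m ℕ.∸ l)))) n)
         (trans (sym (ΣP-⊛ˡ (λ l → E (l ℕ.+ suc l) ⊛ repr K (m ℕ.∸ l)) (suc m) X n))
           (⊛-cong (≗-refl {X}) (λ i → trans (ΣP-cong (suc m) (λ l _ k → cong (λ z → (E z ⊛ repr K (m ℕ.∸ l)) k) (ℕ.+-suc l l)) i)
             (trans (cong (λ f → f i) (sym (repr-odd K m))) (cong (λ z → repr (suc K) z i) (sym (ℕ.+-suc m m))))) n))))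
     (+-identityˡ _)

   drop-zero-odd : ∀ K m → ΣP (λ l → θ (E (suc (l ℕ.+ l))) ⊛ repr K (m ℕ.∸ l)) (suc m) ≗ X ⊛ repr (suc K) (m ℕ.+ m)
   drop-zero-odd K m n = trans
     (ΣP-cong (suc m) (λ l _ → ≗-trans (⊛-cong (θ-E-suc (l ℕ.+ l)) (≗-refl {repr K (m ℕ.∸ l)})) (⊛-assoc X (E (l ℕ.+ l)) (repr K (m ℕ.∸ l)))) n)
     (trans (sym (ΣP-⊛ˡ (λ l → E (l ℕ.+ l) ⊛ repr K (m ℕ.∸ l)) (suc m) X n))
       (⊛-cong (≗-refl {X}) (λ i → cong (λ f → f i) (sym (repr-even K m))) n))

 θ-layer : ∀ e K m → (∀ ℓ → θ (repr K ℓ) ≗ X ⊛ ΣP (λ a → shiftP (2 ℕ.^ a) (repr K) ℓ) K) →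
   θ (layer e (repr K) m) ≗ ΣP (λ l → θ (E (e ℕ.+ (l ℕ.+ l))) ⊛ repr K (m ℕ.∸ l)) (suc m)
       ⊕ X ⊛ ΣP (λ a → shiftP (2 ℕ.^ a) (layer e (repr K)) m) K
 θ-layer e K m ih = ≗-trans (θ-ΣP (λ l → E′ l ⊛ F l) (suc m))
   (≗-trans (ΣP-cong (suc m) (λ l _ → θ-⊛ (E′ l) (F l)))
     (≗-trans (ΣP-⊕ (λ l → θ (E′ l) ⊛ F l) (λ l → E′ l ⊛ θ (F l)) (suc m))
       (⊕-cong (≗-refl {ΣP (λ l → θ (E′ l) ⊛ F l) (suc m)}) second)))
   where
   E′ F : ℕ → PS
   E′ l = E (e ℕ.+ (l ℕ.+ l))
   F l = repr K (m ℕ.∸ l)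
   second : ΣP (λ l → E′ l ⊛ θ (F l)) (suc m) ≗ X ⊛ ΣP (λ a → shiftP (2 ℕ.^ a) (layer e (repr K)) m) K
   second = ≗-trans (ΣP-cong (suc m) (λ l _ → ≗-trans (⊛-cong (≗-refl {E′ l}) (ih (m ℕ.∸ l)))
       (PS-solve 3 (λ a x b → a :* (x :* b) := x :* (a :* b)) ≗-refl (E′ l) X (ΣP (λ a → shiftP (2 ℕ.^ a) (repr K) (m ℕ.∸ l)) K))))
     (≗-trans (≗-sym (ΣP-⊛ˡ (λ l → E′ l ⊛ ΣP (λ a → shiftP (2 ℕ.^ a) (repr K) (m ℕ.∸ l)) K) (suc m) X))
       (⊛-cong (≗-refl {X}) (≗-trans (ΣP-cong (suc m) (λ l _ → ΣP-⊛ˡ (λ a → shiftP (2 ℕ.^ a) (repr K) (m ℕ.∸ l)) K (E′ l)))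
         (λ n → trans (S-swap (λ l a → (E′ l ⊛ shiftP (2 ℕ.^ a) (repr K) (m ℕ.∸ l)) n) (suc m) K)
           (S-cong K (λ a → layer-shift e (2 ℕ.^ a) (repr K) m n))))))

 private
   double-pow : ∀ a → 2 ℕ.^ a ℕ.+ 2 ℕ.^ a ≡ 2 ℕ.^ suc a
   double-pow a = cong (2 ℕ.^ a ℕ.+_) (sym (ℕ.+-identityʳ (2 ℕ.^ a)))

 -- `repr` sorts tuples by the number of zero exponents, whereas `tuplesBelow` builds them entry by
 -- entry. The Euler operator marks one summand: a marked 1 is removed by `drop-zero-even` or
 -- `drop-zero-odd`, and a marked `2 ^ suc a` is a marked `2 ^ a` one layer down. The outcome is the
 -- recursion by entries.
 repr-θ : ∀ K ℓ → θ (repr K ℓ) ≗ X ⊛ ΣP (λ a → shiftP (2 ℕ.^ a) (repr K) ℓ) K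
 repr-θ zero zero    n = trans (θ-C 1ℚ n) (sym (trans (⊛-comm X (ΣP (λ a → shiftP (2 ℕ.^ a) (repr 0) 0) 0) n) (⊛-zeroˡ (λ _ → 0ℚ) X (λ _ → refl) n)))
 repr-θ zero (suc ℓ) n = trans (θ-C 0ℚ n) (sym (trans (⊛-comm X (ΣP (λ a → shiftP (2 ℕ.^ a) (repr 0) (suc ℓ)) 0) n) (⊛-zeroˡ (λ _ → 0ℚ) X (λ _ → refl) n)))
 repr-θ (suc K) ℓ with parity ℓ
 ... | inj₁ (m , refl) = ≗-trans (λ n → cong (λ f → θ f n) (repr-even K m)) (≗-trans (θ-layer 0 K m (repr-θ K))
   (≗-trans (⊕-cong (drop-zero-even K m) (⊛-cong (≗-refl {X}) (ΣP-cong K (λ a _ n → trans (shift-even (2 ℕ.^ a) K m n) (cong (λ z → shiftP z (repr (suc K)) (m ℕ.+ m) n) (double-pow a))))))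
     (≗-sym (⊛-distribˡ X (shiftP 1 (repr (suc K)) (m ℕ.+ m)) (ΣP (λ a → shiftP (2 ℕ.^ suc a) (repr (suc K)) (m ℕ.+ m)) K)))))
 ... | inj₂ (m , refl) = ≗-trans (λ n → cong (λ f → θ f n) (repr-odd K m)) (≗-trans (θ-layer 1 K m (repr-θ K))
   (≗-trans (⊕-cong (drop-zero-odd K m) (⊛-cong (≗-refl {X}) (ΣP-cong K (λ a _ n → trans (shift-odd (2 ℕ.^ a) K m n) (cong (λ z → shiftP z (repr (suc K)) (suc (m ℕ.+ m)) n) (double-pow a))))))
     (≗-sym (⊛-distribˡ X (repr (suc K) (m ℕ.+ m)) (ΣP (λ a → shiftP (2 ℕ.^ suc a) (repr (suc K)) (suc (m ℕ.+ m))) K)))))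

 private
   count : (K ℓ n : ℕ) → ℕ
   count K ℓ n = length (filter (λ as → value as ℕ.≟ ℓ) (tuplesBelow K n))

   filter-shift : ∀ {n} m ℓ (ts : List (Vec ℕ n)) →
     length (filter (λ as → m ℕ.+ value as ℕ.≟ ℓ) ts) ≡ shift 0 m (λ ℓ → length (filter (λ as → value as ℕ.≟ ℓ) ts)) ℓ
   filter-shift zero    ℓ       ts = refl
   filter-shift (suc m) zero    ts = cong length (List.filter-none (λ as → suc m ℕ.+ value as ℕ.≟ 0) (All.universal (λ _ ()) ts))
     where import Data.List.Relation.Unary.All as All
   filter-shift (suc m) (suc ℓ) ts = trans (cong length (List.filter-≐ (λ as → suc m ℕ.+ value as ℕ.≟ suc ℓ) (λ as → m ℕ.+ value as ℕ.≟ ℓ)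
     ((λ e → ℕ.suc-injective e) , cong suc) ts)) (filter-shift m ℓ ts)

   filter-map : ∀ {n} a ℓ (ts : List (Vec ℕ n)) →
     length (filter (λ as → value as ℕ.≟ ℓ) (map (a Vec.∷_) ts)) ≡ length (filter (λ as → 2 ℕ.^ a ℕ.+ value as ℕ.≟ ℓ) ts)
   filter-map a ℓ []       = refl
   filter-map a ℓ (t ∷ ts) with does (2 ℕ.^ a ℕ.+ value t ℕ.≟ ℓ)
   ... | true  = cong suc (filter-map a ℓ ts)
   ... | false = filter-map a ℓ ts

   ι-shift : ∀ m F ℓ → ι (shift 0 m F ℓ) ≡ shift 0ℚ m (ι ∘ F) ℓ
   ι-shift zero    F ℓ       = refl
   ι-shift (suc m) F zero    = ι-0
   ι-shift (suc m) F (suc ℓ) = ι-shift m F ℓ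

   count-product : ∀ {n} K (f : ℕ → ℕ) ℓ (ts : List (Vec ℕ n)) →
     ι (length (filter (λ as → value as ℕ.≟ ℓ) (cartesianProductWith Vec._∷_ (applyUpTo f K) ts)))
     ≡ S (λ a → shift 0ℚ (2 ℕ.^ f a) (λ ℓ → ι (length (filter (λ as → value as ℕ.≟ ℓ) ts))) ℓ) K
   count-product zero    f ℓ ts = ι-0
   count-product (suc K) f ℓ ts = begin
     ι (length (filter P (map (f 0 Vec.∷_) ts ++ rest)))
       ≡⟨ cong (λ xs → ι (length xs)) (List.filter-++ P (map (f 0 Vec.∷_) ts) rest) ⟩
     ι (length (filter P (map (f 0 Vec.∷_) ts) ++ filter P rest))
       ≡⟨ cong ι (List.length-++ (filter P (map (f 0 Vec.∷_) ts))) ⟩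
     ι (length (filter P (map (f 0 Vec.∷_) ts)) ℕ.+ length (filter P rest))
       ≡⟨ ι-+ (length (filter P (map (f 0 Vec.∷_) ts))) (length (filter P rest)) ⟩
     ι (length (filter P (map (f 0 Vec.∷_) ts))) + ι (length (filter P rest))
       ≡⟨ cong₂ _+_ (trans (cong ι (trans (filter-map (f 0) ℓ ts) (filter-shift (2 ℕ.^ f 0) ℓ ts))) (ι-shift (2 ℕ.^ f 0) (λ ℓ → length (filter (λ as → value as ℕ.≟ ℓ) ts)) ℓ))
            (count-product K (f ∘ suc) ℓ ts) ⟩
     S (λ a → shift 0ℚ (2 ℕ.^ f a) (λ ℓ → ι (length (filter (λ as → value as ℕ.≟ ℓ) ts))) ℓ) (suc K) ∎
     where
     open ≡-Reasoning
     P = λ as → value as ℕ.≟ ℓ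
     rest = cartesianProductWith Vec._∷_ (applyUpTo (f ∘ suc) K) ts

   count-suc : ∀ K ℓ n → ι (count K ℓ (suc n)) ≡ S (λ a → shift 0ℚ (2 ℕ.^ a) (λ ℓ → ι (count K ℓ n)) ℓ) K
   count-suc K ℓ n = count-product K id ℓ (tuplesBelow K n)

   shift-scale : ∀ c (F : ℕ → PS) n q ℓ → shift 0ℚ c (λ ℓ → q * F ℓ n) ℓ ≡ q * shiftP c F ℓ n
   shift-scale zero    F n q ℓ       = refl
   shift-scale (suc c) F n q zero    = sym (trans (cong (q *_) (C0 n)) (*-zeroʳ q))
   shift-scale (suc c) F n q (suc ℓ) = shift-scale c F n q ℓ

   shift-ext : ∀ {A : Set} {z : A} c {F G : ℕ → A} → (∀ ℓ → F ℓ ≡ G ℓ) → ∀ ℓ → shift z c F ℓ ≡ shift z c G ℓ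
   shift-ext zero    h ℓ       = h ℓ
   shift-ext (suc c) h zero    = refl
   shift-ext (suc c) h (suc ℓ) = shift-ext c h ℓ

   E-⊛-0 : ∀ j f → (E (suc j) ⊛ f) 0 ≡ 0ℚ
   E-⊛-0 j f = E-⊛-below (suc j) f 0 (s≤s z≤n)

   repr-const : ∀ K ℓ → repr K ℓ 0 ≡ repr 0 ℓ 0
   repr-const zero    ℓ = refl
   repr-const (suc K) ℓ with parity ℓ
   ... | inj₁ (m , refl) = trans (cong (λ f → f 0) (repr-even K m)) (trans
     (cong₂ _+_ (trans (E-⊛-at 0 (repr K m) 0) (trans (cong (_* repr K m 0) inv!-0) (*-identityˡ (repr K m 0))))
       (S-zero (λ l → (E (suc l ℕ.+ suc l) ⊛ repr K (m ℕ.∸ suc l)) 0) m (λ l → E-⊛-0 (l ℕ.+ suc l) (repr K (m ℕ.∸ suc l)))))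
     (trans (+-identityʳ (repr K m 0)) (trans (repr-const K m) (double m))))
     where
     double : ∀ m → repr 0 m 0 ≡ repr 0 (m ℕ.+ m) 0
     double zero    = refl
     double (suc m) = refl
   ... | inj₂ (m , refl) = trans (cong (λ f → f 0) (repr-odd K m))
     (S-zero (λ l → (E (suc (l ℕ.+ l)) ⊛ repr K (m ℕ.∸ l)) 0) (suc m) (λ l → E-⊛-0 (l ℕ.+ l) (repr K (m ℕ.∸ l))))

 -- Both sides satisfy the same recursion by entries, `repr` because of `repr-θ`; the factorial
 -- makes up for the factor `suc n` of the Euler operator.
 count≡repr : ∀ K ℓ n → ι (count K ℓ n) ≡ ι (n !) * repr K ℓ n
 count≡repr K zero    zero = trans ι-1 (sym (trans (cong₂ _*_ ι-1 (repr-const K 0)) refl))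
 count≡repr K (suc ℓ) zero = trans ι-0 (sym (trans (cong₂ _*_ ι-1 (repr-const K (suc ℓ))) refl))
 count≡repr K ℓ (suc n) = begin
   ι (count K ℓ (suc n))
     ≡⟨ count-suc K ℓ n ⟩
   S (λ a → shift 0ℚ (2 ℕ.^ a) (λ ℓ → ι (count K ℓ n)) ℓ) K
     ≡⟨ S-cong K (λ a → trans (shift-ext (2 ℕ.^ a) (λ ℓ → count≡repr K ℓ n) ℓ) (shift-scale (2 ℕ.^ a) (repr K) n (ι (n !)) ℓ)) ⟩
   S (λ a → ι (n !) * shiftP (2 ℕ.^ a) (repr K) ℓ n) K
     ≡⟨ S-scale (ι (n !)) (λ a → shiftP (2 ℕ.^ a) (repr K) ℓ n) K ⟩
   ι (n !) * ΣP (λ a → shiftP (2 ℕ.^ a) (repr K) ℓ) K n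
     ≡⟨ cong (ι (n !) *_) (X-⊛-suc (ΣP (λ a → shiftP (2 ℕ.^ a) (repr K) ℓ) K) n) ⟨
   ι (n !) * (X ⊛ ΣP (λ a → shiftP (2 ℕ.^ a) (repr K) ℓ) K) (suc n)
     ≡⟨ cong (ι (n !) *_) (repr-θ K ℓ (suc n)) ⟨
   ι (n !) * (ι (suc n) * repr K ℓ (suc n))
     ≡⟨ r (ι (n !)) (ι (suc n)) (repr K ℓ (suc n)) ⟩
   ι (suc n) * ι (n !) * repr K ℓ (suc n)
     ≡⟨ cong (_* repr K ℓ (suc n)) (ι-* (suc n) (n !)) ⟨
   ι (suc n !) * repr K ℓ (suc n) ∎
   where
   open ≡-Reasoning
   r : ∀ a b c → a * (b * c) ≡ b * a * c
   r = solve-∀ ℚ-ring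

-- The sum of binary digits under doubling

module BinaryDigits where

 open import Data.Bool.Base using (true; false; if_then_else_)
 open import Data.Digit using (toNatDigits)
 open import Data.List.Base using (List; []; _∷_)
 open import Data.Nat.Base
 open import Data.Nat.DivMod using (m/n<m; m*n/n≡m; m*n%n≡0; [m+kn]%n≡m%n; +-distrib-/-∣ʳ)
 open import Data.Nat.Divisibility using (divides)
 open import Data.Nat.Induction using (Acc; acc; <-wellFounded-fast)
 open import Data.Nat.ListAction using (sum)
 open import Data.Nat.Properties
 open import Relation.Nullary.Decidable using (does)
 open import Defs using (binaryDigitSum)

 -- The recursion behind toNatDigits is local to it; unification recovers it.
 mutual
   digits₁ : (n : ℕ) → Acc _<_ n → List ℕ → List ℕ
   digits₁ = _

   private
     digits₁-spec : ∀ n → toNatDigits 2 n ≡ digits₁ n (<-wellFounded-fast n) []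
     digits₁-spec n with List.[] {A = ℕ} | <-wellFounded-fast n
     ... | xs | a = refl

 mutual
   digits : (n : ℕ) {m : ℕ} → Acc _<_ m → List ℕ → List ℕ
   digits = _

   private
     digits-spec : ∀ n (rs : ∀ {y} → y < suc n → Acc _<_ y) xs → digits₁ (suc n) (acc rs) xs ≡
       (if does (0 <? suc n / 2) then digits n (rs (m/n<m (suc n) 2 sz<ss)) (suc n % 2 ∷ xs) else (suc n % 2 ∷ xs))
     digits-spec n rs xs with does (0 <? suc n / 2)
     ... | false = refl
     ... | true with suc n / 2 | rs (m/n<m (suc n) 2 sz<ss) | suc n % 2 ∷ xs
     ...   | m | a | ys = refl

 private
   -- The sum depends neither on the argument `n` inherited from the enclosing function nor on the
   -- accessibility proof, and an accumulator adds its own sum. A recursive call can thus be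
   -- restarted with an empty accumulator.
   sum-digits : ∀ m (a a′ : Acc _<_ m) n n′ xs → sum (digits n a xs) ≡ sum xs + sum (digits n′ a′ [])
   sum-digits zero    a        a′        n n′ xs = sym (+-identityʳ (sum xs))
   sum-digits (suc m) (acc rs) (acc rs′) n n′ xs with does (0 <? suc m / 2)
   ... | false = trans (+-comm (suc m % 2) (sum xs)) (cong (λ z → sum xs + z) (sym (+-identityʳ (suc m % 2))))
   ... | true  = trans (sum-digits (suc m / 2) (rs (m/n<m (suc m) 2 sz<ss)) (rs (m/n<m (suc m) 2 sz<ss)) n 0 (suc m % 2 ∷ xs))
     (trans (e (suc m % 2) (sum xs) (sum (digits 0 (rs (m/n<m (suc m) 2 sz<ss)) [])))
       (cong (λ z → sum xs + z) (sym (sum-digits (suc m / 2) (rs′ (m/n<m (suc m) 2 sz<ss)) (rs (m/n<m (suc m) 2 sz<ss)) n′ 0 (suc m % 2 ∷ [])))))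
     where
     e : ∀ r x z → r + x + z ≡ x + (r + 0 + z)
     e = ℕ-Solver.solve-∀

   binaryDigitSum≡ : ∀ m (a : Acc _<_ m) n → sum (digits n a []) ≡ binaryDigitSum m
   binaryDigitSum≡ zero    a n = refl
   binaryDigitSum≡ (suc m) a n = sum-digits (suc m) a (<-wellFounded-fast (suc m)) n m []

   step : ∀ m (a : Acc _<_ (suc m)) → sum (digits m a []) ≡ suc m % 2 + binaryDigitSum (suc m / 2)
   step m (acc rs) = by (0 <? suc m / 2) refl
     where
     by : (d : Dec (0 < suc m / 2)) → does (0 <? suc m / 2) ≡ does d → sum (digits m (acc rs) []) ≡ suc m % 2 + binaryDigitSum (suc m / 2)
     by d e with does (0 <? suc m / 2)
     by (yes _) refl | true = trans (sum-digits (suc m / 2) (rs (m/n<m (suc m) 2 sz<ss)) (rs (m/n<m (suc m) 2 sz<ss)) m 0 (suc m % 2 ∷ []))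
       (cong₂ _+_ (+-identityʳ (suc m % 2)) (binaryDigitSum≡ (suc m / 2) (rs (m/n<m (suc m) 2 sz<ss)) 0))
     by (no ¬p) refl | false = cong (λ z → suc m % 2 + z) (sym (cong binaryDigitSum (n≤0⇒n≡0 (≮⇒≥ ¬p))))

 binaryDigitSum-step : ∀ m → binaryDigitSum m ≡ m % 2 + binaryDigitSum (m / 2)
 binaryDigitSum-step zero    = refl
 binaryDigitSum-step (suc m) = trans (sym (binaryDigitSum≡ (suc m) (<-wellFounded-fast (suc m)) m)) (step m (<-wellFounded-fast (suc m)))

 private
   double : ∀ m → m + m ≡ m * 2
   double = ℕ-Solver.solve-∀

 binaryDigitSum-even : ∀ m → binaryDigitSum (m + m) ≡ binaryDigitSum m
 binaryDigitSum-even m = trans (cong binaryDigitSum (double m)) (trans (binaryDigitSum-step (m * 2))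
   (cong₂ (λ r q → r + binaryDigitSum q) (m*n%n≡0 m 2) (m*n/n≡m m 2)))

 binaryDigitSum-odd : ∀ m → binaryDigitSum (suc (m + m)) ≡ suc (binaryDigitSum m)
 binaryDigitSum-odd m = trans (cong (λ z → binaryDigitSum (suc z)) (double m)) (trans (binaryDigitSum-step (1 + m * 2))
   (cong₂ (λ r q → r + binaryDigitSum q) ([m+kn]%n≡m%n 1 m 2)
     (trans (+-distrib-/-∣ʳ 1 {m * 2} {2} (divides m refl)) (m*n/n≡m m 2))))

-- Maximal numbers of representations as coefficients of powers of W

module Maxima where

 open import Data.Nat.Base using (_!; ⌊_/2⌋)
 open import Data.Nat.Induction using (Acc; acc; <-wellFounded)
 open import Defs using (U₂; binaryDigitSum; IsW₂; IsM₂)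
 open RationalArithmetic
 open PowerSeries
 open Coins using (parity)
 open Representations
 open BinaryDigits
 open PS-Solver using (_:+_; _:*_; :-_; _:=_; con) renaming (solve to PS-solve)

 private
   ⌊/2⌋≤ : ∀ K → ⌊ suc K /2⌋ ℕ.≤ K
   ⌊/2⌋≤ K = ℕ.≤-pred (ℕ.⌊n/2⌋<n K)

   -- The power `2 ^ K` exceeds `ℓ`, so admitting it adds no representations.
   repr-stable : ∀ K ℓ → ℓ ℕ.≤ K → repr (suc K) ℓ ≗ repr K ℓ
   repr-stable zero    zero h = ≗-trans (λ n → +-identityʳ _) (≗-trans (⊛-cong E-0 (≗-refl {C 1ℚ})) (⊛-identityˡ (C 1ℚ)))
   repr-stable (suc K) ℓ    h = ΣP-cong (suc ⌊ ℓ /2⌋) (λ l _ → ⊛-cong (≗-refl {E (bit ℓ ℕ.+ (l ℕ.+ l))})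
     (repr-stable K (⌊ ℓ /2⌋ ℕ.∸ l) (ℕ.≤-trans (ℕ.m∸n≤m ⌊ ℓ /2⌋ l) (ℕ.≤-trans (ℕ.⌊n/2⌋-mono h) (⌊/2⌋≤ K)))))

   repr-stable-+ : ∀ o K ℓ → ℓ ℕ.≤ K → repr (o ℕ.+ K) ℓ ≗ repr K ℓ
   repr-stable-+ zero    K ℓ h = ≗-refl {repr K ℓ}
   repr-stable-+ (suc o) K ℓ h = ≗-trans (repr-stable (o ℕ.+ K) ℓ (ℕ.≤-trans h (ℕ.m≤n+m K o))) (repr-stable-+ o K ℓ h)

 -- The generating function Σₙ U₂(ℓ, n) xⁿ/n!.
 rep : ℕ → PS
 rep ℓ = repr ℓ ℓ

 private
   repr≗rep : ∀ K ℓ → ℓ ℕ.≤ K → repr K ℓ ≗ rep ℓ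
   repr≗rep K ℓ h = subst (λ z → repr z ℓ ≗ rep ℓ) (ℕ.m∸n+n≡m h) (repr-stable-+ (K ℕ.∸ ℓ) ℓ ℓ ℕ.≤-refl)

 U₂≡rep : ∀ ℓ n → ι (U₂ ℓ n) ≡ ι (n !) * rep ℓ n
 U₂≡rep ℓ n = count≡repr ℓ ℓ n

 rep-0 : rep 0 ≗ C 1ℚ
 rep-0 = ≗-refl {C 1ℚ}

 rep-even : ∀ m → rep (m ℕ.+ m) ≗ layer 0 rep m
 rep-even m = ≗-trans (≗-sym (repr≗rep (suc (m ℕ.+ m)) (m ℕ.+ m) (ℕ.n≤1+n (m ℕ.+ m))))
   (≗-trans (λ n → cong (λ f → f n) (repr-even (m ℕ.+ m) m)) (layer-cong 0 m (λ i i≤m → repr≗rep (m ℕ.+ m) i (ℕ.≤-trans i≤m (ℕ.m≤m+n m m)))))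

 rep-odd : ∀ m → rep (suc (m ℕ.+ m)) ≗ layer 1 rep m
 rep-odd m = ≗-trans (λ n → cong (λ f → f n) (repr-odd (m ℕ.+ m) m))
   (layer-cong 1 m (λ i i≤m → repr≗rep (m ℕ.+ m) i (ℕ.≤-trans i≤m (ℕ.m≤m+n m m))))

 rep-cases : ∀ e m → e ℕ.≤ 1 → rep (e ℕ.+ (m ℕ.+ m)) ≗ layer e rep m
 rep-cases zero       m _ = rep-even m
 rep-cases (suc zero) m _ = rep-odd m
 rep-cases (suc (suc e)) m (s≤s ())

 Nonneg-layer : ∀ e {F} m → (∀ i → Nonneg (F i)) → Nonneg (layer e F m)
 Nonneg-layer e m h = Nonneg-ΣP (suc m) (λ l → Nonneg-⊛ (Nonneg-E (e ℕ.+ (l ℕ.+ l))) (h (m ℕ.∸ l)))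

 Nonneg-repr : ∀ K ℓ → Nonneg (repr K ℓ)
 Nonneg-repr zero    zero    = Nonneg-C 0≤1
 Nonneg-repr zero    (suc ℓ) = Nonneg-C ≤-refl
 Nonneg-repr (suc K) ℓ       = Nonneg-layer (bit ℓ) ⌊ ℓ /2⌋ (Nonneg-repr K)

 Nonneg-rep : ∀ ℓ → Nonneg (rep ℓ)
 Nonneg-rep ℓ = Nonneg-repr ℓ ℓ

 binary : ∀ a → ∃[ e ] ∃[ b ] (a ≡ e ℕ.+ (b ℕ.+ b) × e ℕ.≤ 1)
 binary a with parity a
 ... | inj₁ (b , e) = 0 , b , e , z≤n
 ... | inj₂ (b , e) = 1 , b , e , s≤s z≤n

 halve-< : ∀ e b k → e ℕ.+ (b ℕ.+ b) ℕ.< 2 ℕ.^ suc k → b ℕ.< 2 ℕ.^ k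
 halve-< e b k h with b ℕ.<? 2 ℕ.^ k
 ... | yes p = p
 ... | no ¬p = contradiction h (ℕ.≤⇒≯ (ℕ.≤-trans (ℕ.≤-reflexive (cong (2 ℕ.^ k ℕ.+_) (ℕ.+-identityʳ (2 ℕ.^ k))))
   (ℕ.≤-trans (ℕ.+-mono-≤ (ℕ.≮⇒≥ ¬p) (ℕ.≮⇒≥ ¬p)) (ℕ.m≤n+m (b ℕ.+ b) e))))

 private
   double-high : ∀ M e b → (M ℕ.+ M) ℕ.+ (e ℕ.+ (b ℕ.+ b)) ≡ e ℕ.+ ((M ℕ.+ b) ℕ.+ (M ℕ.+ b))
   double-high = ℕ-Solver.solve-∀

   c*2^ : ∀ c k → c ℕ.* 2 ℕ.^ suc k ≡ c ℕ.* 2 ℕ.^ k ℕ.+ c ℕ.* 2 ℕ.^ k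
   c*2^ c k = e c (2 ℕ.^ k)
     where
     e : ∀ c p → c ℕ.* (p ℕ.+ (p ℕ.+ 0)) ≡ c ℕ.* p ℕ.+ c ℕ.* p
     e = ℕ-Solver.solve-∀

 -- In the lowest layer of a representation of c 2ᵏ + a, the first a units can be
 -- assigned to a and the rest to c 2ᵏ.
 rep-split : ∀ k c a → a ℕ.< 2 ℕ.^ k → rep (c ℕ.* 2 ℕ.^ k ℕ.+ a) ≤̇ rep (c ℕ.* 2 ℕ.^ k) ⊛ rep a
 rep-split zero    c zero    _ n = ≤-reflexive (trans (cong (λ z → rep z n) (ℕ.+-identityʳ (c ℕ.* 1)))
   (sym (PS-solve 1 (λ f → f :* con 1ℚ := f) ≗-refl (rep (c ℕ.* 1)) n)))
 rep-split zero    c (suc a) (s≤s ())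
 rep-split (suc k) c a a< with binary a
 ... | e , b , refl , e≤1 = λ n → subst (λ z → rep (z ℕ.+ (e ℕ.+ (b ℕ.+ b))) n ≤ (rep z ⊛ rep (e ℕ.+ (b ℕ.+ b))) n) (sym (c*2^ c k)) (main n)
   where
   M = c ℕ.* 2 ℕ.^ k
   Y = rep (e ℕ.+ (b ℕ.+ b))
   Eₑ : ℕ → PS
   Eₑ l = E (e ℕ.+ (l ℕ.+ l))
   high : PS
   high = ΣP (λ l → E (suc l ℕ.+ suc l) ⊛ rep (M ℕ.∸ suc l)) M

   -- The layers are cut after `b`. Those up to `b` are matched with layer 0 of the multiple and all
   -- layers of `a`; layer `b + 1 + l` is matched with layer `l + 1` of the multiple and the last
   -- layer of `a`.
   left : rep ((M ℕ.+ M) ℕ.+ (e ℕ.+ (b ℕ.+ b))) ≗ ΣP (λ l → Eₑ l ⊛ rep (M ℕ.+ b ℕ.∸ l)) (suc b) ⊕ ΣP (λ l → Eₑ (suc b ℕ.+ l) ⊛ rep (M ℕ.+ b ℕ.∸ (suc b ℕ.+ l))) M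
   left n = trans (cong (λ z → rep z n) (double-high M e b)) (trans (rep-cases e (M ℕ.+ b) e≤1 n)
     (trans (cong (S (λ l → (Eₑ l ⊛ rep (M ℕ.+ b ℕ.∸ l)) n)) (cong suc (ℕ.+-comm M b)))
       (S-+ (λ l → (Eₑ l ⊛ rep (M ℕ.+ b ℕ.∸ l)) n) (suc b) M)))

   right : rep (M ℕ.+ M) ⊛ Y ≗ rep M ⊛ Y ⊕ high ⊛ Y
   right = ≗-trans (⊛-cong (≗-trans (rep-even M) (⊕-cong (≗-trans (⊛-cong E-0 (≗-refl {rep M})) (⊛-identityˡ (rep M))) (≗-refl {high}))) (≗-refl {Y}))
     (⊛-distribʳ Y (rep M) high)

   low-part : ΣP (λ l → Eₑ l ⊛ rep (M ℕ.+ b ℕ.∸ l)) (suc b) ≤̇ rep M ⊛ Y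
   low-part n = ≤-trans
     (ΣP-mono {G = λ l → rep M ⊛ (Eₑ l ⊛ rep (b ℕ.∸ l))} (suc b) (λ { l (s≤s l≤b) i → ≤-trans
       (⊛-mono (Nonneg-E (e ℕ.+ (l ℕ.+ l))) (Nonneg-rep (M ℕ.+ b ℕ.∸ l)) (λ _ → ≤-refl)
         (λ j → subst (λ z → rep z j ≤ (rep M ⊛ rep (b ℕ.∸ l)) j) (sym (ℕ.+-∸-assoc M l≤b))
           (rep-split k c (b ℕ.∸ l) (ℕ.≤-<-trans (ℕ.m∸n≤m b l) (halve-< e b k a<)) j)) i)
       (≤-reflexive (PS-solve 3 (λ x y z → x :* (y :* z) := y :* (x :* z)) ≗-refl (Eₑ l) (rep M) (rep (b ℕ.∸ l)) i)) }) n)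
     (≤-reflexive (trans (sym (ΣP-⊛ˡ (λ l → Eₑ l ⊛ rep (b ℕ.∸ l)) (suc b) (rep M) n)) (⊛-cong (≗-refl {rep M}) (≗-sym (rep-cases e b e≤1)) n)))

   last≤Y : Eₑ b ≤̇ Y
   last≤Y n = ≤-trans (≤-reflexive (trans (sym (PS-solve 1 (λ f → f :* con 1ℚ := f) ≗-refl (Eₑ b) n)) (cong (λ z → (Eₑ b ⊛ rep z) n) (sym (ℕ.n∸n≡0 b)))))
     (≤-trans (term≤S b (λ l → Nonneg-⊛ (Nonneg-E (e ℕ.+ (l ℕ.+ l))) (Nonneg-rep (b ℕ.∸ l)) n)) (≤-reflexive (sym (rep-cases e b e≤1 n))))

   high-part : ΣP (λ l → Eₑ (suc b ℕ.+ l) ⊛ rep (M ℕ.+ b ℕ.∸ (suc b ℕ.+ l))) M ≤̇ high ⊛ Y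
   high-part n = ≤-trans
     (ΣP-mono {G = λ l → (E (suc l ℕ.+ suc l) ⊛ rep (M ℕ.∸ suc l)) ⊛ Y} M (λ l l<M i → begin
       (Eₑ (suc b ℕ.+ l) ⊛ rep (M ℕ.+ b ℕ.∸ (suc b ℕ.+ l))) i
         ≡⟨ cong₂ (λ u v → (E u ⊛ rep v) i) (index e b l) (trans (cong (M ℕ.+ b ℕ.∸_) (sym (ℕ.+-suc b l))) (trans (cong (ℕ._∸ (b ℕ.+ suc l)) (ℕ.+-comm M b)) (ℕ.[m+n]∸[m+o]≡n∸o b M (suc l)))) ⟩
       (E ((suc l ℕ.+ suc l) ℕ.+ (e ℕ.+ (b ℕ.+ b))) ⊛ rep (M ℕ.∸ suc l)) i
         ≤⟨ ⊛-mono (Nonneg-E ((suc l ℕ.+ suc l) ℕ.+ (e ℕ.+ (b ℕ.+ b)))) (Nonneg-rep (M ℕ.∸ suc l)) (E-* (suc l ℕ.+ suc l) (e ℕ.+ (b ℕ.+ b))) (λ _ → ≤-refl) i ⟩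
       ((E (suc l ℕ.+ suc l) ⊛ Eₑ b) ⊛ rep (M ℕ.∸ suc l)) i
         ≡⟨ PS-solve 3 (λ x y z → (x :* y) :* z := (x :* z) :* y) ≗-refl (E (suc l ℕ.+ suc l)) (Eₑ b) (rep (M ℕ.∸ suc l)) i ⟩
       ((E (suc l ℕ.+ suc l) ⊛ rep (M ℕ.∸ suc l)) ⊛ Eₑ b) i
         ≤⟨ ⊛-mono (Nonneg-⊛ (Nonneg-E (suc l ℕ.+ suc l)) (Nonneg-rep (M ℕ.∸ suc l))) (Nonneg-E (e ℕ.+ (b ℕ.+ b))) (λ _ → ≤-refl) last≤Y i ⟩
       ((E (suc l ℕ.+ suc l) ⊛ rep (M ℕ.∸ suc l)) ⊛ Y) i ∎) n)
     (≤-reflexive (sym (ΣP-⊛ʳ (λ l → E (suc l ℕ.+ suc l) ⊛ rep (M ℕ.∸ suc l)) M Y n)))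
     where
     open ≤-Reasoning
     index : ∀ e b l → e ℕ.+ ((suc b ℕ.+ l) ℕ.+ (suc b ℕ.+ l)) ≡ (suc l ℕ.+ suc l) ℕ.+ (e ℕ.+ (b ℕ.+ b))
     index = ℕ-Solver.solve-∀

   main : rep ((M ℕ.+ M) ℕ.+ (e ℕ.+ (b ℕ.+ b))) ≤̇ rep (M ℕ.+ M) ⊛ Y
   main n = ≤-trans (≤-reflexive (left n)) (≤-trans (+-mono-≤ (low-part n) (high-part n)) (≤-reflexive (sym (right n))))

 -- The exponents in a representation of `N` are raised by `k`; those of `a` lie below `k`, so the
 -- two parts can be told apart in the union. In terms of layers, the layers up to `b` already
 -- suffice.
 rep-join : ∀ k N a → a ℕ.< 2 ℕ.^ k → rep N ⊛ rep a ≤̇ rep (N ℕ.* 2 ℕ.^ k ℕ.+ a)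
 rep-join zero    N zero    _ n = ≤-reflexive (trans (PS-solve 1 (λ f → f :* con 1ℚ := f) ≗-refl (rep N) n)
   (cong (λ z → rep z n) (sym (trans (ℕ.+-identityʳ (N ℕ.* 1)) (ℕ.*-identityʳ N)))))
 rep-join zero    N (suc a) (s≤s ())
 rep-join (suc k) N a a< with binary a
 ... | e , b , refl , e≤1 = λ n → subst (λ z → (rep N ⊛ rep (e ℕ.+ (b ℕ.+ b))) n ≤ rep (z ℕ.+ (e ℕ.+ (b ℕ.+ b))) n) (sym (c*2^ N k)) (main n)
   where
   open ≤-Reasoning
   M = N ℕ.* 2 ℕ.^ k
   Eₑ : ℕ → PS
   Eₑ l = E (e ℕ.+ (l ℕ.+ l))
   main : rep N ⊛ rep (e ℕ.+ (b ℕ.+ b)) ≤̇ rep ((M ℕ.+ M) ℕ.+ (e ℕ.+ (b ℕ.+ b)))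
   main n = begin
     (rep N ⊛ rep (e ℕ.+ (b ℕ.+ b))) n
       ≡⟨ ⊛-cong (≗-refl {rep N}) (rep-cases e b e≤1) n ⟩
     (rep N ⊛ layer e rep b) n
       ≡⟨ ΣP-⊛ˡ (λ l → Eₑ l ⊛ rep (b ℕ.∸ l)) (suc b) (rep N) n ⟩
     ΣP (λ l → rep N ⊛ (Eₑ l ⊛ rep (b ℕ.∸ l))) (suc b) n
       ≤⟨ ΣP-mono {G = λ l → Eₑ l ⊛ rep (M ℕ.+ b ℕ.∸ l)} (suc b) (λ { l (s≤s l≤b) i → ≤-trans
           (≤-reflexive (PS-solve 3 (λ x y z → y :* (x :* z) := x :* (y :* z)) ≗-refl (Eₑ l) (rep N) (rep (b ℕ.∸ l)) i))
           (⊛-mono (Nonneg-E (e ℕ.+ (l ℕ.+ l))) (Nonneg-⊛ (Nonneg-rep N) (Nonneg-rep (b ℕ.∸ l))) (λ _ → ≤-refl)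
             (λ j → subst (λ z → (rep N ⊛ rep (b ℕ.∸ l)) j ≤ rep z j) (sym (ℕ.+-∸-assoc M l≤b))
               (rep-join k N (b ℕ.∸ l) (ℕ.≤-<-trans (ℕ.m∸n≤m b l) (halve-< e b k a<)) j)) i) }) n ⟩
     ΣP (λ l → Eₑ l ⊛ rep (M ℕ.+ b ℕ.∸ l)) (suc b) n
       ≤⟨ S-mono-n (λ l → Nonneg-⊛ (Nonneg-E (e ℕ.+ (l ℕ.+ l))) (Nonneg-rep (M ℕ.+ b ℕ.∸ l)) n) (s≤s (ℕ.m≤n+m b M)) ⟩
     layer e rep (M ℕ.+ b) n
       ≡⟨ rep-cases e (M ℕ.+ b) e≤1 n ⟨
     rep (e ℕ.+ ((M ℕ.+ b) ℕ.+ (M ℕ.+ b))) n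
       ≡⟨ cong (λ z → rep z n) (double-high M e b) ⟨
     rep ((M ℕ.+ M) ℕ.+ (e ℕ.+ (b ℕ.+ b))) n ∎

 -- 2ᵏ - i needs more than k - i summands.
 rep-sparse : ∀ k ℓ i m → 1 ℕ.≤ i → ℓ ℕ.+ i ≡ 2 ℕ.^ k → m ℕ.+ i ℕ.≤ k → rep ℓ m ≡ 0ℚ
 rep-sparse zero    ℓ i m 1≤i _  h = contradiction 1≤i (ℕ.<⇒≱ (s≤s (ℕ.≤-trans (ℕ.m≤n+m i m) h)))
 rep-sparse (suc k) ℓ i m 1≤i eq h with binary ℓ
 ... | e , q , refl , e≤1 = trans (rep-cases e q e≤1 m) (trans (S-congʷ (suc q) (λ l l≤q → term l (ℕ.≤-pred l≤q))) (S-zero (λ _ → 0ℚ) (suc q) (λ _ → refl)))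
   where
   P = 2 ℕ.^ k
   S-congʷ : ∀ {f g} n → (∀ l → l ℕ.< n → f l ≡ g l) → S f n ≡ S g n
   S-congʷ zero    h = refl
   S-congʷ (suc n) h = cong₂ _+_ (h 0 (s≤s z≤n)) (S-congʷ n (λ l l< → h (suc l) (s≤s l<)))
   eq′ : e ℕ.+ (q ℕ.+ q) ℕ.+ i ≡ P ℕ.+ P
   eq′ = trans eq (cong (P ℕ.+_) (ℕ.+-identityʳ P))
   q<P : q ℕ.< P
   q<P = ℕ.*-cancelʳ-< 2 q P (subst₂ ℕ._<_ (dbl q) (dbl P) (subst (q ℕ.+ q ℕ.<_) eq′
     (ℕ.≤-<-trans (ℕ.m≤n+m (q ℕ.+ q) e) (ℕ.m<m+n (e ℕ.+ (q ℕ.+ q)) 1≤i))))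
     where
     dbl : ∀ m → m ℕ.+ m ≡ m ℕ.* 2
     dbl = ℕ-Solver.solve-∀
   r = P ℕ.∸ q
   q+r : q ℕ.+ r ≡ P
   q+r = ℕ.m+[n∸m]≡n (ℕ.<⇒≤ q<P)
   1≤r : 1 ℕ.≤ r
   1≤r = ℕ.m<n⇒0<n∸m q<P
   -- Removing `e + 2l` units and halving turns the distance `i` from `2 ^ suc k` into the distance
   -- `r + l` from `2 ^ k`. The sum of the number of summands and the distance drops by at least 1,
   -- as `k` does.
   e+i : e ℕ.+ i ≡ r ℕ.+ r
   e+i = ℕ.+-cancelˡ-≡ (q ℕ.+ q) (e ℕ.+ i) (r ℕ.+ r) (trans (s₁ q e i) (trans eq′ (trans (cong₂ ℕ._+_ (sym q+r) (sym q+r)) (s₂ q r))))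
     where
     s₁ : ∀ q e i → q ℕ.+ q ℕ.+ (e ℕ.+ i) ≡ e ℕ.+ (q ℕ.+ q) ℕ.+ i
     s₁ = ℕ-Solver.solve-∀
     s₂ : ∀ q r → (q ℕ.+ r) ℕ.+ (q ℕ.+ r) ≡ q ℕ.+ q ℕ.+ (r ℕ.+ r)
     s₂ = ℕ-Solver.solve-∀
   term : ∀ l → l ℕ.≤ q → (E (e ℕ.+ (l ℕ.+ l)) ⊛ rep (q ℕ.∸ l)) m ≡ 0ℚ
   term l l≤q with ℕ.<-≤-connex m (e ℕ.+ (l ℕ.+ l))
   ... | inj₁ m< = E-⊛-below (e ℕ.+ (l ℕ.+ l)) (rep (q ℕ.∸ l)) m m<
   ... | inj₂ ≤m with ℕ.m≤n⇒∃[o]m+o≡n ≤m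
   ...   | m′ , refl = trans (E-⊛-at (e ℕ.+ (l ℕ.+ l)) (rep (q ℕ.∸ l)) m′)
     (trans (cong (inv! (e ℕ.+ (l ℕ.+ l)) *_) (rep-sparse k (q ℕ.∸ l) (r ℕ.+ l) m′ (ℕ.≤-trans 1≤r (ℕ.m≤m+n r l)) sum-eq
       (ℕ.≤-pred (ℕ.≤-trans (ℕ.+-mono-≤ 1≤r (ℕ.≤-refl {m′ ℕ.+ (r ℕ.+ l)})) (ℕ.≤-trans bound h)))))
       (*-zeroʳ (inv! (e ℕ.+ (l ℕ.+ l)))))
     where
     sum-eq : q ℕ.∸ l ℕ.+ (r ℕ.+ l) ≡ P
     sum-eq = trans (cong (q ℕ.∸ l ℕ.+_) (ℕ.+-comm r l)) (trans (sym (ℕ.+-assoc (q ℕ.∸ l) l r)) (trans (cong (ℕ._+ r) (ℕ.m∸n+n≡m l≤q)) q+r))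
     bound : r ℕ.+ (m′ ℕ.+ (r ℕ.+ l)) ℕ.≤ e ℕ.+ (l ℕ.+ l) ℕ.+ m′ ℕ.+ i
     bound = ℕ.≤-trans (ℕ.m≤m+n (r ℕ.+ (m′ ℕ.+ (r ℕ.+ l))) l) (ℕ.≤-reflexive (trans (s₁ r m′ l) (trans (cong (λ z → z ℕ.+ (m′ ℕ.+ (l ℕ.+ l))) (sym e+i)) (s₂ e i l m′))))
       where
       s₁ : ∀ r m l → r ℕ.+ (m ℕ.+ (r ℕ.+ l)) ℕ.+ l ≡ r ℕ.+ r ℕ.+ (m ℕ.+ (l ℕ.+ l))
       s₁ = ℕ-Solver.solve-∀
       s₂ : ∀ e i l m → e ℕ.+ i ℕ.+ (m ℕ.+ (l ℕ.+ l)) ≡ e ℕ.+ (l ℕ.+ l) ℕ.+ m ℕ.+ i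
       s₂ = ℕ-Solver.solve-∀

 private
   2^suc : ∀ k → 2 ℕ.^ suc k ≡ 2 ℕ.^ k ℕ.+ 2 ℕ.^ k
   2^suc k = cong (2 ℕ.^ k ℕ.+_) (ℕ.+-identityʳ (2 ℕ.^ k))

   upper-layers : ℕ → PS
   upper-layers P = ΣP (λ l → E (suc l ℕ.+ suc l) ⊛ rep (P ℕ.∸ suc l)) P

 rep-double : ∀ P → rep (P ℕ.+ P) ≗ rep P ⊕ ΣP (λ l → E (suc l ℕ.+ suc l) ⊛ rep (P ℕ.∸ suc l)) P
 rep-double P = ≗-trans (rep-even P) (⊕-cong (≗-trans (⊛-cong E-0 (≗-refl {rep P})) (⊛-identityˡ (rep P))) (≗-refl {upper-layers P}))

 rep-2^-mono : ∀ k → rep (2 ℕ.^ k) ≤̇ rep (2 ℕ.^ suc k)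
 rep-2^-mono k n = subst₂ _≤_ (+-identityʳ (rep P n)) (sym (trans (cong (λ z → rep z n) (2^suc k)) (rep-double P n)))
   (+-monoʳ-≤ (rep P n) (Nonneg-ΣP P (λ l → Nonneg-⊛ (Nonneg-E (suc l ℕ.+ suc l)) (Nonneg-rep (P ℕ.∸ suc l))) n))
   where P = 2 ℕ.^ k

 -- Besides `rep (2 ^ k)`, the layers of `2 ^ suc k` contain only the series of some
 -- `2 ^ k - suc l`, which `rep-sparse` kills in the degrees concerned.
 rep-2^-stable : ∀ k n → n ℕ.≤ k → rep (2 ℕ.^ suc k) n ≡ rep (2 ℕ.^ k) n
 rep-2^-stable k n n≤k = trans (cong (λ z → rep z n) (2^suc k)) (trans (rep-double P n)
   (trans (cong (λ z → rep P n + z) (vanish P ℕ.≤-refl)) (+-identityʳ (rep P n))))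
   where
   P = 2 ℕ.^ k
   term : ∀ l → suc l ℕ.≤ P → (E (suc l ℕ.+ suc l) ⊛ rep (P ℕ.∸ suc l)) n ≡ 0ℚ
   term l l<P with ℕ.<-≤-connex n (suc l ℕ.+ suc l)
   ... | inj₁ n< = E-⊛-below (suc l ℕ.+ suc l) (rep (P ℕ.∸ suc l)) n n<
   ... | inj₂ ≤n with ℕ.m≤n⇒∃[o]m+o≡n ≤n
   ...   | m′ , refl = trans (E-⊛-at (suc l ℕ.+ suc l) (rep (P ℕ.∸ suc l)) m′)
     (trans (cong (inv! (suc l ℕ.+ suc l) *_) (rep-sparse k (P ℕ.∸ suc l) (suc l) m′ (s≤s z≤n) (ℕ.m∸n+n≡m l<P)
       (ℕ.≤-trans (ℕ.≤-trans (ℕ.≤-reflexive (ℕ.+-comm m′ (suc l))) (ℕ.+-monoˡ-≤ m′ (ℕ.m≤m+n (suc l) (suc l)))) n≤k)))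
     (*-zeroʳ (inv! (suc l ℕ.+ suc l))))
   vanish : ∀ j → j ℕ.≤ P → ΣP (λ l → E (suc l ℕ.+ suc l) ⊛ rep (P ℕ.∸ suc l)) j n ≡ 0ℚ
   vanish zero    _   = refl
   vanish (suc j) j<P = trans (S-last (λ l → (E (suc l ℕ.+ suc l) ⊛ rep (P ℕ.∸ suc l)) n) j)
     (trans (cong₂ _+_ (vanish j (ℕ.<⇒≤ j<P)) (term j j<P)) (+-identityʳ 0ℚ))

 -- The generating function of 𝒲₂(1, n)/n!, the stable value of rep (2ᵏ).
 abstract
   W : PS
   W n = rep (2 ℕ.^ n) n

   W≡rep : ∀ n → W n ≡ rep (2 ℕ.^ n) n
   W≡rep n = refl

 Nonneg-W : Nonneg W
 Nonneg-W n = subst (0ℚ ≤_) (sym (W≡rep n)) (Nonneg-rep (2 ℕ.^ n) n)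

 rep-2^≡W : ∀ k n → n ℕ.≤ k → rep (2 ℕ.^ k) n ≡ W n
 rep-2^≡W k n h = subst (λ z → rep (2 ℕ.^ z) n ≡ W n) (ℕ.m∸n+n≡m h) (go (k ℕ.∸ n))
   where
   go : ∀ o → rep (2 ℕ.^ (o ℕ.+ n)) n ≡ W n
   go zero    = sym (W≡rep n)
   go (suc o) = trans (rep-2^-stable (o ℕ.+ n) n (ℕ.m≤n+m n o)) (go o)

 rep-2^≤W : ∀ k → rep (2 ℕ.^ k) ≤̇ W
 rep-2^≤W k n with ℕ.≤-total n k
 ... | inj₁ n≤k = ≤-reflexive (rep-2^≡W k n n≤k)
 ... | inj₂ k≤n = subst (rep (2 ℕ.^ k) n ≤_) (sym (W≡rep n)) (subst (λ z → rep (2 ℕ.^ k) n ≤ rep (2 ℕ.^ z) n) (ℕ.m∸n+n≡m k≤n) (go (n ℕ.∸ k)))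
   where
   go : ∀ o → rep (2 ℕ.^ k) n ≤ rep (2 ℕ.^ (o ℕ.+ k)) n
   go zero    = ≤-refl
   go (suc o) = ≤-trans (go o) (rep-2^-mono (o ℕ.+ k) n)

 W-0 : W 0 ≡ 0ℚ
 W-0 = trans (W≡rep 0) (trans (+-identityʳ ((E 1 ⊛ repr 0 0) 0)) (E-⊛-below 1 (repr 0 0) 0 (s≤s z≤n)))

 -- W has no constant term. Hence only finitely many `s` compete for the maximum.
 pow-W-zero : ∀ s n → n ℕ.< s → pow W s n ≡ 0ℚ
 pow-W-zero (suc s) zero    _         = trans (cong (_* pow W s 0) W-0) (*-zeroˡ (pow W s 0))
 pow-W-zero (suc s) (suc n) (s≤s n<s) = trans (cong (_+ (tl W ⊛ pow W s) n) (trans (cong (_* pow W s (suc n)) W-0) (*-zeroˡ (pow W s (suc n)))))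
   (trans (+-identityˡ _) (trans (⊛-comm (tl W) (pow W s) n) (prefix-zero (pow W s) (tl W) n (λ i i≤n → pow-W-zero s i (ℕ.≤-<-trans i≤n n<s)))))
   where
   prefix-zero : ∀ f g n → (∀ i → i ℕ.≤ n → f i ≡ 0ℚ) → (f ⊛ g) n ≡ 0ℚ
   prefix-zero f g zero    h = trans (cong (_* g 0) (h 0 z≤n)) (*-zeroˡ (g 0))
   prefix-zero f g (suc n) h = trans (cong₂ _+_ (trans (cong (_* g (suc n)) (h 0 z≤n)) (*-zeroˡ (g (suc n)))) (prefix-zero (tl f) g n (λ i i≤ → h (suc i) (s≤s i≤)))) (+-identityʳ 0ℚ)

 -- Binary digits are consumed from the lowest on, and `j` counts the places already passed. A digit
 -- 1 splits off `2 ^ j` by `rep-split` and contributes one factor `W`.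
 rep≤pow-W : ∀ ℓ → Acc ℕ._<_ ℓ → ∀ j → rep (ℓ ℕ.* 2 ℕ.^ j) ≤̇ pow W (binaryDigitSum ℓ)
 rep≤pow-W zero    _        j n = ≤-refl
 rep≤pow-W ℓ@(suc ℓ-1) (acc rs) j = by (parity ℓ)
   where
   by : (∃[ m ] ℓ ≡ m ℕ.+ m) ⊎ (∃[ m ] ℓ ≡ suc (m ℕ.+ m)) → rep (ℓ ℕ.* 2 ℕ.^ j) ≤̇ pow W (binaryDigitSum ℓ)
   by (inj₁ (m , e)) n = subst₂ (λ u v → rep u n ≤ pow W v n) (trans (index m (2 ℕ.^ j)) (cong (ℕ._* 2 ℕ.^ j) (sym e)))
     (sym (trans (cong binaryDigitSum e) (binaryDigitSum-even m))) (rep≤pow-W m (rs (smaller m e)) (suc j) n)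
     where
     index : ∀ m p → m ℕ.* (p ℕ.+ (p ℕ.+ 0)) ≡ (m ℕ.+ m) ℕ.* p
     index = ℕ-Solver.solve-∀
     smaller : ∀ m → ℓ ≡ m ℕ.+ m → m ℕ.< ℓ
     smaller zero    ()
     smaller (suc m) e = subst (suc m ℕ.<_) (sym e) (ℕ.m<m+n (suc m) (s≤s z≤n))
   by (inj₂ (m , e)) n = subst₂ (λ u v → rep u n ≤ pow W v n) (trans (index m (2 ℕ.^ j)) (cong (ℕ._* 2 ℕ.^ j) (sym e)))
     (sym (trans (cong binaryDigitSum e) (binaryDigitSum-odd m)))
     (≤-trans (rep-split (suc j) m (2 ℕ.^ j) (ℕ.^-monoʳ-< 2 (s≤s (s≤s z≤n)) (ℕ.n<1+n j)) n)
       (≤-trans (⊛-mono (Nonneg-rep (m ℕ.* 2 ℕ.^ suc j)) (Nonneg-rep (2 ℕ.^ j)) (rep≤pow-W m (rs (subst (m ℕ.<_) (sym e) (s≤s (ℕ.m≤m+n m m)))) (suc j)) (rep-2^≤W j) n)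
         (≤-reflexive (⊛-comm (pow W (binaryDigitSum m)) W n))))
     where
     index : ∀ m p → m ℕ.* (p ℕ.+ (p ℕ.+ 0)) ℕ.+ p ≡ suc (m ℕ.+ m) ℕ.* p
     index = ℕ-Solver.solve-∀

 rep≤ : ∀ ℓ → rep ℓ ≤̇ pow W (binaryDigitSum ℓ)
 rep≤ ℓ n = subst (λ z → rep z n ≤ pow W (binaryDigitSum ℓ) n) (ℕ.*-identityʳ ℓ) (rep≤pow-W ℓ (<-wellFounded ℓ) 0 n)

 binaryDigitSum-+ : ∀ k N a → a ℕ.< 2 ℕ.^ k → binaryDigitSum (N ℕ.* 2 ℕ.^ k ℕ.+ a) ≡ binaryDigitSum N ℕ.+ binaryDigitSum a
 binaryDigitSum-+ zero    N zero    _ = trans (cong binaryDigitSum (trans (ℕ.+-identityʳ (N ℕ.* 1)) (ℕ.*-identityʳ N))) (sym (ℕ.+-identityʳ (binaryDigitSum N)))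
 binaryDigitSum-+ zero    N (suc a) (s≤s ())
 binaryDigitSum-+ (suc k) N a a< = by (parity a)
   where
   index : ∀ N p b → N ℕ.* (p ℕ.+ (p ℕ.+ 0)) ℕ.+ (b ℕ.+ b) ≡ (N ℕ.* p ℕ.+ b) ℕ.+ (N ℕ.* p ℕ.+ b)
   index = ℕ-Solver.solve-∀
   by : (∃[ m ] a ≡ m ℕ.+ m) ⊎ (∃[ m ] a ≡ suc (m ℕ.+ m)) → binaryDigitSum (N ℕ.* 2 ℕ.^ suc k ℕ.+ a) ≡ binaryDigitSum N ℕ.+ binaryDigitSum a
   by (inj₁ (b , refl)) = trans (cong binaryDigitSum (index N (2 ℕ.^ k) b)) (trans (binaryDigitSum-even (N ℕ.* 2 ℕ.^ k ℕ.+ b))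
     (trans (binaryDigitSum-+ k N b (halve-< 0 b k a<)) (cong (binaryDigitSum N ℕ.+_) (sym (binaryDigitSum-even b)))))
   by (inj₂ (b , refl)) = trans (cong binaryDigitSum (trans (ℕ.+-suc (N ℕ.* 2 ℕ.^ suc k) (b ℕ.+ b)) (cong suc (index N (2 ℕ.^ k) b)))) (trans (binaryDigitSum-odd (N ℕ.* 2 ℕ.^ k ℕ.+ b))
     (trans (cong suc (binaryDigitSum-+ k N b (halve-< 1 b k a<))) (trans (sym (ℕ.+-suc (binaryDigitSum N) (binaryDigitSum b))) (cong (binaryDigitSum N ℕ.+_) (sym (binaryDigitSum-odd b))))))

 binaryDigitSum-2^ : ∀ k → binaryDigitSum (2 ℕ.^ k) ≡ 1
 binaryDigitSum-2^ zero    = refl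
 binaryDigitSum-2^ (suc k) = trans (cong binaryDigitSum (2^suc k)) (trans (binaryDigitSum-even (2 ℕ.^ k)) (binaryDigitSum-2^ k))

 n<2^n : ∀ n → n ℕ.< 2 ℕ.^ n
 n<2^n zero    = s≤s z≤n
 n<2^n (suc n) = ℕ.≤-trans (ℕ.+-mono-≤ (ℕ.>-nonZero⁻¹ (2 ℕ.^ n) ⦃ ℕ.m^n≢0 2 n ⦄) (n<2^n n)) (ℕ.≤-reflexive (sym (2^suc n)))

 -- Widely separated binary digits attain the bound.
 extremal : ∀ n s → ∃[ ℓ ] (binaryDigitSum ℓ ≡ s × ∀ i → i ℕ.≤ n → pow W s i ≤ rep ℓ i)
 extremal n zero    = 0 , refl , λ i _ → ≤-refl
 extremal n (suc s) with extremal n s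
 ... | ℓ , sum≡ , attains = 2 ℕ.^ n ℕ.* 2 ℕ.^ ℓ ℕ.+ ℓ
     , trans (binaryDigitSum-+ ℓ (2 ℕ.^ n) ℓ (n<2^n ℓ)) (cong₂ ℕ._+_ (binaryDigitSum-2^ n) sum≡)
     , λ i i≤n → ≤-trans (⊛-mono-upTo n Nonneg-W (Nonneg-pow s Nonneg-W) (λ i i≤n → ≤-reflexive (sym (rep-2^≡W n i i≤n))) attains i i≤n)
         (rep-join ℓ (2 ℕ.^ n) ℓ (n<2^n ℓ) i)

 private
   U₂-mono : ∀ {n k ℓ} → rep k n ≤ rep ℓ n → U₂ k n ℕ.≤ U₂ ℓ n
   U₂-mono {n} {k} {ℓ} h = ι-cancel-≤ (subst₂ _≤_ (sym (U₂≡rep k n)) (sym (U₂≡rep ℓ n)) (*-monoˡ (0≤ι (n !)) h))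

 abstract
   W₂₁ : ℕ → ℕ
   W₂₁ n = U₂ (2 ℕ.^ n) n

   W₂₁-max : ∀ n → IsW₂ 1 n (W₂₁ n)
   W₂₁-max n = (2 ℕ.^ n , (ℕ.>-nonZero⁻¹ (2 ℕ.^ n) ⦃ ℕ.m^n≢0 2 n ⦄ , binaryDigitSum-2^ n) , refl)
     , λ { ℓ (_ , sum≡1) → U₂-mono {n} {ℓ} {2 ℕ.^ n} (≤-trans (subst (λ s → rep ℓ n ≤ pow W s n) sum≡1 (rep≤ ℓ n))
         (≤-reflexive (trans (PS-solve 1 (λ f → f :* con 1ℚ := f) ≗-refl W n) (W≡rep n)))) }

   W₂₁≡W : ∀ n → ι (W₂₁ n) ≡ ι (n !) * W n
   W₂₁≡W n = trans (U₂≡rep (2 ℕ.^ n) n) (cong (ι (n !) *_) (sym (W≡rep n)))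

 private
   argmax : (f : ℕ → ℚ) → ∀ n → ∃[ s ] (1 ℕ.≤ s × s ℕ.≤ suc n × ∀ i → 1 ℕ.≤ i → i ℕ.≤ suc n → f i ≤ f s)
   argmax f zero    = 1 , s≤s z≤n , s≤s z≤n , λ { (suc zero) _ _ → ≤-refl ; (suc (suc i)) _ (s≤s ()) }
   argmax f (suc n) with argmax f n
   ... | s , 1≤s , s≤n , max with ≤-total (f s) (f (suc (suc n)))
   ...   | inj₁ fs≤ = suc (suc n) , s≤s z≤n , ℕ.≤-refl , λ i 1≤i i≤ → case i (ℕ.m≤n⇒m<n∨m≡n i≤) 1≤i
     where
     case : ∀ i → i ℕ.< suc (suc n) ⊎ i ≡ suc (suc n) → 1 ℕ.≤ i → f i ≤ f (suc (suc n))
     case i (inj₁ (s≤s i≤)) 1≤i = ≤-trans (max i 1≤i i≤) fs≤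
     case i (inj₂ refl)     _   = ≤-refl
   ...   | inj₂ ≤fs = s , 1≤s , ℕ.m≤n⇒m≤1+n s≤n , λ i 1≤i i≤ → case i (ℕ.m≤n⇒m<n∨m≡n i≤) 1≤i
     where
     case : ∀ i → i ℕ.< suc (suc n) ⊎ i ≡ suc (suc n) → 1 ℕ.≤ i → f i ≤ f s
     case i (inj₁ (s≤s i≤)) 1≤i = max i 1≤i i≤
     case i (inj₂ refl)     _   = ≤fs

 record Maximal (n M : ℕ) : Set where
   field
     is-max  : IsM₂ n M
     s       : ℕ
     1≤s     : 1 ℕ.≤ s
     s≤n     : s ℕ.≤ n
     value≡  : ι M ≡ ι (n !) * pow W s n
     maximal : ∀ i → 1 ℕ.≤ i → pow W i n ≤ pow W s n

 abstract
   maximum : ∀ n → Σ[ M ∈ ℕ ] Maximal (suc n) M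
   maximum n with argmax (λ s → pow W s (suc n)) n
   ... | s , 1≤s , s≤n , max with extremal (suc n) s
   ...   | ℓ , sum≡s , attains = U₂ ℓ (suc n) , record
     { is-max  = (ℓ , 1≤ℓ ℓ sum≡s , refl) , λ k 1≤k → U₂-mono {suc n} {k} {ℓ} (≤-trans (rep≤ k (suc n))
         (≤-trans (best (binaryDigitSum k)) (attains (suc n) ℕ.≤-refl)))
     ; s       = s
     ; 1≤s     = 1≤s
     ; s≤n     = s≤n
     ; value≡  = trans (U₂≡rep ℓ (suc n)) (cong (ι (suc n !) *_) (ℚ.≤-antisym
         (subst (λ z → rep ℓ (suc n) ≤ pow W z (suc n)) sum≡s (rep≤ ℓ (suc n))) (attains (suc n) ℕ.≤-refl)))
     ; maximal = λ i _ → best i }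
     where
     best : ∀ i → pow W i (suc n) ≤ pow W s (suc n)
     best zero    = Nonneg-pow s Nonneg-W (suc n)
     best (suc i) with ℕ.<-≤-connex (suc n) (suc i)
     ... | inj₁ n<i = ≤-trans (≤-reflexive (pow-W-zero (suc i) (suc n) n<i)) (Nonneg-pow s Nonneg-W (suc n))
     ... | inj₂ i≤n = max (suc i) (s≤s z≤n) i≤n
     1≤ℓ : ∀ ℓ → binaryDigitSum ℓ ≡ s → 1 ℕ.≤ ℓ
     1≤ℓ zero    e = contradiction 1≤s (ℕ.<⇒≱ (ℕ.≤-reflexive (cong suc (sym e))))
     1≤ℓ (suc ℓ) _ = s≤s z≤n

-- Convergence of W beyond θ

module Growth where

 open RationalArithmetic
 open PowerSeries
 open Representations
 open Maxima

 geometric-sum : ∀ f n → Nonneg f → (∀ l → f (suc l) ≤ + 1 / 10 * f l) → S f n ≤ + 10 / 9 * f 0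
 geometric-sum f zero    f≥0 h = 0≤* (≥0 (+ 10 / 9)) (f≥0 0)
 geometric-sum f (suc n) f≥0 h = ≤-trans (+-monoʳ-≤ (f 0) (≤-trans (geometric-sum (tl f) n (λ i → f≥0 (suc i)) (λ l → h (suc l)))
     (*-monoˡ (≥0 (+ 10 / 9)) (h 0))))
   (≤-reflexive (r (f 0)))
   where
   r : ∀ a → a + + 10 / 9 * (+ 1 / 10 * a) ≡ + 10 / 9 * a
   r = solve-∀ ℚ-ring

 -- The radius 4/5 exceeds θ with room for geometric tails. The other two satisfy cosh(ρ₀ √A₀) ≤ κ
 -- A₀ and sinh(ρ₀ √A₀)/√A₀ ≤ κ with κ < 1; truncated, these are `τ₀-sum` and `τ₁-sum`.
 ρ₀ A₀ κ : ℚ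
 ρ₀ = + 4 / 5
 A₀ = + 17 / 10
 κ  = + 97 / 100

 0≤ρ₀ : 0ℚ ≤ ρ₀
 0≤ρ₀ = ≥0 ρ₀
 0≤A₀ : 0ℚ ≤ A₀
 0≤A₀ = ≥0 A₀
 0≤κ : 0ℚ ≤ κ
 0≤κ = ≥0 κ

 private
   -- Terms of the series of cosh (e = 0) and sinh (e = 1) that bound one layer.
   τ : ℕ → PS
   τ e l = inv! (e ℕ.+ (l ℕ.+ l)) * ρ₀ ^ (e ℕ.+ (l ℕ.+ l)) * A₀ ^ l

   Nonneg-τ : ∀ e → Nonneg (τ e)
   Nonneg-τ e l = 0≤* (0≤* (0≤inv! (e ℕ.+ (l ℕ.+ l))) (^-nonneg (e ℕ.+ (l ℕ.+ l)) 0≤ρ₀)) (^-nonneg l 0≤A₀)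

   inv!-2 : ∀ j → inv! j ≡ ι (suc j) * (ι (suc (suc j)) * inv! (suc (suc j)))
   inv!-2 j = sym (trans (cong (ι (suc j) *_) (inv!-suc (suc j))) (inv!-suc j))

   τ-ratio : ∀ e l → τ e (suc (suc l)) ≤ + 1 / 10 * τ e (suc l)
   τ-ratio e l = subst₂ _≤_
     (cong (λ z → inv! z * ρ₀ ^ z * A₀ ^ suc (suc l)) (index e l))
     (cong (λ z → + 1 / 10 * (z * ρ₀ ^ j * A₀ ^ suc l)) (sym (inv!-2 j)))
     (≤-trans (≤-reflexive (r₁ J′ (ρ₀ ^ j) (A₀ ^ l)))
       (≤-trans (*-monoˡ (0≤* (0≤inv! (suc (suc j))) (0≤* (^-nonneg j 0≤ρ₀) (^-nonneg (suc l) 0≤A₀))) big)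
         (≤-reflexive (r₂ J′ (ρ₀ ^ j) (A₀ ^ suc l) (ι (suc j)) (ι (suc (suc j)))))))
     where
     j = e ℕ.+ (suc l ℕ.+ suc l)
     J′ = inv! (suc (suc j))
     index : ∀ e l → suc (suc (e ℕ.+ (suc l ℕ.+ suc l))) ≡ e ℕ.+ (suc (suc l) ℕ.+ suc (suc l))
     index = ℕ-Solver.solve-∀
     3≤ : 3 ℕ.≤ suc j
     3≤ = s≤s (ℕ.≤-trans (ℕ.≤-trans (s≤s (s≤s z≤n)) (ℕ.≤-reflexive (cong suc (sym (ℕ.+-suc l l))))) (ℕ.m≤n+m (suc l ℕ.+ suc l) e))
     -- ρ₀² A₀ = 136/125, and the next two factors of the factorial are at least 3 and 4.
     big : + 136 / 125 ≤ + 1 / 10 * (ι (suc j) * ι (suc (suc j)))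
     big = ≤-trans (≤ᵇ⇒≤ {+ 136 / 125} {+ 1 / 10 * (+ 3 / 1 * (+ 4 / 1))} _) (*-monoˡ (≥0 (+ 1 / 10))
       (*-mono-≤ (≥0 (+ 3 / 1)) (≥0 (+ 4 / 1)) (subst (_≤ ι (suc j)) (ι≡ 3) (ι-mono 3≤)) (subst (_≤ ι (suc (suc j))) (ι≡ 4) (ι-mono (s≤s 3≤)))))
     r₁ : ∀ J′ x a → J′ * (+ 4 / 5 * (+ 4 / 5 * x)) * (+ 17 / 10 * (+ 17 / 10 * a)) ≡ J′ * (x * (+ 17 / 10 * a)) * (+ 136 / 125)
     r₁ = solve-∀ ℚ-ring
     r₂ : ∀ J′ x a p q → J′ * (x * a) * (+ 1 / 10 * (p * q)) ≡ + 1 / 10 * (p * (q * J′) * x * a)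
     r₂ = solve-∀ ℚ-ring

   τ-tail : ∀ e n → S (tl (τ e)) n ≤ + 10 / 9 * τ e 1
   τ-tail e n = geometric-sum (tl (τ e)) n (λ l → Nonneg-τ e (suc l)) (τ-ratio e)

   inv!-1 : inv! 1 ≡ 1ℚ
   inv!-1 = inv!-0

   half : inv! 2 ≡ ½
   half = sym (⁻¹-unique (0<ι! 2) (cong (_* ½) (ι≡ 2)))

   sixth : inv! 3 ≡ + 1 / 6
   sixth = sym (⁻¹-unique (0<ι! 3) (cong (_* (+ 1 / 6)) (ι≡ 6)))

   τ₀-tail : ∀ n → S (tl (τ 0)) n ≤ + 605 / 1000
   τ₀-tail n = ≤-trans (τ-tail 0 n) (≤-trans (≤-reflexive (cong (λ z → + 10 / 9 * (z * ρ₀ ^ 2 * A₀ ^ 1)) half)) (≤ᵇ⇒≤ _))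

   τ₀-sum : ∀ n → S (τ 0) n ≤ κ * A₀
   τ₀-sum n = ≤-trans (S-mono-n (Nonneg-τ 0) (ℕ.n≤1+n n)) (≤-trans (+-mono-≤ (≤-reflexive (cong (λ z → z * 1ℚ * 1ℚ) inv!-0)) (τ₀-tail n)) (≤ᵇ⇒≤ _))

   τ₁-sum : ∀ n → S (τ 1) n ≤ κ
   τ₁-sum n = ≤-trans (S-mono-n (Nonneg-τ 1) (ℕ.n≤1+n n)) (≤-trans (+-mono-≤ (≤-reflexive (cong (λ z → z * ρ₀ ^ 1 * 1ℚ) inv!-1))
     (≤-trans (τ-tail 1 n) (≤-reflexive (cong (λ z → + 10 / 9 * (z * ρ₀ ^ 3 * A₀ ^ 1)) sixth)))) (≤ᵇ⇒≤ _))

 V : PS → ℕ → ℚ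
 V f = S (weight ρ₀ f)

 private
   V-cong : ∀ {f g} N → f ≗ g → V f N ≡ V g N
   V-cong N h = S-cong N (λ i → cong (_* ρ₀ ^ i) (h i))

   V-⊛ : ∀ {f g a b} → Nonneg f → Nonneg g → (∀ N → V f N ≤ a) → (∀ N → V g N ≤ b) → ∀ N → V (f ⊛ g) N ≤ a * b
   V-⊛ {f} {g} f≥0 g≥0 p q N = ≤-trans (≤-reflexive (S-cong N (weight-⊛ ρ₀ f g)))
     (≤-trans (S-⊛-≤ N (Nonneg-weight 0≤ρ₀ f≥0) (Nonneg-weight 0≤ρ₀ g≥0))
       (*-mono-≤ (S-nonneg N (Nonneg-weight 0≤ρ₀ f≥0)) (S-nonneg N (Nonneg-weight 0≤ρ₀ g≥0)) (p N) (q N)))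

   V-ΣP : ∀ F n (b : PS) → (∀ l → l ℕ.< n → ∀ N → V (F l) N ≤ b l) → ∀ N → V (ΣP F n) N ≤ S b n
   V-ΣP F zero    b h N = ≤-reflexive (S-zero (weight ρ₀ (ΣP F 0)) N (λ i → *-zeroˡ (ρ₀ ^ i)))
   V-ΣP F (suc n) b h N = ≤-trans (≤-reflexive (trans
       (S-cong N (λ i → ℚ.*-distribʳ-+ (ρ₀ ^ i) (F 0 i) (ΣP (λ l → F (suc l)) n i)))
       (S-⊕ (weight ρ₀ (F 0)) (weight ρ₀ (ΣP (λ l → F (suc l)) n)) N)))
     (+-mono-≤ (h 0 (s≤s z≤n) N) (V-ΣP (λ l → F (suc l)) n (tl b) (λ l l< → h (suc l) (s≤s l<)) N))

   V-C : ∀ q → 0ℚ ≤ q → ∀ N → V (C q) N ≤ q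
   V-C q h zero    = h
   V-C q h (suc N) = ≤-reflexive (trans (cong₂ _+_ (*-identityʳ q) (S-zero (tl (weight ρ₀ (C q))) N (λ i → *-zeroˡ (ρ₀ ^ suc i)))) (+-identityʳ q))

   V-X : ∀ N → V X N ≤ ρ₀
   V-X zero          = 0≤ρ₀
   V-X (suc zero)    = ≤-trans (≤-reflexive refl) 0≤ρ₀
   V-X (suc (suc N)) = ≤-reflexive (trans (+-identityˡ _) (trans (cong (λ z → 1ℚ * ρ₀ ^ 1 + z) (S-zero (tl (tl (weight ρ₀ X))) N (λ i → *-zeroˡ (ρ₀ ^ suc (suc i))))) refl))

   V-powX : ∀ j N → V (pow X j) N ≤ ρ₀ ^ j
   V-powX zero    = V-C 1ℚ 0≤1
   V-powX (suc j) = V-⊛ Nonneg-X (Nonneg-pow j Nonneg-X) V-X (V-powX j)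

   V-E : ∀ j N → V (E j) N ≤ inv! j * ρ₀ ^ j
   V-E j = V-⊛ (Nonneg-C (0≤inv! j)) (Nonneg-pow j Nonneg-X) (V-C (inv! j) (0≤inv! j)) (V-powX j)

   1≤A₀^ : ∀ n → 1ℚ ≤ A₀ ^ n
   1≤A₀^ zero    = ≤-refl
   1≤A₀^ (suc n) = *-mono-≤ {1ℚ} {A₀} {1ℚ} {A₀ ^ n} 0≤1 0≤1 (≤ᵇ⇒≤ _) (1≤A₀^ n)

   V-layer : ∀ e q (g : ℕ → PS) c r → (∀ i → Nonneg (g i)) → (∀ l → l ℕ.≤ q → ∀ N → V (g (q ℕ.∸ l)) N ≤ c * A₀ ^ (r ℕ.+ l)) →
       ∀ N → V (layer e g q) N ≤ c * A₀ ^ r * S (τ e) (suc q)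
   V-layer e q g c r g≥0 h N = ≤-trans
     (V-ΣP (λ l → E (e ℕ.+ (l ℕ.+ l)) ⊛ g (q ℕ.∸ l)) (suc q) (λ l → c * A₀ ^ r * τ e l)
       (λ l l<q N → ≤-trans (V-⊛ (Nonneg-E (e ℕ.+ (l ℕ.+ l))) (g≥0 (q ℕ.∸ l)) (V-E (e ℕ.+ (l ℕ.+ l))) (h l (ℕ.≤-pred l<q)) N)
         (≤-reflexive (trans (cong (λ z → inv! (e ℕ.+ (l ℕ.+ l)) * ρ₀ ^ (e ℕ.+ (l ℕ.+ l)) * (c * z)) (^-+ A₀ r l))
           (r₁ (inv! (e ℕ.+ (l ℕ.+ l)) * ρ₀ ^ (e ℕ.+ (l ℕ.+ l))) c (A₀ ^ r) (A₀ ^ l))))) N)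
     (≤-reflexive (S-scale (c * A₀ ^ r) (τ e) (suc q)))
     where
     r₁ : ∀ x c a b → x * (c * (a * b)) ≡ c * a * (x * b)
     r₁ = solve-∀ ℚ-ring

 -- The weights A₀ⁱ form a strict supersolution, with factor κ, of the recursion for rep (2ᵏ - i).
 V-rep : ∀ k ℓ i → 1 ℕ.≤ i → ℓ ℕ.+ i ≡ 2 ℕ.^ k → ∀ N → V (rep ℓ) N ≤ κ ^ k * A₀ ^ i
 V-rep zero    zero    (suc zero)    _ eq N = ≤-trans (V-C 1ℚ 0≤1 N) (≤ᵇ⇒≤ {1ℚ} {κ ^ 0 * A₀ ^ 1} _)
 V-rep zero    zero    (suc (suc i)) _ ()
 V-rep zero    (suc ℓ) (suc i)       _ eq = contradiction (ℕ.suc-injective eq) (λ e → ℕ.1+n≢0 (trans (sym (ℕ.+-suc ℓ i)) e))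
 V-rep (suc k) ℓ       i             1≤i eq = by (binary ℓ)
   where
   P = 2 ℕ.^ k
   by : (∃[ e ] ∃[ b ] (ℓ ≡ e ℕ.+ (b ℕ.+ b) × e ℕ.≤ 1)) → ∀ N → V (rep ℓ) N ≤ κ ^ suc k * A₀ ^ i
   by (e , q , refl , e≤1) N = ≤-trans (≤-reflexive (V-cong N (rep-cases e q e≤1)))
       (≤-trans (V-layer e q rep (κ ^ k) r Nonneg-rep (λ l l≤q → V-rep k (q ℕ.∸ l) (r ℕ.+ l) (ℕ.≤-trans 1≤r (ℕ.m≤m+n r l)) (sum-eq l l≤q)) N)
         (final e e≤1 (half-sum P q e i eq e≤1 1≤i)))
     where
     half-sum : ∀ P q e i → e ℕ.+ (q ℕ.+ q) ℕ.+ i ≡ 2 ℕ.* P → e ℕ.≤ 1 → 1 ℕ.≤ i → e ℕ.+ i ≡ (P ℕ.∸ q) ℕ.+ (P ℕ.∸ q)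
     half-sum P q e i eq e≤1 1≤i = ℕ.+-cancelˡ-≡ (q ℕ.+ q) (e ℕ.+ i) ((P ℕ.∸ q) ℕ.+ (P ℕ.∸ q))
       (trans (s₁ q e i) (trans eq (trans (s₃ P) (trans (cong₂ ℕ._+_ (sym q+r′) (sym q+r′)) (s₂ q (P ℕ.∸ q))))))
       where
       s₁ : ∀ q e i → q ℕ.+ q ℕ.+ (e ℕ.+ i) ≡ e ℕ.+ (q ℕ.+ q) ℕ.+ i
       s₁ = ℕ-Solver.solve-∀
       s₂ : ∀ q r → (q ℕ.+ r) ℕ.+ (q ℕ.+ r) ≡ q ℕ.+ q ℕ.+ (r ℕ.+ r)
       s₂ = ℕ-Solver.solve-∀
       s₃ : ∀ P → 2 ℕ.* P ≡ P ℕ.+ P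
       s₃ = ℕ-Solver.solve-∀
       q+r′ : q ℕ.+ (P ℕ.∸ q) ≡ P
       q+r′ = ℕ.m+[n∸m]≡n {q} {P} (ℕ.*-cancelˡ-≤ 2 (ℕ.≤-trans (ℕ.≤-trans (ℕ.≤-reflexive (s₃ q)) (ℕ.m≤n+m (q ℕ.+ q) e)) (ℕ.≤-trans (ℕ.m≤m+n (e ℕ.+ (q ℕ.+ q)) i) (ℕ.≤-reflexive eq))))
     r = P ℕ.∸ q
     q<P : q ℕ.< P
     q<P = ℕ.*-cancelˡ-< 2 q P (ℕ.≤-trans (s≤s (ℕ.≤-trans (ℕ.≤-reflexive (s₃ q)) (ℕ.m≤n+m (q ℕ.+ q) e)))
       (ℕ.≤-trans (ℕ.m<m+n (e ℕ.+ (q ℕ.+ q)) 1≤i) (ℕ.≤-reflexive eq)))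
       where
       s₃ : ∀ P → 2 ℕ.* P ≡ P ℕ.+ P
       s₃ = ℕ-Solver.solve-∀
     1≤r : 1 ℕ.≤ r
     1≤r = ℕ.m<n⇒0<n∸m q<P
     q+r : q ℕ.+ r ≡ P
     q+r = ℕ.m+[n∸m]≡n (ℕ.<⇒≤ q<P)
     sum-eq : ∀ l → l ℕ.≤ q → q ℕ.∸ l ℕ.+ (r ℕ.+ l) ≡ P
     sum-eq l l≤q = trans (cong (q ℕ.∸ l ℕ.+_) (ℕ.+-comm r l)) (trans (sym (ℕ.+-assoc (q ℕ.∸ l) l r)) (trans (cong (ℕ._+ r) (ℕ.m∸n+n≡m l≤q)) q+r))
     0≤c : 0ℚ ≤ κ ^ k * A₀ ^ r
     0≤c = 0≤* (^-nonneg k 0≤κ) (^-nonneg r 0≤A₀)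
     r-pred : ∃[ r′ ] r ≡ suc r′
     r-pred = ℕ.pred r , sym (ℕ.suc-pred r ⦃ ℕ.>-nonZero 1≤r ⦄)
     -- In the even case `i = 2r`, and `A₀ ^ (r + 1)` is at most `A₀ ^ i` because `r ≥ 1`; in the
     -- odd case `i = 2r - 1`, and the layer gives only `A₀ ^ r`.
     final : ∀ e → e ℕ.≤ 1 → e ℕ.+ i ≡ r ℕ.+ r → κ ^ k * A₀ ^ r * S (τ e) (suc q) ≤ κ ^ suc k * A₀ ^ i
     final zero _ i≡ = begin
       κ ^ k * A₀ ^ r * S (τ 0) (suc q) ≤⟨ *-monoˡ 0≤c (τ₀-sum (suc q)) ⟩
       κ ^ k * A₀ ^ r * (κ * A₀) ≡⟨ r₁ (κ ^ k) (A₀ ^ r) κ A₀ ⟩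
       κ * κ ^ k * (A₀ ^ r * (A₀ * 1ℚ)) ≤⟨ *-monoˡ (^-nonneg (suc k) 0≤κ) (*-monoˡ (^-nonneg r 0≤A₀) (*-monoˡ 0≤A₀ (1≤A₀^ (proj₁ r-pred)))) ⟩
       κ * κ ^ k * (A₀ ^ r * A₀ ^ suc (proj₁ r-pred)) ≡⟨ cong (λ z → κ * κ ^ k * (A₀ ^ r * A₀ ^ z)) (sym (proj₂ r-pred)) ⟩
       κ * κ ^ k * (A₀ ^ r * A₀ ^ r) ≡⟨ cong (κ * κ ^ k *_) (trans (sym (^-+ A₀ r r)) (cong (A₀ ^_) (sym i≡))) ⟩
       κ * κ ^ k * A₀ ^ i ∎
       where
       open ≤-Reasoning
       r₁ : ∀ a b c d → a * b * (c * d) ≡ c * a * (b * (d * 1ℚ))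
       r₁ = solve-∀ ℚ-ring
     final (suc zero) _ i≡ = begin
       κ ^ k * A₀ ^ r * S (τ 1) (suc q) ≤⟨ *-monoˡ 0≤c (τ₁-sum (suc q)) ⟩
       κ ^ k * A₀ ^ r * κ ≡⟨ r₁ (κ ^ k) (A₀ ^ r) κ ⟩
       κ * κ ^ k * (A₀ ^ r * 1ℚ) ≤⟨ *-monoˡ (^-nonneg (suc k) 0≤κ) (*-monoˡ (^-nonneg r 0≤A₀) (1≤A₀^ (proj₁ r-pred))) ⟩
       κ * κ ^ k * (A₀ ^ r * A₀ ^ proj₁ r-pred) ≡⟨ cong (κ * κ ^ k *_) (trans (sym (^-+ A₀ r (proj₁ r-pred)))
           (cong (A₀ ^_) (ℕ.suc-injective (trans (sym (ℕ.+-suc r (proj₁ r-pred))) (trans (cong (r ℕ.+_) (sym (proj₂ r-pred))) (sym i≡)))))) ⟩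
       κ * κ ^ k * A₀ ^ i ∎
       where
       open ≤-Reasoning
       r₁ : ∀ a b c → a * b * c ≡ c * a * (b * 1ℚ)
       r₁ = solve-∀ ℚ-ring
     final (suc (suc e)) (s≤s ()) _

 private
   -- From `2 ^ k` to `2 ^ suc k` the weighted sum grows by at most 0.605 κᵏ. With Z = 0.605/(1 - κ)
   -- the sum plus Z κᵏ never increases.
   Z : ℚ
   Z = + 605 / 30

   V-top : ∀ k N → V (rep (2 ℕ.^ k)) N + Z * κ ^ k ≤ ρ₀ + Z
   V-top zero    N = ≤-trans (+-monoˡ-≤ (Z * 1ℚ) (≤-trans (≤-reflexive (V-cong N rep-1)) (V-X N))) (≤ᵇ⇒≤ {ρ₀ + Z * 1ℚ} {ρ₀ + Z} _)
     where
     rep-1 : rep 1 ≗ X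
     rep-1 = ≗-trans (λ n → +-identityʳ ((E 1 ⊛ repr 0 0) n)) (≗-trans (⊛-comm (E 1) (C 1ℚ)) (≗-trans (⊛-identityˡ (E 1))
       (≗-trans (⊛-cong (λ i → cong (λ z → C z i) inv!-1) (≗-refl {pow X 1})) (≗-trans (⊛-identityˡ (pow X 1)) (≗-trans (⊛-comm X (C 1ℚ)) (⊛-identityˡ X))))))
   V-top (suc k) N = begin
     V (rep (2 ℕ.^ suc k)) N + Z * (κ * κ ^ k)
       ≡⟨ cong (_+ Z * (κ * κ ^ k)) (trans (cong (λ z → V (rep z) N) (cong (P ℕ.+_) (ℕ.+-identityʳ P))) (trans (V-cong N (rep-double P))
           (trans (S-cong N (λ i → ℚ.*-distribʳ-+ (ρ₀ ^ i) (rep P i) (up i))) (S-⊕ (weight ρ₀ (rep P)) (weight ρ₀ up) N)))) ⟩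
     V (rep P) N + V up N + Z * (κ * κ ^ k)
       ≤⟨ +-monoˡ-≤ (Z * (κ * κ ^ k)) (+-monoʳ-≤ (V (rep P) N) up-bound) ⟩
     V (rep P) N + κ ^ k * (+ 605 / 1000) + Z * (κ * κ ^ k)
       ≡⟨ r (V (rep P) N) (κ ^ k) ⟩
     V (rep P) N + Z * κ ^ k
       ≤⟨ V-top k N ⟩
     ρ₀ + Z ∎
     where
     open ≤-Reasoning
     P = 2 ℕ.^ k
     up = ΣP (λ l → E (suc l ℕ.+ suc l) ⊛ rep (P ℕ.∸ suc l)) P
     r : ∀ v x → v + x * (+ 605 / 1000) + + 605 / 30 * (+ 97 / 100 * x) ≡ v + + 605 / 30 * x
     r = solve-∀ ℚ-ring
     r₂ : ∀ e c a → e * (c * a) ≡ c * (e * a)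
     r₂ = solve-∀ ℚ-ring
     up-bound : V up N ≤ κ ^ k * (+ 605 / 1000)
     up-bound = ≤-trans (V-ΣP (λ l → E (suc l ℕ.+ suc l) ⊛ rep (P ℕ.∸ suc l)) P (λ l → κ ^ k * tl (τ 0) l)
         (λ l l<P N → ≤-trans (V-⊛ (Nonneg-E (suc l ℕ.+ suc l)) (Nonneg-rep (P ℕ.∸ suc l)) (V-E (suc l ℕ.+ suc l)) (V-rep k (P ℕ.∸ suc l) (suc l) (s≤s z≤n) (ℕ.m∸n+n≡m l<P)) N)
           (≤-reflexive (r₂ (inv! (suc l ℕ.+ suc l) * ρ₀ ^ (suc l ℕ.+ suc l)) (κ ^ k) (A₀ ^ suc l)))) N)
       (≤-trans (≤-reflexive (S-scale (κ ^ k) (tl (τ 0)) P)) (*-monoˡ (^-nonneg k 0≤κ) (τ₀-tail P)))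

 W-growth : ∀ N → S (weight ρ₀ W) N ≤ + 21 / 1
 W-growth N = ≤-trans (≤-reflexive (below N ℕ.≤-refl)) (≤-trans
   (≤-trans (≤-reflexive (sym (+-identityʳ (V (rep (2 ℕ.^ N)) N)))) (+-monoʳ-≤ (V (rep (2 ℕ.^ N)) N) (0≤* (≥0 Z) (^-nonneg N 0≤κ))))
   (≤-trans (V-top N N) (≤ᵇ⇒≤ _)))
   where
   below : ∀ n → n ℕ.≤ N → S (weight ρ₀ W) n ≡ V (rep (2 ℕ.^ N)) n
   below zero    _   = refl
   below (suc n) n<N = trans (S-last (weight ρ₀ W) n) (trans (cong₂ _+_ (below n (ℕ.<⇒≤ n<N)) (cong (_* ρ₀ ^ n) (sym (rep-2^≡W N n (ℕ.<⇒≤ n<N)))))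
     (sym (S-last (weight ρ₀ (rep (2 ℕ.^ N))) n)))

-- Moments of the coefficients of W near θ

module Tilt where

 open RationalArithmetic
 open PowerSeries
 open Representations
 open Maxima
 open Growth

 M : ℕ → ℚ → ℕ → ℚ
 M j x N = S (λ k → ι k ^ j * weight x W k) N

 moment-nonneg : ∀ j {x} → 0ℚ ≤ x → Nonneg (λ k → ι k ^ j * weight x W k)
 moment-nonneg j 0≤x k = 0≤* (^-nonneg j (0≤ι k)) (Nonneg-weight 0≤x Nonneg-W k)

 private

   linear-decay : ∀ k → (ι k + + 17 / 1) * (+ 17 / 18) ^ k ≤ + 17 / 1
   linear-decay zero    = ≤-reflexive (cong (λ z → (z + + 17 / 1) * 1ℚ) ι-0)
   linear-decay (suc k) = ≤-trans
     (≤-cert {a = (ι (suc k) + + 17 / 1) * (+ 17 / 18 * q)} {b = (ι k + + 17 / 1) * q} (0≤* (0≤* (≥0 (+ 1 / 18)) (0≤ι k)) 0≤q)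
       (trans (r (ι k) q) (cong (λ z → (ι k + + 17 / 1) * q - (z + + 17 / 1) * (+ 17 / 18 * q)) (sym (ι-suc k)))))
     (linear-decay k)
     where
     q = (+ 17 / 18) ^ k
     0≤q : 0ℚ ≤ q
     0≤q = ^-nonneg k (≥0 (+ 17 / 18))
     r : ∀ k q → + 1 / 18 * k * q ≡ (k + + 17 / 1) * q - (k + 1ℚ + + 17 / 1) * (+ 17 / 18 * q)
     r = solve-∀ ℚ-ring

   ιk*ρᵏ≤17 : ∀ k → ι k * (+ 17 / 18) ^ k ≤ + 17 / 1
   ιk*ρᵏ≤17 k = ≤-trans (*-monoʳ (^-nonneg k (≥0 (+ 17 / 18))) (subst (_≤ ι k + + 17 / 1) (+-identityʳ (ι k)) (+-monoʳ-≤ (ι k) (≥0 (+ 17 / 1))))) (linear-decay k)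

   -- k(17/18)ᵏ ≤ 17, and (17/18)⁵ · 4/5 still exceeds 3/5; so the step from radius 4/5 down to 3/5
   -- pays for five powers of k.
   fifth-power : ∀ k → ι k ^ 5 * (+ 3 / 5) ^ k ≤ (+ 17 / 1) ^ 5 * ρ₀ ^ k
   fifth-power k = begin
     ι k ^ 5 * (+ 3 / 5) ^ k
       ≤⟨ *-monoˡ (^-nonneg 5 (0≤ι k)) (≤-trans (^-mono-≤ k (≥0 (+ 3 / 5)) (≤ᵇ⇒≤ {+ 3 / 5} {(+ 17 / 18) ^ 5 * ρ₀} _)) (≤-reflexive split)) ⟩
     ι k ^ 5 * (q ^ 5 * ρ₀ ^ k)
       ≡⟨ r (ι k) q (ρ₀ ^ k) ⟩
     (ι k * q) ^ 5 * ρ₀ ^ k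
       ≤⟨ *-monoʳ (^-nonneg k 0≤ρ₀) (^-mono-≤ 5 (0≤* (0≤ι k) (^-nonneg k (≥0 (+ 17 / 18)))) (ιk*ρᵏ≤17 k)) ⟩
     (+ 17 / 1) ^ 5 * ρ₀ ^ k ∎
     where
     open ≤-Reasoning
     q = (+ 17 / 18) ^ k
     r : ∀ a q s → (a * (a * (a * (a * (a * 1ℚ))))) * ((q * (q * (q * (q * (q * 1ℚ))))) * s) ≡ (a * q) * ((a * q) * ((a * q) * ((a * q) * ((a * q) * 1ℚ)))) * s
     r = solve-∀ ℚ-ring
     pow-comm : ∀ x j k → (x ^ j) ^ k ≡ (x ^ k) ^ j
     pow-comm x zero    k = 1^ k
     pow-comm x (suc j) k = trans (^-distrib-* x (x ^ j) k) (cong (x ^ k *_) (pow-comm x j k))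
     split : ((+ 17 / 18) ^ 5 * ρ₀) ^ k ≡ q ^ 5 * ρ₀ ^ k
     split = trans (^-distrib-* ((+ 17 / 18) ^ 5) ρ₀ k) (cong (_* ρ₀ ^ k) (pow-comm (+ 17 / 18) 5 k))

 abstract
   -- The local limit theorem needs the third moment, and two more powers give tails of order
   -- m^(-2); hence one common bound for moments up to the fifth. It is abstract because its digits
   -- never matter.
   big : ℚ
   big = (+ 17 / 1) ^ 5 * (+ 21 / 1)

   0≤big : 0ℚ ≤ big
   0≤big = ≥0 ((+ 17 / 1) ^ 5 * (+ 21 / 1))

   fifth-moment : ∀ {x} → 0ℚ ≤ x → x ≤ + 3 / 5 → ∀ N → M 5 x N ≤ big
   fifth-moment {x} 0≤x x≤ N = ≤-trans (S-mono N (λ k → begin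
       ι k ^ 5 * (W k * x ^ k) ≤⟨ *-monoˡ (^-nonneg 5 (0≤ι k)) (*-monoˡ (Nonneg-W k) (^-mono-≤ k 0≤x x≤)) ⟩
       ι k ^ 5 * (W k * (+ 3 / 5) ^ k) ≡⟨ r (ι k ^ 5) (W k) ((+ 3 / 5) ^ k) ⟩
       W k * (ι k ^ 5 * (+ 3 / 5) ^ k) ≤⟨ *-monoˡ (Nonneg-W k) (fifth-power k) ⟩
       W k * ((+ 17 / 1) ^ 5 * ρ₀ ^ k) ≡⟨ r (W k) ((+ 17 / 1) ^ 5) (ρ₀ ^ k) ⟩
       (+ 17 / 1) ^ 5 * (W k * ρ₀ ^ k) ∎))
     (≤-trans (≤-reflexive (S-scale ((+ 17 / 1) ^ 5) (weight ρ₀ W) N)) (*-monoˡ (^-nonneg 5 (≥0 (+ 17 / 1))) (W-growth N)))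
     where
     open ≤-Reasoning
     r : ∀ a b c → a * (b * c) ≡ b * (a * c)
     r = solve-∀ ℚ-ring

 1≤^ : ∀ {x} n → 1ℚ ≤ x → 1ℚ ≤ x ^ n
 1≤^ zero    h = ≤-refl
 1≤^ {x} (suc n) h = *-mono-≤ {1ℚ} {x} {1ℚ} {x ^ n} 0≤1 0≤1 h (1≤^ n h)

 private
   power-≤ : ∀ i j k x → 0ℚ ≤ x → ι k ^ i * weight x W k ≤ ι k ^ (i ℕ.+ j) * weight x W k
   power-≤ i j zero    x 0≤x = ≤-reflexive (trans (zero-term i) (sym (zero-term (i ℕ.+ j))))
     where
     zero-term : ∀ i → ι 0 ^ i * weight x W 0 ≡ 0ℚ
     zero-term i = trans (cong (λ z → ι 0 ^ i * (z * 1ℚ)) W-0) (*-zeroʳ (ι 0 ^ i))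
   power-≤ i j (suc k) x 0≤x = *-monoʳ (Nonneg-weight 0≤x Nonneg-W (suc k)) (≤-trans (≤-reflexive (sym (*-identityʳ (ι (suc k) ^ i))))
     (≤-trans (*-monoˡ (^-nonneg i (0≤ι (suc k))) (1≤^ j (1≤ι k))) (≤-reflexive (sym (^-+ (ι (suc k)) i j)))))

 moment≤big : ∀ j → j ℕ.≤ 5 → ∀ {x} → 0ℚ ≤ x → x ≤ + 3 / 5 → ∀ N → M j x N ≤ big
 moment≤big j j≤5 {x} 0≤x x≤ N with ℕ.m≤n⇒∃[o]m+o≡n j≤5
 ... | o , j+o≡5 = ≤-trans (S-mono N (λ k → ≤-trans (power-≤ j o k x 0≤x) (≤-reflexive (cong (λ z → ι k ^ z * weight x W k) j+o≡5)))) (fifth-moment 0≤x x≤ N)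

 moment-mono-N : ∀ j {x m n} → 0ℚ ≤ x → m ℕ.≤ n → M j x m ≤ M j x n
 moment-mono-N j 0≤x = S-mono-n (moment-nonneg j 0≤x)

 moment-mono-x : ∀ j {x y} N → 0ℚ ≤ x → x ≤ y → M j x N ≤ M j y N
 moment-mono-x j N 0≤x x≤y = S-mono N (λ k → *-monoˡ (^-nonneg j (0≤ι k)) (*-monoˡ (Nonneg-W k) (^-mono-≤ k 0≤x x≤y)))

 -- Beyond `m` a factor m² is at most k², so the tail is controlled by the moment of order j + 2.
 moment-tail : ∀ j → j ℕ.≤ 3 → ∀ {x} → 0ℚ ≤ x → x ≤ + 3 / 5 → ∀ m o → ι m * ι m * (M j x (m ℕ.+ o) - M j x m) ≤ big
 moment-tail j j≤3 {x} 0≤x x≤ m o = begin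
   ι m * ι m * (M j x (m ℕ.+ o) - M j x m)
     ≡⟨ cong (λ z → ι m * ι m * z) (trans (cong (_- M j x m) (S-+ (λ k → ι k ^ j * weight x W k) m o)) (cancel (M j x m) (S (λ i → ι (m ℕ.+ i) ^ j * weight x W (m ℕ.+ i)) o))) ⟩
   ι m * ι m * S (λ i → ι (m ℕ.+ i) ^ j * weight x W (m ℕ.+ i)) o
     ≡⟨ S-scale (ι m * ι m) (λ i → ι (m ℕ.+ i) ^ j * weight x W (m ℕ.+ i)) o ⟨
   S (λ i → ι m * ι m * (ι (m ℕ.+ i) ^ j * weight x W (m ℕ.+ i))) o
     ≤⟨ S-mono o (λ i → ≤-trans (*-monoʳ (moment-nonneg j 0≤x (m ℕ.+ i)) (*-mono-≤ (0≤ι m) (0≤ι m) (ι-mono (ℕ.m≤m+n m i)) (ι-mono (ℕ.m≤m+n m i))))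
          (≤-reflexive (r (ι (m ℕ.+ i)) (ι (m ℕ.+ i) ^ j) (weight x W (m ℕ.+ i))))) ⟩
   S (λ i → ι (m ℕ.+ i) ^ suc (suc j) * weight x W (m ℕ.+ i)) o
     ≤⟨ subst₂ _≤_ (+-identityˡ _) (sym (S-+ (λ k → ι k ^ suc (suc j) * weight x W k) m o)) (+-monoˡ-≤ (S (λ i → ι (m ℕ.+ i) ^ suc (suc j) * weight x W (m ℕ.+ i)) o) (S-nonneg m (moment-nonneg (suc (suc j)) 0≤x))) ⟩
   M (suc (suc j)) x (m ℕ.+ o)
     ≤⟨ moment≤big (suc (suc j)) (s≤s (s≤s j≤3)) 0≤x x≤ (m ℕ.+ o) ⟩
   big ∎
   where
   open ≤-Reasoning
   cancel : ∀ a b → a + b - a ≡ b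
   cancel = solve-∀ ℚ-ring
   r : ∀ k a w → k * k * (a * w) ≡ k * (k * a) * w
   r = solve-∀ ℚ-ring

 -- The mean value estimate for k-th powers, multiplied by `y` to avoid the exponent k - 1.
 power-lipschitz : ∀ {x y} → 0ℚ ≤ x → x ≤ y → ∀ k → y * (y ^ k - x ^ k) ≤ (y - x) * (ι k * y ^ k)
 power-lipschitz {x} {y} 0≤x x≤y zero    = ≤-reflexive (trans (r x y) (cong (λ z → (y - x) * (z * 1ℚ)) (sym ι-0)))
   where
   r : ∀ x y → y * (1ℚ - 1ℚ) ≡ (y - x) * (0ℚ * 1ℚ)
   r = solve-∀ ℚ-ring
 power-lipschitz {x} {y} 0≤x x≤y (suc k) = ≤-trans
   (≤-cert {a = y * (y * y ^ k - x * x ^ k)} {b = y * (y * (y ^ k - x ^ k)) + y * ((y - x) * y ^ k)}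
     (0≤* (0≤* (≤-trans 0≤x x≤y) (0≤-diff x≤y)) (0≤-diff (^-mono-≤ k 0≤x x≤y))) (r₁ x y (x ^ k) (y ^ k)))
   (≤-trans (+-monoˡ-≤ (y * ((y - x) * y ^ k)) (*-monoˡ (≤-trans 0≤x x≤y) (power-lipschitz 0≤x x≤y k)))
     (≤-reflexive (trans (r₂ x y (ι k) (y ^ k)) (cong (λ z → (y - x) * (z * (y * y ^ k))) (sym (ι-suc k))))))
   where
   r₁ : ∀ x y a b → y * (y - x) * (b - a) ≡ y * (y * (b - a)) + y * ((y - x) * b) - y * (y * b - x * a)
   r₁ = solve-∀ ℚ-ring
   r₂ : ∀ x y k b → y * ((y - x) * (k * b)) + y * ((y - x) * b) ≡ (y - x) * ((k + 1ℚ) * (y * b))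
   r₂ = solve-∀ ℚ-ring

 S-diff : ∀ f g n → S f n - S g n ≡ S (λ k → f k - g k) n
 S-diff f g zero    = refl
 S-diff f g (suc n) = trans (r (f 0) (g 0) (S (tl f) n) (S (tl g) n)) (cong (λ z → f 0 - g 0 + z) (S-diff (tl f) (tl g) n))
   where
   r : ∀ a b c d → a + c - (b + d) ≡ a - b + (c - d)
   r = solve-∀ ℚ-ring

 moment-lipschitz : ∀ j {x y} → 0ℚ ≤ x → x ≤ y → ∀ N → y * (M j y N - M j x N) ≤ (y - x) * M (suc j) y N
 moment-lipschitz j {x} {y} 0≤x x≤y N = begin
   y * (M j y N - M j x N)
     ≡⟨ trans (cong (y *_) (S-diff (λ k → ι k ^ j * weight y W k) (λ k → ι k ^ j * weight x W k) N)) (sym (S-scale y (λ k → ι k ^ j * weight y W k - ι k ^ j * weight x W k) N)) ⟩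
   S (λ k → y * (ι k ^ j * weight y W k - ι k ^ j * weight x W k)) N
     ≤⟨ S-mono N (λ k → ≤-trans (≤-reflexive (r₁ y (ι k ^ j) (W k) (y ^ k) (x ^ k)))
          (≤-trans (*-monoˡ (0≤* (^-nonneg j (0≤ι k)) (Nonneg-W k)) (power-lipschitz 0≤x x≤y k)) (≤-reflexive (r₂ (ι k ^ j) (W k) (y - x) (ι k) (y ^ k))))) ⟩
   S (λ k → (y - x) * (ι k ^ suc j * weight y W k)) N
     ≡⟨ S-scale (y - x) (λ k → ι k ^ suc j * weight y W k) N ⟩
   (y - x) * M (suc j) y N ∎
   where
   open ≤-Reasoning
   r₁ : ∀ y a w p q → y * (a * (w * p) - a * (w * q)) ≡ a * w * (y * (p - q))
   r₁ = solve-∀ ℚ-ring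
   r₂ : ∀ a w d k p → a * w * (d * (k * p)) ≡ d * (k * a * (w * p))
   r₂ = solve-∀ ℚ-ring

 W-1 : W 1 ≡ 1ℚ
 W-1 = trans (W≡rep 1) (trans (rep-double 1 1) (trans (cong₂ _+_ first (trans (+-identityʳ _) (E-⊛-below 2 (rep 0) 1 (s≤s (s≤s z≤n))))) (+-identityʳ 1ℚ)))
   where
   first : rep 1 1 ≡ 1ℚ
   first = trans (+-identityʳ ((E 1 ⊛ repr 0 0) 1)) (trans (E-⊛-at 1 (repr 0 0) 0) (cong (_* 1ℚ) inv!-0))

 -- The linear term alone already makes x ↦ Σ W_k xᵏ expansive.
 expansive : ∀ {x y} → 0ℚ ≤ x → x ≤ y → ∀ N → y - x ≤ M 0 y (2 ℕ.+ N) - M 0 x (2 ℕ.+ N)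
 expansive {x} {y} 0≤x x≤y N = subst (y - x ≤_) (sym (S-diff f g (2 ℕ.+ N)))
   (≤-trans (≤-cert {a = y - x} {b = f 0 - g 0 + (f 1 - g 1 + 0ℚ)} ≤-refl (sym zero≡)) (S-mono-n (λ k → 0≤-diff (*-monoˡ 0≤1 (*-monoˡ (Nonneg-W k) (^-mono-≤ k 0≤x x≤y)))) (s≤s (s≤s (z≤n {N})))))
   where
   f g : PS
   f k = ι k ^ 0 * weight y W k
   g k = ι k ^ 0 * weight x W k
   zero≡ : f 0 - g 0 + (f 1 - g 1 + 0ℚ) - (y - x) ≡ 0ℚ
   zero≡ = trans (cong₂ (λ u v → 1ℚ * (u * 1ℚ) - 1ℚ * (u * 1ℚ) + (1ℚ * (v * (y * 1ℚ)) - 1ℚ * (v * (x * 1ℚ)) + 0ℚ) - (y - x)) W-0 W-1) (r x y)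
     where
     r : ∀ x y → 1ℚ * (0ℚ * 1ℚ) - 1ℚ * (0ℚ * 1ℚ) + (1ℚ * (1ℚ * (y * 1ℚ)) - 1ℚ * (1ℚ * (x * 1ℚ)) + 0ℚ) - (y - x) ≡ 0ℚ
     r = solve-∀ ℚ-ring

-- Rational approximations of θ with quadratic accuracy

module Root where

 open RationalArithmetic
 open Tilt

 -- Order n^(-2) is what the sequel requires: approximations of θ are raised to the n-th power, and
 -- the mass they miss is multiplied by s² ≤ n².
 rate : ℕ → ℚ
 rate n = ι (suc n) ⁻¹ * ι (suc n) ⁻¹

 0≤rate : ∀ n → 0ℚ ≤ rate n
 0≤rate n = 0≤* (0≤⁻¹ (0<ι n)) (0≤⁻¹ (0<ι n))

 rate-anti : ∀ {m n} → m ℕ.≤ n → rate n ≤ rate m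
 rate-anti {m} {n} h = *-mono-≤ (0≤⁻¹ (0<ι n)) (0≤⁻¹ (0<ι n)) le le
   where le = ⁻¹-anti (0<ι m) (ι-mono (s≤s h))

 rate≤ : ∀ n → rate n ≤ ι (suc n) ⁻¹
 rate≤ n = ≤-trans (*-monoˡ (0≤⁻¹ (0<ι n)) (subst (ι (suc n) ⁻¹ ≤_) one (⁻¹-anti 0<1 (1≤ι n)))) (≤-reflexive (*-identityʳ (ι (suc n) ⁻¹)))
   where
   one : 1ℚ ⁻¹ ≡ 1ℚ
   one = sym (⁻¹-unique 0<1 refl)

 ≤-rate : ∀ n {c d} → ι (suc n) * ι (suc n) * c ≤ d → c ≤ d * rate n
 ≤-rate n {c} {d} h = subst₂ _≤_ (trans (r₁ (ι (suc n)) (ι (suc n) ⁻¹) c) (trans (cong (λ z → c * (z * z)) (*-⁻¹ (0<ι n))) (*-identityʳ c))) refl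
   (*-monoʳ (0≤rate n) h)
   where
   r₁ : ∀ s i c → s * s * c * (i * i) ≡ c * ((s * i) * (s * i))
   r₁ = solve-∀ ℚ-ring

 module Bracket (a b : ℚ) (N₀ : ℕ) (½≤a : ½ ≤ a) (a≤b : a ≤ b) (b≤ : b ≤ + 3 / 5)
   (low : ∀ N → M 0 a N ≤ 1ℚ) (high : 1ℚ ≤ M 0 b (3 ℕ.+ N₀)) where

   -- The number of terms in use at index `n`. It exceeds `n`, so truncation does not affect the
   -- coefficients up to degree `n` of any power.
   len : ℕ → ℕ
   len n = 3 ℕ.+ (N₀ ℕ.+ n)

   n<len : ∀ n → suc n ℕ.≤ len n
   n<len n = ℕ.≤-trans (ℕ.m≤n+m (suc n) (2 ℕ.+ N₀)) (ℕ.≤-reflexive (e N₀ n))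
     where
     e : ∀ N n → 2 ℕ.+ N ℕ.+ suc n ≡ 3 ℕ.+ (N ℕ.+ n)
     e = ℕ-Solver.solve-∀

   len-mono : ∀ {m n} → m ℕ.≤ n → len m ℕ.≤ len n
   len-mono h = ℕ.+-monoʳ-≤ 3 (ℕ.+-monoʳ-≤ N₀ h)

   0≤a : 0ℚ ≤ a
   0≤a = ≤-trans (≥0 ½) ½≤a

   private
     δ : ℕ → ℚ
     δ n = (b - a) * rate n

     0≤δ : ∀ n → 0ℚ ≤ δ n
     0≤δ n = 0≤* (0≤-diff a≤b) (0≤rate n)

     point : ℕ → ℕ → ℚ
     point n i = a + ι i * δ n

     a≤point : ∀ n i → a ≤ point n i
     a≤point n i = subst (_≤ point n i) (+-identityʳ a) (+-monoʳ-≤ a (0≤* (0≤ι i) (0≤δ n)))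

     point-top : ∀ n → point n (suc n ℕ.* suc n) ≡ b
     point-top n = trans (cong (λ z → a + z * δ n) (ι-* (suc n) (suc n))) (trans (r a b (ι (suc n)) (ι (suc n) ⁻¹))
       (trans (cong (λ z → a + (b - a) * (z * z)) (*-⁻¹ (0<ι n))) (r′ a b)))
       where
       r : ∀ a b s i → a + s * s * ((b - a) * (i * i)) ≡ a + (b - a) * ((s * i) * (s * i))
       r = solve-∀ ℚ-ring
       r′ : ∀ a b → a + (b - a) * (1ℚ * 1ℚ) ≡ b
       r′ = solve-∀ ℚ-ring

     point-suc : ∀ n i → point n (suc i) - point n i ≡ δ n
     point-suc n i = trans (cong (λ z → a + z * δ n - point n i) (ι-suc i)) (r a (ι i) (δ n))
       where
       r : ∀ a i d → a + (i + 1ℚ) * d - (a + i * d) ≡ d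
       r = solve-∀ ℚ-ring

   record Located (n : ℕ) : Set where
     field
       x y   : ℚ
       a≤x   : a ≤ x
       x≤y   : x ≤ y
       y≤b   : y ≤ b
       y-x≤  : y - x ≤ (b - a) * rate n
       below : M 0 x (len n) ≤ 1ℚ
       above : 1ℚ ≤ M 0 y (len n)

   private
     -- Truncated sums at rational points are rational, so comparison with 1 is decidable. The walk
     -- goes down a grid of (n + 1)² steps and stops as soon as the sum no longer exceeds 1.
     search : ∀ n i → point n i ≤ b → 1ℚ ≤ M 0 (point n i) (len n) → Located n
     search n zero ≤b h = record
       { x = a ; y = a ; a≤x = ≤-refl ; x≤y = ≤-refl ; y≤b = a≤b
       ; y-x≤ = subst (_≤ δ n) (sym (+-inverseʳ a)) (0≤δ n)
       ; below = low (len n)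
       ; above = subst (λ z → 1ℚ ≤ M 0 z (len n)) (trans (cong (λ z → a + z * δ n) ι-0) (trans (cong (λ z → a + z) (*-zeroˡ (δ n))) (+-identityʳ a))) h }
     search n (suc i) ≤b h with M 0 (point n i) (len n) ℚ.≤? 1ℚ
     ... | yes p = record
       { x = point n i ; y = point n (suc i) ; a≤x = a≤point n i
       ; x≤y = ≤-cert (0≤δ n) (sym (point-suc n i)) ; y≤b = ≤b
       ; y-x≤ = ≤-reflexive (point-suc n i) ; below = p ; above = h }
     ... | no ¬p = search n i (≤-trans (≤-cert (0≤δ n) (sym (point-suc n i))) ≤b) (<⇒≤ (≰⇒> ¬p))

   abstract
     located : ∀ n → Located n
     located n = search n (suc n ℕ.* suc n) (≤-reflexive (point-top n))
       (subst (λ z → 1ℚ ≤ M 0 z (len n)) (sym (point-top n)) (≤-trans high (moment-mono-N 0 (≤-trans 0≤a a≤b) (ℕ.+-monoʳ-≤ 3 (ℕ.m≤m+n N₀ n)))))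

   module _ (n : ℕ) where
     open Located (located n) public using () renaming (x to root; a≤x to a≤root; below to M₀≤1)

     root≤b : root ≤ b
     root≤b = ≤-trans (Located.x≤y (located n)) (Located.y≤b (located n))

     ½≤root : ½ ≤ root
     ½≤root = ≤-trans ½≤a a≤root

     0≤root : 0ℚ ≤ root
     0≤root = ≤-trans 0≤a a≤root

     0<root : 0ℚ < root
     0<root = <-≤-trans (>0 ½) ½≤root

     root≤ : root ≤ + 3 / 5
     root≤ = ≤-trans root≤b b≤

     m₀ m₁ m₂ : ℚ
     m₀ = M 0 root (len n)
     m₁ = M 1 root (len n)
     m₂ = M 2 root (len n)

   lipschitz : ∀ j → suc j ℕ.≤ 5 → ∀ {x y} → ½ ≤ x → x ≤ y → y ≤ + 3 / 5 → ∀ N → M j y N - M j x N ≤ + 2 / 1 * ((y - x) * big)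
   lipschitz j j<5 {x} {y} ½≤x x≤y y≤ N = ≤-trans (≤-reflexive (r (M j y N - M j x N)))
     (*-monoˡ (≥0 (+ 2 / 1)) (≤-trans (*-monoʳ (0≤-diff (moment-mono-x j N 0≤x x≤y)) (≤-trans ½≤x x≤y))
       (≤-trans (moment-lipschitz j 0≤x x≤y N) (*-monoˡ (0≤-diff x≤y) (moment≤big (suc j) j<5 (≤-trans 0≤x x≤y) y≤ N)))))
     where
     0≤x = ≤-trans (≥0 ½) ½≤x
     r : ∀ d → d ≡ + 2 / 1 * (½ * d)
     r = solve-∀ ℚ-ring

   deficiency : ℕ → ℚ
   deficiency n = 1ℚ - m₀ n

   0≤deficiency : ∀ n → 0ℚ ≤ deficiency n
   0≤deficiency n = 0≤-diff (M₀≤1 n)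

   deficiency≤ : ∀ n → deficiency n ≤ big * rate n
   deficiency≤ n = begin
     1ℚ - m₀ n ≤⟨ +-monoˡ-≤ (- m₀ n) above ⟩
     M 0 y (len n) - m₀ n ≤⟨ lipschitz 0 (s≤s z≤n) (½≤root n) x≤y (≤-trans y≤b b≤) (len n) ⟩
     + 2 / 1 * ((y - x) * big) ≤⟨ *-monoˡ (≥0 (+ 2 / 1)) (*-monoʳ 0≤big (≤-trans y-x≤ (*-monoʳ (0≤rate n) b-a≤))) ⟩
     + 2 / 1 * (½ * rate n * big) ≡⟨ r (rate n) big ⟩
     big * rate n ∎
     where
     open ≤-Reasoning
     open Located (located n)
     r : ∀ u c → + 2 / 1 * (½ * u * c) ≡ c * u
     r = solve-∀ ℚ-ring
     b-a≤ : b - a ≤ ½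
     b-a≤ = ≤-cert {a = b - a} {b = ½} (0≤+ (0≤+ (0≤-diff b≤) (0≤-diff ½≤a)) (≥0 (+ 2 / 5))) (r′ a b)
       where
       r′ : ∀ a b → (+ 3 / 5 - b) + (a - ½) + + 2 / 5 ≡ ½ - (b - a)
       r′ = solve-∀ ℚ-ring

   tail≤ : ∀ j → j ℕ.≤ 3 → ∀ {x} → 0ℚ ≤ x → x ≤ + 3 / 5 → ∀ {n m} → n ℕ.≤ m → M j x (len m) ≤ M j x (len n) + big * rate n
   tail≤ j j≤3 {x} 0≤x x≤ {n} {m} n≤m = helper (ℕ.m≤n⇒∃[o]m+o≡n (len-mono n≤m))
     where
     helper : (∃[ o ] len n ℕ.+ o ≡ len m) → M j x (len m) ≤ M j x (len n) + big * rate n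
     helper (o , e) = ≤-cert (0≤-diff (≤-rate n (≤-trans
         (*-monoʳ (0≤-diff (moment-mono-N j 0≤x (len-mono n≤m))) (*-mono-≤ (0≤ι (suc n)) (0≤ι (suc n)) (ι-mono (n<len n)) (ι-mono (n<len n))))
         (subst (λ z → ι (len n) * ι (len n) * (M j x z - M j x (len n)) ≤ big) e (moment-tail j j≤3 0≤x x≤ (len n) o)))))
       (r (M j x (len m)) (M j x (len n)) (big * rate n))
       where
       r : ∀ a b c → c - (a - b) ≡ b + c - a
       r = solve-∀ ℚ-ring

   -- Both roots are evaluated in the longer sum. `expansive` bounds their distance by the
   -- difference of the values, and that is controlled by tails and deficiencies.
   root-cauchy : ∀ {n m} → n ℕ.≤ m → ∣ root n - root m ∣ ≤ + 2 / 1 * big * rate n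
   root-cauchy {n} {m} n≤m = ∣-∣≤ (by₁ (≤-total (root m) (root n))) (by₂ (≤-total (root n) (root m)))
     where
     c≥0 : 0ℚ ≤ + 2 / 1 * big * rate n
     c≥0 = 0≤* (0≤* (≥0 (+ 2 / 1)) 0≤big) (0≤rate n)
     +c : ∀ x → x ≤ x + + 2 / 1 * big * rate n
     +c x = subst (_≤ x + + 2 / 1 * big * rate n) (+-identityʳ x) (+-monoʳ-≤ x c≥0)
     by₁ : root m ≤ root n ⊎ root n ≤ root m → root n ≤ root m + + 2 / 1 * big * rate n
     by₁ (inj₂ h) = ≤-trans h (+c (root m))
     by₁ (inj₁ h) = ≤-cert (0≤+ (0≤+ (0≤+ (0≤+ (0≤-diff (expansive (0≤root m) h (suc (N₀ ℕ.+ m)))) (0≤-diff (tail≤ 0 z≤n (0≤root n) (root≤ n) n≤m))) (0≤-diff (M₀≤1 n)))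
         (0≤-diff (deficiency≤ m))) (0≤-diff (*-monoˡ 0≤big (rate-anti n≤m))))
       (r (root n) (root m) (M 0 (root n) (len m)) (m₀ m) (m₀ n) big (rate n) (rate m))
       where
       r : ∀ xn xm A mm mn b un um → A - mm - (xn - xm) + (mn + b * un - A) + (1ℚ - mn) + (b * um - (1ℚ - mm)) + (b * un - b * um) ≡ xm + + 2 / 1 * b * un - xn
       r = solve-∀ ℚ-ring
     by₂ : root n ≤ root m ⊎ root m ≤ root n → root m ≤ root n + + 2 / 1 * big * rate n
     by₂ (inj₂ h) = ≤-trans h (+c (root n))
     by₂ (inj₁ h) = ≤-cert (0≤+ (0≤+ (0≤+ (0≤+ (0≤-diff (expansive (0≤root n) h (suc (N₀ ℕ.+ m)))) (0≤-diff (M₀≤1 m))) (0≤-diff (moment-mono-N 0 (0≤root n) (len-mono n≤m))))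
         (0≤-diff (deficiency≤ n))) (0≤* 0≤big (0≤rate n)))
       (r (root n) (root m) (m₀ m) (M 0 (root n) (len m)) (m₀ n) big (rate n))
       where
       r : ∀ xn xm mm A mn b un → mm - A - (xm - xn) + (1ℚ - mm) + (A - mn) + (b * un - (1ℚ - mn)) + b * un ≡ xn + + 2 / 1 * b * un - xm
       r = solve-∀ ℚ-ring

   big₂ : ℚ
   big₂ = big + + 4 / 1 * (big * big)

   0≤big₂ : 0ℚ ≤ big₂
   0≤big₂ = 0≤+ 0≤big (0≤* (≥0 (+ 4 / 1)) (0≤* 0≤big 0≤big))

   moment-cauchy : ∀ j → suc j ℕ.≤ 3 → ∀ {n m} → n ℕ.≤ m → ∣ M j (root n) (len n) - M j (root m) (len m) ∣ ≤ big₂ * rate n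
   moment-cauchy j j<3 {n} {m} n≤m = ≤-trans (∣∣-tri (M j (root n) (len n)) (M j (root n) (len m)) (M j (root m) (len m)))
     (≤-trans (+-mono-≤ step₁ step₂) (≤-reflexive (r big (rate n))))
     where
     r : ∀ b u → b * u + + 2 / 1 * (+ 2 / 1 * b * u * b) ≡ (b + + 4 / 1 * (b * b)) * u
     r = solve-∀ ℚ-ring
     j<5 : suc j ℕ.≤ 5
     j<5 = ℕ.≤-trans j<3 (s≤s (s≤s (s≤s z≤n)))
     0≤bu = 0≤* 0≤big (0≤rate n)
     step₁ : ∣ M j (root n) (len n) - M j (root n) (len m) ∣ ≤ big * rate n
     step₁ = ∣-∣≤ (≤-trans (moment-mono-N j (0≤root n) (len-mono n≤m)) (subst (_≤ M j (root n) (len m) + big * rate n) (+-identityʳ (M j (root n) (len m))) (+-monoʳ-≤ (M j (root n) (len m)) 0≤bu)))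
       (tail≤ j (ℕ.<⇒≤ j<3) (0≤root n) (root≤ n) n≤m)
     step₂ : ∣ M j (root n) (len m) - M j (root m) (len m) ∣ ≤ + 2 / 1 * (+ 2 / 1 * big * rate n * big)
     step₂ = by (≤-total (root n) (root m))
       where
       via : ∀ {x y} → ½ ≤ x → x ≤ y → y ≤ + 3 / 5 → ∣ y - x ∣ ≤ + 2 / 1 * big * rate n → ∣ M j y (len m) - M j x (len m) ∣ ≤ + 2 / 1 * (+ 2 / 1 * big * rate n * big)
       via {x} {y} ½≤x x≤y y≤ h = ≤-trans (≤-reflexive (ℚ.0≤p⇒∣p∣≡p (0≤-diff (moment-mono-x j (len m) (≤-trans (≥0 ½) ½≤x) x≤y))))
         (≤-trans (lipschitz j j<5 ½≤x x≤y y≤ (len m)) (*-monoˡ (≥0 (+ 2 / 1)) (*-monoʳ 0≤big (≤-trans (≤∣∣ (y - x)) h))))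
       by : root n ≤ root m ⊎ root m ≤ root n → ∣ M j (root n) (len m) - M j (root m) (len m) ∣ ≤ + 2 / 1 * (+ 2 / 1 * big * rate n * big)
       by (inj₁ h) = ≤-trans (≤-reflexive (∣-∣-sym (M j (root n) (len m)) (M j (root m) (len m))))
         (via (½≤root n) h (root≤ m) (≤-trans (≤-reflexive (∣-∣-sym (root m) (root n))) (root-cauchy n≤m)))
       by (inj₂ h) = via (½≤root m) h (root≤ n) (root-cauchy n≤m)

-- The tilted law at a rational approximation of θ

module TiltedLaw where

 open RationalArithmetic
 open PowerSeries
 open Coins
 open LocalLimit
 open Laws
 open Representations
 open Maxima
 open Tilt
 open Root

 pow-upTo : ∀ {f g} N s → Nonneg f → (∀ i → i ℕ.≤ N → f i ≤ g i) → ∀ i → i ℕ.≤ N → pow f s i ≤ pow g s i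
 pow-upTo N zero    f≥0 h i _ = ≤-refl
 pow-upTo N (suc s) f≥0 h     = ⊛-mono-upTo N f≥0 (Nonneg-pow s f≥0) h (pow-upTo N s f≥0 h)

 ⊛-+const : ∀ f g h c n → Nonneg f → (∀ i → g i ≤ h i + c) → (f ⊛ g) n ≤ (f ⊛ h) n + c * S f (suc n)
 ⊛-+const f g h c zero    f≥0 p = ≤-trans (*-monoˡ (f≥0 0) (p 0)) (≤-reflexive (r (f 0) (h 0) c))
   where
   r : ∀ f h c → f * (h + c) ≡ f * h + c * (f + 0ℚ)
   r = solve-∀ ℚ-ring
 ⊛-+const f g h c (suc n) f≥0 p = ≤-trans (+-mono-≤ (*-monoˡ (f≥0 0) (p (suc n))) (⊛-+const (tl f) g h c n (λ i → f≥0 (suc i)) p))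
   (≤-reflexive (r (f 0) (h (suc n)) c ((tl f ⊛ h) n) (S (tl f) (suc n))))
   where
   r : ∀ f h c u s → f * (h + c) + (u + c * s) ≡ f * h + u + c * (f + s)
   r = solve-∀ ℚ-ring

 -- The extra atom is removed from one factor after the other. Each removal costs at most `q`, since
 -- the remaining product has mass at most 1.
 pow-atom : ∀ f q → Nonneg f → 0ℚ ≤ q → L1 (C q ⊕ f) 1ℚ → ∀ s n → pow (C q ⊕ f) s n ≤ pow f s n + ι s * q
 pow-atom f q f≥0 0≤q mass zero    n = ≤-reflexive (trans (sym (+-identityʳ (C 1ℚ n))) (cong (λ z → C 1ℚ n + z) (sym (trans (cong (_* q) ι-0) (*-zeroˡ q)))))
 pow-atom f q f≥0 0≤q mass (suc s) n = begin
   ((C q ⊕ f) ⊛ A^s) n ≡⟨ trans (⊛-distribʳ A^s (C q) f n) (cong (_+ (f ⊛ A^s) n) (C-⊛ q A^s n)) ⟩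
   q * A^s n + (f ⊛ A^s) n ≤⟨ +-mono-≤ (*-monoˡ 0≤q A^s≤1) (⊛-+const f A^s (pow f s) (ι s * q) n f≥0 (pow-atom f q f≥0 0≤q mass s)) ⟩
   q * 1ℚ + ((f ⊛ pow f s) n + ι s * q * S f (suc n)) ≤⟨ +-monoʳ-≤ (q * 1ℚ) (+-monoʳ-≤ ((f ⊛ pow f s) n) (*-monoˡ (0≤* (0≤ι s) 0≤q) Sf≤1)) ⟩
   q * 1ℚ + ((f ⊛ pow f s) n + ι s * q * 1ℚ) ≡⟨ r q ((f ⊛ pow f s) n) (ι s) ⟩
   (f ⊛ pow f s) n + (ι s + 1ℚ) * q ≡⟨ cong (λ z → (f ⊛ pow f s) n + z * q) (sym (ι-suc s)) ⟩
   (f ⊛ pow f s) n + ι (suc s) * q ∎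
   where
   open ≤-Reasoning
   A^s = pow (C q ⊕ f) s
   r : ∀ q u s → q * 1ℚ + (u + s * q * 1ℚ) ≡ u + (s + 1ℚ) * q
   r = solve-∀ ℚ-ring
   A^s≤1 : A^s n ≤ 1ℚ
   A^s≤1 = ≤-trans (≤∣∣ (A^s n)) (L1⇒Sup (L1-pow1 s mass) n)
   Sf≤1 : S f (suc n) ≤ 1ℚ
   Sf≤1 = ≤-trans (S-mono (suc n) (λ i → ≤-trans (subst (_≤ C q i + f i) (+-identityˡ (f i)) (+-monoˡ-≤ (f i) (Nonneg-C 0≤q i))) (≤∣∣ (C q i + f i)))) (mass (suc n))

 -- An interval [a, b] around θ, with bounds for the first two moments on it.
 record Enclosure : Set where
   field
     a b   : ℚ
     N₀    : ℕ
     ½≤a   : ½ ≤ a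
     a≤b   : a ≤ b
     b≤    : b ≤ + 3 / 5
     low   : ∀ N → M 0 a N ≤ 1ℚ
     high  : 1ℚ ≤ M 0 b (3 ℕ.+ N₀)
     lo₁ hi₁ lo₂ hi₂ : ℚ
     lo₁≤  : lo₁ ≤ M 1 a (3 ℕ.+ N₀)
     ≤hi₁  : ∀ N → M 1 b N ≤ hi₁
     lo₂≤  : lo₂ ≤ M 2 a (3 ℕ.+ N₀)
     ≤hi₂  : ∀ N → M 2 b N ≤ hi₂
     2≤lo₁ : + 2 / 1 ≤ lo₁
     hi₁≤3 : hi₁ ≤ + 3 / 1
     4≤var : + 4 / 1 ≤ lo₂ - hi₁ * hi₁
     var≤5 : hi₂ - lo₁ * lo₁ ≤ + 5 / 1

 module Estimates (enclosure : Enclosure) where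

   open Enclosure enclosure public
   open Bracket a b N₀ ½≤a a≤b b≤ low high public

   module _ (n : ℕ) where

     lo₁≤m₁ : lo₁ ≤ m₁ n
     lo₁≤m₁ = ≤-trans lo₁≤ (≤-trans (moment-mono-x 1 (3 ℕ.+ N₀) 0≤a (a≤root n)) (moment-mono-N 1 (0≤root n) (ℕ.+-monoʳ-≤ 3 (ℕ.m≤m+n N₀ n))))

     m₁≤hi₁ : m₁ n ≤ hi₁
     m₁≤hi₁ = ≤-trans (moment-mono-x 1 (len n) (0≤root n) (root≤b n)) (≤hi₁ (len n))

     lo₂≤m₂ : lo₂ ≤ m₂ n
     lo₂≤m₂ = ≤-trans lo₂≤ (≤-trans (moment-mono-x 2 (3 ℕ.+ N₀) 0≤a (a≤root n)) (moment-mono-N 2 (0≤root n) (ℕ.+-monoʳ-≤ 3 (ℕ.m≤m+n N₀ n))))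

     m₂≤hi₂ : m₂ n ≤ hi₂
     m₂≤hi₂ = ≤-trans (moment-mono-x 2 (len n) (0≤root n) (root≤b n)) (≤hi₂ (len n))

     2≤m₁ : + 2 / 1 ≤ m₁ n
     2≤m₁ = ≤-trans 2≤lo₁ lo₁≤m₁

     m₁≤3 : m₁ n ≤ + 3 / 1
     m₁≤3 = ≤-trans m₁≤hi₁ hi₁≤3

     0≤m₁ : 0ℚ ≤ m₁ n
     0≤m₁ = ≤-trans (≥0 (+ 2 / 1)) 2≤m₁

     var : ℚ
     var = m₂ n - m₁ n * m₁ n

     lo-var : lo₂ - hi₁ * hi₁ ≤ var
     lo-var = +-mono-≤ lo₂≤m₂ (neg-antimono-≤ (*-mono-≤ 0≤m₁ 0≤m₁ m₁≤hi₁ m₁≤hi₁))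

     var-hi : var ≤ hi₂ - lo₁ * lo₁
     var-hi = +-mono-≤ m₂≤hi₂ (neg-antimono-≤ (*-mono-≤ 0≤lo₁ 0≤lo₁ lo₁≤m₁ lo₁≤m₁))
       where 0≤lo₁ = ≤-trans (≥0 (+ 2 / 1)) 2≤lo₁

     4≤var′ : + 4 / 1 ≤ var
     4≤var′ = ≤-trans 4≤var lo-var

     var≤5′ : var ≤ + 5 / 1
     var≤5′ = ≤-trans var-hi var≤5

     w̃ : PS
     w̃ = weight (root n) W

     -- The missing mass is placed at 0. The first `len n` terms then form an exact probability law,
     -- whose first two moments are those of the weights alone.
     law : PS
     law = C (deficiency n) ⊕ w̃

     Nonneg-w̃ : Nonneg w̃
     Nonneg-w̃ = Nonneg-weight (0≤root n) Nonneg-W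

     Nonneg-law : Nonneg law
     Nonneg-law = Nonneg-⊕ (Nonneg-C (0≤deficiency n)) Nonneg-w̃

     private
       ℓ = len n
       C-sum : ∀ q k → S (C q) (suc k) ≡ q
       C-sum q k = trans (cong (λ z → q + z) (S-zero (tl (C q)) k (λ _ → refl))) (+-identityʳ q)
       w̃-sum : S w̃ ℓ ≡ m₀ n
       w̃-sum = S-cong ℓ (λ k → sym (*-identityˡ (w̃ k)))

     law-total : S law ℓ ≡ 1ℚ
     law-total = trans (S-⊕ (C (deficiency n)) w̃ ℓ) (trans (cong₂ _+_ (C-sum (deficiency n) (2 ℕ.+ (N₀ ℕ.+ n))) w̃-sum) (r (m₀ n)))
       where
       r : ∀ m → 1ℚ - m + m ≡ 1ℚ
       r = solve-∀ ℚ-ring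

     law-sum : ∀ (φ : ℕ → ℚ) → φ 0 ≡ 0ℚ → S (λ k → law k * φ k) ℓ ≡ S (λ k → φ k * w̃ k) ℓ
     law-sum φ φ0 = S-cong ℓ eq
       where
       eq : ∀ k → law k * φ k ≡ φ k * w̃ k
       eq zero    = trans (cong (law 0 *_) φ0) (trans (*-zeroʳ (law 0)) (sym (trans (cong (_* w̃ 0) φ0) (*-zeroˡ (w̃ 0)))))
       eq (suc k) = trans (cong (_* φ (suc k)) (+-identityˡ (w̃ (suc k)))) (*-comm (w̃ (suc k)) (φ (suc k)))

     law-m₁ : S (λ k → law k * ι k) ℓ ≡ m₁ n
     law-m₁ = trans (law-sum ι ι-0) (S-cong ℓ (λ k → cong (_* w̃ k) (sym (*-identityʳ (ι k)))))

     law-m₂ : S (λ k → law k * (ι k * ι k)) ℓ ≡ m₂ n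
     law-m₂ = trans (law-sum (λ k → ι k * ι k) (trans (cong (λ z → z * z) ι-0) refl)) (S-cong ℓ (λ k → cong (λ z → ι k * z * w̃ k) (sym (*-identityʳ (ι k)))))

     private
       S-affine : ∀ α β γ → S (λ k → law k * (α + β * ι k + γ * (ι k * ι k))) ℓ ≡ α + β * m₁ n + γ * m₂ n
       S-affine α β γ = begin
         S (λ k → law k * (α + β * ι k + γ * (ι k * ι k))) ℓ
           ≡⟨ S-cong ℓ (λ k → r (law k) α β γ (ι k)) ⟩
         S ((λ k → α * law k) ⊕ (λ k → β * (law k * ι k)) ⊕ (λ k → γ * (law k * (ι k * ι k)))) ℓ
           ≡⟨ S-⊕ ((λ k → α * law k) ⊕ (λ k → β * (law k * ι k))) (λ k → γ * (law k * (ι k * ι k))) ℓ ⟩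
         S ((λ k → α * law k) ⊕ (λ k → β * (law k * ι k))) ℓ + S (λ k → γ * (law k * (ι k * ι k))) ℓ
           ≡⟨ cong₂ _+_ (S-⊕ (λ k → α * law k) (λ k → β * (law k * ι k)) ℓ) (trans (S-scale γ (λ k → law k * (ι k * ι k)) ℓ) (cong (γ *_) law-m₂)) ⟩
         S (λ k → α * law k) ℓ + S (λ k → β * (law k * ι k)) ℓ + γ * m₂ n
           ≡⟨ cong (_+ γ * m₂ n) (cong₂ _+_ (trans (S-scale α law ℓ) (trans (cong (α *_) law-total) (*-identityʳ α))) (trans (S-scale β (λ k → law k * ι k) ℓ) (cong (β *_) law-m₁))) ⟩
         α + β * m₁ n + γ * m₂ n ∎
         where
         open ≡-Reasoning
         r : ∀ p α β γ k → p * (α + β * k + γ * (k * k)) ≡ α * p + β * (p * k) + γ * (p * (k * k))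
         r = solve-∀ ℚ-ring

       ι+9 : ∀ k → ι (k ℕ.+ 9) ≡ ι k + + 9 / 1
       ι+9 k = trans (ι-+ k 9) (cong (λ z → ι k + z) (ι≡ 9))

     Σ₁-law : Σ₁ law ℓ 9 ≡ m₁ n + + 9 / 1
     Σ₁-law = trans (S-cong ℓ (λ k → cong (law k *_) (trans (ι+9 k) (r (ι k))))) (trans (S-affine (+ 9 / 1) 1ℚ 0ℚ) (r′ (m₁ n) (m₂ n)))
       where
       r : ∀ k → k + + 9 / 1 ≡ + 9 / 1 + 1ℚ * k + 0ℚ * (k * k)
       r = solve-∀ ℚ-ring
       r′ : ∀ m q → + 9 / 1 + 1ℚ * m + 0ℚ * q ≡ m + + 9 / 1
       r′ = solve-∀ ℚ-ring

     Σ₂-law : second (m₁ n + + 9 / 1) var ≡ Σ₂ law ℓ 9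
     Σ₂-law = sym (trans (S-cong ℓ (λ k → cong (law k *_) (trans (cong (λ z → ½ * (z * z - z)) (ι+9 k)) (r (ι k))))) (trans (S-affine (+ 36 / 1) (+ 17 / 2) ½) (r′ (m₁ n) (m₂ n))))
       where
       r : ∀ k → ½ * ((k + + 9 / 1) * (k + + 9 / 1) - (k + + 9 / 1)) ≡ + 36 / 1 + + 17 / 2 * k + ½ * (k * k)
       r = solve-∀ ℚ-ring
       r′ : ∀ m q → + 36 / 1 + + 17 / 2 * m + ½ * q ≡ ½ * (q - m * m + (m + + 9 / 1) * (m + + 9 / 1) - (m + + 9 / 1))
       r′ = solve-∀ ℚ-ring

     -- (k + 9)³ ≤ 1000k³ for k ≥ 1, and 9³ ≤ 1000 covers the atom at 0.
     third-bound : ℚ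
     third-bound = + 1000 / 1 * (1ℚ + big)

     Σ₃-law : Σ₃ law ℓ 9 ≤ third-bound
     Σ₃-law = ≤-trans (S-mono ℓ term) (≤-trans (≤-reflexive (trans (S-scale (+ 1000 / 1) (λ k → law k + ι k ^ 3 * w̃ k) ℓ) (cong (+ 1000 / 1 *_) (trans (S-⊕ law (λ k → ι k ^ 3 * w̃ k) ℓ) (cong (_+ M 3 (root n) ℓ) law-total)))))
       (*-monoˡ (≥0 (+ 1000 / 1)) (+-monoʳ-≤ 1ℚ (moment≤big 3 (s≤s (s≤s (s≤s z≤n))) (0≤root n) (root≤ n) ℓ))))
       where
       term : ∀ k → law k * ι (k ℕ.+ 9) ^ 3 ≤ + 1000 / 1 * (law k + ι k ^ 3 * w̃ k)
       term zero    = ≤-trans (*-monoˡ (Nonneg-law 0) (≤-trans (≤-reflexive (cong (_^ 3) (ι≡ 9))) (≤ᵇ⇒≤ {(+ 9 / 1) ^ 3} {+ 1000 / 1} _)))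
         (≤-cert {a = law 0 * (+ 1000 / 1)} {b = + 1000 / 1 * (law 0 + ι 0 ^ 3 * w̃ 0)} (0≤* (≥0 (+ 1000 / 1)) (0≤* (^-nonneg 3 (0≤ι 0)) (Nonneg-w̃ 0))) (r (law 0) (ι 0 ^ 3 * w̃ 0)))
         where
         r : ∀ l w → + 1000 / 1 * w ≡ + 1000 / 1 * (l + w) - l * (+ 1000 / 1)
         r = solve-∀ ℚ-ring
       term (suc k) = begin
         law (suc k) * ι (suc k ℕ.+ 9) ^ 3 ≤⟨ *-monoˡ (Nonneg-law (suc k)) (^-mono-≤ 3 (0≤ι (suc k ℕ.+ 9)) ten) ⟩
         law (suc k) * (+ 10 / 1 * ι (suc k)) ^ 3 ≡⟨ cong (_* (+ 10 / 1 * ι (suc k)) ^ 3) (+-identityˡ (w̃ (suc k))) ⟩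
         w̃ (suc k) * (+ 10 / 1 * ι (suc k)) ^ 3 ≡⟨ r (w̃ (suc k)) (ι (suc k)) ⟩
         + 1000 / 1 * (ι (suc k) ^ 3 * w̃ (suc k)) ≤⟨ *-monoˡ (≥0 (+ 1000 / 1)) (subst (_≤ law (suc k) + ι (suc k) ^ 3 * w̃ (suc k)) (+-identityˡ (ι (suc k) ^ 3 * w̃ (suc k))) (+-monoˡ-≤ (ι (suc k) ^ 3 * w̃ (suc k)) (Nonneg-law (suc k)))) ⟩
         + 1000 / 1 * (law (suc k) + ι (suc k) ^ 3 * w̃ (suc k)) ∎
         where
         open ≤-Reasoning
         r : ∀ w k → w * ((+ 10 / 1 * k) * ((+ 10 / 1 * k) * ((+ 10 / 1 * k) * 1ℚ))) ≡ + 1000 / 1 * (k * (k * (k * 1ℚ)) * w)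
         r = solve-∀ ℚ-ring
         ten : ι (suc k ℕ.+ 9) ≤ + 10 / 1 * ι (suc k)
         ten = ≤-trans (ι-mono (ℕ.≤-trans (ℕ.m≤m+n (suc k ℕ.+ 9) (9 ℕ.* k)) (ℕ.≤-reflexive (e k)))) (≤-reflexive (trans (ι-* 10 (suc k)) (cong (_* ι (suc k)) (ι≡ 10))))
           where
           e : ∀ k → suc k ℕ.+ 9 ℕ.+ 9 ℕ.* k ≡ 10 ℕ.* suc k
           e = ℕ-Solver.solve-∀

     private
       law₁≥ : + 1 / 10 ≤ law 1
       law₁≥ = ≤-trans (≤-trans (≤ᵇ⇒≤ {+ 1 / 10} {½} _) (½≤root n)) (≤-reflexive (sym (trans (+-identityˡ (w̃ 1)) (trans (cong (_* (root n * 1ℚ)) W-1) (r (root n))))))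
         where
         r : ∀ x → 1ℚ * (x * 1ℚ) ≡ x
         r = solve-∀ ℚ-ring
       ½≤W2 : ½ ≤ W 2
       ½≤W2 = ≤-trans (≤-trans (≤-reflexive (sym (trans (E-⊛-at 2 (rep 0) 0) (trans (cong (_* 1ℚ) half) refl))))
           (≤-trans (subst₂ _≤_ (+-identityˡ ((E 2 ⊛ rep 0) 2)) (sym (rep-double 1 2)) (+-mono-≤ {0ℚ} {rep 1 2} (Nonneg-rep 1 2) (≤-reflexive (sym (+-identityʳ ((E 2 ⊛ rep 0) 2)))))) ≤-refl)) (rep-2^≤W 1 2)
         where
         half : inv! 2 ≡ ½
         half = sym (⁻¹-unique (0<ι! 2) (cong (_* ½) (ι≡ 2)))
       law₂≥ : + 1 / 10 ≤ law 2
       law₂≥ = ≤-trans (≤-trans (≤ᵇ⇒≤ {+ 1 / 10} {½ * (½ * (½ * 1ℚ))} _) (*-mono-≤ {½} {W 2} {½ * (½ * 1ℚ)} {root n * (root n * 1ℚ)} (≥0 ½) (≥0 (½ * (½ * 1ℚ))) ½≤W2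
           (^-mono-≤ 2 (≥0 ½) (½≤root n)))) (≤-reflexive (sym (+-identityˡ (w̃ 2))))

     module Coin = CoinInside law (N₀ ℕ.+ n) 9 Nonneg-law law-total law₁≥ law₂≥

     moments : Moments (poly law ℓ 9) (m₁ n + + 9 / 1) var third-bound
     moments = record { R = Moments.R M′ ; expand = subst (λ z → poly law ℓ 9 ≗ K z var ⊕ ⊖ (D³′ ⊛ Moments.R M′)) Σ₁-law (Moments.expand M′) ; R-bound = L1-mono Σ₃-law (Moments.R-bound M′) }
       where
       open Smoothing using () renaming (D³ to D³′)
       M′ = poly-Moments law 9 Nonneg-law ℓ var law-total (trans (cong (λ z → second z var) Σ₁-law) Σ₂-law)

     -- The shift by 9 moves the mean from [2, 3] to [11, 12], and the two atoms that contain the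
     -- coin from 1 and 2 to 10 and 11.
     open Interpolation (poly law ℓ 9) Coin.G 10 Coin.decompose Coin.G-small (m₁ n + + 9 / 1) var third-bound moments
       (+-monoˡ-≤ (+ 9 / 1) 2≤m₁) (+-monoˡ-≤ (+ 9 / 1) m₁≤3) 4≤var′ var≤5′ public using (local-limit) renaming (error to law-error)

     private
       q = deficiency n
       w̃ℓ = poly w̃ ℓ 0
       A = poly law ℓ 0

       n<ℓ : n ℕ.< ℓ
       n<ℓ = n<len n

       A≗ : A ≗ C q ⊕ w̃ℓ
       A≗ i = by (ℕ.<-≤-connex i ℓ)
         where
         C-outside : ∀ i → ℓ ℕ.≤ i → C q i ≡ 0ℚ
         C-outside (suc i) _ = refl
         by : i ℕ.< ℓ ⊎ ℓ ℕ.≤ i → A i ≡ C q i + w̃ℓ i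
         by (inj₁ i<ℓ) = trans (poly-inside law ℓ i i<ℓ) (cong (λ z → C q i + z) (sym (poly-inside w̃ ℓ i i<ℓ)))
         by (inj₂ ℓ≤i) = trans (poly-outside law ℓ i ℓ≤i) (sym (trans (cong₂ _+_ (C-outside i ℓ≤i) (poly-outside w̃ ℓ i ℓ≤i)) (+-identityʳ 0ℚ)))

       Nonneg-w̃ℓ : Nonneg w̃ℓ
       Nonneg-w̃ℓ i = by (ℕ.<-≤-connex i ℓ)
         where
         by : i ℕ.< ℓ ⊎ ℓ ℕ.≤ i → 0ℚ ≤ w̃ℓ i
         by (inj₁ i<ℓ) = subst (0ℚ ≤_) (sym (poly-inside w̃ ℓ i i<ℓ)) (Nonneg-w̃ i)
         by (inj₂ ℓ≤i) = ≤-reflexive (sym (poly-outside w̃ ℓ i ℓ≤i))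

     -- 𝒲₂(s, n)/n! xⁿ at the tilt x = root n
     tilted : ℕ → ℚ
     tilted s = pow W s n * root n ^ n

     Nonneg-tilted : ∀ s → 0ℚ ≤ tilted s
     Nonneg-tilted s = 0≤* (Nonneg-pow s Nonneg-W n) (^-nonneg n (0≤root n))

     private
       tilted≡ : ∀ s → tilted s ≡ pow w̃ s n
       tilted≡ s = weight-pow (root n) W s n

       tilted≤ : ∀ s → tilted s ≤ pow A s n
       tilted≤ s = ≤-trans (≤-reflexive (tilted≡ s)) (pow-upTo n s Nonneg-w̃
         (λ i i≤n → ≤-trans (subst (_≤ C q i + w̃ i) (+-identityˡ (w̃ i)) (+-monoˡ-≤ (w̃ i) (Nonneg-C (0≤deficiency n) i)))
           (≤-reflexive (sym (poly-inside law ℓ i (ℕ.≤-<-trans i≤n n<ℓ))))) n ℕ.≤-refl)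

       ≤tilted : ∀ s → pow A s n ≤ tilted s + ι s * q
       ≤tilted s = ≤-trans (≤-reflexive (pow-cong s A≗ n)) (≤-trans
         (pow-atom w̃ℓ q Nonneg-w̃ℓ (0≤deficiency n) (L1-cong A≗ (L1-mono (≤-reflexive (trans (S-cong ℓ (abs-nonneg Nonneg-law)) law-total)) (L1-poly law 0 ℓ))) s n)
         (+-monoˡ-≤ (ι s * q) (≤-trans (pow-upTo n s Nonneg-w̃ℓ (λ i i≤n → ≤-reflexive (poly-inside w̃ ℓ i (ℕ.≤-<-trans i≤n n<ℓ))) n ℕ.≤-refl)
           (≤-reflexive (sym (tilted≡ s))))))

     tilted-chebyshev : ∀ s → tilted s * ((ι n - ι s * m₁ n) * (ι n - ι s * m₁ n)) ≤ ι s * var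
     tilted-chebyshev s = ≤-trans (*-monoʳ (0≤sq (ι n - ι s * m₁ n)) (tilted≤ s))
       (subst₂ (λ u v → pow A s n * ((ι n - ι s * u) * (ι n - ι s * u)) ≤ ι s * (v - u * u)) law-m₁ law-m₂
         (Expectation.chebyshev law ℓ Nonneg-law law-total s n))

     tilted-error : ℚ
     tilted-error = law-error + big

     TiltedApproximation : ℕ → Set
     TiltedApproximation s = CoinApproximation (ι s * (m₁ n + + 9 / 1)) (ι s * var) (λ d t → ι s * ∣ tilted s - (pow X d ⊛ coin t) (s ℕ.* 9 ℕ.+ n) ∣ ≤ tilted-error)

     abstract
       tilted-approximation : ∀ s → suc s ℕ.≤ n → TiltedApproximation (suc s)
       tilted-approximation s s≤n = record
         { ε = ε ; v = v ; d = d ; t = t ; is-reduced = is-reduced ; mean = mean ; variance = variance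
         ; close = subst₂ _≤_ (r (ι (suc s)) ∣ pow A (suc s) n - g ∣ ∣ tilted (suc s) - pow A (suc s) n ∣) refl (+-mono-≤ part₁ part₂) ⟫ (*-monoˡ (0≤ι (suc s)) (∣∣-tri (tilted (suc s)) (pow A (suc s) n) g)) }
         where
         open CoinApproximation (local-limit s)
         _⟫_ : ∀ {x y z : ℚ} → y ≤ z → x ≤ y → x ≤ z
         p ⟫ q = ≤-trans q p
         g : ℚ
         g = (pow X d ⊛ coin t) (suc s ℕ.* 9 ℕ.+ n)
         r : ∀ s x y → s * x + s * y ≡ s * (y + x)
         r = solve-∀ ℚ-ring
         part₁ : ι (suc s) * ∣ pow A (suc s) n - g ∣ ≤ law-error
         part₁ = subst (λ z → ι (suc s) * ∣ z - g ∣ ≤ law-error) (shifted-power law ℓ 9 (suc s) n) (close (suc s ℕ.* 9 ℕ.+ n))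
         sq≥0 : 0ℚ ≤ ι (suc s) * q
         sq≥0 = 0≤* (0≤ι (suc s)) (0≤deficiency n)
         -- The atom at 0 costs the deficiency once per factor. With the outer factor this is at
         -- most (n + 1)² times the deficiency, which quadratic accuracy keeps bounded.
         part₂ : ι (suc s) * ∣ tilted (suc s) - pow A (suc s) n ∣ ≤ big
         part₂ = ≤-trans (*-monoˡ (0≤ι (suc s)) (∣-∣≤ {e = ι (suc s) * q}
             (≤-trans (tilted≤ (suc s)) (subst (_≤ pow A (suc s) n + ι (suc s) * q) (+-identityʳ (pow A (suc s) n)) (+-monoʳ-≤ (pow A (suc s) n) sq≥0)))
             (≤tilted (suc s))))
           (≤-trans (*-monoˡ (0≤ι (suc s)) (*-mono-≤ (0≤ι (suc s)) (0≤deficiency n) (ι-mono (ℕ.≤-trans s≤n (ℕ.n≤1+n n))) (deficiency≤ n)))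
             (≤-trans (*-monoʳ (0≤* (0≤ι (suc n)) (0≤* 0≤big (0≤rate n))) (ι-mono (ℕ.≤-trans s≤n (ℕ.n≤1+n n))))
               (≤-reflexive (trans (r′ (ι (suc n)) big (ι (suc n) ⁻¹)) (trans (cong (λ z → big * (z * z)) (*-⁻¹ (0<ι n))) (*-identityʳ big))))))
           where
           r′ : ∀ s b i → s * (s * (b * (i * i))) ≡ b * ((s * i) * (s * i))
           r′ = solve-∀ ℚ-ring

-- The maximum over s and the constant λ

module Asymptotics where

 open import Data.Nat.Base using (⌊_/2⌋; ⌈_/2⌉)
 open RationalArithmetic
 open PowerSeries
 open Coins
 open Wallis
 open Smoothing
 open LocalLimit
 open Tilt
 open Root
 open TiltedLaw

 -- With `h` the inverse of `η`, 2xe ≤ ηx² + he². An error is thus split off from a square at the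
 -- price of a factor 1 + η.
 square-of-sum : ∀ {V x e} η h → η * h ≡ 1ℚ → 0ℚ ≤ h → 0ℚ ≤ V → V ≤ x + e → V * V ≤ (1ℚ + η) * (x * x) + (1ℚ + h) * (e * e)
 square-of-sum {V} {x} {e} η h ηh 0≤h 0≤V V≤ = ≤-trans (*-mono-≤ 0≤V 0≤V V≤ V≤)
   (≤-cert (0≤* 0≤h (0≤sq (η * x - e))) (trans (r₁ η h x e) (trans (cong (λ z → z * η * (x * x) - + 2 / 1 * z * (x * e) + h * (e * e)) ηh) (r₂ η h x e))))
   where
   r₁ : ∀ η h x e → h * ((η * x - e) * (η * x - e)) ≡ (η * h) * η * (x * x) - + 2 / 1 * (η * h) * (x * e) + h * (e * e)
   r₁ = solve-∀ ℚ-ring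
   r₂ : ∀ η h x e → 1ℚ * η * (x * x) - + 2 / 1 * 1ℚ * (x * e) + h * (e * e) ≡ (1ℚ + η) * (x * x) + (1ℚ + h) * (e * e) - (x + e) * (x + e)
   r₂ = solve-∀ ℚ-ring

 a≤a+b : ∀ {a b} → 0ℚ ≤ b → a ≤ a + b
 a≤a+b {a} {b} h = subst (_≤ a + b) (+-identityʳ a) (+-monoʳ-≤ a h)

 module Limits (enclosure : Enclosure) where

   open Estimates enclosure public hiding (a; b; low; high)

   private
     0<2var : ∀ n → 0ℚ < + 2 / 1 * var n
     0<2var n = 0<* (>0 (+ 2 / 1)) (<-≤-trans (>0 (+ 4 / 1)) (4≤var′ n))

   -- The limit of g n is μ/(2σ²), so that of gauss n is μ/(2πσ²) = λ².
   g : ℕ → ℚ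
   g n = m₁ n ÷′ (+ 2 / 1 * var n)

   g-var : ∀ n → g n * (+ 2 / 1 * var n) ≡ m₁ n
   g-var n = ÷-* (0<2var n)

   0≤g : ∀ n → 0ℚ ≤ g n
   0≤g n = 0≤* (0≤m₁ n) (0≤⁻¹ (0<2var n))

   g≤½ : ∀ n → g n ≤ ½
   g≤½ n = ÷-≤ (0<2var n) (≤-cert {a = m₁ n} {b = ½ * (+ 2 / 1 * var n)} (0≤+ (0≤+ (0≤-diff (4≤var′ n)) (0≤-diff (m₁≤3 n))) 0≤1) (r (m₁ n) (var n)))
     where
     r : ∀ m v → v - + 4 / 1 + (+ 3 / 1 - m) + 1ℚ ≡ ½ * (+ 2 / 1 * v) - m
     r = solve-∀ ℚ-ring

   ⅕≤g : ∀ n → + 1 / 5 ≤ g n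
   ⅕≤g n = ≤-÷ (0<2var n) (≤-cert {a = + 1 / 5 * (+ 2 / 1 * var n)} {b = m₁ n} (0≤+ (0≤* (≥0 (+ 2 / 5)) (0≤-diff (var≤5′ n))) (0≤-diff (2≤m₁ n))) (r (m₁ n) (var n)))
     where
     r : ∀ m v → + 2 / 5 * (+ 5 / 1 - v) + (m - + 2 / 1) ≡ m - + 1 / 5 * (+ 2 / 1 * v)
     r = solve-∀ ℚ-ring

   gauss : ℕ → ℚ
   gauss n = g n * wal (suc n)

   -- `tilted-error` has the same value at every index, so 0 represents all. The added 20 is 5 · 4:
   -- the atom used for the lower bound lies at most 5 places from the mode of the coins, and
   -- neighbouring coin probabilities differ by at most 4/(t + 1).
   E₀ E₁ : ℚ
   E₀ = tilted-error 0
   E₁ = + 20 / 1 + E₀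

   0≤E₀ : 0ℚ ≤ E₀
   0≤E₀ = 0≤+ (0≤+ (0≤* (≥0 (+ 1260000 / 1)) (0≤+ (≥0 (+ 14286 / 1)) (0≤* (≥0 (+ 379 / 1))
     (0≤* (≥0 (+ 1000 / 1)) (0≤+ 0≤1 0≤big))))) (≥0 (+ 12 / 1))) 0≤big

   0≤E₁ : 0ℚ ≤ E₁
   0≤E₁ = 0≤+ (≥0 (+ 20 / 1)) 0≤E₀

   private

     divide : ∀ s {x y} → ι (suc s) * x ≤ y → x ≤ y * ι (suc s) ⁻¹
     divide s {x} {y} h = ≤-÷ (0<ι s) (subst (_≤ y) (*-comm (ι (suc s)) x) h)

     module Coins′ (n s : ℕ) (t : ℕ) (v : ℚ) (0≤v : 0ℚ ≤ v) (v<¼ : v < + 1 / 4) (variance : + 1 / 4 * ι t + v ≡ ι (suc s) * var n) where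
       i = ι (suc s) ⁻¹
       0≤i : 0ℚ ≤ i
       0≤i = 0≤⁻¹ (0<ι s)
       β = peak t
       b = ⌈ t /2⌉
       0≤β = Nonneg-peak t
       16s≤ : + 16 / 1 * ι (suc s) ≤ ι t + 1ℚ
       16s≤ = ≤-cert {a = + 16 / 1 * ι (suc s)} {b = ι t + 1ℚ} (0≤+ (0≤* (≥0 (+ 4 / 1)) (0≤* (0≤ι (suc s)) (0≤-diff (4≤var′ n)))) (0≤* (≥0 (+ 4 / 1)) (0≤-diff (<⇒≤ v<¼))))
         (trans (r₁ (ι (suc s)) (var n) v) (trans (cong (λ z → + 4 / 1 * z + 1ℚ - + 4 / 1 * v - + 16 / 1 * ι (suc s)) (sym variance)) (r₂ (ι (suc s)) (ι t) v)))
         where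
         r₁ : ∀ s w v → + 4 / 1 * (s * (w - + 4 / 1)) + + 4 / 1 * (+ 1 / 4 - v) ≡ + 4 / 1 * (s * w) + 1ℚ - + 4 / 1 * v - + 16 / 1 * s
         r₁ = solve-∀ ℚ-ring
         r₂ : ∀ s t v → + 4 / 1 * (+ 1 / 4 * t + v) + 1ℚ - + 4 / 1 * v - + 16 / 1 * s ≡ t + 1ℚ - + 16 / 1 * s
         r₂ = solve-∀ ℚ-ring
       s≤t+1 : ι (suc s) ≤ ι (suc t)
       s≤t+1 = ≤-trans (≤-cert {a = ι (suc s)} {b = + 16 / 1 * ι (suc s)} (0≤* (≥0 (+ 15 / 1)) (0≤ι (suc s))) (r (ι (suc s)))) (≤-trans 16s≤ (≤-reflexive (sym (ι-suc t))))
         where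
         r : ∀ s → + 15 / 1 * s ≡ + 16 / 1 * s - s
         r = solve-∀ ℚ-ring
       t+1⁻¹≤i : ι (suc t) ⁻¹ ≤ i
       t+1⁻¹≤i = ⁻¹-anti (0<ι s) s≤t+1
       t≤2b : ι t ≤ ι b + ι b
       t≤2b = subst (ι t ≤_) (ι-+ b b) (ι-mono (subst (ℕ._≤ b ℕ.+ b) (ℕ.⌊n/2⌋+⌈n/2⌉≡n t) (ℕ.+-monoˡ-≤ b (ℕ.⌊n/2⌋≤⌈n/2⌉ t))))
       2b≤t+1 : ι b + ι b ≤ ι t + 1ℚ
       2b≤t+1 = subst₂ _≤_ (ι-+ b b) (ι-suc t) (ι-mono (ℕ.≤-trans (ℕ.+-monoˡ-≤ b (ℕ.⌊n/2⌋≤⌈n/2⌉ (suc t))) (ℕ.≤-reflexive (e t))))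
         where
         e : ∀ t → ⌈ suc t /2⌉ ℕ.+ ⌈ t /2⌉ ≡ suc t
         e t = trans (ℕ.+-comm ⌈ suc t /2⌉ ⌈ t /2⌉) (ℕ.⌊n/2⌋+⌈n/2⌉≡n (suc t))
       s≤b : suc s ℕ.≤ b
       s≤b = ι-cancel-≤ (≤-cert {a = ι (suc s)} {b = ι b} (0≤+ (0≤+ (0≤* (≥0 ½) (0≤-diff 16s≤)) (0≤* (≥0 ½) (0≤-diff t≤2b))) (0≤+ (0≤* (≥0 (+ 7 / 1)) (0≤-diff (1≤ι s))) (≥0 (+ 13 / 2)))) (r (ι (suc s)) (ι t) (ι b)))
         where
         r : ∀ s t b → ½ * (t + 1ℚ - + 16 / 1 * s) + ½ * (b + b - t) + (+ 7 / 1 * (s - 1ℚ) + + 13 / 2) ≡ b - s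
         r = solve-∀ ℚ-ring
       β²≤i : β * β ≤ i
       β²≤i = ≤-trans (≤-÷ (0<ι t) (subst (_≤ 1ℚ) (*-comm (ι (suc t)) (β * β)) (peak²-≤ t))) (≤-trans (≤-reflexive (*-identityˡ (ι (suc t) ⁻¹))) t+1⁻¹≤i)
       variance-above : + 2 / 1 * var n * ι (suc s) ≤ ι b + + 1 / 4 + + 1 / 4
       variance-above = ≤-cert {a = + 2 / 1 * var n * ι (suc s)} {b = ι b + + 1 / 4 + + 1 / 4} (0≤+ (0≤* (≥0 ½) (0≤-diff t≤2b)) (0≤* (≥0 (+ 2 / 1)) (0≤-diff (<⇒≤ v<¼))))
         (trans (r₁ (ι t) v (ι b)) (trans (cong (λ z → ι b + + 1 / 4 + + 1 / 4 - + 2 / 1 * z) variance) (r₂ (ι (suc s)) (var n) (ι b))))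
         where
         r₁ : ∀ t v b → ½ * (b + b - t) + + 2 / 1 * (+ 1 / 4 - v) ≡ b + + 1 / 4 + + 1 / 4 - + 2 / 1 * (+ 1 / 4 * t + v)
         r₁ = solve-∀ ℚ-ring
         r₂ : ∀ s w b → b + + 1 / 4 + + 1 / 4 - + 2 / 1 * (s * w) ≡ b + + 1 / 4 + + 1 / 4 - + 2 / 1 * w * s
         r₂ = solve-∀ ℚ-ring
       variance-below : ι b + + 1 / 4 ≤ + 2 / 1 * var n * ι (suc s) + + 3 / 4
       variance-below = ≤-cert {a = ι b + + 1 / 4} {b = + 2 / 1 * var n * ι (suc s) + + 3 / 4} (0≤+ (0≤* (≥0 ½) (0≤-diff 2b≤t+1)) (0≤* (≥0 (+ 2 / 1)) 0≤v))
         (trans (r₁ (ι t) v (ι b)) (trans (cong (λ z → + 2 / 1 * z + + 3 / 4 - (ι b + + 1 / 4)) variance) (r₂ (ι (suc s)) (var n) (ι b))))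
         where
         r₁ : ∀ t v b → ½ * (t + 1ℚ - (b + b)) + + 2 / 1 * v ≡ + 2 / 1 * (+ 1 / 4 * t + v) + + 3 / 4 - (b + + 1 / 4)
         r₁ = solve-∀ ℚ-ring
         r₂ : ∀ s w b → + 2 / 1 * (s * w) + + 3 / 4 - (b + + 1 / 4) ≡ + 2 / 1 * w * s + + 3 / 4 - (b + + 1 / 4)
         r₂ = solve-∀ ℚ-ring
       -- `m₁` is `g` times twice the variance, and 2 s var is about `b`, half the number of coins.
       -- So the left side is close to `g n * wal b`, and `wal` hardly varies any more.
       peak-above : s ℕ.≤ n → ι (suc s) * m₁ n * (β * β) ≤ gauss n + i
       peak-above s≤n = begin
         ι (suc s) * m₁ n * (β * β) ≡⟨ cong (λ z → ι (suc s) * z * (β * β)) (sym (g-var n)) ⟩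
         ι (suc s) * (g n * (+ 2 / 1 * var n)) * (β * β) ≡⟨ r₁ (ι (suc s)) (g n) (+ 2 / 1 * var n) (β * β) ⟩
         g n * (+ 2 / 1 * var n * ι (suc s) * (β * β)) ≤⟨ *-monoˡ (0≤g n) (*-monoʳ (0≤sq β) variance-above) ⟩
         g n * ((ι b + + 1 / 4 + + 1 / 4) * (β * β)) ≡⟨ r₂ (g n) (ι b) (β * β) ⟩
         g n * wal b + + 1 / 4 * (g n * (β * β)) ≤⟨ +-mono-≤ (*-monoˡ (0≤g n) (wal-close s s≤b (s≤s s≤n))) (*-monoˡ (≥0 (+ 1 / 4)) (*-monoˡ (0≤g n) β²≤i)) ⟩
         g n * (wal (suc n) + i) + + 1 / 4 * (g n * i) ≡⟨ r₃ (g n) (wal (suc n)) i ⟩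
         gauss n + g n * (+ 5 / 4 * i) ≤⟨ +-monoʳ-≤ (gauss n) (≤-trans (*-monoʳ (0≤* (≥0 (+ 5 / 4)) 0≤i) (g≤½ n))
             (≤-cert {a = ½ * (+ 5 / 4 * i)} {b = i} (0≤* (≥0 (+ 3 / 8)) 0≤i) (r₄ i))) ⟩
         gauss n + i ∎
         where
         open ≤-Reasoning
         r₁ : ∀ s g w b → s * (g * w) * b ≡ g * (w * s * b)
         r₁ = solve-∀ ℚ-ring
         r₂ : ∀ g b c → g * ((b + + 1 / 4 + + 1 / 4) * c) ≡ g * ((b + + 1 / 4) * c) + + 1 / 4 * (g * c)
         r₂ = solve-∀ ℚ-ring
         r₃ : ∀ g w i → g * (w + i) + + 1 / 4 * (g * i) ≡ g * w + g * (+ 5 / 4 * i)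
         r₃ = solve-∀ ℚ-ring
         r₄ : ∀ i → + 3 / 8 * i ≡ i - ½ * (+ 5 / 4 * i)
         r₄ = solve-∀ ℚ-ring
       peak-below : s ℕ.≤ n → gauss n ≤ ι (suc s) * m₁ n * (β * β) + i
       peak-below s≤n = begin
         g n * wal (suc n) ≤⟨ *-monoˡ (0≤g n) (wal-close s (s≤s s≤n) s≤b) ⟩
         g n * (wal b + i) ≤⟨ *-monoˡ (0≤g n) (+-monoˡ-≤ i (*-monoʳ (0≤sq β) variance-below)) ⟩
         g n * ((+ 2 / 1 * var n * ι (suc s) + + 3 / 4) * (β * β) + i) ≡⟨ r₁ (ι (suc s)) (g n) (+ 2 / 1 * var n) (β * β) i ⟩
         ι (suc s) * (g n * (+ 2 / 1 * var n)) * (β * β) + g n * (+ 3 / 4 * (β * β) + i) ≤⟨ +-mono-≤ (≤-reflexive (cong (λ z → ι (suc s) * z * (β * β)) (g-var n)))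
             (≤-trans (*-mono-≤ (0≤g n) (0≤+ (0≤* (≥0 (+ 3 / 4)) (0≤sq β)) 0≤i) (g≤½ n) (+-monoˡ-≤ i (*-monoˡ (≥0 (+ 3 / 4)) β²≤i)))
               (≤-cert {a = ½ * (+ 3 / 4 * i + i)} {b = i} (0≤* (≥0 (+ 1 / 8)) 0≤i) (r₂ i))) ⟩
         ι (suc s) * m₁ n * (β * β) + i ∎
         where
         open ≤-Reasoning
         r₁ : ∀ s g w b i → g * ((w * s + + 3 / 4) * b + i) ≡ s * (g * w) * b + g * (+ 3 / 4 * b + i)
         r₁ = solve-∀ ℚ-ring
         r₂ : ∀ i → + 1 / 8 * i ≡ i - ½ * (+ 3 / 4 * i + i)
         r₂ = solve-∀ ℚ-ring

     module Scale (n s : ℕ) (n≤6s : ι (suc n) ≤ + 6 / 1 * ι (suc s)) where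
       j = ι (suc n) ⁻¹
       i = ι (suc s) ⁻¹
       0≤j : 0ℚ ≤ j
       0≤j = 0≤⁻¹ (0<ι n)
       0≤i : 0ℚ ≤ i
       0≤i = 0≤⁻¹ (0<ι s)
       i≤6j : i ≤ + 6 / 1 * j
       i≤6j = ≤-÷ (0<ι n) (≤-trans (*-monoˡ 0≤i n≤6s) (≤-reflexive (trans (r i (ι (suc s))) (cong (+ 6 / 1 *_) (*-⁻¹ (0<ι s))))))
         where
         r : ∀ i s → i * (+ 6 / 1 * s) ≡ + 6 / 1 * (s * i)
         r = solve-∀ ℚ-ring
       error² : ∀ E → 0ℚ ≤ E → ι (suc n) * ((E * i) * (E * i)) ≤ + 36 / 1 * (E * E) * j
       error² E 0≤E = ≤-trans (*-monoˡ (0≤ι (suc n)) (*-mono-≤ (0≤* 0≤E 0≤i) (0≤* 0≤E 0≤i) (*-monoˡ 0≤E i≤6j) (*-monoˡ 0≤E i≤6j)))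
         (≤-reflexive (trans (r (ι (suc n)) E j) (trans (cong (λ z → + 36 / 1 * (E * E) * j * z) (*-⁻¹ (0<ι n))) (*-identityʳ (+ 36 / 1 * (E * E) * j)))))
         where
         r : ∀ n E j → n * ((E * (+ 6 / 1 * j)) * (E * (+ 6 / 1 * j))) ≡ + 36 / 1 * (E * E) * j * (n * j)
         r = solve-∀ ℚ-ring

   -- `η` is the relative loss allowed, `h` its inverse. The constants below may depend on them but
   -- not on `n`.
   module Margin (η h : ℚ) (0<η : 0ℚ < η) (η≤½ : η ≤ ½) (ηh : η * h ≡ 1ℚ) (0≤h : 0ℚ ≤ h) where

     private
       0≤η = <⇒≤ 0<η
       0≤1-η : 0ℚ ≤ 1ℚ - η
       0≤1-η = 0≤-diff (≤-trans η≤½ (≤ᵇ⇒≤ {½} {1ℚ} _))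
       0≤1+η : 0ℚ ≤ 1ℚ + η
       0≤1+η = 0≤+ 0≤1 0≤η
       0≤1+h : 0ℚ ≤ 1ℚ + h
       0≤1+h = 0≤+ 0≤1 0≤h

       ½≤1-η : ½ ≤ 1ℚ - η
       ½≤1-η = ≤-cert {a = ½} {b = 1ℚ - η} (0≤-diff η≤½) (r η)
         where
         r : ∀ η → ½ - η ≡ 1ℚ - η - ½
         r = solve-∀ ℚ-ring

     near-constant : ℚ
     near-constant = + 12 / 1 + + 36 / 1 * ((1ℚ + h) * (E₀ * E₀))

     private
       near-algebra : ∀ {V² n B e² sm G i j X} → 0ℚ ≤ n → 0ℚ ≤ B → 0ℚ ≤ e² → 0ℚ ≤ j → 0ℚ ≤ X → 0ℚ ≤ i →
         V² ≤ (1ℚ + η) * B + (1ℚ + h) * e² → (1ℚ - η) * n ≤ sm → sm * B ≤ G + i → i ≤ + 6 / 1 * j → n * e² ≤ + 36 / 1 * X * j →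
         (1ℚ - η) * (V² * n) ≤ (1ℚ + η) * G + (+ 12 / 1 + + 36 / 1 * ((1ℚ + h) * X)) * j
       near-algebra {V²} {n} {B} {e²} {sm} {G} {i} {j} {X} 0≤n 0≤B 0≤e² 0≤j 0≤X 0≤i V²≤ n≤sm smB≤ i≤ ne²≤ = begin
         (1ℚ - η) * (V² * n)
           ≤⟨ *-monoˡ 0≤1-η (*-monoʳ 0≤n V²≤) ⟩
         (1ℚ - η) * (((1ℚ + η) * B + (1ℚ + h) * e²) * n)
           ≡⟨ r₁ η h n B e² ⟩
         (1ℚ + η) * ((1ℚ - η) * n * B) + (1ℚ - η) * ((1ℚ + h) * (n * e²))
           ≤⟨ +-mono-≤ (*-monoˡ 0≤1+η (≤-trans (*-monoʳ 0≤B n≤sm) (≤-trans smB≤ (+-monoʳ-≤ G i≤))))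
                (≤-trans (*-monoʳ (0≤* 0≤1+h (0≤* 0≤n 0≤e²)) 1-η≤1) (*-monoˡ 0≤1 (*-monoˡ 0≤1+h ne²≤))) ⟩
         (1ℚ + η) * (G + + 6 / 1 * j) + 1ℚ * ((1ℚ + h) * (+ 36 / 1 * X * j))
           ≤⟨ ≤-cert {b = (1ℚ + η) * G + (+ 12 / 1 + + 36 / 1 * ((1ℚ + h) * X)) * j} (0≤* (0≤* (≥0 (+ 6 / 1)) 0≤1-η) 0≤j) (r₂ η h G j X) ⟩
         (1ℚ + η) * G + (+ 12 / 1 + + 36 / 1 * ((1ℚ + h) * X)) * j ∎
         where
         open ≤-Reasoning
         1-η≤1 : 1ℚ - η ≤ 1ℚ
         1-η≤1 = ≤-cert {a = 1ℚ - η} {b = 1ℚ} 0≤η (r η)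
           where
           r : ∀ η → η ≡ 1ℚ - (1ℚ - η)
           r = solve-∀ ℚ-ring
         r₁ : ∀ η h n B e → (1ℚ - η) * (((1ℚ + η) * B + (1ℚ + h) * e) * n) ≡ (1ℚ + η) * ((1ℚ - η) * n * B) + (1ℚ - η) * ((1ℚ + h) * (n * e))
         r₁ = solve-∀ ℚ-ring
         r₂ : ∀ η h G j X → + 6 / 1 * (1ℚ - η) * j ≡ (1ℚ + η) * G + (+ 12 / 1 + + 36 / 1 * ((1ℚ + h) * X)) * j - ((1ℚ + η) * (G + + 6 / 1 * j) + 1ℚ * ((1ℚ + h) * (+ 36 / 1 * X * j)))
         r₂ = solve-∀ ℚ-ring

     module _ (n′ : ℕ) where

       private
         n = suc n′
         j = ι n ⁻¹
         0≤j : 0ℚ ≤ j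
         0≤j = 0≤⁻¹ (0<ι n′)

       -- Large `s` is included: `s m₁` times the squared peak is about `gauss n` for every `s`, so
       -- when `s m₁` is at least (1 - η)n, the product of `n` and the squared peak exceeds
       -- `gauss n` at most by a factor 1/(1 - η), up to the error.
       upper-near : ∀ s → s ℕ.≤ n′ → (1ℚ - η) * ι n ≤ ι (suc s) * m₁ n →
         (1ℚ - η) * (tilted n (suc s) * tilted n (suc s) * ι n) ≤ (1ℚ + η) * gauss n + near-constant * j
       upper-near s s≤n′ near = near-algebra {B = peak t * peak t} {i = i} {j = j} (0≤ι n) (0≤sq (peak t)) (0≤sq (E₀ * i)) 0≤j (0≤sq E₀) 0≤i
         (square-of-sum {x = peak t} {e = E₀ * i} η h ηh 0≤h (Nonneg-tilted n (suc s)) V≤) near (peak-above (ℕ.m≤n⇒m≤1+n s≤n′)) i≤6j (error² E₀ 0≤E₀)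
         where
         approx : TiltedApproximation n (suc s)
         approx = tilted-approximation n s (s≤s s≤n′)
         open CoinApproximation approx
         n≤6s : ι n ≤ + 6 / 1 * ι (suc s)
         n≤6s = ≤-cert {a = ι n} {b = + 6 / 1 * ι (suc s)} (0≤+ (0≤+ (0≤* (≥0 (+ 2 / 1)) (0≤-diff near)) (0≤* (≥0 (+ 2 / 1)) (0≤* (0≤ι n) (0≤-diff ½≤1-η)))) (0≤* (≥0 (+ 2 / 1)) (0≤* (0≤ι (suc s)) (0≤-diff (m₁≤3 n)))))
           (r η (ι n) (ι (suc s)) (m₁ n))
           where
           r : ∀ η n s m → + 2 / 1 * (s * m - (1ℚ - η) * n) + + 2 / 1 * (n * (1ℚ - η - ½)) + + 2 / 1 * (s * (+ 3 / 1 - m)) ≡ + 6 / 1 * s - n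
           r = solve-∀ ℚ-ring
         open Coins′ n s t v (Reduced.0≤v is-reduced) (Reduced.v<¼ is-reduced) variance using (peak-above)
         open Scale n′ s n≤6s using (i; 0≤i; i≤6j; error²)
         atom = (pow X d ⊛ coin t) (suc s ℕ.* 9 ℕ.+ n)
         V≤ : tilted n (suc s) ≤ peak t + E₀ * i
         V≤ = ≤-trans (∣-∣⇒≤ {a = tilted n (suc s)} {b = atom} {e = E₀ * i} (divide s close)) (+-monoˡ-≤ (E₀ * i) (≤-trans (≤∣∣ atom)
           (≤-trans (Sup-⊛ (L1-pow1 d L1-X) (Sup-coin t) (suc s ℕ.* 9 ℕ.+ n)) (≤-reflexive (*-identityˡ (peak t))))))

       -- The place `n` is then at least ηn away from the mean, and Chebyshev's inequality gives V
       -- η²n² ≤ 5n. Hence nV ≤ 5h², and nV² is O(1/n).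
       upper-far : ∀ s → suc s ℕ.≤ n → ι (suc s) * m₁ n ≤ (1ℚ - η) * ι n → tilted n (suc s) * tilted n (suc s) * ι n ≤ + 25 / 1 * (h * h * (h * h)) * j
       upper-far s s≤n far = ≤-÷ (0<ι n′) (≤-trans (≤-reflexive (r₁ V (ι n))) (≤-trans (*-mono-≤ 0≤Vn 0≤Vn Vn≤ Vn≤) (≤-reflexive (r₂ h))))
         where
         V = tilted n (suc s)
         0≤V = Nonneg-tilted n (suc s)
         0≤Vn : 0ℚ ≤ V * ι n
         0≤Vn = 0≤* 0≤V (0≤ι n)
         gap : η * ι n ≤ ι n - ι (suc s) * m₁ n
         gap = ≤-cert {a = η * ι n} {b = ι n - ι (suc s) * m₁ n} (0≤-diff far) (r η (ι n) (ι (suc s) * m₁ n))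
           where
           r : ∀ η n s → (1ℚ - η) * n - s ≡ n - s - η * n
           r = solve-∀ ℚ-ring
         0≤ηn : 0ℚ ≤ η * ι n
         0≤ηn = 0≤* 0≤η (0≤ι n)
         bounded : ι n * (V * ι n) ≤ ι n * (+ 5 / 1 * (h * h))
         bounded = begin
           ι n * (V * ι n) ≡⟨ trans (sym (r₃ (ι n) V)) (cong (λ z → z * z * (V * (ι n * ι n))) (sym ηh)) ⟩
           η * h * (η * h) * (V * (ι n * ι n)) ≡⟨ r₄ η h V (ι n) ⟩
           h * h * (V * ((η * ι n) * (η * ι n))) ≤⟨ *-monoˡ (0≤* 0≤h 0≤h) (*-monoˡ 0≤V (*-mono-≤ 0≤ηn 0≤ηn gap gap)) ⟩
           h * h * (V * ((ι n - ι (suc s) * m₁ n) * (ι n - ι (suc s) * m₁ n))) ≤⟨ *-monoˡ (0≤* 0≤h 0≤h) (tilted-chebyshev n (suc s)) ⟩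
           h * h * (ι (suc s) * var n) ≤⟨ *-monoˡ (0≤* 0≤h 0≤h) (*-mono-≤ (0≤ι (suc s)) (≤-trans (≥0 (+ 4 / 1)) (4≤var′ n)) (ι-mono s≤n) (var≤5′ n)) ⟩
           h * h * (ι n * (+ 5 / 1)) ≡⟨ r₅ h (ι n) ⟩
           ι n * (+ 5 / 1 * (h * h)) ∎
           where
           open ≤-Reasoning
           r₃ : ∀ n V → 1ℚ * 1ℚ * (V * (n * n)) ≡ n * (V * n)
           r₃ = solve-∀ ℚ-ring
           r₄ : ∀ η h V n → η * h * (η * h) * (V * (n * n)) ≡ h * h * (V * ((η * n) * (η * n)))
           r₄ = solve-∀ ℚ-ring
           r₅ : ∀ h n → h * h * (n * (+ 5 / 1)) ≡ n * (+ 5 / 1 * (h * h))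
           r₅ = solve-∀ ℚ-ring
         Vn≤ : V * ι n ≤ + 5 / 1 * (h * h)
         Vn≤ = *-cancelˡ-≤ (0<ι n′) bounded
         r₁ : ∀ V n → V * V * n * n ≡ (V * n) * (V * n)
         r₁ = solve-∀ ℚ-ring
         r₂ : ∀ h → (+ 5 / 1 * (h * h)) * (+ 5 / 1 * (h * h)) ≡ + 25 / 1 * (h * h * (h * h))
         r₂ = solve-∀ ℚ-ring

     upper-constant : ℚ
     upper-constant = near-constant + + 25 / 1 * (h * h * (h * h))

     private
       0≤near : 0ℚ ≤ near-constant
       0≤near = 0≤+ (≥0 (+ 12 / 1)) (0≤* (≥0 (+ 36 / 1)) (0≤* 0≤1+h (0≤sq E₀)))
       0≤far : 0ℚ ≤ + 25 / 1 * (h * h * (h * h))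
       0≤far = 0≤* (≥0 (+ 25 / 1)) (0≤sq (h * h))

     0≤upper-constant : 0ℚ ≤ upper-constant
     0≤upper-constant = 0≤+ 0≤near 0≤far

     0≤gauss : ∀ n → 0ℚ ≤ gauss n
     0≤gauss n = 0≤* (0≤g n) (≤-trans (≥0 (+ 1 / 4)) (¼≤wal (suc n)))

     upper : ∀ n′ s → s ℕ.≤ n′ → let n = suc n′ in
       (1ℚ - η) * (tilted n (suc s) * tilted n (suc s) * ι n) ≤ (1ℚ + η) * gauss n + upper-constant * ι n ⁻¹
     upper n′ s s≤n′ = by (≤-total (ι (suc s) * m₁ n) ((1ℚ - η) * ι n))
       where
       n = suc n′
       j = ι n ⁻¹
       0≤j : 0ℚ ≤ j
       0≤j = 0≤⁻¹ (0<ι n′)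
       V²n = tilted n (suc s) * tilted n (suc s) * ι n
       0≤V²n : 0ℚ ≤ V²n
       0≤V²n = 0≤* (0≤sq (tilted n (suc s))) (0≤ι n)
       by : ι (suc s) * m₁ n ≤ (1ℚ - η) * ι n ⊎ (1ℚ - η) * ι n ≤ ι (suc s) * m₁ n → (1ℚ - η) * V²n ≤ (1ℚ + η) * gauss n + upper-constant * j
       by (inj₂ near) = ≤-trans (upper-near n′ s s≤n′ near) (+-monoʳ-≤ ((1ℚ + η) * gauss n) (*-monoʳ 0≤j (a≤a+b {near-constant} 0≤far)))
       by (inj₁ far)  = ≤-cert {a = (1ℚ - η) * V²n} {b = (1ℚ + η) * gauss n + upper-constant * j}
         (0≤+ (0≤+ (0≤+ (0≤* 0≤η 0≤V²n) (0≤-diff (upper-far n′ s (s≤s s≤n′) far))) (0≤* 0≤1+η (0≤gauss n))) (0≤* 0≤near 0≤j))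
         (r η V²n (+ 25 / 1 * (h * h * (h * h))) near-constant j (gauss n))
         where
         r : ∀ η V f c j G → η * V + (f * j - V) + (1ℚ + η) * G + c * j ≡ (1ℚ + η) * G + (c + f) * j - (1ℚ - η) * V
         r = solve-∀ ℚ-ring

     lower-constant : ℚ
     lower-constant = + 6 / 1 + + 36 / 1 * ((1ℚ + h) * (E₁ * E₁))

     0≤lower-constant : 0ℚ ≤ lower-constant
     0≤lower-constant = 0≤+ (≥0 (+ 6 / 1)) (0≤* (≥0 (+ 36 / 1)) (0≤* 0≤1+h (0≤sq E₁)))

     private
       lower-algebra : ∀ {V² n B e² sm G i j X} → 0ℚ ≤ n → 0ℚ ≤ B → G ≤ sm * B + i → sm ≤ n → B ≤ (1ℚ + η) * V² + (1ℚ + h) * e² →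
         i ≤ + 6 / 1 * j → n * e² ≤ + 36 / 1 * X * j → G ≤ (1ℚ + η) * (V² * n) + (+ 6 / 1 + + 36 / 1 * ((1ℚ + h) * X)) * j
       lower-algebra {V²} {n} {B} {e²} {sm} {G} {i} {j} {X} 0≤n 0≤B G≤ sm≤n B≤ i≤ ne²≤ = begin
         G ≤⟨ G≤ ⟩
         sm * B + i ≤⟨ +-mono-≤ (≤-trans (*-monoʳ 0≤B sm≤n) (*-monoˡ 0≤n B≤)) i≤ ⟩
         n * ((1ℚ + η) * V² + (1ℚ + h) * e²) + + 6 / 1 * j ≡⟨ r₁ η h n V² e² j ⟩
         (1ℚ + η) * (V² * n) + (1ℚ + h) * (n * e²) + + 6 / 1 * j ≤⟨ +-monoˡ-≤ (+ 6 / 1 * j) (+-monoʳ-≤ ((1ℚ + η) * (V² * n)) (*-monoˡ 0≤1+h ne²≤)) ⟩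
         (1ℚ + η) * (V² * n) + (1ℚ + h) * (+ 36 / 1 * X * j) + + 6 / 1 * j ≡⟨ r₂ η h n V² X j ⟩
         (1ℚ + η) * (V² * n) + (+ 6 / 1 + + 36 / 1 * ((1ℚ + h) * X)) * j ∎
         where
         open ≤-Reasoning
         r₁ : ∀ η h n V e j → n * ((1ℚ + η) * V + (1ℚ + h) * e) + + 6 / 1 * j ≡ (1ℚ + η) * (V * n) + (1ℚ + h) * (n * e) + + 6 / 1 * j
         r₁ = solve-∀ ℚ-ring
         r₂ : ∀ η h n V X j → (1ℚ + η) * (V * n) + (1ℚ + h) * (+ 36 / 1 * X * j) + + 6 / 1 * j ≡ (1ℚ + η) * (V * n) + (+ 6 / 1 + + 36 / 1 * ((1ℚ + h) * X)) * j
         r₂ = solve-∀ ℚ-ring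

       coin-near-mode : ∀ t o → peak t ≤ coin t (⌊ t /2⌋ ℕ.+ o) + ι o * (+ 4 / 1 * ι (suc t) ⁻¹)
       coin-near-mode t zero    = ≤-reflexive (trans (peak≡mode t) (trans (cong (coin t) (sym (ℕ.+-identityʳ ⌊ t /2⌋)))
         (sym (trans (cong (λ z → coin t (⌊ t /2⌋ ℕ.+ 0) + z * (+ 4 / 1 * ι (suc t) ⁻¹)) ι-0) (r (coin t (⌊ t /2⌋ ℕ.+ 0)) (+ 4 / 1 * ι (suc t) ⁻¹))))))
         where
         r : ∀ c x → c + 0ℚ * x ≡ c
         r = solve-∀ ℚ-ring
       coin-near-mode t (suc o) = ≤-trans (coin-near-mode t o) (≤-trans (+-monoˡ-≤ (ι o * δ) (∣-∣⇒≥ {a = coin t (suc k)} {b = coin t k}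
           (subst (λ z → ∣ z ∣ ≤ δ) (D-⊛-suc (coin t) k) (ι*Sup-D-coin t (suc k)))))
         (≤-reflexive (trans (r (coin t (suc k)) δ (ι o)) (cong₂ (λ u z → coin t u + z * δ) (sym (ℕ.+-suc ⌊ t /2⌋ o)) (sym (ι-suc o))))))
         where
         k = ⌊ t /2⌋ ℕ.+ o
         δ = + 4 / 1 * ι (suc t) ⁻¹
         r : ∀ c d o → c + d + o * d ≡ c + (o + 1ℚ) * d
         r = solve-∀ ℚ-ring

     -- The number of summands is the floor of n/m₁. The mean then falls short of `n` by at most m₁
     -- ≤ 3, so the place `n` is close to the mode.
     lower : ∀ n′ → 2 ℕ.≤ n′ → let n = suc n′ in ∃[ s ] (s ℕ.≤ n′ × gauss n ≤ (1ℚ + η) * (tilted n (suc s) * tilted n (suc s) * ι n) + lower-constant * ι n ⁻¹)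
     lower n′ 2≤n′ = result (nat-floor (ι n ÷′ m₁ n) (0≤* (0≤ι n) (0≤⁻¹ 0<m₁)))
       where
       n = suc n′
       j = ι n ⁻¹
       0<m₁ : 0ℚ < m₁ n
       0<m₁ = <-≤-trans (>0 (+ 2 / 1)) (2≤m₁ n)
       3≤n : + 3 / 1 ≤ ι n
       3≤n = subst (_≤ ι n) (ι≡ 3) (ι-mono (s≤s 2≤n′))
       result : (∃[ f ] (ι f ≤ ι n ÷′ m₁ n × ι n ÷′ m₁ n < ι f + 1ℚ)) → ∃[ s ] (s ℕ.≤ n′ × gauss n ≤ (1ℚ + η) * (tilted n (suc s) * tilted n (suc s) * ι n) + lower-constant * j)
       result (zero , _ , <1) = contradiction (≤-trans (m₁≤3 n) 3≤n)
         (<⇒≱ (subst₂ _<_ (÷-* 0<m₁) (trans (cong (λ z → (z + 1ℚ) * m₁ n) ι-0) (*-identityˡ (m₁ n))) (ℚ.*-monoˡ-<-pos (m₁ n) ⦃ positive 0<m₁ ⦄ <1)))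
       result (suc s , s≤ , <s+1) = s , s≤n′ , lower-algebra {V² = V * V} {B = peak t * peak t} {i = i} {j = j} (0≤ι n) (0≤sq (peak t))
           (peak-below (ℕ.m≤n⇒m≤1+n s≤n′)) sm≤n (square-of-sum {x = V} {e = E₁ * i} η h ηh 0≤h (Nonneg-peak t) β≤) i≤6j (error² E₁ 0≤E₁)
         where
         V = tilted n (suc s)
         sm≤n : ι (suc s) * m₁ n ≤ ι n
         sm≤n = subst (ι (suc s) * m₁ n ≤_) (÷-* 0<m₁) (*-monoʳ (0≤m₁ n) s≤)
         n≤sm+m : ι n ≤ ι (suc s) * m₁ n + m₁ n
         n≤sm+m = ≤-trans (≤-reflexive (sym (÷-* 0<m₁))) (≤-trans (*-monoʳ (0≤m₁ n) (<⇒≤ <s+1)) (≤-reflexive (r (ι (suc s)) (m₁ n))))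
           where
           r : ∀ s m → (s + 1ℚ) * m ≡ s * m + m
           r = solve-∀ ℚ-ring
         s≤n′ : s ℕ.≤ n′
         s≤n′ = ℕ.≤-pred (ι-cancel-≤ (≤-trans (≤-cert {a = ι (suc s)} {b = ι (suc s) * m₁ n} (0≤* (0≤ι (suc s)) (0≤+ (0≤-diff (2≤m₁ n)) 0≤1)) (r (ι (suc s)) (m₁ n))) sm≤n))
           where
           r : ∀ s m → s * (m - + 2 / 1 + 1ℚ) ≡ s * m - s
           r = solve-∀ ℚ-ring
         n≤6s : ι n ≤ + 6 / 1 * ι (suc s)
         n≤6s = ≤-cert {a = ι n} {b = + 6 / 1 * ι (suc s)} (0≤+ (0≤+ (0≤+ (0≤-diff n≤sm+m) (0≤* (0≤ι (suc s)) (0≤-diff (m₁≤3 n)))) (0≤-diff (m₁≤3 n))) (0≤* (≥0 (+ 3 / 1)) (0≤-diff (1≤ι s))))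
           (r (ι n) (ι (suc s)) (m₁ n))
           where
           r : ∀ n s m → (s * m + m - n) + s * (+ 3 / 1 - m) + (+ 3 / 1 - m) + + 3 / 1 * (s - 1ℚ) ≡ + 6 / 1 * s - n
           r = solve-∀ ℚ-ring
         approx : TiltedApproximation n (suc s)
         approx = tilted-approximation n s (s≤s s≤n′)
         open CoinApproximation approx
         open Coins′ n s t v (Reduced.0≤v is-reduced) (Reduced.v<¼ is-reduced) variance using (peak-below; t+1⁻¹≤i)
         open Scale n′ s n≤6s using (i; 0≤i; i≤6j; error²)
         place = suc s ℕ.* 9 ℕ.+ n
         -- The place of the atom is within 4 of the mode of the coins.
         offset : ι place - ι d ≡ ½ * ι t + ε + (ι n - ι (suc s) * m₁ n)
         offset = trans (cong (_- ι d) (trans (ι-+ (suc s ℕ.* 9) n) (cong (_+ ι n) (trans (ι-* (suc s) 9) (cong (ι (suc s) *_) (ι≡ 9))))))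
           (trans (r₁ (ι (suc s)) (ι n) (ι d) (m₁ n)) (trans (cong (λ z → z - ι d + (ι n - ι (suc s) * m₁ n)) (sym mean)) (r₂ (ι d) (½ * ι t) ε (ι n - ι (suc s) * m₁ n))))
           where
           r₁ : ∀ s n d m → s * (+ 9 / 1) + n - d ≡ s * (m + + 9 / 1) - d + (n - s * m)
           r₁ = solve-∀ ℚ-ring
           r₂ : ∀ d h e x → d + h + e - d + x ≡ h + e + x
           r₂ = solve-∀ ℚ-ring
         h₂ = ⌊ t /2⌋
         2h≤t : ι h₂ + ι h₂ ≤ ι t
         2h≤t = subst (_≤ ι t) (ι-+ h₂ h₂) (ι-mono (subst (h₂ ℕ.+ h₂ ℕ.≤_) (ℕ.⌊n/2⌋+⌈n/2⌉≡n t) (ℕ.+-monoʳ-≤ h₂ (ℕ.⌊n/2⌋≤⌈n/2⌉ t))))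
         t≤2h+1 : ι t ≤ ι h₂ + ι h₂ + 1ℚ
         t≤2h+1 = subst (ι t ≤_) (trans (ι-suc (h₂ ℕ.+ h₂)) (cong (_+ 1ℚ) (ι-+ h₂ h₂)))
           (ι-mono (ℕ.≤-trans (ℕ.≤-reflexive (sym (ℕ.⌊n/2⌋+⌈n/2⌉≡n t))) (ℕ.≤-trans (ℕ.+-monoʳ-≤ h₂ (⌈/2⌉≤ t)) (ℕ.≤-reflexive (ℕ.+-suc h₂ h₂)))))
           where
           ⌈/2⌉≤ : ∀ t → ⌈ t /2⌉ ℕ.≤ suc ⌊ t /2⌋
           ⌈/2⌉≤ zero          = z≤n
           ⌈/2⌉≤ (suc zero)    = s≤s z≤n
           ⌈/2⌉≤ (suc (suc t)) = s≤s (⌈/2⌉≤ t)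
         dh≤ : d ℕ.+ h₂ ℕ.≤ place
         dh≤ = ι-cancel-≤ (≤-cert {a = ι (d ℕ.+ h₂)} {b = ι place} (0≤+ (0≤+ (0≤* (≥0 ½) (0≤-diff 2h≤t)) (Reduced.0≤ε is-reduced)) (0≤-diff sm≤n))
           (trans (r₁ (ι h₂) (ι t) ε (ι n - ι (suc s) * m₁ n)) (trans (cong (_- ι h₂) (sym offset)) (trans (r₂ (ι place) (ι d) (ι h₂)) (cong (λ z → ι place - z) (sym (ι-+ d h₂)))))))
           where
           r₁ : ∀ h t e x → ½ * (t - (h + h)) + e + x ≡ ½ * t + e + x - h
           r₁ = solve-∀ ℚ-ring
           r₂ : ∀ p d h → p - d - h ≡ p - (d + h)
           r₂ = solve-∀ ℚ-ring
         placed : ∃[ o ] d ℕ.+ h₂ ℕ.+ o ≡ place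
         placed = ℕ.m≤n⇒∃[o]m+o≡n dh≤
         o = proj₁ placed
         o≤5 : ι o ≤ + 5 / 1
         o≤5 = ≤-cert {a = ι o} {b = + 5 / 1}
           (0≤+ (0≤+ (0≤+ (0≤+ (0≤-diff (<⇒≤ (Reduced.ε<1 is-reduced))) (0≤* (≥0 ½) (0≤-diff t≤2h+1))) (0≤-diff n≤sm+m)) (0≤-diff (m₁≤3 n))) (≥0 ½))
           (trans (r₁ (ι h₂) (ι t) ε (ι n) (ι (suc s) * m₁ n) (m₁ n)) (trans (cong (λ z → + 5 / 1 - (z - ι h₂)) (sym offset)) (cong (λ z → + 5 / 1 - z)
             (trans (cong (λ z → ι z - ι d - ι h₂) (sym (proj₂ placed))) (trans (cong (λ z → z - ι d - ι h₂) (trans (ι-+ (d ℕ.+ h₂) o) (cong (_+ ι o) (ι-+ d h₂)))) (r₂ (ι d) (ι h₂) (ι o)))))))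
           where
           r₁ : ∀ h t e n x m → (1ℚ - e) + ½ * (h + h + 1ℚ - t) + (x + m - n) + (+ 3 / 1 - m) + ½ ≡ + 5 / 1 - (½ * t + e + (n - x) - h)
           r₁ = solve-∀ ℚ-ring
           r₂ : ∀ d h o → d + h + o - d - h ≡ o
           r₂ = solve-∀ ℚ-ring
         atom = (pow X d ⊛ coin t) place
         atom≡ : atom ≡ coin t (h₂ ℕ.+ o)
         atom≡ = trans (cong (pow X d ⊛ coin t) (trans (sym (proj₂ placed)) (ℕ.+-assoc d h₂ o))) (powX-⊛ d (coin t) (h₂ ℕ.+ o))
         β≤ : peak t ≤ V + E₁ * i
         β≤ = begin
           peak t ≤⟨ coin-near-mode t o ⟩
           coin t (h₂ ℕ.+ o) + ι o * (+ 4 / 1 * ι (suc t) ⁻¹) ≤⟨ +-mono-≤ (≤-trans (≤-reflexive (sym atom≡)) (∣-∣⇒≥ {a = V} {b = atom} {e = E₀ * i} (divide s close)))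
               (*-mono-≤ (0≤ι o) (0≤* (≥0 (+ 4 / 1)) (0≤⁻¹ (0<ι t))) o≤5 (*-monoˡ (≥0 (+ 4 / 1)) t+1⁻¹≤i)) ⟩
           V + E₀ * i + + 5 / 1 * (+ 4 / 1 * i) ≡⟨ r V E₀ i ⟩
           V + E₁ * i ∎
           where
           open ≤-Reasoning
           r : ∀ V E i → V + E * i + + 5 / 1 * (+ 4 / 1 * i) ≡ V + (+ 20 / 1 + E) * i
           r = solve-∀ ℚ-ring

   private
     scaled : ℕ → ℚ
     scaled k = ι (suc k) * ι (suc k) ÷′ g k

     0<g : ∀ k → 0ℚ < g k
     0<g k = <-≤-trans (>0 (+ 1 / 5)) (⅕≤g k)

   abstract
     half-coins : ∀ k → ∃[ a ] (ι a ≤ scaled k × scaled k < ι a + 1ℚ)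
     half-coins k = nat-floor (scaled k) (0≤* (0≤sq (ι (suc k))) (0≤⁻¹ (0<g k)))

   -- For large `a` the squared central probability is about 1/(πa). With `a` close to K²/g, where K
   -- = k + 1, K² times it is about g/π; the central probability itself thus supplies a rational
   -- square root.
   lam : ℕ → ℚ
   lam k = ι (suc k) * central (proj₁ (half-coins k))

   0≤lam : ∀ k → 0ℚ ≤ lam k
   0≤lam k = 0≤* (0≤ι (suc k)) (Nonneg-central (proj₁ (half-coins k)))

   lam²-close : ∀ k → ∣ lam k * lam k - gauss k ∣ ≤ ι (suc k) ⁻¹
   lam²-close k = ∣-∣≤ above below
     where
     a = proj₁ (half-coins k)
     i = ι (suc k) ⁻¹
     K² = ι (suc k) * ι (suc k)
     c = central a * central a
     0≤i : 0ℚ ≤ i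
     0≤i = 0≤⁻¹ (0<ι k)
     0≤c : 0ℚ ≤ c
     0≤c = 0≤sq (central a)
     lam²≡ : lam k * lam k ≡ K² * c
     lam²≡ = r (ι (suc k)) (central a)
       where
       r : ∀ k c → (k * c) * (k * c) ≡ k * k * (c * c)
       r = solve-∀ ℚ-ring
     ga≤ : ι a * g k ≤ K²
     ga≤ = subst (ι a * g k ≤_) (÷-* (0<g k)) (*-monoʳ (0≤g k) (proj₁ (proj₂ (half-coins k))))
     K²≤ : K² ≤ (ι a + 1ℚ) * g k
     K²≤ = subst (_≤ (ι a + 1ℚ) * g k) (÷-* (0<g k)) (*-monoʳ (0≤g k) (<⇒≤ (proj₂ (proj₂ (half-coins k)))))
     K<a+1 : suc k ℕ.≤ a
     K<a+1 = ι-cancel-≤ (≤-cert {a = ι (suc k)} {b = ι a} (0≤+ (0≤+ (0≤* (≥0 (+ 2 / 1)) (0≤-diff K²≤)) (0≤* (0≤* (≥0 (+ 2 / 1)) (0≤+ (0≤ι a) 0≤1)) (0≤-diff (g≤½ k)))) (0≤+ (0≤* (≥0 (+ 2 / 1)) (0≤sq (ι (suc k) - 1ℚ))) (0≤* (≥0 (+ 3 / 1)) (0≤-diff (1≤ι k)))))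
         (r (ι (suc k)) (ι a) (g k)))
       where
       r : ∀ K a g → + 2 / 1 * ((a + 1ℚ) * g - K * K) + + 2 / 1 * (a + 1ℚ) * (½ - g) + (+ 2 / 1 * ((K - 1ℚ) * (K - 1ℚ)) + + 3 / 1 * (K - 1ℚ)) ≡ a - K
       r = solve-∀ ℚ-ring
     c≤i : c ≤ i
     c≤i = ≤-÷ (0<ι k) (≤-trans (*-monoˡ 0≤c (≤-trans (ι-mono K<a+1) (≤-cert {a = ι a} {b = ι a + ι a + 1ℚ} (0≤+ (0≤ι a) 0≤1) (r (ι a)))))
       (≤-trans (≤-reflexive (*-comm c (ι a + ι a + 1ℚ))) (central²-≤ a))) ⟫′ ≤-reflexive (*-identityˡ i)
       where
       _⟫′_ : ∀ {x y z : ℚ} → x ≤ y → y ≤ z → x ≤ z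
       _⟫′_ = ≤-trans
       r : ∀ a → a + 1ℚ ≡ a + a + 1ℚ - a
       r = solve-∀ ℚ-ring
     above : lam k * lam k ≤ gauss k + i
     above = begin
       lam k * lam k ≡⟨ lam²≡ ⟩
       K² * c ≤⟨ *-monoʳ 0≤c K²≤ ⟩
       (ι a + 1ℚ) * g k * c ≡⟨ r₁ (ι a) (g k) c ⟩
       g k * (wal a + + 3 / 4 * c) ≤⟨ *-monoˡ (0≤g k) (+-mono-≤ (wal-close k K<a+1 ℕ.≤-refl) (*-monoˡ (≥0 (+ 3 / 4)) c≤i)) ⟩
       g k * (wal (suc k) + i + + 3 / 4 * i) ≡⟨ r₂ (g k) (wal (suc k)) i ⟩
       gauss k + g k * (+ 7 / 4 * i) ≤⟨ +-monoʳ-≤ (gauss k) (≤-trans (*-monoʳ (0≤* (≥0 (+ 7 / 4)) 0≤i) (g≤½ k)) (≤-cert {a = ½ * (+ 7 / 4 * i)} {b = i} (0≤* (≥0 (+ 1 / 8)) 0≤i) (r₃ i))) ⟩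
       gauss k + i ∎
       where
       open ≤-Reasoning
       r₁ : ∀ a g c → (a + 1ℚ) * g * c ≡ g * ((a + + 1 / 4) * c + + 3 / 4 * c)
       r₁ = solve-∀ ℚ-ring
       r₂ : ∀ g w i → g * (w + i + + 3 / 4 * i) ≡ g * w + g * (+ 7 / 4 * i)
       r₂ = solve-∀ ℚ-ring
       r₃ : ∀ i → + 1 / 8 * i ≡ i - ½ * (+ 7 / 4 * i)
       r₃ = solve-∀ ℚ-ring
     below : gauss k ≤ lam k * lam k + i
     below = begin
       g k * wal (suc k) ≤⟨ *-monoˡ (0≤g k) (wal-close k ℕ.≤-refl K<a+1) ⟩
       g k * (wal a + i) ≡⟨ r₁ (ι a) (g k) c i ⟩
       ι a * g k * c + g k * (+ 1 / 4 * c + i) ≤⟨ +-mono-≤ (*-monoʳ 0≤c ga≤) (*-mono-≤ (0≤g k) (0≤+ (0≤* (≥0 (+ 1 / 4)) 0≤c) 0≤i) (g≤½ k) (+-monoˡ-≤ i (*-monoˡ (≥0 (+ 1 / 4)) c≤i))) ⟩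
       K² * c + ½ * (+ 1 / 4 * i + i) ≤⟨ ≤-cert {a = K² * c + ½ * (+ 1 / 4 * i + i)} {b = K² * c + i} (0≤* (≥0 (+ 3 / 8)) 0≤i) (r₂ (K² * c) i) ⟩
       K² * c + i ≡⟨ cong (_+ i) (sym lam²≡) ⟩
       lam k * lam k + i ∎
       where
       open ≤-Reasoning
       r₁ : ∀ a g c i → g * ((a + + 1 / 4) * c + i) ≡ a * g * c + g * (+ 1 / 4 * c + i)
       r₁ = solve-∀ ℚ-ring
       r₂ : ∀ x i → + 3 / 8 * i ≡ x + i - (x + ½ * (+ 1 / 4 * i + i))
       r₂ = solve-∀ ℚ-ring

   private
     module Pair {n m : ℕ} (n≤m : n ℕ.≤ m) where
       B′ = big₂ * rate n
       0≤B′ : 0ℚ ≤ B′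
       0≤B′ = 0≤* 0≤big₂ (0≤rate n)
       m₁-diff : ∣ m₁ n - m₁ m ∣ ≤ B′
       m₁-diff = moment-cauchy 1 (s≤s (s≤s z≤n)) n≤m
       m₂-diff : ∣ m₂ n - m₂ m ∣ ≤ B′
       m₂-diff = moment-cauchy 2 (s≤s (s≤s (s≤s z≤n))) n≤m

       g-step : ∀ p q → m₁ p ≤ m₁ q + B′ → m₁ q ≤ m₁ p + B′ → m₂ q ≤ m₂ p + B′ → g p ≤ g q + B′
       g-step p q h₁ h₁′ h₂ = *-cancelˡ-≤ (0<2var p) (begin
         + 2 / 1 * var p * g p ≡⟨ trans (*-comm (+ 2 / 1 * var p) (g p)) (g-var p) ⟩
         m₁ p ≤⟨ h₁ ⟩
         m₁ q + B′ ≡⟨ cong (_+ B′) (sym (g-var q)) ⟩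
         g q * (+ 2 / 1 * var q) + B′ ≤⟨ ≤-cert {a = g q * (+ 2 / 1 * var q) + B′} {b = + 2 / 1 * var p * (g q + B′)}
               (0≤+ (0≤+ (0≤* (0≤* (≥0 (+ 2 / 1)) (0≤g q)) (0≤-diff var-step)) (0≤* (0≤* (≥0 (+ 14 / 1)) 0≤B′) (0≤-diff (g≤½ q)))) (0≤* (0≤* (≥0 (+ 2 / 1)) 0≤B′) (0≤-diff (4≤var′ p))))
               (r (g q) (var p) (var q) B′) ⟩
         + 2 / 1 * var p * (g q + B′) ∎)
         where
         open ≤-Reasoning
         r : ∀ g v w B → + 2 / 1 * g * (v + + 7 / 1 * B - w) + + 14 / 1 * B * (½ - g) + + 2 / 1 * B * (v - + 4 / 1) ≡ + 2 / 1 * v * (g + B) - (g * (+ 2 / 1 * w) + B)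
         r = solve-∀ ℚ-ring
         -- The second moments differ by at most `B′`, the squares of the means by at most (3 + 3)
         -- `B′`.
         var-step : var q ≤ var p + + 7 / 1 * B′
         var-step = ≤-cert {a = var q} {b = var p + + 7 / 1 * B′} (0≤+ (0≤+ (0≤-diff h₂) (0≤* (0≤+ (0≤m₁ p) (0≤m₁ q)) (0≤-diff h₁))) (0≤* 0≤B′ (0≤+ (0≤-diff (m₁≤3 p)) (0≤-diff (m₁≤3 q)))))
           (r′ (m₁ p) (m₂ p) (m₁ q) (m₂ q) B′)
           where
           r′ : ∀ a b c d B → (b + B - d) + (a + c) * (c + B - a) + B * ((+ 3 / 1 - a) + (+ 3 / 1 - c)) ≡ b - a * a + + 7 / 1 * B - (d - c * c)
           r′ = solve-∀ ℚ-ring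

   gauss-cauchy : ∀ {n m} → n ℕ.≤ m → ∣ gauss n - gauss m ∣ ≤ (1ℚ + big₂) * ι (suc n) ⁻¹
   gauss-cauchy {n} {m} n≤m = ∣-∣≤ up down
     where
     open Pair n≤m
     i = ι (suc n) ⁻¹
     0≤i : 0ℚ ≤ i
     0≤i = 0≤⁻¹ (0<ι n)
     0≤wal : ∀ a → 0ℚ ≤ wal a
     0≤wal a = ≤-trans (≥0 (+ 1 / 4)) (¼≤wal a)
     B′≤ : B′ ≤ big₂ * i
     B′≤ = *-monoˡ 0≤big₂ (rate≤ n)
     gn≤ : g n ≤ g m + B′
     gn≤ = g-step n m (∣-∣⇒≤ {m₁ n} {m₁ m} {B′} m₁-diff) (∣-∣⇒≥ {m₁ n} {m₁ m} {B′} m₁-diff) (∣-∣⇒≥ {m₂ n} {m₂ m} {B′} m₂-diff)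
     gm≤ : g m ≤ g n + B′
     gm≤ = g-step m n (∣-∣⇒≥ {m₁ n} {m₁ m} {B′} m₁-diff) (∣-∣⇒≤ {m₁ n} {m₁ m} {B′} m₁-diff) (∣-∣⇒≤ {m₂ n} {m₂ m} {B′} m₂-diff)
     up : gauss n ≤ gauss m + (1ℚ + big₂) * i
     up = ≤-trans (*-mono-≤ (0≤g n) (0≤wal (suc n)) gn≤ (wal-mono (s≤s n≤m)))
       (≤-cert {a = (g m + B′) * wal (suc m)} {b = gauss m + (1ℚ + big₂) * i} (0≤+ (0≤+ (0≤+ (0≤* 0≤B′ (0≤-diff (wal≤½ (suc m)))) (0≤* (≥0 ½) 0≤B′)) (0≤-diff B′≤)) 0≤i) (r (g m) B′ (wal (suc m)) big₂ i))
       where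
       r : ∀ g B w b i → B * (½ - w) + ½ * B + (b * i - B) + i ≡ g * w + (1ℚ + b) * i - (g + B) * w
       r = solve-∀ ℚ-ring
     down : gauss m ≤ gauss n + (1ℚ + big₂) * i
     down = ≤-trans (*-monoʳ (0≤wal (suc m)) gm≤)
       (≤-cert {a = (g n + B′) * wal (suc m)} {b = gauss n + (1ℚ + big₂) * i}
         (0≤+ (0≤+ (0≤+ (0≤+ (0≤* (0≤g n) (0≤-diff (wal-close n (s≤s n≤m) ℕ.≤-refl))) (0≤* 0≤i (0≤-diff (g≤½ n)))) (0≤* (≥0 ½) 0≤i)) (0≤* 0≤B′ (0≤-diff (wal≤½ (suc m))))) (0≤+ (0≤* (≥0 ½) 0≤B′) (0≤-diff B′≤)))
         (r (g n) B′ (wal (suc m)) (wal (suc n)) big₂ i))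
       where
       r : ∀ g B w w′ b i → g * (w′ + i - w) + i * (½ - g) + ½ * i + B * (½ - w) + (½ * B + (b * i - B)) ≡ g * w′ + (1ℚ + b) * i - (g + B) * w
       r = solve-∀ ℚ-ring

   gauss-≥ : ∀ {L y} k → y ≤ wal (suc k) → 0ℚ ≤ L → L * (+ 2 / 1 * (hi₂ - lo₁ * lo₁)) ≤ lo₁ * y → L ≤ gauss k
   gauss-≥ {L} {y} k y≤ 0≤L h = *-cancelˡ-≤ (0<2var k) (begin
     + 2 / 1 * var k * L ≤⟨ *-monoʳ 0≤L (*-monoˡ (≥0 (+ 2 / 1)) (var-hi k)) ⟩
     + 2 / 1 * (hi₂ - lo₁ * lo₁) * L ≡⟨ *-comm (+ 2 / 1 * (hi₂ - lo₁ * lo₁)) L ⟩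
     L * (+ 2 / 1 * (hi₂ - lo₁ * lo₁)) ≤⟨ h ⟩
     lo₁ * y ≤⟨ *-monoˡ 0≤lo₁ y≤ ⟩
     lo₁ * wal (suc k) ≤⟨ *-monoʳ (≤-trans (≥0 (+ 1 / 4)) (¼≤wal (suc k))) (lo₁≤m₁ k) ⟩
     m₁ k * wal (suc k) ≡⟨ cong (_* wal (suc k)) (sym (g-var k)) ⟩
     g k * (+ 2 / 1 * var k) * wal (suc k) ≡⟨ r (g k) (+ 2 / 1 * var k) (wal (suc k)) ⟩
     + 2 / 1 * var k * gauss k ∎)
     where
     open ≤-Reasoning
     0≤lo₁ = ≤-trans (≥0 (+ 2 / 1)) 2≤lo₁
     r : ∀ g v w → g * v * w ≡ v * (g * w)
     r = solve-∀ ℚ-ring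

   gauss-≤ : ∀ {L y} k → wal (suc k) ≤ y → 0ℚ ≤ L → hi₁ * y ≤ L * (+ 2 / 1 * (lo₂ - hi₁ * hi₁)) → gauss k ≤ L
   gauss-≤ {L} {y} k ≤y 0≤L h = *-cancelˡ-≤ (0<2var k) (begin
     + 2 / 1 * var k * gauss k ≡⟨ r (g k) (+ 2 / 1 * var k) (wal (suc k)) ⟨
     g k * (+ 2 / 1 * var k) * wal (suc k) ≡⟨ cong (_* wal (suc k)) (g-var k) ⟩
     m₁ k * wal (suc k) ≤⟨ *-mono-≤ (0≤m₁ k) (≤-trans (≥0 (+ 1 / 4)) (¼≤wal (suc k))) (m₁≤hi₁ k) ≤y ⟩
     hi₁ * y ≤⟨ h ⟩
     L * (+ 2 / 1 * (lo₂ - hi₁ * hi₁)) ≤⟨ *-monoˡ 0≤L (*-monoˡ (≥0 (+ 2 / 1)) (lo-var k)) ⟩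
     L * (+ 2 / 1 * var k) ≡⟨ *-comm L (+ 2 / 1 * var k) ⟩
     + 2 / 1 * var k * L ∎)
     where
     open ≤-Reasoning
     r : ∀ g v w → g * v * w ≡ v * (g * w)
     r = solve-∀ ℚ-ring

-- A recursion for the coefficients of W without powers of 2

module Layers where

 open RationalArithmetic
 open PowerSeries
 open Representations
 open Maxima

 -- rep (2ᵏ - i), or 0 if 2ᵏ < i
 gap : ℕ → ℕ → PS
 gap k i with i ℕ.≤? 2 ℕ.^ k
 ... | yes _ = rep (2 ℕ.^ k ℕ.∸ i)
 ... | no  _ = C 0ℚ

 private
   gap-inside : ∀ k i → i ℕ.≤ 2 ℕ.^ k → gap k i ≡ rep (2 ℕ.^ k ℕ.∸ i)
   gap-inside k i h with i ℕ.≤? 2 ℕ.^ k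
   ... | yes _ = refl
   ... | no ¬p = contradiction h ¬p

   gap-outside : ∀ k i → 2 ℕ.^ k ℕ.< i → gap k i ≡ C 0ℚ
   gap-outside k i h with i ℕ.≤? 2 ℕ.^ k
   ... | yes p = contradiction p (ℕ.<⇒≱ h)
   ... | no _  = refl

   C0 : ∀ n → C 0ℚ n ≡ 0ℚ
   C0 zero    = refl
   C0 (suc n) = refl

   gap-vanish : ∀ k i n → 1 ℕ.≤ i → n ℕ.+ i ℕ.≤ k → gap k i n ≡ 0ℚ
   gap-vanish k i n 1≤i h = by (ℕ.≤-<-connex i (2 ℕ.^ k))
     where
     by : i ℕ.≤ 2 ℕ.^ k ⊎ 2 ℕ.^ k ℕ.< i → gap k i n ≡ 0ℚ
     by (inj₁ i≤) = trans (cong (λ f → f n) (gap-inside k i i≤)) (rep-sparse k (2 ℕ.^ k ℕ.∸ i) i n 1≤i (ℕ.m∸n+n≡m i≤) h)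
     by (inj₂ <i) = trans (cong (λ f → f n) (gap-outside k i <i)) (C0 n)

   S-extend : ∀ f m o → (∀ l → m ℕ.≤ l → f l ≡ 0ℚ) → S f (m ℕ.+ o) ≡ S f m
   S-extend f m o h = trans (S-+ f m o) (trans (cong (λ z → S f m + z) (S-zero (λ i → f (m ℕ.+ i)) o (λ i → h (m ℕ.+ i) (ℕ.m≤m+n m i)))) (+-identityʳ (S f m)))

   S-same : ∀ f m o → (∀ l → m ℕ.≤ l → f l ≡ 0ℚ) → (∀ l → o ℕ.≤ l → f l ≡ 0ℚ) → S f m ≡ S f o
   S-same f m o h₁ h₂ = trans (sym (S-extend f m o h₁)) (trans (cong (S f) (ℕ.+-comm m o)) (S-extend f o m h₂))

   term-vanish : ∀ e (F : ℕ → PS) n l → n ℕ.< l → (E (e ℕ.+ (l ℕ.+ l)) ⊛ F l) n ≡ 0ℚ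
   term-vanish e F n l n<l = E-⊛-below (e ℕ.+ (l ℕ.+ l)) (F l) n (ℕ.<-≤-trans n<l (ℕ.≤-trans (ℕ.m≤m+n l l) (ℕ.m≤n+m (l ℕ.+ l) e)))

 -- As `e + i = 2r`, the number `2 ^ suc k - i` is `e` plus twice `2 ^ k - r`, so halving maps gaps
 -- to gaps; the value 0 for large indices is consistent with this. `L` terms suffice because `E j`
 -- starts in degree `j`.
 gap-suc : ∀ k r e i L n → e ℕ.≤ 1 → 1 ℕ.≤ r → e ℕ.+ i ≡ r ℕ.+ r → n ℕ.< L →
   gap (suc k) i n ≡ ΣP (λ l → E (e ℕ.+ (l ℕ.+ l)) ⊛ gap k (r ℕ.+ l)) L n
 gap-suc k r e i L n e≤1 1≤r e+i n<L = by (ℕ.≤-<-connex r P)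
   where
   P = 2 ℕ.^ k
   term : ℕ → ℚ
   term l = (E (e ℕ.+ (l ℕ.+ l)) ⊛ gap k (r ℕ.+ l)) n
   dbl : 2 ℕ.^ suc k ≡ P ℕ.+ P
   dbl = cong (P ℕ.+_) (ℕ.+-identityʳ P)
   vanish : ∀ l → P ℕ.< r ℕ.+ l → term l ≡ 0ℚ
   vanish l h = trans (cong (λ f → (E (e ℕ.+ (l ℕ.+ l)) ⊛ f) n) (gap-outside k (r ℕ.+ l) h))
     (trans (⊛-comm (E (e ℕ.+ (l ℕ.+ l))) (C 0ℚ) n) (trans (C-⊛ 0ℚ (E (e ℕ.+ (l ℕ.+ l))) n) (*-zeroˡ (E (e ℕ.+ (l ℕ.+ l)) n))))
   by : r ℕ.≤ P ⊎ P ℕ.< r → gap (suc k) i n ≡ S term L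
   by (inj₁ r≤P) = trans (cong (λ f → f n) (gap-inside (suc k) i i≤)) (trans (cong (λ z → rep z n) ℓ≡) (trans (rep-cases e q e≤1 n)
       (trans (S-congʷ (suc q) (λ l l≤q → cong (λ f → (E (e ℕ.+ (l ℕ.+ l)) ⊛ f) n)
           (sym (trans (gap-inside k (r ℕ.+ l) (r+l≤ l (ℕ.≤-pred l≤q))) (cong rep (sym (ℕ.∸-+-assoc P r l)))))))
         (S-same term (suc q) L (λ l q<l → vanish l (ℕ.≤-trans (ℕ.≤-reflexive (cong suc (sym (ℕ.m+[n∸m]≡n r≤P)))) (ℕ.≤-trans (ℕ.≤-reflexive (sym (ℕ.+-suc r q))) (ℕ.+-monoʳ-≤ r q<l))))
           (λ l L≤l → term-vanish e (λ l → gap k (r ℕ.+ l)) n l (ℕ.<-≤-trans n<L L≤l))))))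
     where
     q = P ℕ.∸ r
     S-congʷ : ∀ {f g} n → (∀ l → l ℕ.< n → f l ≡ g l) → S f n ≡ S g n
     S-congʷ zero    h = refl
     S-congʷ (suc n) h = cong₂ _+_ (h 0 (s≤s z≤n)) (S-congʷ n (λ l l< → h (suc l) (s≤s l<)))
     i≤ : i ℕ.≤ 2 ℕ.^ suc k
     i≤ = ℕ.≤-trans (ℕ.m≤n+m i e) (ℕ.≤-trans (ℕ.≤-reflexive e+i) (ℕ.≤-trans (ℕ.+-mono-≤ r≤P r≤P) (ℕ.≤-reflexive (sym dbl))))
     ℓ≡ : 2 ℕ.^ suc k ℕ.∸ i ≡ e ℕ.+ (q ℕ.+ q)
     ℓ≡ = trans (cong (ℕ._∸ i) (trans dbl (trans (cong₂ ℕ._+_ (sym (ℕ.m∸n+n≡m r≤P)) (sym (ℕ.m∸n+n≡m r≤P))) (trans (s₁ q r) (trans (cong (q ℕ.+ q ℕ.+_) (sym e+i)) (s₂ q e i)))))) (ℕ.m+n∸n≡m (e ℕ.+ (q ℕ.+ q)) i)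
       where
       s₁ : ∀ q r → (q ℕ.+ r) ℕ.+ (q ℕ.+ r) ≡ q ℕ.+ q ℕ.+ (r ℕ.+ r)
       s₁ = ℕ-Solver.solve-∀
       s₂ : ∀ q e i → q ℕ.+ q ℕ.+ (e ℕ.+ i) ≡ e ℕ.+ (q ℕ.+ q) ℕ.+ i
       s₂ = ℕ-Solver.solve-∀
     r+l≤ : ∀ l → l ℕ.≤ q → r ℕ.+ l ℕ.≤ P
     r+l≤ l h = ℕ.≤-trans (ℕ.+-monoʳ-≤ r h) (ℕ.≤-reflexive (ℕ.m+[n∸m]≡n r≤P))
   by (inj₂ P<r) = trans (cong (λ f → f n) (gap-outside (suc k) i <i)) (trans (C0 n) (sym (S-zero term L (λ l → vanish l (ℕ.<-≤-trans P<r (ℕ.m≤m+n r l))))))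
     where
     <i : 2 ℕ.^ suc k ℕ.< i
     <i = ℕ.+-cancelˡ-≤ e (suc (2 ℕ.^ suc k)) i (ℕ.≤-trans (ℕ.+-mono-≤ e≤1 (ℕ.≤-reflexive (cong suc dbl)))
       (ℕ.≤-trans (ℕ.≤-reflexive (cong suc (sym (ℕ.+-suc P P)))) (ℕ.≤-trans (ℕ.+-mono-≤ P<r P<r) (ℕ.≤-reflexive (sym e+i)))))

 gaps : ℕ → ℕ → PS
 gaps K i = ΣP (λ k → gap k i) K

 -- H 0 = W and H i = Σ_k rep (2ᵏ - i) for i ≥ 1; the sum is finite in every degree.
 H : ℕ → PS
 H zero      = W
 H (suc i) n = gaps (n ℕ.+ suc i) (suc i) n

 private
   gaps≡H : ∀ K i n → 1 ℕ.≤ i → n ℕ.+ i ℕ.≤ K → gaps K i n ≡ H i n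
   gaps≡H K (suc i) n _ h = subst (λ z → gaps z (suc i) n ≡ H (suc i) n) (ℕ.m+[n∸m]≡n h)
     (S-extend (λ k → gap k (suc i) n) (n ℕ.+ suc i) (K ℕ.∸ (n ℕ.+ suc i)) (λ k h → gap-vanish k (suc i) n (s≤s z≤n) h))

   E-⊛-upTo : ∀ j f g n → (∀ m → m ℕ.≤ n → f m ≡ g m) → (E j ⊛ f) n ≡ (E j ⊛ g) n
   E-⊛-upTo j f g n h = by (ℕ.<-≤-connex n j)
     where
     by : n ℕ.< j ⊎ j ℕ.≤ n → (E j ⊛ f) n ≡ (E j ⊛ g) n
     by (inj₁ n<j) = trans (E-⊛-below j f n n<j) (sym (E-⊛-below j g n n<j))
     by (inj₂ j≤n) = let m , e = ℕ.m≤n⇒∃[o]m+o≡n j≤n in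
       subst (λ z → (E j ⊛ f) z ≡ (E j ⊛ g) z) e (trans (E-⊛-at j f m) (trans (cong (inv! j *_) (h m (ℕ.≤-trans (ℕ.m≤n+m m j) (ℕ.≤-reflexive e)))) (sym (E-⊛-at j g m))))

   layers : ∀ r e L n → 1 ℕ.≤ r → ∀ K → n ℕ.+ (r ℕ.+ L) ℕ.≤ K →
     S (λ k → ΣP (λ l → E (e ℕ.+ (l ℕ.+ l)) ⊛ gap k (r ℕ.+ l)) L n) K ≡ ΣP (λ l → E (e ℕ.+ (l ℕ.+ l)) ⊛ H (r ℕ.+ l)) L n
   layers r e L n 1≤r K h = trans (S-swap (λ k l → (E (e ℕ.+ (l ℕ.+ l)) ⊛ gap k (r ℕ.+ l)) n) K L)
     (ΣP-cong′ L (λ l l<L → trans (sym (ΣP-⊛ˡ (λ k → gap k (r ℕ.+ l)) K (E (e ℕ.+ (l ℕ.+ l))) n))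
       (E-⊛-upTo (e ℕ.+ (l ℕ.+ l)) (gaps K (r ℕ.+ l)) (H (r ℕ.+ l)) n (λ m m≤n → gaps≡H K (r ℕ.+ l) m (ℕ.≤-trans 1≤r (ℕ.m≤m+n r l))
         (ℕ.≤-trans (ℕ.+-mono-≤ m≤n (ℕ.+-monoʳ-≤ r (ℕ.<⇒≤ l<L))) h)))))
     where
     ΣP-cong′ : ∀ {f g : ℕ → ℚ} n → (∀ l → l ℕ.< n → f l ≡ g l) → S f n ≡ S g n
     ΣP-cong′ zero    h = refl
     ΣP-cong′ (suc n) h = cong₂ _+_ (h 0 (s≤s z≤n)) (ΣP-cong′ n (λ l l< → h (suc l) (s≤s l<)))

 -- Summing the halving recursion over all `k` eliminates `2 ^ k`: only the indices `i` and `r`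
 -- remain, and `k = 0` supplies the inhomogeneous term. This makes coefficients computable that are
 -- defined through representations of `2 ^ n`.
 H-suc : ∀ r e i L n → e ℕ.≤ 1 → 1 ℕ.≤ r → 1 ℕ.≤ i → e ℕ.+ i ≡ r ℕ.+ r → n ℕ.< L →
   H i n ≡ gap 0 i n + ΣP (λ l → E (e ℕ.+ (l ℕ.+ l)) ⊛ H (r ℕ.+ l)) L n
 H-suc r e i L n e≤1 1≤r 1≤i e+i n<L = trans (sym (gaps≡H (suc K) i n 1≤i (ℕ.≤-trans (ℕ.≤-trans (ℕ.+-monoʳ-≤ n (ℕ.m≤m+n i (r ℕ.+ L))) (ℕ.≤-reflexive (s₁ n i (r ℕ.+ L)))) (ℕ.n≤1+n K))))
   (cong (λ z → gap 0 i n + z) (trans (S-cong K (λ k → gap-suc k r e i L n e≤1 1≤r e+i n<L)) (layers r e L n 1≤r K (ℕ.m≤m+n (n ℕ.+ (r ℕ.+ L)) i))))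
   where
   K = n ℕ.+ (r ℕ.+ L) ℕ.+ i
   s₁ : ∀ n i r → n ℕ.+ (i ℕ.+ r) ≡ n ℕ.+ r ℕ.+ i
   s₁ = ℕ-Solver.solve-∀

 gap-0-big : ∀ i → gap 0 (suc (suc i)) ≡ C 0ℚ
 gap-0-big i = gap-outside 0 (suc (suc i)) (s≤s (s≤s z≤n))

 -- The increments from `rep (2 ^ k)` to `rep (2 ^ suc k)` telescope, starting from `rep 1`, which
 -- is `X`.
 W-layers : ∀ L n → n ℕ.< L → W n ≡ X n + ΣP (λ l → E (2 ℕ.+ (l ℕ.+ l)) ⊛ H (suc l)) L n
 W-layers L n n<L = trans (sym (rep-2^≡W K n (ℕ.m≤m+n n (1 ℕ.+ L)))) (trans (telescope K) (cong₂ _+_ (rep-1 n)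
   (trans (S-cong K (λ k → top k)) (layers 1 2 L n (s≤s z≤n) K ℕ.≤-refl))))
   where
   K = n ℕ.+ (1 ℕ.+ L)
   up : ℕ → ℚ
   up k = ΣP (λ l → E (suc l ℕ.+ suc l) ⊛ rep (2 ℕ.^ k ℕ.∸ suc l)) (2 ℕ.^ k) n
   telescope : ∀ K → rep (2 ℕ.^ K) n ≡ rep 1 n + S up K
   telescope zero    = sym (+-identityʳ (rep 1 n))
   telescope (suc K) = trans (cong (λ z → rep z n) (cong (2 ℕ.^ K ℕ.+_) (ℕ.+-identityʳ (2 ℕ.^ K)))) (trans (rep-double (2 ℕ.^ K) n)
     (trans (cong (_+ up K) (telescope K)) (trans (+-assoc (rep 1 n) (S up K) (up K)) (cong (λ z → rep 1 n + z) (sym (S-last up K))))))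
   top : ∀ k → up k ≡ ΣP (λ l → E (2 ℕ.+ (l ℕ.+ l)) ⊛ gap k (1 ℕ.+ l)) L n
   top k = trans (S-congʷ (2 ℕ.^ k) (λ l l<P → cong₂ (λ u f → (E u ⊛ f) n) (cong suc (ℕ.+-suc l l)) (sym (gap-inside k (suc l) l<P))))
     (S-same term (2 ℕ.^ k) L (λ l h → trans (cong (λ f → (E (2 ℕ.+ (l ℕ.+ l)) ⊛ f) n) (gap-outside k (suc l) (s≤s h)))
         (trans (⊛-comm (E (2 ℕ.+ (l ℕ.+ l))) (C 0ℚ) n) (trans (C-⊛ 0ℚ (E (2 ℕ.+ (l ℕ.+ l))) n) (*-zeroˡ (E (2 ℕ.+ (l ℕ.+ l)) n)))))
       (λ l h → term-vanish 2 (λ l → gap k (suc l)) n l (ℕ.<-≤-trans n<L h)))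
     where
     term : ℕ → ℚ
     term l = (E (2 ℕ.+ (l ℕ.+ l)) ⊛ gap k (suc l)) n
     S-congʷ : ∀ {f g} n → (∀ l → l ℕ.< n → f l ≡ g l) → S f n ≡ S g n
     S-congʷ zero    h = refl
     S-congʷ (suc n) h = cong₂ _+_ (h 0 (s≤s z≤n)) (S-congʷ n (λ l l< → h (suc l) (s≤s l<)))
   rep-1 : rep 1 ≗ X
   rep-1 = ≗-trans (λ n → +-identityʳ ((E 1 ⊛ repr 0 0) n)) (≗-trans (⊛-comm (E 1) (C 1ℚ)) (≗-trans (⊛-identityˡ (E 1))
     (≗-trans (⊛-cong (λ i → cong (λ z → C z i) inv!-0) (≗-refl {pow X 1})) (≗-trans (⊛-identityˡ (pow X 1)) (≗-trans (⊛-comm X (C 1ℚ)) (⊛-identityˡ X))))))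

-- A verified table of the coefficients of W

module Table where

 open import Data.Empty using (⊥)
 open import Data.List.Base using (List; []; _∷_; _++_; length; drop)
 import Data.List.Properties as List
 open import Data.Nat.Base using (_!; ⌊_/2⌋)
 open import Data.Unit.Base using (⊤; tt)
 open RationalArithmetic
 open PowerSeries
 open Representations
 open Maxima
 open Layers

 -- Tabulating n! H i n row by row

 nth : List ℕ → ℕ → ℕ
 nth []       _       = 0
 nth (x ∷ xs) zero    = x
 nth (x ∷ xs) (suc i) = nth xs i

 -- Both lists are consumed two entries at a time.
 sumFrom : List (List ℕ) → List ℕ → ℕ → ℕ
 sumFrom (row ∷ _ ∷ rows) (c ∷ _ ∷ cs) i = c ℕ.* nth row i ℕ.+ sumFrom rows cs (suc i)
 sumFrom (row ∷ _)        (c ∷ _)      i = c ℕ.* nth row i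
 sumFrom _                _            i = 0

 pascal : List ℕ → List ℕ
 pascal (x ∷ y ∷ zs) = x ℕ.+ y ∷ pascal (y ∷ zs)
 pascal (x ∷ [])     = x ∷ []
 pascal []           = []

 -- The inhomogeneous terms of the recursion: `X` for index 0, and the constant `gap 0 1` for index
 -- 1.
 unit : ℕ → ℕ → ℕ
 unit 0 1 = 1
 unit 1 0 = 1
 unit _ _ = 0

 odd-entry even-entry : ℕ → List (List ℕ) → List ℕ → ℕ → ℕ
 odd-entry  n prev bs r = unit (r ℕ.+ r ℕ.∸ 1) n ℕ.+ sumFrom prev (drop 1 bs) r
 even-entry n prev bs r = sumFrom (drop 1 prev) (drop 2 bs) (suc r)

 -- The entries `2r - 1` and `2r` are appended. The even one needs entry `r` of the same row, since
 -- its layer without zero exponents stays in the same degree; it is read from `cur′` because for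
 -- `r = 1` that entry has only just been added.
 extend : ℕ → List (List ℕ) → List ℕ → ℕ → List ℕ → List ℕ
 extend n prev bs r cur = cur′ ++ (nth cur′ r ℕ.+ even-entry n prev bs r ∷ [])
   where cur′ = cur ++ (odd-entry n prev bs r ∷ [])

 build : ℕ → ℕ → List (List ℕ) → List ℕ → ℕ → List ℕ → List ℕ
 build zero    n prev bs r cur = cur
 build (suc p) n prev bs r cur = build p n prev bs (suc r) (extend n prev bs r cur)

 new-row : ℕ → ℕ → List (List ℕ) → List ℕ → List ℕ
 new-row N n prev bs = build ⌊ N ℕ.∸ n /2⌋ n prev bs 1 (unit 0 n ℕ.+ even-entry n prev bs 0 ∷ [])

 rows : ℕ → ℕ → ℕ → List (List ℕ) → List ℕ → List (List ℕ)
 rows zero    N n prev bs = prev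
 rows (suc k) N n prev bs = rows k N (suc n) (new-row N n prev bs ∷ prev) (1 ∷ pascal bs)

 ascend : List (List ℕ) → List ℕ → List ℕ
 ascend []         acc = acc
 ascend (row ∷ rs) acc = ascend rs (nth row 0 ∷ acc)

 -- n! W n for n ≤ N
 numbers : ℕ → List ℕ
 numbers N = ascend (rows (suc N) N 0 [] (1 ∷ [])) []

 Value : ℕ → ℕ → ℕ → Set
 Value x i n = ι x ≡ ι (n !) * H i n

 -- The last `k` entries of a row of Pascal's triangle, from position `j` on. Writing them with
 -- inverse factorials fits the coefficients of `E` and needs no separate binomial function.
 Bins : ℕ → ℕ → ℕ → List ℕ → Set
 Bins n j zero    []       = ⊤
 Bins n j (suc k) (c ∷ cs) = ι c ≡ ι (n !) * (inv! j * inv! k) × Bins n (suc j) k cs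
 Bins _ _ _       _        = ⊥

 private
   n!*inv! : ∀ n → ι (n !) * (inv! n * inv! 0) ≡ 1ℚ
   n!*inv! n = trans (cong (λ z → ι (n !) * (inv! n * z)) inv!-0) (trans (cong (ι (n !) *_) (*-identityʳ (inv! n))) (*-⁻¹ (0<ι! n)))

   pascal-rule : ∀ n j k → j ℕ.+ suc k ≡ n → ι (n !) * (inv! j * inv! (suc k)) + ι (n !) * (inv! (suc j) * inv! k) ≡ ι (suc n !) * (inv! (suc j) * inv! (suc k))
   pascal-rule n j k refl = begin
     ι (n !) * (inv! j * inv! (suc k)) + ι (n !) * (inv! (suc j) * inv! k)
       ≡⟨ cong₂ (λ u v → ι (n !) * (u * inv! (suc k)) + ι (n !) * (inv! (suc j) * v)) (sym (inv!-suc j)) (sym (inv!-suc k)) ⟩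
     ι (n !) * (ι (suc j) * inv! (suc j) * inv! (suc k)) + ι (n !) * (inv! (suc j) * (ι (suc k) * inv! (suc k)))
       ≡⟨ r (ι (n !)) (ι (suc j)) (ι (suc k)) (inv! (suc j)) (inv! (suc k)) ⟩
     (ι (suc j) + ι (suc k)) * ι (n !) * (inv! (suc j) * inv! (suc k))
       ≡⟨ cong (λ z → z * ι (n !) * (inv! (suc j) * inv! (suc k))) (sym (ι-+ (suc j) (suc k))) ⟩
     ι (suc n) * ι (n !) * (inv! (suc j) * inv! (suc k))
       ≡⟨ cong (_* (inv! (suc j) * inv! (suc k))) (sym (ι-* (suc n) (n !))) ⟩
     ι (suc n !) * (inv! (suc j) * inv! (suc k)) ∎
     where
     open ≡-Reasoning
     r : ∀ f a b x y → f * (a * x * y) + f * (x * (b * y)) ≡ (a + b) * f * (x * y)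
     r = solve-∀ ℚ-ring

   pascal-ok : ∀ n j k cs → j ℕ.+ k ≡ n → Bins n j (suc k) cs → Bins (suc n) (suc j) (suc k) (pascal cs)
   pascal-ok n j zero    (x ∷ [])     j+k (e , _)        = trans e (trans (cong (λ z → ι (n !) * (inv! z * inv! 0)) j≡n) (trans (n!*inv! n) (trans (sym (n!*inv! (suc n))) (cong (λ z → ι (suc n !) * (inv! (suc z) * inv! 0)) (sym j≡n))))) , tt
     where
     j≡n : j ≡ n
     j≡n = trans (sym (ℕ.+-identityʳ j)) j+k
   pascal-ok n j (suc k) (x ∷ y ∷ zs) j+k (ex , ey , bs) =
     trans (ι-+ x y) (trans (cong₂ _+_ ex ey) (pascal-rule n j k j+k)) , pascal-ok n (suc j) k (y ∷ zs) (trans (sym (ℕ.+-suc j k)) j+k) (ey , bs)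

 next-bins : ∀ n bs → Bins n 0 (suc n) bs → Bins (suc n) 0 (suc (suc n)) (1 ∷ pascal bs)
 next-bins n bs ok = trans ι-1 (sym (trans (cong (ι (suc n !) *_) (*-comm (inv! 0) (inv! (suc n)))) (n!*inv! (suc n)))) , pascal-ok n 0 n bs refl ok

 module Correct (N : ℕ) where

   -- The recursion for row `k` and index `i` reads only entries whose row plus twice the index is
   -- at most `k + 2i`, so this triangle is closed under it.
   RowOK : ℕ → List ℕ → Set
   RowOK k row = ∀ i → k ℕ.+ (i ℕ.+ i) ℕ.≤ N → Value (nth row i) i k

   RowsOK : ℕ → List (List ℕ) → Set
   RowsOK zero    []         = ⊤
   RowsOK (suc k) (row ∷ rs) = RowOK k row × RowsOK k rs
   RowsOK _       _          = ⊥

   private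
     term : ℕ → ℕ → ℕ → ℕ → ℚ
     term n j i l = (E (j ℕ.+ (l ℕ.+ l)) ⊛ H (i ℕ.+ l)) n

     shift-term : ∀ n j i l → term n j i (suc l) ≡ term n (suc (suc j)) (suc i) l
     shift-term n j i l = cong₂ (λ u v → (E u ⊛ H v) n) (e j l) (ℕ.+-suc i l)
       where
       e : ∀ j l → j ℕ.+ (suc l ℕ.+ suc l) ≡ suc (suc j) ℕ.+ (l ℕ.+ l)
       e = ℕ-Solver.solve-∀

     high-terms : ∀ n j i L → n ℕ.< j → S (term n j i) L ≡ 0ℚ
     high-terms n j i L n<j = S-zero (term n j i) L (λ l → E-⊛-below (j ℕ.+ (l ℕ.+ l)) (H (i ℕ.+ l)) n (ℕ.<-≤-trans n<j (ℕ.m≤m+n j (l ℕ.+ l))))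

     first-term : ∀ n j k i c x → j ℕ.+ k ≡ n → ι c ≡ ι (n !) * (inv! j * inv! k) → Value x i k → ι (c ℕ.* x) ≡ ι (n !) * term n j i 0
     first-term n j k i c x refl ec ex = trans (ι-* c x) (trans (cong₂ _*_ ec ex) (trans (r (ι (n !)) (inv! j) (inv! k) (ι (k !)) (H i k))
       (trans (cong (λ z → ι (n !) * (inv! j * H i k) * z) (*-⁻¹ (0<ι! k))) (trans (*-identityʳ _)
         (cong (ι (n !) *_) (trans (sym (E-⊛-at j (H i) k)) (cong₂ (λ u v → (E u ⊛ H v) n) (sym (ℕ.+-identityʳ j)) (sym (ℕ.+-identityʳ i)))))))))
       where
       r : ∀ f a b c h → f * (a * b) * (c * h) ≡ f * (a * h) * (c * b)
       r = solve-∀ ℚ-ring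

   -- The heads of the lists are row `n - j` and the binomial coefficient of n over j. A step raises
   -- `j` by 2 and `i` by 1, exactly as in a layer.
   sumFrom-ok : ∀ n k rs cs j i L → RowsOK k rs → Bins n j k cs → j ℕ.+ k ≡ suc n → k ℕ.≤ L → k ℕ.+ (i ℕ.+ i) ℕ.≤ suc N →
     ι (sumFrom rs cs i) ≡ ι (n !) * S (term n j i) L
   sumFrom-ok n zero          []             []           j i L _ _ j+k _ _ =
     trans ι-0 (sym (trans (cong (ι (n !) *_) (high-terms n j i L (ℕ.≤-reflexive (trans (sym j+k) (ℕ.+-identityʳ j))))) (*-zeroʳ (ι (n !)))))
   sumFrom-ok n (suc zero)    (row ∷ [])     (c ∷ [])     j i (suc L) (ok , _) (ec , _) j+k _ b =
     trans (first-term n j 0 i c (nth row i) j+0≡n ec (ok i (ℕ.≤-pred b)))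
       (cong (ι (n !) *_) (trans (sym (+-identityʳ (term n j i 0))) (cong (λ z → term n j i 0 + z)
         (sym (trans (S-cong L (shift-term n j i)) (high-terms n (suc (suc j)) (suc i) L (ℕ.≤-trans (ℕ.≤-reflexive (cong suc (trans (sym j+0≡n) (ℕ.+-identityʳ j)))) (ℕ.n≤1+n (suc j)))))))))
     where
     j+0≡n : j ℕ.+ 0 ≡ n
     j+0≡n = ℕ.suc-injective (trans (sym (ℕ.+-suc j 0)) j+k)
   sumFrom-ok n (suc (suc k)) (row ∷ _ ∷ rs) (c ∷ _ ∷ cs) j i (suc L) (ok , _ , oks) (ec , _ , bs) j+k (s≤s k≤L) b =
     trans (ι-+ (c ℕ.* nth row i) (sumFrom rs cs (suc i))) (trans (cong₂ _+_
       (first-term n j (suc k) i c (nth row i) (ℕ.suc-injective (trans (sym (ℕ.+-suc j (suc k))) j+k)) ec (ok i (ℕ.≤-pred b)))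
       (trans (sumFrom-ok n k rs cs (suc (suc j)) (suc i) L oks bs (trans (e₁ j k) j+k) (ℕ.≤-trans (ℕ.n≤1+n k) k≤L) (ℕ.≤-trans (ℕ.≤-reflexive (e₂ k i)) b))
         (cong (ι (n !) *_) (S-cong L (λ l → sym (shift-term n j i l))))))
       (sym (*-distribˡ-+ (ι (n !)) (term n j i 0) (S (λ l → term n j i (suc l)) L))))
     where
     e₁ : ∀ j k → suc (suc j) ℕ.+ k ≡ j ℕ.+ suc (suc k)
     e₁ = ℕ-Solver.solve-∀
     e₂ : ∀ k i → k ℕ.+ (suc i ℕ.+ suc i) ≡ suc (suc k) ℕ.+ (i ℕ.+ i)
     e₂ = ℕ-Solver.solve-∀

   private
     drop-1 : ∀ n j k bs → Bins n j (suc k) bs → Bins n (suc j) k (drop 1 bs)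
     drop-1 n j k (c ∷ cs) (_ , ok) = ok

     drop-row : ∀ k rs → RowsOK (suc k) rs → RowsOK k (drop 1 rs)
     drop-row k (row ∷ rs) (_ , ok) = ok

   module _ (n : ℕ) (prev : List (List ℕ)) (bs : List ℕ) (prev-ok : RowsOK n prev) (bs-ok : Bins n 0 (suc n) bs) where

     odd-sum : ∀ r → n ℕ.+ (r ℕ.+ r) ℕ.≤ suc N → ι (sumFrom prev (drop 1 bs) r) ≡ ι (n !) * S (term n 1 r) (suc n)
     odd-sum r b = sumFrom-ok n n prev (drop 1 bs) 1 r (suc n) prev-ok (drop-1 n 0 n bs bs-ok) refl (ℕ.n≤1+n n) b

     even-sum : ∀ r → n ℕ.+ (r ℕ.+ r) ℕ.≤ N → ι (even-entry n prev bs r) ≡ ι (n !) * S (term n 2 (suc r)) (suc n)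
     even-sum r b = by n prev bs prev-ok bs-ok b
       where
       by : ∀ n prev bs → RowsOK n prev → Bins n 0 (suc n) bs → n ℕ.+ (r ℕ.+ r) ℕ.≤ N → ι (even-entry n prev bs r) ≡ ι (n !) * S (term n 2 (suc r)) (suc n)
       by zero    []   (c ∷ [])     _  _              _ = trans ι-0 (sym (trans (cong (ι (0 !) *_) (high-terms 0 2 (suc r) 1 (s≤s z≤n))) (*-zeroʳ (ι (0 !)))))
       by (suc n) prev bs           ok bok            b = sumFrom-ok (suc n) n (drop 1 prev) (drop 2 bs) 2 (suc r) (suc (suc n)) (drop-row n prev ok)
         (subst (Bins (suc n) 2 n) (List.drop-drop 1 1 bs) (drop-1 (suc n) 1 n (drop 1 bs) (drop-1 (suc n) 0 (suc n) bs bok))) refl (ℕ.≤-trans (ℕ.n≤1+n n) (ℕ.n≤1+n (suc n)))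
         (ℕ.≤-trans (ℕ.≤-reflexive (e n r)) (s≤s b))
         where
         e : ∀ n r → n ℕ.+ (suc r ℕ.+ suc r) ≡ suc (suc n ℕ.+ (r ℕ.+ r))
         e = ℕ-Solver.solve-∀

     private
       unit-0 : ∀ n → ι (unit 0 n) ≡ ι (n !) * X n
       unit-0 zero          = trans ι-0 (sym (*-zeroʳ (ι 1)))
       unit-0 (suc zero)    = trans ι-1 (sym (trans (cong (_* 1ℚ) ι-1) refl))
       unit-0 (suc (suc n)) = trans ι-0 (sym (*-zeroʳ (ι (suc (suc n) !))))

       unit-suc : ∀ i n → ι (unit (suc i) n) ≡ ι (n !) * gap 0 (suc i) n
       unit-suc zero    zero    = trans ι-1 (sym (trans (cong (_* 1ℚ) ι-1) refl))
       unit-suc zero    (suc n) = trans ι-0 (sym (*-zeroʳ (ι (suc n !))))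
       unit-suc (suc i) n       = trans ι-0 (sym (trans (cong (λ f → ι (n !) * f n) (gap-0-big i)) (trans (cong (ι (n !) *_) (C0 n)) (*-zeroʳ (ι (n !))))))
         where
         C0 : ∀ n → C 0ℚ n ≡ 0ℚ
         C0 zero    = refl
         C0 (suc n) = refl

     first-ok : n ℕ.≤ N → Value (unit 0 n ℕ.+ even-entry n prev bs 0) 0 n
     first-ok n≤N = trans (ι-+ (unit 0 n) (even-entry n prev bs 0)) (trans (cong₂ _+_ (unit-0 n) (even-sum 0 (ℕ.≤-trans (ℕ.≤-reflexive (ℕ.+-identityʳ n)) n≤N)))
       (trans (sym (*-distribˡ-+ (ι (n !)) (X n) (S (term n 2 1) (suc n)))) (cong (ι (n !) *_) (sym (W-layers (suc n) n ℕ.≤-refl)))))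

     odd-ok : ∀ r → n ℕ.+ (suc r ℕ.+ suc r) ℕ.≤ suc N → Value (odd-entry n prev bs (suc r)) (suc (r ℕ.+ r)) n
     odd-ok r b = trans (ι-+ (unit (suc r ℕ.+ suc r ℕ.∸ 1) n) (sumFrom prev (drop 1 bs) (suc r))) (trans (cong₂ _+_
         (trans (cong (λ z → ι (unit z n)) (ℕ.+-suc r r)) (unit-suc (r ℕ.+ r) n)) (odd-sum (suc r) b))
       (trans (sym (*-distribˡ-+ (ι (n !)) (gap 0 (suc (r ℕ.+ r)) n) (S (term n 1 (suc r)) (suc n))))
         (cong (ι (n !) *_) (sym (H-suc (suc r) 1 (suc (r ℕ.+ r)) (suc n) n (s≤s z≤n) (s≤s z≤n) (s≤s z≤n) (cong suc (sym (ℕ.+-suc r r))) ℕ.≤-refl)))))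

     even-ok : ∀ r x → Value x (suc r) n → n ℕ.+ (suc r ℕ.+ suc r) ℕ.≤ N → Value (x ℕ.+ even-entry n prev bs (suc r)) (suc r ℕ.+ suc r) n
     even-ok r x ex b = trans (ι-+ x (even-entry n prev bs (suc r))) (trans (cong₂ _+_ ex (even-sum (suc r) b))
       (trans (sym (*-distribˡ-+ (ι (n !)) (H (suc r) n) (S (term n 2 (suc (suc r))) (suc n)))) (cong (ι (n !) *_) (sym eq))))
       where
       i-1 = r ℕ.+ suc r
       C0 : ∀ n → C 0ℚ n ≡ 0ℚ
       C0 zero    = refl
       C0 (suc n) = refl
       gap-0 : gap 0 (suc r ℕ.+ suc r) n ≡ 0ℚ
       gap-0 = trans (cong (λ z → gap 0 z n) (cong suc (ℕ.+-suc r r))) (trans (cong (λ f → f n) (gap-0-big (r ℕ.+ r))) (C0 n))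
       eq : H (suc r ℕ.+ suc r) n ≡ H (suc r) n + S (term n 2 (suc (suc r))) (suc n)
       eq = trans (H-suc (suc r) 0 (suc r ℕ.+ suc r) (suc (suc n)) n z≤n (s≤s z≤n) (s≤s z≤n) refl (ℕ.n≤1+n (suc n)))
         (trans (cong₂ _+_ gap-0 (cong₂ _+_ (trans (⊛-cong E-0 (λ i → cong (λ z → H z i) (ℕ.+-identityʳ (suc r))) n) (⊛-identityˡ (H (suc r)) n))
             (S-cong (suc n) (λ l → shift-term n 0 (suc r) l))))
           (+-identityˡ (H (suc r) n + S (term n 2 (suc (suc r))) (suc n))))

     Partial : ℕ → List ℕ → Set
     Partial len cur = length cur ≡ len × ∀ i → i ℕ.< len → n ℕ.+ (i ℕ.+ i) ℕ.≤ N → Value (nth cur i) i n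

     private
       nth-++ˡ : ∀ xs ys i → i ℕ.< length xs → nth (xs ++ ys) i ≡ nth xs i
       nth-++ˡ (x ∷ xs) ys zero    _       = refl
       nth-++ˡ (x ∷ xs) ys (suc i) (s≤s h) = nth-++ˡ xs ys i h
       nth-last : ∀ xs y → nth (xs ++ (y ∷ [])) (length xs) ≡ y
       nth-last []       y = refl
       nth-last (x ∷ xs) y = nth-last xs y

       snoc : ∀ len cur y → Partial len cur → (n ℕ.+ (len ℕ.+ len) ℕ.≤ N → Value y len n) → Partial (suc len) (cur ++ (y ∷ []))
       snoc len cur y (refl , ok) oky = trans (List.length-++ cur) (ℕ.+-comm (length cur) 1) , λ i i<  b → by i b (ℕ.m≤n⇒m<n∨m≡n (ℕ.≤-pred i<))
         where
         by : ∀ i → n ℕ.+ (i ℕ.+ i) ℕ.≤ N → i ℕ.< length cur ⊎ i ≡ length cur → Value (nth (cur ++ (y ∷ [])) i) i n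
         by i b (inj₁ i<) = trans (cong ι (nth-++ˡ cur (y ∷ []) i i<)) (ok i i< b)
         by i b (inj₂ refl) = trans (cong ι (nth-last cur y)) (oky b)

     extend-ok : ∀ r cur → Partial (suc (r ℕ.+ r)) cur → Partial (suc (suc r ℕ.+ suc r)) (extend n prev bs (suc r) cur)
     extend-ok r cur ok = subst (λ z → Partial (suc z) (extend n prev bs (suc r) cur)) (cong suc (sym (ℕ.+-suc r r)))
       (snoc (suc (suc (r ℕ.+ r))) cur′ (nth cur′ (suc r) ℕ.+ even-entry n prev bs (suc r)) ok′
         (λ b → subst (λ z → Value (nth cur′ (suc r) ℕ.+ even-entry n prev bs (suc r)) z n) (cong suc (ℕ.+-suc r r))
           (even-ok r (nth cur′ (suc r)) (proj₂ ok′ (suc r) (s≤s (s≤s (ℕ.m≤m+n r r))) (ℕ.≤-trans (small b) ℕ.≤-refl)) (small b))))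
       where
       cur′ = cur ++ (odd-entry n prev bs (suc r) ∷ [])
       small : n ℕ.+ (suc (suc (r ℕ.+ r)) ℕ.+ suc (suc (r ℕ.+ r))) ℕ.≤ N → n ℕ.+ (suc r ℕ.+ suc r) ℕ.≤ N
       small b = ℕ.≤-trans (ℕ.+-monoʳ-≤ n (ℕ.+-mono-≤ (s≤s (ℕ.≤-trans (ℕ.m≤m+n r r) (ℕ.n≤1+n (r ℕ.+ r)))) (s≤s (ℕ.≤-trans (ℕ.m≤m+n r r) (ℕ.n≤1+n (r ℕ.+ r)))))) b
       odd-small : n ℕ.+ (suc (r ℕ.+ r) ℕ.+ suc (r ℕ.+ r)) ℕ.≤ N → n ℕ.+ (suc r ℕ.+ suc r) ℕ.≤ suc N
       odd-small b = ℕ.≤-trans (ℕ.+-monoʳ-≤ n (ℕ.+-mono-≤ (s≤s (ℕ.m≤m+n r r)) (s≤s (ℕ.m≤m+n r r)))) (ℕ.≤-trans b (ℕ.n≤1+n N))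
       ok′ : Partial (suc (suc (r ℕ.+ r))) cur′
       ok′ = snoc (suc (r ℕ.+ r)) cur (odd-entry n prev bs (suc r)) ok (λ b → odd-ok r (odd-small b))

     build-ok : ∀ p r cur → Partial (suc (r ℕ.+ r)) cur → Partial (suc ((p ℕ.+ r) ℕ.+ (p ℕ.+ r))) (build p n prev bs (suc r) cur)
     build-ok zero    r cur ok = ok
     build-ok (suc p) r cur ok = subst (λ z → Partial (suc (z ℕ.+ z)) (build p n prev bs (suc (suc r)) (extend n prev bs (suc r) cur))) (ℕ.+-suc p r)
       (build-ok p (suc r) (extend n prev bs (suc r) cur) (extend-ok r cur ok))

     new-row-ok : n ℕ.≤ N → RowOK n (new-row N n prev bs)
     new-row-ok n≤N i b = proj₂ (build-ok p 0 (unit 0 n ℕ.+ even-entry n prev bs 0 ∷ []) (refl , λ { zero _ _ → first-ok n≤N ; (suc i) (s≤s ()) _ })) i i< b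
       where
       p = ⌊ N ℕ.∸ n /2⌋
       i≤p : i ℕ.≤ p
       i≤p = subst (ℕ._≤ p) (⌊i+i/2⌋ i) (ℕ.⌊n/2⌋-mono (ℕ.≤-trans (ℕ.≤-reflexive (sym (ℕ.m+n∸m≡n n (i ℕ.+ i)))) (ℕ.∸-monoˡ-≤ n b)))
         where
         open Coins using () renaming (⌊a+a/2⌋ to ⌊i+i/2⌋)
       i< : i ℕ.< suc ((p ℕ.+ 0) ℕ.+ (p ℕ.+ 0))
       i< = s≤s (ℕ.≤-trans i≤p (ℕ.≤-trans (ℕ.≤-reflexive (sym (ℕ.+-identityʳ p))) (ℕ.m≤m+n (p ℕ.+ 0) (p ℕ.+ 0))))

   rows-ok : ∀ k n prev bs → RowsOK n prev → Bins n 0 (suc n) bs → k ℕ.+ n ℕ.≤ suc N → RowsOK (k ℕ.+ n) (rows k N n prev bs)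
   rows-ok zero    n prev bs ok bok _ = ok
   rows-ok (suc k) n prev bs ok bok h = subst (λ z → RowsOK z (rows k N (suc n) (new-row N n prev bs ∷ prev) (1 ∷ pascal bs))) (ℕ.+-suc k n)
     (rows-ok k (suc n) (new-row N n prev bs ∷ prev) (1 ∷ pascal bs)
       (new-row-ok n prev bs ok bok (ℕ.≤-trans (ℕ.m≤n+m n k) (ℕ.≤-pred h)) , ok) (next-bins n bs bok) (ℕ.≤-trans (ℕ.≤-reflexive (ℕ.+-suc k n)) h))

 Ascending : ℕ → List ℕ → Set
 Ascending k []       = ⊤
 Ascending k (w ∷ ws) = ι w ≡ ι (k !) * W k × Ascending (suc k) ws

 ascend-ok : ∀ N k rs acc → Correct.RowsOK N k rs → k ℕ.≤ suc N → Ascending k acc → Ascending 0 (ascend rs acc)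
 ascend-ok N zero    []         acc _          _ ok = ok
 ascend-ok N (suc k) (row ∷ rs) acc (rok , ok) h aok = ascend-ok N k rs (nth row 0 ∷ acc) ok (ℕ.≤-trans (ℕ.n≤1+n k) h)
   (rok 0 (ℕ.≤-trans (ℕ.≤-reflexive (ℕ.+-identityʳ k)) (ℕ.≤-pred h)) , aok)

 numbers-ok : ∀ N → Ascending 0 (numbers N)
 numbers-ok N = ascend-ok N (suc N) (rows (suc N) N 0 [] (1 ∷ [])) []
   (subst (λ z → Correct.RowsOK N z (rows (suc N) N 0 [] (1 ∷ []))) (ℕ.+-identityʳ (suc N))
     (Correct.rows-ok N (suc N) 0 [] (1 ∷ []) tt (trans ι-1 (sym (n!*inv! 0)) , tt) (ℕ.≤-reflexive (ℕ.+-identityʳ (suc N))))) ℕ.≤-refl tt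

-- Decimal enclosures of θ, of the moments and of λ²

module Numerics where

 open import Data.Bool.Base using (Bool; true; _∧_; T)
 open import Data.List.Base using (List; []; _∷_; length)
 open import Data.Nat.Base using (_!; _≤ᵇ_)
 open import Data.Unit.Base using (tt)
 open RationalArithmetic hiding (_≤ᵇ_)
 open PowerSeries hiding (D)
 open Coins using (central; central-ratio)
 open Wallis
 open Representations
 open Maxima
 open Growth
 open Tilt
 open TiltedLaw using (Enclosure)
 open Asymptotics
 open Table

 frac : ℕ → ℕ → ℚ
 frac a b = ι a * ι b ⁻¹

 private
   ∧-split : ∀ {x y} → x ∧ y ≡ true → x ≡ true × y ≡ true
   ∧-split {true} {true} _ = refl , refl

   ≤-true : ∀ {m n} → (m ≤ᵇ n) ≡ true → m ℕ.≤ n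
   ≤-true {m} {n} e = ℕ.≤ᵇ⇒≤ m n (subst T (sym e) tt)

 -- With x = p/D, the pair (A, B) satisfies M j x k = A/B, where B = k! Dᵏ and P = pᵏ.
 accumulate : (j p D k P B A : ℕ) → List ℕ → ℕ × ℕ
 accumulate j p D k P B A []       = A , B
 accumulate j p D k P B A (w ∷ ws) = accumulate j p D (suc k) (P ℕ.* p) (B ℕ.* (suc k ℕ.* D)) ((A ℕ.+ k ℕ.^ j ℕ.* (w ℕ.* P)) ℕ.* (suc k ℕ.* D)) ws

 private
   accumulate-ok : ∀ j p D-1 k P B A ws → let D = suc D-1; x = frac p D in
     ι P ≡ ι p ^ k → ι B ≡ ι (k !) * ι D ^ k → ι A ≡ M j x k * ι B → Ascending k ws →
     let A′ , B′ = accumulate j p D k P B A ws in ι A′ ≡ M j x (k ℕ.+ length ws) * ι B′ × 0ℚ < ι B′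
   accumulate-ok j p D-1 k P B A []       eP eB eA _ = subst (λ z → ι A ≡ M j (frac p (suc D-1)) z * ι B) (sym (ℕ.+-identityʳ k)) eA
     , subst (0ℚ <_) (sym eB) (0<* (0<ι! k) (^-pos k (0<ι D-1)))
   accumulate-ok j p D-1 k P B A (w ∷ ws) eP eB eA (ew , asc) =
     subst (λ z → ι A′ ≡ M j x z * ι B′ × 0ℚ < ι B′) (sym (ℕ.+-suc k (length ws)))
       (accumulate-ok j p D-1 (suc k) (P ℕ.* p) (B ℕ.* (suc k ℕ.* D)) ((A ℕ.+ k ℕ.^ j ℕ.* (w ℕ.* P)) ℕ.* (suc k ℕ.* D)) ws
         (trans (ι-* P p) (trans (cong (_* ι p) eP) (*-comm (ι p ^ k) (ι p)))) eB′ eA′ asc)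
     where
     D = suc D-1
     x = frac p D
     A′ = proj₁ (accumulate j p D k P B A (w ∷ ws))
     B′ = proj₂ (accumulate j p D k P B A (w ∷ ws))
     kD : ι (suc k ℕ.* D) ≡ ι (suc k) * ι D
     kD = ι-* (suc k) D
     eB′ : ι (B ℕ.* (suc k ℕ.* D)) ≡ ι (suc k !) * ι D ^ suc k
     eB′ = trans (ι-* B (suc k ℕ.* D)) (trans (cong₂ _*_ eB kD) (trans (r (ι (k !)) (ι D ^ k) (ι (suc k)) (ι D)) (cong (_* (ι D * ι D ^ k)) (sym (ι-* (suc k) (k !))))))
       where
       r : ∀ f d s e → f * d * (s * e) ≡ s * f * (e * d)
       r = solve-∀ ℚ-ring
     xᵏB : x ^ k * ι B ≡ ι (k !) * ι p ^ k
     xᵏB = trans (cong₂ _*_ (^-distrib-* (ι p) (ι D ⁻¹) k) eB) (trans (r (ι p ^ k) ((ι D ⁻¹) ^ k) (ι (k !)) (ι D ^ k))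
       (trans (cong (λ z → ι (k !) * ι p ^ k * z) (trans (sym (^-distrib-* (ι D ⁻¹) (ι D) k)) (trans (cong (_^ k) (⁻¹-* (0<ι D-1))) (1^ k)))) (*-identityʳ (ι (k !) * ι p ^ k))))
       where
       r : ∀ a b c d → a * b * (c * d) ≡ c * a * (b * d)
       r = solve-∀ ℚ-ring
     new : ι (k ℕ.^ j ℕ.* (w ℕ.* P)) ≡ ι k ^ j * weight x W k * ι B
     new = trans (ι-* (k ℕ.^ j) (w ℕ.* P)) (trans (cong₂ _*_ (ι-^ k j) (trans (ι-* w P) (cong₂ _*_ ew eP)))
       (trans (r (ι k ^ j) (ι (k !)) (W k) (ι p ^ k)) (trans (cong (ι k ^ j * W k *_) (sym xᵏB)) (r′ (ι k ^ j) (W k) (x ^ k) (ι B)))))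
       where
       r : ∀ a f w p → a * (f * w * p) ≡ a * w * (f * p)
       r = solve-∀ ℚ-ring
       r′ : ∀ a w x b → a * w * (x * b) ≡ a * (w * x) * b
       r′ = solve-∀ ℚ-ring
     eA′ : ι ((A ℕ.+ k ℕ.^ j ℕ.* (w ℕ.* P)) ℕ.* (suc k ℕ.* D)) ≡ M j x (suc k) * ι (B ℕ.* (suc k ℕ.* D))
     eA′ = trans (ι-* (A ℕ.+ k ℕ.^ j ℕ.* (w ℕ.* P)) (suc k ℕ.* D)) (trans (cong (_* ι (suc k ℕ.* D)) (trans (ι-+ A (k ℕ.^ j ℕ.* (w ℕ.* P))) (cong₂ _+_ eA new)))
       (trans (r (M j x k) (ι k ^ j * weight x W k) (ι B) (ι (suc k ℕ.* D))) (cong₂ _*_ (sym (S-last (λ k → ι k ^ j * weight x W k) k)) (sym (ι-* B (suc k ℕ.* D))))))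
       where
       r : ∀ m n b c → (m * b + n * b) * c ≡ (m + n) * (b * c)
       r = solve-∀ ℚ-ring

 partial-moment : ℕ → ℕ → ℕ → List ℕ → ℕ × ℕ
 partial-moment j p D ws = accumulate j p D 0 1 1 0 ws

 partial-moment-ok : ∀ j p D-1 ws → Ascending 0 ws → let A , B = partial-moment j p (suc D-1) ws in
   ι A ≡ M j (frac p (suc D-1)) (length ws) * ι B × 0ℚ < ι B
 partial-moment-ok j p D-1 ws asc = accumulate-ok j p D-1 0 1 1 0 ws ι-1 (trans ι-1 (sym (trans (cong (_* 1ℚ) ι-1) refl))) (trans ι-0 (sym (*-zeroˡ (ι 1)))) asc

 private
   -- q₀ρ₀ = 0.576 lies just above θ. For arguments up to it, the moments beyond the first 111 terms
   -- are at most 111² q₀¹¹¹ times the bound 21 of `W-growth`, and `tiny` puts this below 10⁻¹⁰.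
   q₀ : ℚ
   q₀ = + 18 / 25

   0≤q₀ : 0ℚ ≤ q₀
   0≤q₀ = ≥0 q₀

   -- The certificate for q₀(k + 1)² ≤ k² is expanded at 100, where all its coefficients are
   -- positive.
   square-decay : ∀ i → ι (111 ℕ.+ i) ^ 2 * q₀ ^ (111 ℕ.+ i) ≤ ι 111 ^ 2 * q₀ ^ 111
   square-decay zero    = ≤-reflexive (cong (λ z → ι z ^ 2 * q₀ ^ z) (ℕ.+-identityʳ 111))
   square-decay (suc i) = ≤-trans (≤-reflexive (cong (λ z → ι z ^ 2 * q₀ ^ z) (ℕ.+-suc 111 i))) (≤-trans
     (≤-trans (≤-reflexive (trans (cong (λ z → z ^ 2 * (q₀ * Q)) (ι-suc (111 ℕ.+ i))) (r₁ k q₀ Q)))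
       (≤-trans (*-monoʳ (^-nonneg (111 ℕ.+ i) 0≤q₀) (≤-cert {a = (k + 1ℚ) * (k + 1ℚ) * q₀} {b = k ^ 2} (0≤+ (0≤+ (0≤* (≥0 (+ 7 / 25)) (0≤* (0≤-diff 100≤k) (0≤-diff 100≤k))) (0≤* (≥0 (+ 1364 / 25)) (0≤-diff 100≤k))) (≥0 (+ 66382 / 25))) (r₂ k))) ≤-refl))
     (square-decay i))
     where
     k = ι (111 ℕ.+ i)
     Q = q₀ ^ (111 ℕ.+ i)
     100≤k : + 100 / 1 ≤ k
     100≤k = subst (_≤ k) (ι≡ 100) (ι-mono (ℕ.≤-trans (ℕ.≤ᵇ⇒≤ 100 111 tt) (ℕ.m≤m+n 111 i)))
     r₁ : ∀ k q Q → (k + 1ℚ) * ((k + 1ℚ) * 1ℚ) * (q * Q) ≡ (k + 1ℚ) * (k + 1ℚ) * q * Q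
     r₁ = solve-∀ ℚ-ring
     r₂ : ∀ k → + 7 / 25 * ((k - + 100 / 1) * (k - + 100 / 1)) + + 1364 / 25 * (k - + 100 / 1) + + 66382 / 25 ≡ k * (k * 1ℚ) - (k + 1ℚ) * (k + 1ℚ) * (+ 18 / 25)
     r₂ = solve-∀ ℚ-ring

 D₀ : ℕ
 D₀ = 10000000000

 private
   q₀^≡ : ∀ n → q₀ ^ n * ι (25 ℕ.^ n) ≡ ι (18 ℕ.^ n)
   q₀^≡ n = trans (cong (q₀ ^ n *_) (ι-^ 25 n)) (trans (sym (^-distrib-* q₀ (ι 25) n)) (trans (cong (_^ n) (trans (cong (q₀ *_) (ι≡ 25)) (sym (ι≡ 18)))) (sym (ι-^ 18 n))))

   0<25^ : ∀ n → 0ℚ < ι (25 ℕ.^ n)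
   0<25^ n = subst (0ℚ <_) (sym (ι-^ 25 n)) (^-pos n (0<ι 24))

   tiny-ℕ : 21 ℕ.* (111 ℕ.* 111) ℕ.* 18 ℕ.^ 111 ℕ.* D₀ ℕ.≤ 25 ℕ.^ 111
   tiny-ℕ = ℕ.≤ᵇ⇒≤ (21 ℕ.* (111 ℕ.* 111) ℕ.* 18 ℕ.^ 111 ℕ.* D₀) (25 ℕ.^ 111) tt

 abstract
   tiny : ι 111 ^ 2 * q₀ ^ 111 * (+ 21 / 1) ≤ ι D₀ ⁻¹
   tiny = ≤-trans (≤-÷ {c = ι 111 ^ 2 * q₀ ^ 111 * (+ 21 / 1)} (0<ι 9999999999) (*-cancelˡ-≤ (0<25^ 111) (begin
     ι (25 ℕ.^ 111) * (ι 111 ^ 2 * q₀ ^ 111 * (+ 21 / 1) * ι D₀) ≡⟨ r (ι (25 ℕ.^ 111)) (ι 111) (q₀ ^ 111) (+ 21 / 1) (ι D₀) ⟩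
     + 21 / 1 * (ι 111 * ι 111) * (q₀ ^ 111 * ι (25 ℕ.^ 111)) * ι D₀ ≡⟨ cong₂ (λ u v → u * v * (q₀ ^ 111 * ι (25 ℕ.^ 111)) * ι D₀) (sym (ι≡ 21)) (sym (ι-* 111 111)) ⟩
     ι 21 * ι (111 ℕ.* 111) * (q₀ ^ 111 * ι (25 ℕ.^ 111)) * ι D₀ ≡⟨ cong₂ (λ u v → u * v * ι D₀) (sym (ι-* 21 (111 ℕ.* 111))) (q₀^≡ 111) ⟩
     ι (21 ℕ.* (111 ℕ.* 111)) * ι (18 ℕ.^ 111) * ι D₀ ≡⟨ trans (cong (_* ι D₀) (sym (ι-* (21 ℕ.* (111 ℕ.* 111)) (18 ℕ.^ 111)))) (sym (ι-* (21 ℕ.* (111 ℕ.* 111) ℕ.* 18 ℕ.^ 111) D₀)) ⟩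
     ι (21 ℕ.* (111 ℕ.* 111) ℕ.* 18 ℕ.^ 111 ℕ.* D₀) ≤⟨ ι-mono tiny-ℕ ⟩
     ι (25 ℕ.^ 111) ≡⟨ sym (*-identityʳ (ι (25 ℕ.^ 111))) ⟩
     ι (25 ℕ.^ 111) * 1ℚ ∎))) (≤-reflexive (*-identityˡ (ι D₀ ⁻¹)))
     where
     open ≤-Reasoning
     r : ∀ e a q t d → e * (a * (a * 1ℚ) * q * t * d) ≡ t * (a * a) * (q * e) * d
     r = solve-∀ ℚ-ring

 moment-beyond : ∀ j → j ℕ.≤ 2 → ∀ {x} → 0ℚ ≤ x → x ≤ q₀ * ρ₀ → ∀ N → M j x N ≤ M j x 111 + ι D₀ ⁻¹
 moment-beyond j j≤2 {x} 0≤x x≤ N = ≤-trans (moment-mono-N j 0≤x (ℕ.m≤n+m N 111)) (≤-trans (≤-reflexive (S-+ (λ k → ι k ^ j * weight x W k) 111 N))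
   (+-monoʳ-≤ (M j x 111) (≤-trans (S-mono N term) (≤-trans (≤-reflexive (S-scale (ι 111 ^ 2 * q₀ ^ 111) (λ i → weight ρ₀ W (111 ℕ.+ i)) N))
     (≤-trans (*-monoˡ (0≤* (^-nonneg 2 (0≤ι 111)) (^-nonneg 111 0≤q₀)) (≤-trans late (W-growth (111 ℕ.+ N)))) tiny)))))
   where
   late : S (λ i → weight ρ₀ W (111 ℕ.+ i)) N ≤ S (weight ρ₀ W) (111 ℕ.+ N)
   late = subst₂ _≤_ (+-identityˡ _) (sym (S-+ (weight ρ₀ W) 111 N)) (+-monoˡ-≤ (S (λ i → weight ρ₀ W (111 ℕ.+ i)) N) (S-nonneg 111 (Nonneg-weight 0≤ρ₀ Nonneg-W)))
   term : ∀ i → ι (111 ℕ.+ i) ^ j * weight x W (111 ℕ.+ i) ≤ ι 111 ^ 2 * q₀ ^ 111 * weight ρ₀ W (111 ℕ.+ i)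
   term i = begin
     ι k ^ j * (W k * x ^ k) ≤⟨ *-mono-≤ (^-nonneg j (0≤ι k)) (Nonneg-weight 0≤x Nonneg-W k) j-to-2 (*-monoˡ (Nonneg-W k) (^-mono-≤ k 0≤x x≤)) ⟩
     ι k ^ 2 * (W k * (q₀ * ρ₀) ^ k) ≡⟨ cong (λ z → ι k ^ 2 * (W k * z)) (^-distrib-* q₀ ρ₀ k) ⟩
     ι k ^ 2 * (W k * (q₀ ^ k * ρ₀ ^ k)) ≡⟨ r (ι k ^ 2) (W k) (q₀ ^ k) (ρ₀ ^ k) ⟩
     ι k ^ 2 * q₀ ^ k * (W k * ρ₀ ^ k) ≤⟨ *-monoʳ (Nonneg-weight 0≤ρ₀ Nonneg-W k) (square-decay i) ⟩
     ι 111 ^ 2 * q₀ ^ 111 * (W k * ρ₀ ^ k) ∎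
     where
     open ≤-Reasoning
     k = 111 ℕ.+ i
     r : ∀ a w q p → a * (w * (q * p)) ≡ a * q * (w * p)
     r = solve-∀ ℚ-ring
     j-to-2 : ι k ^ j ≤ ι k ^ 2
     j-to-2 = let o , j+o≡2 = ℕ.m≤n⇒∃[o]m+o≡n j≤2 in ≤-trans (≤-reflexive (sym (*-identityʳ (ι k ^ j))))
       (≤-trans (*-monoˡ (^-nonneg j (0≤ι k)) (1≤^ o (1≤ι (110 ℕ.+ i)))) (≤-reflexive (trans (sym (^-+ (ι k) j o)) (cong (ι k ^_) j+o≡2))))

 -- The enclosure of θ = 0.57071698259…

 private
   -- Cross-multiplied comparisons of A/B with m/D. `above` reserves 1/D for the tail.
   below above : ℕ → ℕ → ℕ × ℕ → Bool
   below D m (A , B) = B ℕ.* m ≤ᵇ A ℕ.* D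
   above D m (A , B) = A ℕ.* D ℕ.+ B ≤ᵇ B ℕ.* m

   -- Numerators over `D₀`: an interval of length 10⁻¹⁰ around θ, then bounds for the first and for
   -- the second moment on it.
   pa pb l₁ u₁ l₂ u₂ : ℕ
   pa = 5707169825
   pb = 5707169826
   l₁ = 22287989100
   u₁ = 22287989200
   l₂ = 95928191900
   u₂ = 95928192100

   check : List ℕ → Bool
   check ws = above D₀ D₀ (partial-moment 0 pa D₀ ws) ∧ (below D₀ D₀ (partial-moment 0 pb D₀ ws)
     ∧ (below D₀ l₁ (partial-moment 1 pa D₀ ws) ∧ (above D₀ u₁ (partial-moment 1 pb D₀ ws)
     ∧ (below D₀ l₂ (partial-moment 2 pa D₀ ws) ∧ (above D₀ u₂ (partial-moment 2 pb D₀ ws)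
     ∧ (length ws ℕ.≡ᵇ 111))))))

   below-ok : ∀ D m {A B Q} → ι A ≡ Q * ι B → 0ℚ < ι B → below (suc D) m (A , B) ≡ true → frac m (suc D) ≤ Q
   below-ok D m {A} {B} {Q} eA 0<B h = ÷-≤ (0<ι D) (*-cancelˡ-≤ 0<B (begin
     ι B * ι m ≡⟨ ι-* B m ⟨
     ι (B ℕ.* m) ≤⟨ ι-mono (≤-true h) ⟩
     ι (A ℕ.* (suc D)) ≡⟨ ι-* A (suc D) ⟩
     ι A * ι (suc D) ≡⟨ cong (_* ι (suc D)) eA ⟩
     Q * ι B * ι (suc D) ≡⟨ r Q (ι B) (ι (suc D)) ⟩
     ι B * (Q * ι (suc D)) ∎))
     where
     open ≤-Reasoning
     r : ∀ q b d → q * b * d ≡ b * (q * d)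
     r = solve-∀ ℚ-ring

   above-ok : ∀ D m {A B Q} → ι A ≡ Q * ι B → 0ℚ < ι B → above (suc D) m (A , B) ≡ true → Q + ι (suc D) ⁻¹ ≤ frac m (suc D)
   above-ok D m {A} {B} {Q} eA 0<B h = ≤-÷ (0<ι D) (*-cancelˡ-≤ 0<B (begin
     ι B * ((Q + ι (suc D) ⁻¹) * ι (suc D)) ≡⟨ r (ι B) Q (ι (suc D)) (ι (suc D) ⁻¹) ⟩
     Q * ι B * ι (suc D) + ι B * (ι (suc D) * ι (suc D) ⁻¹) ≡⟨ cong₂ _+_ (cong (_* ι (suc D)) (sym eA)) (trans (cong (ι B *_) (*-⁻¹ (0<ι D))) (*-identityʳ (ι B))) ⟩
     ι A * ι (suc D) + ι B ≡⟨ cong (_+ ι B) (sym (ι-* A (suc D))) ⟩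
     ι (A ℕ.* (suc D)) + ι B ≡⟨ ι-+ (A ℕ.* (suc D)) B ⟨
     ι (A ℕ.* (suc D) ℕ.+ B) ≤⟨ ι-mono (≤-true h) ⟩
     ι (B ℕ.* m) ≡⟨ ι-* B m ⟩
     ι B * ι m ∎))
     where
     open ≤-Reasoning
     r : ∀ b q d i → b * ((q + i) * d) ≡ q * b * d + b * (d * i)
     r = solve-∀ ℚ-ring

 record MomentBounds (n : ℕ) : Set where
   field
     low₀  : M 0 (frac pa D₀) n + ι D₀ ⁻¹ ≤ 1ℚ
     high₀ : 1ℚ ≤ M 0 (frac pb D₀) n
     low₁  : frac l₁ D₀ ≤ M 1 (frac pa D₀) n
     high₁ : M 1 (frac pb D₀) n + ι D₀ ⁻¹ ≤ frac u₁ D₀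
     low₂  : frac l₂ D₀ ≤ M 2 (frac pa D₀) n
     high₂ : M 2 (frac pb D₀) n + ι D₀ ⁻¹ ≤ frac u₂ D₀

 private
   bounds-from : ∀ ws → Ascending 0 ws → check ws ≡ true → MomentBounds 111
   bounds-from ws asc h = subst MomentBounds len≡ (record
     { low₀  = subst (M 0 (frac pa D₀) (length ws) + ι D₀ ⁻¹ ≤_) one (up 0 pa D₀ (proj₁ h₁))
     ; high₀ = subst (_≤ M 0 (frac pb D₀) (length ws)) one (lo 0 pb D₀ (proj₁ h₂))
     ; low₁  = lo 1 pa l₁ (proj₁ h₃)
     ; high₁ = up 1 pb u₁ (proj₁ h₄)
     ; low₂  = lo 2 pa l₂ (proj₁ h₅)
     ; high₂ = up 2 pb u₂ (proj₁ h₆) })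
     where
     h₁ = ∧-split h
     h₂ = ∧-split (proj₂ h₁)
     h₃ = ∧-split (proj₂ h₂)
     h₄ = ∧-split (proj₂ h₃)
     h₅ = ∧-split (proj₂ h₄)
     h₆ = ∧-split (proj₂ h₅)
     len≡ : length ws ≡ 111
     len≡ = ℕ.≡ᵇ⇒≡ (length ws) 111 (subst T (sym (proj₂ h₆)) tt)
     one : frac D₀ D₀ ≡ 1ℚ
     one = *-⁻¹ (0<ι 9999999999)
     lo : ∀ j p m → below D₀ m (partial-moment j p D₀ ws) ≡ true → frac m D₀ ≤ M j (frac p D₀) (length ws)
     lo j p m e = below-ok 9999999999 m {Q = M j (frac p D₀) (length ws)} (proj₁ (partial-moment-ok j p 9999999999 ws asc)) (proj₂ (partial-moment-ok j p 9999999999 ws asc)) e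
     up : ∀ j p m → above D₀ m (partial-moment j p D₀ ws) ≡ true → M j (frac p D₀) (length ws) + ι D₀ ⁻¹ ≤ frac m D₀
     up j p m e = above-ok 9999999999 m {Q = M j (frac p D₀) (length ws)} (proj₁ (partial-moment-ok j p 9999999999 ws asc)) (proj₂ (partial-moment-ok j p 9999999999 ws asc)) e

 private
   bounds-at : ∀ N → check (numbers N) ≡ true → MomentBounds 111
   bounds-at N = bounds-from (numbers N) (numbers-ok N)

 abstract
   moment-bounds : MomentBounds 111
   -- Here the table of 111 coefficients and all comparisons of `check` are evaluated; the abstract
   -- block prevents later evaluations.
   moment-bounds = bounds-at 110 refl

 private
   frac≡ : ∀ m → frac m D₀ ≡ + m / D₀
   frac≡ m = sym (/-≡ m D₀)

   pa≤q₀ρ₀ : frac pa D₀ ≤ q₀ * ρ₀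
   pa≤q₀ρ₀ = subst (_≤ q₀ * ρ₀) (sym (frac≡ pa)) (≤ᵇ⇒≤ {+ pa / D₀} {q₀ * ρ₀} _)

   pb≤q₀ρ₀ : frac pb D₀ ≤ q₀ * ρ₀
   pb≤q₀ρ₀ = subst (_≤ q₀ * ρ₀) (sym (frac≡ pb)) (≤ᵇ⇒≤ {+ pb / D₀} {q₀ * ρ₀} _)

   0≤frac : ∀ m → 0ℚ ≤ frac m D₀
   0≤frac m = 0≤* (0≤ι m) (0≤⁻¹ (0<ι 9999999999))

   beyond : ∀ n → n ≡ 111 → ∀ j → j ℕ.≤ 2 → ∀ {x} → 0ℚ ≤ x → x ≤ q₀ * ρ₀ → ∀ N → M j x N ≤ M j x n + ι D₀ ⁻¹
   beyond n refl = moment-beyond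

   -- The number of terms is kept a variable: M would unfold at a numeral.
   enclosure-for : ∀ N₀ → 3 ℕ.+ N₀ ≡ 111 → Enclosure
   enclosure-for N₀ N₀≡ = record
     { a = + pa / D₀ ; b = + pb / D₀ ; N₀ = N₀
     ; ½≤a = ≤ᵇ⇒≤ {½} {+ pa / D₀} _
     ; a≤b = ≤ᵇ⇒≤ {+ pa / D₀} {+ pb / D₀} _
     ; b≤  = ≤ᵇ⇒≤ {+ pb / D₀} {+ 3 / 5} _
     ; low = λ N → subst (λ x → M 0 x N ≤ 1ℚ) (frac≡ pa) (≤-trans (below-b 0 z≤n (0≤frac pa) pa≤q₀ρ₀ N) low₀)
     ; high = subst (λ x → 1ℚ ≤ M 0 x (3 ℕ.+ N₀)) (frac≡ pb) high₀
     ; lo₁ = + l₁ / D₀ ; hi₁ = + u₁ / D₀ ; lo₂ = + l₂ / D₀ ; hi₂ = + u₂ / D₀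
     ; lo₁≤ = subst₂ (λ l x → l ≤ M 1 x (3 ℕ.+ N₀)) (frac≡ l₁) (frac≡ pa) low₁
     ; ≤hi₁ = λ N → subst₂ (λ l x → M 1 x N ≤ l) (frac≡ u₁) (frac≡ pb) (≤-trans (below-b 1 (s≤s z≤n) (0≤frac pb) pb≤q₀ρ₀ N) high₁)
     ; lo₂≤ = subst₂ (λ l x → l ≤ M 2 x (3 ℕ.+ N₀)) (frac≡ l₂) (frac≡ pa) low₂
     ; ≤hi₂ = λ N → subst₂ (λ l x → M 2 x N ≤ l) (frac≡ u₂) (frac≡ pb) (≤-trans (below-b 2 (s≤s (s≤s z≤n)) (0≤frac pb) pb≤q₀ρ₀ N) high₂)
     ; 2≤lo₁ = ≤ᵇ⇒≤ {+ 2 / 1} {+ l₁ / D₀} _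
     ; hi₁≤3 = ≤ᵇ⇒≤ {+ u₁ / D₀} {+ 3 / 1} _
     ; 4≤var = ≤ᵇ⇒≤ {+ 4 / 1} {+ l₂ / D₀ - + u₁ / D₀ * (+ u₁ / D₀)} _
     ; var≤5 = ≤ᵇ⇒≤ {+ u₂ / D₀ - + l₁ / D₀ * (+ l₁ / D₀)} {+ 5 / 1} _ }
     where
     open MomentBounds (subst MomentBounds (sym N₀≡) moment-bounds)
     below-b : ∀ j → j ℕ.≤ 2 → ∀ {x} → 0ℚ ≤ x → x ≤ q₀ * ρ₀ → ∀ N → M j x N ≤ M j x (3 ℕ.+ N₀) + ι D₀ ⁻¹
     below-b = beyond (3 ℕ.+ N₀) N₀≡

 abstract
   enclosure : Enclosure
   enclosure = enclosure-for 108 refl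

   -- The excess 10⁻⁹ in the second part provides the positive gap demanded by the strict upper
   -- bound for ν.
   root-bounds : let open Enclosure enclosure in + 17521819 / 10000000 * b ≤ 1ℚ × + 1000000001 / 1000000000 ≤ + 17521820 / 10000000 * a
   root-bounds = ≤ᵇ⇒≤ {+ 17521819 / 10000000 * (+ pb / D₀)} {1ℚ} _ , ≤ᵇ⇒≤ {+ 1000000001 / 1000000000} {+ 17521820 / 10000000 * (+ pa / D₀)} _

   -- λ² is 1/π times the mean over twice the variance, with 1/π between 0.31830987 and 0.31830989;
   -- denominators are cleared.
   λ²-bounds : let open Enclosure enclosure in
     + 7669259 / 100000000 * (+ 2 / 1 * (hi₂ - lo₁ * lo₁)) ≤ lo₁ * (+ 31830987 / 100000000)
     × hi₁ * (+ 31830989 / 100000000) ≤ + 7669262 / 100000000 * (+ 2 / 1 * (lo₂ - hi₁ * hi₁))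
   λ²-bounds = ≤ᵇ⇒≤ {+ 7669259 / 100000000 * (+ 2 / 1 * (+ u₂ / D₀ - + l₁ / D₀ * (+ l₁ / D₀)))} {+ l₁ / D₀ * (+ 31830987 / 100000000)} _
     , ≤ᵇ⇒≤ {+ u₁ / D₀ * (+ 31830989 / 100000000)} {+ 7669262 / 100000000 * (+ 2 / 1 * (+ l₂ / D₀ - + u₁ / D₀ * (+ u₁ / D₀)))} _

 -- The value of λ²

 private
   numerator-of denominator-of : ℕ → ℕ
   numerator-of zero      = 1
   numerator-of (suc a)   = numerator-of a ℕ.* suc (a ℕ.+ a)
   denominator-of zero    = 1
   denominator-of (suc a) = denominator-of a ℕ.* (suc a ℕ.+ suc a)

   central-fraction : ∀ a → central a * ι (denominator-of a) ≡ ι (numerator-of a) × 0ℚ < ι (denominator-of a)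
   central-fraction zero    = trans (cong (1ℚ *_) ι-1) (sym ι-1) , 0<ι 0
   central-fraction (suc a) = (begin
       central (suc a) * ι (denominator-of a ℕ.* (suc a ℕ.+ suc a)) ≡⟨ cong (central (suc a) *_) den ⟩
       central (suc a) * (d * (ι a + 1ℚ + (ι a + 1ℚ))) ≡⟨ r₁ (central (suc a)) d (ι a + 1ℚ + (ι a + 1ℚ)) ⟩
       d * ((ι a + 1ℚ + (ι a + 1ℚ)) * central (suc a)) ≡⟨ cong (d *_) (central-ratio a) ⟩
       d * ((ι a + ι a + 1ℚ) * central a) ≡⟨ r₂ d (ι a + ι a + 1ℚ) (central a) ⟩
       central a * d * (ι a + ι a + 1ℚ) ≡⟨ cong₂ _*_ (proj₁ (central-fraction a)) (sym (trans (ι-suc (a ℕ.+ a)) (cong (_+ 1ℚ) (ι-+ a a)))) ⟩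
       ι (numerator-of a) * ι (suc (a ℕ.+ a)) ≡⟨ ι-* (numerator-of a) (suc (a ℕ.+ a)) ⟨
       ι (numerator-of a ℕ.* suc (a ℕ.+ a)) ∎)
     , subst (0ℚ <_) (sym (ι-* (denominator-of a) (suc a ℕ.+ suc a))) (0<* (proj₂ (central-fraction a)) (0<ι (a ℕ.+ suc a)))
     where
     open ≡-Reasoning
     d = ι (denominator-of a)
     den : ι (denominator-of a ℕ.* (suc a ℕ.+ suc a)) ≡ d * (ι a + 1ℚ + (ι a + 1ℚ))
     den = trans (ι-* (denominator-of a) (suc a ℕ.+ suc a)) (cong (d *_) (trans (ι-+ (suc a) (suc a)) (cong₂ _+_ (ι-suc a) (ι-suc a))))
     r₁ : ∀ c d e → c * (d * e) ≡ d * (e * c)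
     r₁ = solve-∀ ℚ-ring
     r₂ : ∀ d e c → d * (e * c) ≡ c * d * e
     r₂ = solve-∀ ℚ-ring

   square-fraction : ℕ → ℕ × ℕ
   square-fraction a = numerator-of a ℕ.* numerator-of a , denominator-of a ℕ.* denominator-of a

   square-fraction-ok : ∀ a → let A , B = square-fraction a in ι A ≡ central a * central a * ι B × 0ℚ < ι B
   square-fraction-ok a = (begin
       ι (numerator-of a ℕ.* numerator-of a) ≡⟨ ι-* (numerator-of a) (numerator-of a) ⟩
       ι (numerator-of a) * ι (numerator-of a) ≡⟨ cong (λ z → z * z) (sym (proj₁ (central-fraction a))) ⟩
       central a * d * (central a * d) ≡⟨ r (central a) d ⟩
       central a * central a * (d * d) ≡⟨ cong (central a * central a *_) (sym (ι-* (denominator-of a) (denominator-of a))) ⟩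
       central a * central a * ι (denominator-of a ℕ.* denominator-of a) ∎)
     , subst (0ℚ <_) (sym (ι-* (denominator-of a) (denominator-of a))) (0<* (proj₂ (central-fraction a)) (proj₂ (central-fraction a)))
     where
     open ≡-Reasoning
     d = ι (denominator-of a)
     r : ∀ c d → c * d * (c * d) ≡ c * c * (d * d)
     r = solve-∀ ℚ-ring

   D₁ : ℕ
   D₁ = 10000000000000

   central²-lower : ∀ a m → below D₁ m (square-fraction a) ≡ true → frac m D₁ ≤ central a * central a
   central²-lower a m e = below-ok 9999999999999 m {Q = central a * central a} (proj₁ (square-fraction-ok a)) (proj₂ (square-fraction-ok a)) e

   central²-upper : ∀ a m → above D₁ m (square-fraction a) ≡ true → central a * central a ≤ frac m D₁
   central²-upper a m e = ≤-trans (subst (_≤ central a * central a + ι D₁ ⁻¹) (+-identityʳ (central a * central a)) (+-monoʳ-≤ (central a * central a) (0≤⁻¹ (0<ι 9999999999999))))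
     (above-ok 9999999999999 m {Q = central a * central a} (proj₁ (square-fraction-ok a)) (proj₂ (square-fraction-ok a)) e)

   -- At 1000 the gap between the bounds for 1/π is about 10⁻⁸, small enough for the decimals of λ.
   -- A variable with an equation, instead of a numeral, keeps `central` from being unfolded there.
   wal-bounds : ∀ a → a ≡ 1000 → + 31830987 / 100000000 ≤ wal a × wal a + wal-gap a ≤ + 31830989 / 100000000
   wal-bounds a a≡ = lower , upper
     where
     c = central a * central a
     ιa : ι a ≡ + 1000 / 1
     ιa = trans (cong ι a≡) (ι≡ 1000)
     ιa⁻¹ : ι a ⁻¹ ≡ + 1 / 1000
     ιa⁻¹ = sym (⁻¹-unique (subst (0ℚ <_) (sym ιa) (>0 (+ 1000 / 1))) (cong (_* (+ 1 / 1000)) ιa))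
     lo : + 3182303186 / D₁ ≤ c
     lo = subst (_≤ c) (sym (/-≡ 3182303186 D₁)) (central²-lower a 3182303186 (subst (λ z → below D₁ 3182303186 (square-fraction z) ≡ true) (sym a≡) refl))
     hi : c ≤ + 3182303188 / D₁
     hi = subst (c ≤_) (sym (/-≡ 3182303188 D₁)) (central²-upper a 3182303188 (subst (λ z → above D₁ 3182303188 (square-fraction z) ≡ true) (sym a≡) refl))
     lower : + 31830987 / 100000000 ≤ wal a
     lower = ≤-trans (≤ᵇ⇒≤ {+ 31830987 / 100000000} {+ 4001 / 4 * (+ 3182303186 / D₁)} _)
       (subst (λ z → + 4001 / 4 * (+ 3182303186 / D₁) ≤ (z + + 1 / 4) * c) (sym ιa) (*-monoˡ (≥0 (+ 4001 / 4)) lo))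
     upper : wal a + wal-gap a ≤ + 31830989 / 100000000
     upper = subst₂ (λ u v → (u + + 1 / 4) * c + c * (+ 1 / 32 * v) ≤ + 31830989 / 100000000) (sym ιa) (sym ιa⁻¹)
       (≤-trans (+-mono-≤ (*-monoˡ {c} {+ 3182303188 / D₁} (≥0 (+ 4001 / 4)) hi) (*-monoʳ {c} {+ 3182303188 / D₁} (≥0 (+ 1 / 32000)) hi))
         (≤ᵇ⇒≤ {+ 4001 / 4 * (+ 3182303188 / D₁) + + 3182303188 / D₁ * (+ 1 / 32000)} {+ 31830989 / 100000000} _))

   wal-beyond : ∀ a → suc a ≡ 1000 → ∀ {k} → a ℕ.≤ k → + 31830987 / 100000000 ≤ wal (suc k) × wal (suc k) ≤ + 31830989 / 100000000
   wal-beyond a a≡ {k} h = ≤-trans (proj₁ (wal-bounds (suc a) a≡)) (wal-mono {suc a} {suc k} (s≤s h))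
     , ≤-trans (wal-upper {a} {suc k} (s≤s h)) (proj₂ (wal-bounds (suc a) a≡))

 wal-enclosure : ∀ {k} → 999 ℕ.≤ k → + 31830987 / 100000000 ≤ wal (suc k) × wal (suc k) ≤ + 31830989 / 100000000
 wal-enclosure = wal-beyond 999 refl

 open Limits enclosure using (gauss; gauss-≥; gauss-≤)

 gauss-enclosure : ∀ {k} → 999 ℕ.≤ k → + 7669259 / 100000000 ≤ gauss k × gauss k ≤ + 7669262 / 100000000
 gauss-enclosure {k} h = gauss-≥ k (proj₁ (wal-enclosure h)) (≥0 (+ 7669259 / 100000000)) (proj₁ λ²-bounds)
   , gauss-≤ k (proj₂ (wal-enclosure h)) (≥0 (+ 7669262 / 100000000)) (proj₂ λ²-bounds)

-- Rational forms of the bound, of its optimality and of the asymptotic formula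

module Comparison where

 open RationalArithmetic
 open PowerSeries
 open Wallis
 open Maxima
 open Tilt
 open Root
 open Asymptotics
 open Numerics

 open Limits enclosure public

 ½<1 : ½ < 1ℚ
 ½<1 = <-cert {a = ½} {b = 1ℚ} (>0 ½) refl

 -- Bernoulli's inequality as an upper bound for powers of numbers slightly above 1, free of
 -- division.
 bernoulli : ∀ n {x e} → 0ℚ ≤ e → 0ℚ ≤ x → x ≤ 1ℚ + e → ι n * e ≤ 1ℚ → x ^ n * (1ℚ - ι n * e) ≤ 1ℚ
 bernoulli zero    {x} {e} 0≤e 0≤x x≤ ne≤1 = ≤-reflexive (trans (cong (λ z → 1ℚ * (1ℚ - z * e)) ι-0) (r e))
   where
   r : ∀ e → 1ℚ * (1ℚ - 0ℚ * e) ≡ 1ℚ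
   r = solve-∀ ℚ-ring
 bernoulli (suc n) {x} {e} 0≤e 0≤x x≤ ne≤1 = ≤-trans
   (*-monoʳ {c = 1ℚ - ι (suc n) * e} (0≤-diff ne≤1) (*-monoʳ (^-nonneg n 0≤x) x≤))
   (≤-trans (≤-cert {a = (1ℚ + e) * Y * (1ℚ - ι (suc n) * e)} {b = Y * (1ℚ - ι n * e)} (0≤* (^-nonneg n 0≤x) (0≤* (0≤ι (suc n)) (0≤sq e)))
       (trans (cong (λ z → Y * (z * (e * e))) (ι-suc n)) (trans (r Y (ι n) e) (cong (λ z → Y * (1ℚ - ι n * e) - (1ℚ + e) * Y * (1ℚ - z * e)) (sym (ι-suc n))))))
     (bernoulli n 0≤e 0≤x x≤ (≤-trans (*-monoʳ 0≤e (ι-mono (ℕ.n≤1+n n))) ne≤1)))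
   where
   Y = x ^ n
   r : ∀ Y n e → Y * ((n + 1ℚ) * (e * e)) ≡ Y * (1ℚ - n * e) - (1ℚ + e) * Y * (1ℚ - (n + 1ℚ) * e)
   r = solve-∀ ℚ-ring

 power-decay : ∀ n {x d} → 0ℚ ≤ d → 0ℚ ≤ x → x ≤ 1ℚ - d → x ^ n * (1ℚ + ι n * d) ≤ 1ℚ
 power-decay zero    {x} {d} 0≤d 0≤x x≤ = ≤-reflexive (trans (cong (λ z → 1ℚ * (1ℚ + z * d)) ι-0) (r d))
   where
   r : ∀ e → 1ℚ * (1ℚ + 0ℚ * e) ≡ 1ℚ
   r = solve-∀ ℚ-ring
 power-decay (suc n) {x} {d} 0≤d 0≤x x≤ = ≤-trans
   (*-monoʳ {c = 1ℚ + ι (suc n) * d} (0≤+ 0≤1 (0≤* (0≤ι (suc n)) 0≤d)) (*-monoʳ (^-nonneg n 0≤x) x≤))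
   (≤-trans (≤-cert {a = (1ℚ - d) * Y * (1ℚ + ι (suc n) * d)} {b = Y * (1ℚ + ι n * d)} (0≤* (^-nonneg n 0≤x) (0≤* (0≤ι (suc n)) (0≤sq d)))
       (trans (cong (λ z → Y * (z * (d * d))) (ι-suc n)) (trans (r Y (ι n) d) (cong (λ z → Y * (1ℚ + ι n * d) - (1ℚ - d) * Y * (1ℚ + z * d)) (sym (ι-suc n))))))
     (power-decay n 0≤d 0≤x x≤))
   where
   Y = x ^ n
   r : ∀ Y n e → Y * ((n + 1ℚ) * (e * e)) ≡ Y * (1ℚ + n * e) - (1ℚ - e) * Y * (1ℚ + (n + 1ℚ) * e)
   r = solve-∀ ℚ-ring

 partial-sum-tail : ∀ k n → n ℕ.≤ k → 1ℚ ≤ M 0 (root k) (suc n) + + 2 / 1 * big * ι (suc n) ⁻¹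
 partial-sum-tail k n n≤k = ≤-cert {a = 1ℚ} {b = M 0 (root k) (suc n) + + 2 / 1 * big * ι (suc n) ⁻¹}
   (0≤+ (0≤+ (0≤-diff (deficiency≤ k)) (0≤-diff tail)) (0≤+ (0≤-diff (*-monoˡ 0≤big (≤-trans (rate≤ k) (⁻¹-anti (0<ι n) (ι-mono (s≤s n≤k)))))) (0≤-diff (*-monoˡ 0≤big (rate≤ n)))))
   (r (m₀ k) (M 0 (root k) (suc n)) big (rate k) (rate n) (ι (suc n) ⁻¹))
   where
   r : ∀ m p b x y i → b * x - (1ℚ - m) + (p + b * y - m) + ((b * i - b * x) + (b * i - b * y)) ≡ p + + 2 / 1 * b * i - 1ℚ
   r = solve-∀ ℚ-ring
   tail : m₀ k ≤ M 0 (root k) (suc n) + big * rate n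
   tail = helper (ℕ.m≤n⇒∃[o]m+o≡n (ℕ.≤-trans (s≤s n≤k) (n<len k)))
     where
     helper : (∃[ o ] suc n ℕ.+ o ≡ len k) → M 0 (root k) (len k) ≤ M 0 (root k) (suc n) + big * rate n
     helper (o , e) = ≤-cert (0≤-diff (≤-rate n (subst (λ z → ι (suc n) * ι (suc n) * (M 0 (root k) z - M 0 (root k) (suc n)) ≤ big) e (moment-tail 0 z≤n (0≤root k) (root≤ k) (suc n) o))))
       (r′ (M 0 (root k) (len k)) (M 0 (root k) (suc n)) (big * rate n))
       where
       r′ : ∀ a b c → c - (a - b) ≡ b + c - a
       r′ = solve-∀ ℚ-ring

 partial-sum≤1 : ∀ k n → n ℕ.≤ k → M 0 (root k) (suc n) ≤ 1ℚ
 partial-sum≤1 k n n≤k = ≤-trans (moment-mono-N 0 (0≤root k) (ℕ.≤-trans (s≤s n≤k) (n<len k))) (M₀≤1 k)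

 ⊛-≤S : ∀ f g n → Nonneg f → (∀ i → i ℕ.≤ n → g i ≤ 1ℚ) → (f ⊛ g) n ≤ S f (suc n)
 ⊛-≤S f g zero    f≥0 h = ≤-trans (*-monoˡ (f≥0 0) (h 0 z≤n)) (≤-reflexive (trans (*-identityʳ (f 0)) (sym (+-identityʳ (f 0)))))
 ⊛-≤S f g (suc n) f≥0 h = +-mono-≤ (≤-trans (*-monoˡ (f≥0 0) (h (suc n) ℕ.≤-refl)) (≤-reflexive (*-identityʳ (f 0))))
   (⊛-≤S (tl f) g n (λ i → f≥0 (suc i)) (λ i i≤n → h i (ℕ.≤-trans i≤n (ℕ.n≤1+n n))))

 pow-≤1 : ∀ {f} N → Nonneg f → S f (suc N) ≤ 1ℚ → ∀ s n → n ℕ.≤ N → pow f s n ≤ 1ℚ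
 pow-≤1 N f≥0 h zero    zero    _ = ≤-refl
 pow-≤1 N f≥0 h zero    (suc n) _ = 0≤1
 pow-≤1 {f} N f≥0 h (suc s) n n≤N = ≤-trans (⊛-≤S f (pow f s) n f≥0 (λ i i≤n → pow-≤1 N f≥0 h s i (ℕ.≤-trans i≤n n≤N)))
   (≤-trans (S-mono-n f≥0 (s≤s n≤N)) h)

 -- At `root k` the weights up to degree `n` have total mass at most 1, so no coefficient of a power
 -- in these degrees exceeds 1. This is M₂(n)/n! ≤ νⁿ with a rational in place of θ.
 coefficient-bound : ∀ k s n → n ℕ.≤ k → pow W s n * root k ^ n ≤ 1ℚ
 coefficient-bound k s n n≤k = ≤-trans (≤-reflexive (weight-pow (root k) W s n))
   (pow-≤1 n (Nonneg-weight (0≤root k) Nonneg-W) (≤-trans (S-mono (suc n) (λ i → ≤-reflexive (sym (*-identityˡ (weight (root k) W i))))) (partial-sum≤1 k n n≤k)) s n ℕ.≤-refl)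

 top : ℕ → ℚ
 top n = pow W (Maximal.s (proj₂ (maximum n))) (suc n)

 Nonneg-top : ∀ n → 0ℚ ≤ top n
 Nonneg-top n = Nonneg-pow (Maximal.s (proj₂ (maximum n))) Nonneg-W (suc n)

 ≤top : ∀ n s → pow W (suc s) (suc n) ≤ top n
 ≤top n s = Maximal.maximal (proj₂ (maximum n)) (suc s) (s≤s z≤n)

 top-bound : ∀ n k → suc n ℕ.≤ k → top n * root k ^ suc n ≤ 1ℚ
 top-bound n k n<k = coefficient-bound k (Maximal.s (proj₂ (maximum n))) (suc n) n<k

 1≤top₀ : 1ℚ ≤ top 0
 1≤top₀ = ≤-trans (≤-reflexive (sym e)) (≤top 0 0)
   where
   e : pow W 1 1 ≡ 1ℚ
   e = trans (⊛-comm W (C 1ℚ) 1) (trans (⊛-identityˡ W 1) W-1)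

 1/20≤gauss : ∀ n → + 1 / 20 ≤ gauss n
 1/20≤gauss n = ≤-trans (≤-reflexive refl) (*-mono-≤ {+ 1 / 5} {g n} {+ 1 / 4} {wal (suc n)} (≥0 (+ 1 / 5)) (≥0 (+ 1 / 4)) (⅕≤g n) (¼≤wal (suc n)))

 -- (m θᵏ)² k for k = n + 1 and m = M₂(k)/k!, with θ replaced by an approximation.
 top² : ℕ → ℚ
 top² n = top n * root (suc n) ^ suc n * (top n * root (suc n) ^ suc n) * ι (suc n)

 0≤top² : ∀ n → 0ℚ ≤ top² n
 0≤top² n = 0≤* (0≤sq (top n * root (suc n) ^ suc n)) (0≤ι (suc n))

 small : ∀ c {e} → 0ℚ ≤ c → 0ℚ < e → ∃[ N ] (∀ n → N ℕ.≤ n → c * ι (suc n) ⁻¹ ≤ e)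
 small c {e} 0≤c 0<e = let N , h = archimedes (c ÷′ e) in N , λ n N≤n → ÷-≤ {c} {ι (suc n)} {e} (0<ι n) (≤-trans (≤-reflexive (sym (÷-* {c} 0<e)))
   (≤-trans (*-monoʳ (<⇒≤ 0<e) (≤-trans (<⇒≤ h) (ι-mono (ℕ.≤-trans N≤n (ℕ.n≤1+n n))))) (≤-reflexive (*-comm (ι (suc n)) e))))

 module Ratio (η : ℚ) (0<η : 0ℚ < η) (η≤½ : η ≤ ½) where

   private
     0≤η = <⇒≤ 0<η
     open Margin η (η ⁻¹) 0<η η≤½ (*-⁻¹ 0<η) (0≤⁻¹ 0<η)

     e : ℚ
     e = η * (+ 1 / 20)
     0<e : 0ℚ < e
     0<e = 0<* 0<η (>0 (+ 1 / 20))

     small₁ = small upper-constant 0≤upper-constant 0<e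
     small₂ = small lower-constant 0≤lower-constant 0<e

     e≤ : ∀ n → e ≤ η * gauss n
     e≤ n = *-monoˡ 0≤η (1/20≤gauss n)

   N₁ : ℕ
   N₁ = 2 ℕ.+ (proj₁ small₁ ℕ.+ proj₁ small₂)

   -- The error term is at most η times `gauss`, so 1 + 2η over 1 - η has to be absorbed: (1 - η)(1
   -- + 6η) - (1 + 2η) = 6η(½ - η) is nonnegative for η ≤ ½.
   top²≤ : ∀ n → N₁ ℕ.≤ n → top² n ≤ (1ℚ + + 6 / 1 * η) * gauss (suc n)
   top²≤ n N≤n = *-cancelˡ-≤ {c = 1ℚ - η} 0<1-η (≤-trans (at (Maximal.s mx) (Maximal.1≤s mx) (Maximal.s≤n mx) )
     (≤-cert {a = (1ℚ + η) * G + u} {b = (1ℚ - η) * ((1ℚ + + 6 / 1 * η) * G)}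
       (0≤+ (0≤+ (0≤-diff (proj₂ small₁ n s₁≤)) (0≤-diff (e≤ (suc n)))) (0≤* (0≤* (0≤* (≥0 (+ 6 / 1)) 0≤η) (0≤-diff η≤½)) 0≤G)) (r η G u e)))
     where
     mx = proj₂ (maximum n)
     G = gauss (suc n)
     u = upper-constant * ι (suc n) ⁻¹
     0≤G : 0ℚ ≤ G
     0≤G = ≤-trans (≥0 (+ 1 / 20)) (1/20≤gauss (suc n))
     s₁≤ : proj₁ small₁ ℕ.≤ n
     s₁≤ = ℕ.≤-trans (ℕ.≤-trans (ℕ.m≤m+n (proj₁ small₁) (proj₁ small₂)) (ℕ.m≤n+m _ 2)) N≤n
     0<1-η : 0ℚ < 1ℚ - η
     0<1-η = 0<-diff (≤-<-trans η≤½ (½<1))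
     at : ∀ s → 1 ℕ.≤ s → s ℕ.≤ suc n → let V = pow W s (suc n) * root (suc n) ^ suc n in (1ℚ - η) * (V * V * ι (suc n)) ≤ (1ℚ + η) * G + u
     at (suc s) _ (s≤s s≤n) = upper n s s≤n
     r : ∀ η G u e → (e - u) + (η * G - e) + + 6 / 1 * η * (½ - η) * G ≡ (1ℚ - η) * ((1ℚ + + 6 / 1 * η) * G) - ((1ℚ + η) * G + u)
     r = solve-∀ ℚ-ring

   ≤top² : ∀ n → N₁ ℕ.≤ n → gauss (suc n) ≤ (1ℚ + + 6 / 1 * η) * top² n
   ≤top² n N≤n = *-cancelˡ-≤ {c = 1ℚ - η} 0<1-η (≤-trans (at (lower n (ℕ.≤-trans (ℕ.m≤m+n 2 _) N≤n)))
     (≤-cert {a = (1ℚ + η) * top² n} {b = (1ℚ - η) * ((1ℚ + + 6 / 1 * η) * top² n)}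
       (0≤* (0≤* 0≤η (0≤+ (≥0 1ℚ) (0≤* (≥0 (+ 6 / 1)) (0≤-diff η≤½)))) (0≤top² n)) (r η (top² n))))
     where
     G = gauss (suc n)
     v = lower-constant * ι (suc n) ⁻¹
     s₂≤ : proj₁ small₂ ℕ.≤ n
     s₂≤ = ℕ.≤-trans (ℕ.≤-trans (ℕ.m≤n+m (proj₁ small₂) (proj₁ small₁)) (ℕ.m≤n+m _ 2)) N≤n
     0<1-η : 0ℚ < 1ℚ - η
     0<1-η = 0<-diff (≤-<-trans η≤½ (½<1))
     at : (∃[ s ] (s ℕ.≤ n × G ≤ (1ℚ + η) * (tilted (suc n) (suc s) * tilted (suc n) (suc s) * ι (suc n)) + v)) → (1ℚ - η) * G ≤ (1ℚ + η) * top² n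
     at (s , _ , h) = ≤-cert {a = (1ℚ - η) * G} {b = (1ℚ + η) * top² n}
       (0≤+ (0≤+ (0≤-diff h) (0≤* (0≤+ 0≤1 0≤η) (0≤-diff (*-monoʳ (0≤ι (suc n)) (*-mono-≤ 0≤V 0≤V V≤ V≤))))) (0≤+ (0≤-diff (proj₂ small₂ n s₂≤)) (0≤-diff (e≤ (suc n)))))
       (r′ η G (tilted (suc n) (suc s) * tilted (suc n) (suc s) * ι (suc n)) v (top² n) e)
       where
       0≤V = Nonneg-tilted (suc n) (suc s)
       V≤ : tilted (suc n) (suc s) ≤ top n * root (suc n) ^ suc n
       V≤ = *-monoʳ (^-nonneg (suc n) (0≤root (suc n))) (≤top n s)
       r′ : ∀ η G V v T e → ((1ℚ + η) * V + v - G) + (1ℚ + η) * (T - V) + ((e - v) + (η * G - e)) ≡ (1ℚ + η) * T - (1ℚ - η) * G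
       r′ = solve-∀ ℚ-ring
     r : ∀ η T → η * (1ℚ + + 6 / 1 * (½ - η)) * T ≡ (1ℚ - η) * ((1ℚ + + 6 / 1 * η) * T) - (1ℚ + η) * T
     r = solve-∀ ℚ-ring

   -- Because y ≥ ½, the quotient x/y is at most 1 + 2e, and `bernoulli` bounds its m-th power while
   -- 2me ≤ η.
   power-ratio : ∀ m {x y e} → 0ℚ ≤ e → ½ ≤ y → 0ℚ ≤ x → x ≤ y + e → ι m * (+ 2 / 1 * e) ≤ η → x ^ m ≤ (1ℚ + + 6 / 1 * η) * y ^ m
   power-ratio m {x} {y} {e} 0≤e ½≤y 0≤x x≤ me≤ = subst (λ z → z ^ m ≤ (1ℚ + + 6 / 1 * η) * y ^ m) (÷-* {x} 0<y)
     (≤-trans (≤-reflexive (^-distrib-* (x ÷′ y) y m)) (*-monoʳ (^-nonneg m (<⇒≤ 0<y)) z^m≤))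
     where
     0<y = <-≤-trans (>0 ½) ½≤y
     d = ι m * (+ 2 / 1 * e)
     z = x ÷′ y
     0≤z : 0ℚ ≤ z
     0≤z = 0≤* 0≤x (0≤⁻¹ 0<y)
     z≤ : z ≤ 1ℚ + + 2 / 1 * e
     z≤ = ÷-≤ {x} {y} 0<y (≤-cert {a = x} {b = (1ℚ + + 2 / 1 * e) * y} (0≤+ (0≤-diff x≤) (0≤* (0≤* (≥0 (+ 2 / 1)) 0≤e) (0≤-diff ½≤y))) (r x y e))
       where
       r : ∀ x y e → (y + e - x) + + 2 / 1 * e * (y - ½) ≡ (1ℚ + + 2 / 1 * e) * y - x
       r = solve-∀ ℚ-ring
     0<1-d : 0ℚ < 1ℚ - d
     0<1-d = 0<-diff (≤-<-trans (≤-trans me≤ η≤½) ½<1)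
     z^m≤ : z ^ m ≤ 1ℚ + + 6 / 1 * η
     z^m≤ = *-cancelˡ-≤ {c = 1ℚ - d} 0<1-d (≤-trans (≤-reflexive (*-comm (1ℚ - d) (z ^ m)))
       (≤-trans (bernoulli m (0≤* (≥0 (+ 2 / 1)) 0≤e) 0≤z z≤ (≤-trans me≤ (≤-trans η≤½ (<⇒≤ ½<1))))
         (≤-cert {a = 1ℚ} {b = (1ℚ - d) * (1ℚ + + 6 / 1 * η)} (0≤+ (0≤+ (0≤* (0≤+ 0≤1 (0≤* (≥0 (+ 6 / 1)) 0≤η)) (0≤-diff me≤)) (0≤* (0≤* (≥0 (+ 6 / 1)) 0≤η) (0≤-diff η≤½))) (0≤* (≥0 (+ 2 / 1)) 0≤η)) (r′ η d))))
       where
       r′ : ∀ η d → (1ℚ + + 6 / 1 * η) * (η - d) + + 6 / 1 * η * (½ - η) + + 2 / 1 * η ≡ (1ℚ - d) * (1ℚ + + 6 / 1 * η) - 1ℚ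
       r′ = solve-∀ ℚ-ring

   private
     small₃ = small (+ 4 / 1 * big) (0≤* (≥0 (+ 4 / 1)) 0≤big) 0<η
     small₄ = small (+ 2 / 1 + big₂) (0≤+ (≥0 (+ 2 / 1)) 0≤big₂) (0<* 0<η (>0 (+ 1 / 40)))

   N₂ : ℕ
   N₂ = N₁ ℕ.+ (proj₁ small₃ ℕ.+ proj₁ small₄)

   w : ℚ
   w = 1ℚ + + 6 / 1 * η

   0≤w : 0ℚ ≤ w
   0≤w = 0≤+ 0≤1 (0≤* (≥0 (+ 6 / 1)) 0≤η)

   -- `k` is the index at which the real numbers are evaluated, and `s` approximates (n + 1)^(-1/2).
   -- The estimates for `top²` use `root (suc n)` and `gauss (suc n)`, whereas `y` is built from
   -- `root k` and `lam k`; each replacement costs factors `w`.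
   module Close (n k : ℕ) (N₂≤n : N₂ ℕ.≤ n) (n<k : suc n ℕ.≤ k) (s : ℚ) (1≤F : 1ℚ ≤ s * s * ι (suc n)) (F≤ : s * s * ι (suc n) ≤ w * w) where

     private
       N₁≤n : N₁ ℕ.≤ n
       N₁≤n = ℕ.≤-trans (ℕ.m≤m+n N₁ _) N₂≤n
       s₃≤n : proj₁ small₃ ℕ.≤ n
       s₃≤n = ℕ.≤-trans (ℕ.≤-trans (ℕ.m≤m+n (proj₁ small₃) (proj₁ small₄)) (ℕ.m≤n+m _ N₁)) N₂≤n
       s₄≤n : proj₁ small₄ ℕ.≤ n
       s₄≤n = ℕ.≤-trans (ℕ.≤-trans (ℕ.m≤n+m (proj₁ small₄) (proj₁ small₃)) (ℕ.m≤n+m _ N₁)) N₂≤n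
       m = suc n
       i = ι m ⁻¹
       0≤i : 0ℚ ≤ i
       0≤i = 0≤⁻¹ (0<ι n)
       G = gauss m
       L = lam k * lam k
       A = root m ^ m
       B = root k ^ m
       q = (root k ⁻¹) ^ m
       F = s * s * ι m
       0≤L : 0ℚ ≤ L
       0≤L = 0≤sq (lam k)
       0<A : 0ℚ < A
       0<A = ^-pos m (0<root m)
       0≤q : 0ℚ ≤ q
       0≤q = ^-nonneg m (0≤⁻¹ (0<root k))
       qB : q * B ≡ 1ℚ
       qB = trans (sym (^-distrib-* (root k ⁻¹) (root k) m)) (trans (cong (_^ m) (⁻¹-* (0<root k))) (1^ m))

       ι≤i : ι (suc m) ⁻¹ ≤ i
       ι≤i = ⁻¹-anti (0<ι n) (ι-mono (ℕ.n≤1+n m))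
       d = + 2 / 1 * big * rate m
       0≤d : 0ℚ ≤ d
       0≤d = 0≤* (0≤* (≥0 (+ 2 / 1)) 0≤big) (0≤rate m)
       md≤ : ι m * (+ 2 / 1 * d) ≤ η
       md≤ = begin
         ι m * (+ 2 / 1 * (+ 2 / 1 * big * (j * j))) ≤⟨ *-monoʳ (0≤* (≥0 (+ 2 / 1)) 0≤d) (ι-mono (ℕ.n≤1+n m)) ⟩
         ι (suc m) * (+ 2 / 1 * (+ 2 / 1 * big * (j * j))) ≡⟨ r (ι (suc m)) big j ⟩
         + 4 / 1 * big * (ι (suc m) * j * j) ≡⟨ cong (λ z → + 4 / 1 * big * (z * j)) (*-⁻¹ (0<ι m)) ⟩
         + 4 / 1 * big * (1ℚ * j) ≡⟨ cong (+ 4 / 1 * big *_) (*-identityˡ j) ⟩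
         + 4 / 1 * big * j ≤⟨ *-monoˡ (0≤* (≥0 (+ 4 / 1)) 0≤big) ι≤i ⟩
         + 4 / 1 * big * i ≤⟨ proj₂ small₃ n s₃≤n ⟩
         η ∎
         where
         open ≤-Reasoning
         j = ι (suc m) ⁻¹
         r : ∀ m b j → m * (+ 2 / 1 * (+ 2 / 1 * b * (j * j))) ≡ + 4 / 1 * b * (m * j * j)
         r = solve-∀ ℚ-ring
       near : ∣ root m - root k ∣ ≤ d
       near = root-cauchy n<k
       A≤ : A ≤ w * B
       A≤ = power-ratio m 0≤d (½≤root k) (0≤root m) (∣-∣⇒≤ {root m} {root k} {d} near) md≤
       B≤ : B ≤ w * A
       B≤ = power-ratio m 0≤d (½≤root m) (0≤root k) (∣-∣⇒≥ {root m} {root k} {d} near) md≤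
       qA≤ : q * A ≤ w
       qA≤ = ≤-trans (*-monoˡ 0≤q A≤) (≤-reflexive (trans (r q w B) (trans (cong (w *_) qB) (*-identityʳ w))))
         where
         r : ∀ q w b → q * (w * b) ≡ w * (q * b)
         r = solve-∀ ℚ-ring
       1≤wqA : 1ℚ ≤ w * (q * A)
       1≤wqA = ≤-trans (≤-reflexive (sym qB)) (≤-trans (*-monoˡ 0≤q B≤) (≤-reflexive (r q w A)))
         where
         r : ∀ q w b → q * (w * b) ≡ w * (q * b)
         r = solve-∀ ℚ-ring

       distance : ∣ L - G ∣ ≤ η * (+ 1 / 40)
       distance = ≤-trans (∣∣-tri L (gauss k) G) (≤-trans (+-mono-≤ part₁ part₂) (≤-trans (≤-reflexive (r i big₂)) (proj₂ small₄ n s₄≤n)))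
         where
         part₁ : ∣ L - gauss k ∣ ≤ i
         part₁ = ≤-trans (lam²-close k) (⁻¹-anti (0<ι n) (ι-mono (ℕ.≤-trans n<k (ℕ.n≤1+n k))))
         part₂ : ∣ gauss k - G ∣ ≤ (1ℚ + big₂) * i
         part₂ = ≤-trans (≤-reflexive (∣-∣-sym (gauss k) G)) (≤-trans (gauss-cauchy n<k) (*-monoˡ (0≤+ 0≤1 0≤big₂) ι≤i))
         r : ∀ i b → i + (1ℚ + b) * i ≡ (+ 2 / 1 + b) * i
         r = solve-∀ ℚ-ring
       L≤wG : L ≤ w * G
       L≤wG = ≤-cert {a = L} {b = w * G} (0≤+ (0≤+ (0≤-diff (∣-∣⇒≤ {L} {G} distance)) (0≤* (0≤* (≥0 (+ 6 / 1)) 0≤η) (0≤-diff (1/20≤gauss m)))) (0≤* (≥0 (+ 11 / 40)) 0≤η)) (r η L G)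
         where
         r : ∀ η L G → (G + η * (+ 1 / 40) - L) + + 6 / 1 * η * (G - + 1 / 20) + + 11 / 40 * η ≡ (1ℚ + + 6 / 1 * η) * G - L
         r = solve-∀ ℚ-ring
       G≤wL : G ≤ w * L
       G≤wL = ≤-cert {a = G} {b = w * L} (0≤+ (0≤+ (0≤-diff G≤L) (0≤* (0≤* (≥0 (+ 6 / 1)) 0≤η) (0≤+ (0≤-diff G≤L) (0≤-diff (1/20≤gauss m)))))
           (0≤+ (0≤* (0≤* (≥0 (+ 6 / 40)) 0≤η) (0≤-diff η≤½)) (0≤* (≥0 (+ 1 / 5)) 0≤η))) (r η L G)
         where
         G≤L = ∣-∣⇒≥ {L} {G} distance
         r : ∀ η L G → (L + η * (+ 1 / 40) - G) + + 6 / 1 * η * ((L + η * (+ 1 / 40) - G) + (G - + 1 / 20)) + (+ 6 / 40 * η * (½ - η) + + 1 / 5 * η) ≡ (1ℚ + + 6 / 1 * η) * L - G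
         r = solve-∀ ℚ-ring

     y : ℚ
     y = lam k * s * q

     private
       t = top n
       Z = A * A * ι m
       0<Z : 0ℚ < Z
       0<Z = 0<* (0<* 0<A 0<A) (0<ι n)
       w³ = w * (w * w)
       y²Z≡ : Z * (y * y) ≡ L * F * (q * A * (q * A))
       y²Z≡ = r A (ι m) (lam k) s q
         where
         r : ∀ A m l s q → A * A * m * (l * s * q * (l * s * q)) ≡ l * l * (s * s * m) * (q * A * (q * A))
         r = solve-∀ ℚ-ring
       t²Z≡ : Z * (t * t) ≡ top² n
       t²Z≡ = r A (ι m) t
         where
         r : ∀ A m t → A * A * m * (t * t) ≡ t * A * (t * A) * m
         r = solve-∀ ℚ-ring
       0≤F : 0ℚ ≤ F
       0≤F = ≤-trans 0≤1 1≤F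
       0≤qA : 0ℚ ≤ q * A
       0≤qA = 0≤* 0≤q (<⇒≤ 0<A)
       0≤ww = 0≤* 0≤w 0≤w

     -- Squares are compared, multiplied by `Z`. Four factors `w` arise here and six in `≤top′`;
     -- `w³` on the unsquared side serves both.
     top≤ : 0ℚ ≤ s → t ≤ w³ * y
     top≤ 0≤s = sq-cancel-≤ (0≤* (0≤* 0≤w 0≤ww) (0≤* (0≤* (0≤lam k) 0≤s) 0≤q)) (*-cancelˡ-≤ 0<Z (begin
       Z * (t * t) ≡⟨ t²Z≡ ⟩
       top² n ≤⟨ top²≤ n N₁≤n ⟩
       w * G ≤⟨ *-monoˡ 0≤w G≤wL ⟩
       w * (w * L) ≡⟨ r₀ w L ⟩
       w * w * (L * 1ℚ * (1ℚ * 1ℚ)) ≤⟨ *-monoˡ 0≤ww (*-mono-≤ (0≤* 0≤L 0≤1) (0≤* 0≤1 0≤1) (*-monoˡ 0≤L 1≤F) (*-mono-≤ 0≤1 0≤1 1≤wqA 1≤wqA)) ⟩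
       w * w * (L * F * (w * (q * A) * (w * (q * A)))) ≤⟨ ≤-cert {a = w * w * (L * F * (w * (q * A) * (w * (q * A))))} {b = w³ * w³ * (L * F * (q * A * (q * A)))}
           (0≤* (0≤* (0≤* 0≤ww 0≤ww) (0≤* (0≤* 0≤L 0≤F) (0≤* 0≤qA 0≤qA))) (0≤* 0≤w-1 (0≤+ 0≤w 0≤1))) (r₁ w (L * F) (q * A)) ⟩
       w³ * w³ * (L * F * (q * A * (q * A))) ≡⟨ cong (w³ * w³ *_) (sym y²Z≡) ⟩
       w³ * w³ * (Z * (y * y)) ≡⟨ r₂ w³ Z y ⟩
       Z * (w³ * y * (w³ * y)) ∎))
       where
       open ≤-Reasoning
       0≤w-1 : 0ℚ ≤ w - 1ℚ
       0≤w-1 = subst (0ℚ ≤_) (r η) (0≤* (≥0 (+ 6 / 1)) 0≤η)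
         where
         r : ∀ η → + 6 / 1 * η ≡ 1ℚ + + 6 / 1 * η - 1ℚ
         r = solve-∀ ℚ-ring
       r₀ : ∀ w L → w * (w * L) ≡ w * w * (L * 1ℚ * (1ℚ * 1ℚ))
       r₀ = solve-∀ ℚ-ring
       r₁ : ∀ w X x → w * w * (w * w) * (X * (x * x)) * ((w - 1ℚ) * (w + 1ℚ)) ≡ w * (w * w) * (w * (w * w)) * (X * (x * x)) - w * w * (X * (w * x * (w * x)))
       r₁ = solve-∀ ℚ-ring
       r₂ : ∀ u Z y → u * u * (Z * (y * y)) ≡ Z * (u * y * (u * y))
       r₂ = solve-∀ ℚ-ring

     ≤top′ : y ≤ w³ * t
     ≤top′ = sq-cancel-≤ (0≤* (0≤* 0≤w 0≤ww) (Nonneg-top n)) (*-cancelˡ-≤ 0<Z (begin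
       Z * (y * y) ≡⟨ y²Z≡ ⟩
       L * F * (q * A * (q * A)) ≤⟨ *-mono-≤ (0≤* 0≤L 0≤F) (0≤* 0≤qA 0≤qA) (*-mono-≤ 0≤L 0≤F L≤wG F≤) (*-mono-≤ 0≤qA 0≤qA qA≤ qA≤) ⟩
       w * G * (w * w) * (w * w) ≡⟨ r₀ w G ⟩
       w * w * w * w * w * G ≤⟨ *-monoˡ (0≤* (0≤* (0≤* 0≤ww 0≤w) 0≤w) 0≤w) (≤top² n N₁≤n) ⟩
       w * w * w * w * w * (w * top² n) ≡⟨ cong (λ z → w * w * w * w * w * (w * z)) (sym t²Z≡) ⟩
       w * w * w * w * w * (w * (Z * (t * t))) ≡⟨ r₂ w Z t ⟩
       Z * (w³ * t * (w³ * t)) ∎))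
       where
       open ≤-Reasoning
       r₀ : ∀ w G → w * G * (w * w) * (w * w) ≡ w * w * w * w * w * G
       r₀ = solve-∀ ℚ-ring
       r₂ : ∀ w Z t → w * w * w * w * w * (w * (Z * (t * t))) ≡ Z * (w * (w * w) * t * (w * (w * w) * t))
       r₂ = solve-∀ ℚ-ring

 -- If Cθ ≤ 1 - d, then (2 Cⁿ θⁿ)² n tends to 0, whereas (m_n θⁿ)² n is bounded below.
 optimal : ∀ {C d} K → 0ℚ ≤ C → 0ℚ < d → (∀ k → K ℕ.≤ k → C * root k ≤ 1ℚ - d) → ¬ (∀ n → top n ≤ + 2 / 1 * C ^ suc n)
 optimal {C} {d} K 0≤C 0<d C≤ top≤ = <⇒≱ many few
   where
   open Ratio ½ (>0 ½) ≤-refl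
   -- 320 = 20 · 4 · 2²: the lower bound 1/20 for `gauss`, the factor 1 + 6η at η = ½, and the
   -- square of the 2 in the assumed bound for `top`.
   bound = archimedes (+ 320 / 1 ÷′ (d * d))
   n = N₁ ℕ.+ (K ℕ.+ proj₁ bound)
   m = suc n
   p = 1ℚ + ι m * d
   0<dd = 0<* 0<d 0<d
   0≤d = <⇒≤ 0<d
   0≤p : 0ℚ ≤ p
   0≤p = 0≤+ 0≤1 (0≤* (0≤ι m) 0≤d)
   many : + 320 / 1 < ι m * (d * d)
   many = ≤-<-trans (≤-reflexive (sym (÷-* {+ 320 / 1} 0<dd))) (ℚ.*-monoˡ-<-pos (d * d) ⦃ positive 0<dd ⦄
     (<-≤-trans (proj₂ bound) (ι-mono (ℕ.≤-trans (ℕ.m≤n+m (proj₁ bound) K) (ℕ.≤-trans (ℕ.m≤n+m _ N₁) (ℕ.n≤1+n n))))))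
   A = root m ^ m
   0≤A : 0ℚ ≤ A
   0≤A = ^-nonneg m (0≤root m)
   x = C * root m
   0≤x : 0ℚ ≤ x
   0≤x = 0≤* 0≤C (0≤root m)
   x^m*p≤1 : x ^ m * p ≤ 1ℚ
   x^m*p≤1 = power-decay m 0≤d 0≤x (C≤ m (ℕ.≤-trans (ℕ.m≤m+n K (proj₁ bound)) (ℕ.≤-trans (ℕ.m≤n+m _ N₁) (ℕ.n≤1+n n))))
   tA≤ : top n * A * p ≤ + 2 / 1
   tA≤ = ≤-trans (*-monoʳ 0≤p (*-monoʳ 0≤A (top≤ n))) (≤-trans (≤-reflexive (trans (r (C ^ m) A p) (cong (λ z → + 2 / 1 * (z * p)) (sym (^-distrib-* C (root m) m)))))
     (*-monoˡ (≥0 (+ 2 / 1)) x^m*p≤1))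
     where
     r : ∀ c a p → + 2 / 1 * c * a * p ≡ + 2 / 1 * (c * a * p)
     r = solve-∀ ℚ-ring
   0≤tAp : 0ℚ ≤ top n * A * p
   0≤tAp = 0≤* (0≤* (Nonneg-top n) 0≤A) 0≤p
   few : ι m * (d * d) ≤ + 320 / 1
   few = *-cancelˡ-≤ {c = ι m} (0<ι n) (begin
     ι m * (ι m * (d * d)) ≤⟨ ≤-cert {a = ι m * (ι m * (d * d))} {b = + 20 / 1 * (+ 1 / 20 * (p * p))} (0≤+ 0≤1 (0≤* (≥0 (+ 2 / 1)) (0≤* (0≤ι m) 0≤d))) (r₁ (ι m) d) ⟩
     + 20 / 1 * (+ 1 / 20 * (p * p)) ≤⟨ *-monoˡ (≥0 (+ 20 / 1)) (*-monoʳ (0≤sq p) (≤-trans (1/20≤gauss m) (≤top² n (ℕ.m≤m+n N₁ _)))) ⟩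
     + 20 / 1 * ((1ℚ + + 6 / 1 * ½) * top² n * (p * p)) ≡⟨ r₂ (top n) A (ι m) p ⟩
     + 80 / 1 * ι m * (top n * A * p * (top n * A * p)) ≤⟨ *-monoˡ (0≤* (≥0 (+ 80 / 1)) (0≤ι m)) (*-mono-≤ 0≤tAp 0≤tAp tA≤ tA≤) ⟩
     + 80 / 1 * ι m * (+ 2 / 1 * (+ 2 / 1)) ≡⟨ r₃ (ι m) ⟩
     ι m * (+ 320 / 1) ∎)
     where
     open ≤-Reasoning
     r₁ : ∀ m d → 1ℚ + + 2 / 1 * (m * d) ≡ + 20 / 1 * (+ 1 / 20 * ((1ℚ + m * d) * (1ℚ + m * d))) - m * (m * (d * d))
     r₁ = solve-∀ ℚ-ring
     r₂ : ∀ t A m p → + 20 / 1 * ((1ℚ + + 6 / 1 * ½) * (t * A * (t * A) * m) * (p * p)) ≡ + 80 / 1 * m * (t * A * p * (t * A * p))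
     r₂ = solve-∀ ℚ-ring
     r₃ : ∀ m → + 80 / 1 * m * (+ 2 / 1 * (+ 2 / 1)) ≡ m * (+ 320 / 1)
     r₃ = solve-∀ ℚ-ring

 -- From this index on, the error of `lam²-close` is at most 10⁻⁹ and fits between the bounds of
 -- `gauss-enclosure` and the squares of 0.2769343 plus or minus 5 · 10⁻⁸.
 threshold : ℕ
 threshold = 1000000000

 lam-near : ∀ k → threshold ℕ.≤ k → ∣ lam k - + 2769343 / 10000000 ∣ ≤ + 1 / 20000000
 lam-near k h = ∣-∣≤ {lam k} {+ 2769343 / 10000000} {+ 1 / 20000000}
   (sq-cancel-≤ {lam k} {+ 2769343 / 10000000 + + 1 / 20000000} (≥0 (+ 2769343 / 10000000 + + 1 / 20000000)) (begin
     lam k * lam k ≤⟨ ∣-∣⇒≤ {lam k * lam k} {gauss k} (lam²-close k) ⟩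
     gauss k + ι (suc k) ⁻¹ ≤⟨ +-mono-≤ (proj₂ (gauss-enclosure 999≤k)) i≤ ⟩
     + 7669262 / 100000000 + + 1 / threshold ≤⟨ ≤ᵇ⇒≤ {+ 7669262 / 100000000 + + 1 / threshold} {(+ 2769343 / 10000000 + + 1 / 20000000) * (+ 2769343 / 10000000 + + 1 / 20000000)} _ ⟩
     (+ 2769343 / 10000000 + + 1 / 20000000) * (+ 2769343 / 10000000 + + 1 / 20000000) ∎))
   (≤-cert {a = + 2769343 / 10000000} {b = lam k + + 1 / 20000000} (0≤-diff below) (r (+ 2769343 / 10000000) (+ 1 / 20000000) (lam k)))
   where
   open ≤-Reasoning
   r : ∀ a b l → l - (a - b) ≡ l + b - a
   r = solve-∀ ℚ-ring
   999≤k = ℕ.≤-trans (ℕ.≤ᵇ⇒≤ 999 threshold _) h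
   i≤ : ι (suc k) ⁻¹ ≤ + 1 / threshold
   i≤ = ≤-trans (⁻¹-anti (0<ι 999999999) (ι-mono (ℕ.≤-trans h (ℕ.n≤1+n k)))) (≤-reflexive (trans (sym (*-identityˡ (ι threshold ⁻¹))) (trans (cong (_* ι threshold ⁻¹) (sym ι-1)) (sym (/-≡ 1 threshold)))))
   below : + 2769343 / 10000000 - + 1 / 20000000 ≤ lam k
   below = sq-cancel-≤ {+ 2769343 / 10000000 - + 1 / 20000000} {lam k} (0≤lam k) (begin
     (+ 2769343 / 10000000 - + 1 / 20000000) * (+ 2769343 / 10000000 - + 1 / 20000000)
       ≤⟨ ≤ᵇ⇒≤ {(+ 2769343 / 10000000 - + 1 / 20000000) * (+ 2769343 / 10000000 - + 1 / 20000000)} {+ 7669259 / 100000000 - + 1 / threshold} _ ⟩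
     + 7669259 / 100000000 - + 1 / threshold
       ≤⟨ ≤-cert {a = + 7669259 / 100000000 - + 1 / threshold} {b = lam k * lam k} (0≤+ (0≤+ (0≤-diff (proj₁ (gauss-enclosure 999≤k))) (0≤-diff i≤)) (0≤-diff (∣-∣⇒≥ {lam k * lam k} {gauss k} (lam²-close k))))
            (r′ (+ 7669259 / 100000000) (+ 1 / threshold) (gauss k) (ι (suc k) ⁻¹) (lam k * lam k)) ⟩
     lam k * lam k ∎)
     where
     r′ : ∀ a b g i l → g - a + (b - i) + (l + i - g) ≡ l - (a - b)
     r′ = solve-∀ ℚ-ring

 ¼≤lam : ∀ k → threshold ℕ.≤ k → + 1 / 4 ≤ lam k
 ¼≤lam k h = ≤-cert {a = + 1 / 4} {b = lam k} (0≤+ (0≤-diff (∣-∣⇒≥ {lam k} {+ 2769343 / 10000000} (lam-near k h))) (≥0 (+ 2769343 / 10000000 - + 1 / 20000000 - + 1 / 4)))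
   (r (+ 2769343 / 10000000) (+ 1 / 20000000) (lam k) (+ 1 / 4))
   where
   r : ∀ a b l q → l + b - a + (a - b - q) ≡ l - q
   r = solve-∀ ℚ-ring

 -- The squares are Cauchy, and above 1/4 the square root is Lipschitz with constant 2.
 lam-cauchy : ∀ {n m} → threshold ℕ.≤ n → n ℕ.≤ m → ∣ lam n - lam m ∣ ≤ + 2 / 1 * (+ 3 / 1 + big₂) * ι (suc n) ⁻¹
 lam-cauchy {n} {m} h n≤m = ∣-∣≤ {lam n} {lam m} (one-sided (0≤lam m) (¼≤lam m (ℕ.≤-trans h n≤m)) (∣-∣⇒≤ {lam n * lam n} {lam m * lam m} close))
   (one-sided (0≤lam n) (¼≤lam n h) (∣-∣⇒≥ {lam n * lam n} {lam m * lam m} close))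
   where
   i = ι (suc n) ⁻¹
   δ = (+ 3 / 1 + big₂) * i
   0≤δ : 0ℚ ≤ δ
   0≤δ = 0≤* (0≤+ (≥0 (+ 3 / 1)) 0≤big₂) (0≤⁻¹ (0<ι n))
   close : ∣ lam n * lam n - lam m * lam m ∣ ≤ δ
   close = ≤-trans (∣∣-tri (lam n * lam n) (gauss n) (lam m * lam m)) (≤-trans (+-mono-≤ (lam²-close n)
       (≤-trans (∣∣-tri (gauss n) (gauss m) (lam m * lam m)) (+-mono-≤ (gauss-cauchy n≤m)
         (≤-trans (≤-reflexive (∣-∣-sym (gauss m) (lam m * lam m))) (≤-trans (lam²-close m) (⁻¹-anti (0<ι n) (ι-mono (s≤s n≤m))))))))
     (≤-reflexive (r i big₂)))
     where
     r : ∀ i b → i + ((1ℚ + b) * i + i) ≡ (+ 3 / 1 + b) * i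
     r = solve-∀ ℚ-ring
   one-sided : ∀ {a b} → 0ℚ ≤ b → + 1 / 4 ≤ b → a * a ≤ b * b + δ → a ≤ b + + 2 / 1 * (+ 3 / 1 + big₂) * i
   one-sided {a} {b} 0≤b ¼≤b h = ≤-trans (sq-cancel-≤ {a} {b + + 2 / 1 * δ} (0≤+ 0≤b (0≤* (≥0 (+ 2 / 1)) 0≤δ)) (≤-trans h
     (≤-cert {a = b * b + δ} {b = (b + + 2 / 1 * δ) * (b + + 2 / 1 * δ)} (0≤+ (0≤* (0≤* (≥0 (+ 4 / 1)) 0≤δ) (0≤-diff ¼≤b)) (0≤* (≥0 (+ 4 / 1)) (0≤sq δ))) (r₁ b δ))))
     (≤-reflexive (r₂ b (+ 3 / 1 + big₂) i))
     where
     r₁ : ∀ b δ → + 4 / 1 * δ * (b - + 1 / 4) + + 4 / 1 * (δ * δ) ≡ (b + + 2 / 1 * δ) * (b + + 2 / 1 * δ) - (b * b + δ)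
     r₁ = solve-∀ ℚ-ring
     r₂ : ∀ b c i → b + + 2 / 1 * (c * i) ≡ b + + 2 / 1 * c * i
     r₂ = solve-∀ ℚ-ring

-- Transfer to the real numbers

module Reals where

 open import Data.Nat.Base using (_!)
 open import Defs using (ℝ; mkℝ; seq; cauchy; fromℚ; 0ℝ; 1ℝ; inv; partialSum; √-approx; isqrt; isqrt-spec; _^-½; √-pos; EGF[_,_]≃_; _∼_)
 open RationalArithmetic
 open PowerSeries hiding (θ; C)
 open Representations using (0<ι!)
 open Maxima
 open Tilt
 open Root
 open Numerics
 open Comparison

 private
   half : ∀ e → e * ½ + e * ½ ≡ e
   half = solve-∀ ℚ-ring

   0<½* : ∀ {e} → 0ℚ < e → 0ℚ < e * ½
   0<½* h = 0<* h (>0 ½)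

   half-< : ∀ {e} → 0ℚ < e → e * ½ < e
   half-< {e} h = <-cert {a = e * ½} {b = e} (0<½* h) (r e)
     where
     r : ∀ e → e * ½ ≡ e - e * ½
     r = solve-∀ ℚ-ring

 rate-cauchy : ∀ {u : ℕ → ℚ} T c → 0ℚ ≤ c → (∀ {n m} → T ℕ.≤ n → n ℕ.≤ m → ∣ u n - u m ∣ ≤ c * ι (suc n) ⁻¹) →
   ∀ ε → 0ℚ < ε → ∃[ N ] (∀ m n → N ℕ.≤ m → N ℕ.≤ n → ∣ u m - u n ∣ < ε)
 rate-cauchy {u} T c 0≤c h ε 0<ε = let N , hN = small c 0≤c (0<½* 0<ε) in T ℕ.+ N , λ m n p q → ordered N hN m n p q (ℕ.≤-total m n)
   where
   ordered : ∀ N → (∀ n → N ℕ.≤ n → c * ι (suc n) ⁻¹ ≤ ε * ½) → ∀ m n → T ℕ.+ N ℕ.≤ m → T ℕ.+ N ℕ.≤ n → m ℕ.≤ n ⊎ n ℕ.≤ m → ∣ u m - u n ∣ < ε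
   ordered N hN m n p q (inj₁ m≤n) = ≤-<-trans (h (ℕ.≤-trans (ℕ.m≤m+n T N) p) m≤n) (≤-<-trans (hN m (ℕ.≤-trans (ℕ.m≤n+m N T) p)) (half-< 0<ε))
   ordered N hN m n p q (inj₂ n≤m) = subst (_< ε) (∣-∣-sym (u n) (u m))
     (≤-<-trans (h (ℕ.≤-trans (ℕ.m≤m+n T N) q) n≤m) (≤-<-trans (hN n (ℕ.≤-trans (ℕ.m≤n+m N T) q)) (half-< 0<ε)))

 θ : ℝ
 θ = mkℝ root (rate-cauchy {root} 0 (+ 2 / 1 * big) (0≤* (≥0 (+ 2 / 1)) 0≤big)
   (λ {n} _ n≤m → ≤-trans (root-cauchy n≤m) (*-monoˡ (0≤* (≥0 (+ 2 / 1)) 0≤big) (rate≤ n))))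

 θ>0 : 0ℝ ℝ.< θ
 -- The bound ½ holds from index 0 on, so `inv` changes no term and `seq ν k` is the inverse of
 -- `root k` for every `k`.
 θ>0 = ½ , >0 ½ , 0 , λ k _ → ½≤root k

 λ₀ : ℝ
 λ₀ = mkℝ lam (rate-cauchy {lam} threshold (+ 2 / 1 * (+ 3 / 1 + big₂)) (0≤* (≥0 (+ 2 / 1)) (0≤+ (≥0 (+ 3 / 1)) 0≤big₂)) lam-cauchy)

 seq-inv : ∀ x (x>0 : 0ℝ ℝ.< x) k → proj₁ x>0 ≤ seq x k → seq (inv x x>0) k ≡ seq x k ⁻¹
 seq-inv x (δ , 0<δ , N , p) k δ≤ = ⁻¹-unique (<-≤-trans 0<δ δ≤) (trans (cong (_* (1/ (seq x k ⊔ δ))) (sym (ℚ.p≥q⇒p⊔q≡p δ≤))) (ℚ.*-inverseʳ (seq x k ⊔ δ)))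
   where
   instance
     ⊔-nonZero : ℚ.NonZero (seq x k ⊔ δ)
     ⊔-nonZero = ℚ.pos⇒nonZero (seq x k ⊔ δ) ⦃ positive (<-≤-trans 0<δ (ℚ.p≤q⊔p (seq x k) δ)) ⦄

 ν : ℝ
 ν = inv θ θ>0

 seq-ν : ∀ k → seq ν k ≡ root k ⁻¹
 seq-ν k = seq-inv θ θ>0 k (½≤root k)

 seq-^ : ∀ x n k → seq (x ℝ.^ n) k ≡ seq x k ^ n
 seq-^ x zero    k = refl
 seq-^ x (suc n) k = cong (seq x k *_) (seq-^ x n k)

 /!≡ : ∀ a n q → ι a ≡ ι (n !) * q → ∀ k → seq (a ℝ./ n !) k ≡ q
 /!≡ a n q e k = trans (/-≡ a (n !) ⦃ n ℕ.!≢0 ⦄) (trans (cong (_* ι (n !) ⁻¹) e) (trans (r (ι (n !)) q (ι (n !) ⁻¹)) (trans (cong (q *_) (*-⁻¹ (0<ι! n))) (*-identityʳ q))))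
   where
   r : ∀ f q i → f * q * i ≡ q * (f * i)
   r = solve-∀ ℚ-ring

 -- The equation W(θ) = 1

 term : ℝ → ℕ → ℝ
 term x n = W₂₁ n ℝ./ n ! ℝ.* x ℝ.^ n

 seq-partialSum : ∀ x n k → seq (partialSum (term x) n) k ≡ M 0 (seq x k) (suc n)
 seq-partialSum x zero    k = sym (trans (+-identityʳ (1ℚ * (W 0 * 1ℚ))) (trans (cong (λ z → 1ℚ * (z * 1ℚ)) W-0) refl))
 seq-partialSum x (suc n) k = trans (cong₂ _+_ (seq-partialSum x n k)
     (trans (cong₂ _*_ (/!≡ (W₂₁ (suc n)) (suc n) (W (suc n)) (W₂₁≡W (suc n)) k) (seq-^ x (suc n) k)) (sym (*-identityˡ (weight (seq x k) W (suc n))))))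
   (sym (S-last (λ i → ι i ^ 0 * weight (seq x k) W i) (suc n)))

 0<+⇒ : ∀ {ε} → 0ℝ ℝ.< ε → ∃[ δ ] (0ℚ < δ × ∃[ N ] (∀ k → N ℕ.≤ k → δ ≤ seq ε k))
 0<+⇒ {ε} (δ , 0<δ , N , h) = δ , 0<δ , N , λ k p → subst (_≤ seq ε k) (+-identityˡ δ) (h k p)

 constant>0 : ∀ {δ} → 0ℚ < δ → 0ℝ ℝ.< fromℚ δ
 constant>0 {δ} h = δ , h , 0 , λ _ _ → ≤-reflexive (+-identityˡ δ)

 ≤+ε : ∀ {a b ε} → 0ℚ < ε → a ≤ b → a ≤ b + ε
 ≤+ε {a} {b} {ε} h p = ≤-trans p (subst (_≤ b + ε) (+-identityʳ b) (+-monoʳ-≤ b (<⇒≤ h)))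

 0≤2big : 0ℚ ≤ + 2 / 1 * big
 0≤2big = 0≤* (≥0 (+ 2 / 1)) 0≤big

 sum-near-1 : ∀ {δ} → 0ℚ < δ → ∃[ N ] (∀ n → N ℕ.≤ n → ∀ k → n ℕ.≤ k → ∣ M 0 (root k) (suc n) - 1ℚ ∣ ≤ δ)
 sum-near-1 {δ} 0<δ = let N , h = small (+ 2 / 1 * big) 0≤2big 0<δ in N , λ n N≤n k n≤k →
   ∣-∣≤ {M 0 (root k) (suc n)} {1ℚ} {δ} (≤+ε 0<δ (partial-sum≤1 k n n≤k)) (≤-trans (partial-sum-tail k n n≤k) (+-monoʳ-≤ (M 0 (root k) (suc n)) (h n N≤n)))

 solution : EGF[ W₂₁ , θ ]≃ 1ℝ
 solution ε ε>0 = from (0<+⇒ {ε} ε>0)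
   where
   from : (∃[ δ ] (0ℚ < δ × ∃[ N ] (∀ k → N ℕ.≤ k → δ ≤ seq ε k))) → ∃[ N ] (∀ n → N ℕ.≤ n → ℝ.∣ partialSum (term θ) n ℝ.- 1ℝ ∣ ℝ.≤ ε)
   from (δ , 0<δ , K , δ≤) = let N , h = sum-near-1 0<δ in N , λ n N≤n ε′ 0<ε′ → K ℕ.+ n , λ k K+n≤k →
     ≤+ε 0<ε′ (≤-trans (subst (λ z → ∣ z - 1ℚ ∣ ≤ δ) (sym (seq-partialSum θ n k)) (h n N≤n k (ℕ.≤-trans (ℕ.m≤n+m n K) K+n≤k)))
       (δ≤ k (ℕ.≤-trans (ℕ.m≤m+n K n) K+n≤k)))

 sum-separates : ∀ N {x y} → 0ℚ ≤ x → 0ℚ ≤ y → ∣ x - y ∣ ≤ ∣ M 0 x (2 ℕ.+ N) - M 0 y (2 ℕ.+ N) ∣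
 sum-separates N {x} {y} 0≤x 0≤y = by (≤-total x y)
   where
   Mx = M 0 x (2 ℕ.+ N)
   My = M 0 y (2 ℕ.+ N)
   up : ∀ {a b} → a ≤ b → ∣ b - a ∣ ≡ b - a
   up h = ℚ.0≤p⇒∣p∣≡p (0≤-diff h)
   by : x ≤ y ⊎ y ≤ x → ∣ x - y ∣ ≤ ∣ Mx - My ∣
   by (inj₁ h) = subst₂ _≤_ (trans (sym (up h)) (∣-∣-sym y x)) (∣-∣-sym My Mx) (≤-trans (expansive 0≤x h N) (≤∣∣ (My - Mx)))
   by (inj₂ h) = subst (_≤ ∣ Mx - My ∣) (sym (up h)) (≤-trans (expansive 0≤y h N) (≤∣∣ (Mx - My)))

 -- Long partial sums are near 1 at both arguments, and by `sum-separates` the arguments are at most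
 -- as far apart as these sums.
 unique : ∀ x → 0ℝ ℝ.< x → EGF[ W₂₁ , x ]≃ 1ℝ → x ℝ.≃ θ
 unique x x>0 sol ε 0<ε = from (0<+⇒ {x} x>0) (sol (fromℚ δ) (constant>0 0<δ)) (sum-near-1 0<δ)
   where
   δ = ε * (+ 1 / 4)
   0<δ : 0ℚ < δ
   0<δ = 0<* 0<ε (>0 (+ 1 / 4))
   3δ<ε : δ + δ + δ < ε
   3δ<ε = <-cert {a = δ + δ + δ} {b = ε} 0<δ (r ε)
     where
     r : ∀ e → e * (+ 1 / 4) ≡ e - (e * (+ 1 / 4) + e * (+ 1 / 4) + e * (+ 1 / 4))
     r = solve-∀ ℚ-ring
   from : (∃[ d ] (0ℚ < d × ∃[ N ] (∀ k → N ℕ.≤ k → d ≤ seq x k))) →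
     (∃[ N ] (∀ n → N ℕ.≤ n → ℝ.∣ partialSum (term x) n ℝ.- 1ℝ ∣ ℝ.≤ fromℚ δ)) →
     (∃[ N ] (∀ n → N ℕ.≤ n → ∀ k → n ℕ.≤ k → ∣ M 0 (root k) (suc n) - 1ℚ ∣ ≤ δ)) →
     ∃[ N ] (∀ k → N ℕ.≤ k → ∣ seq x k - root k ∣ < ε)
   from (d , 0<d , N₁ , d≤) (N₂ , h) (N₃ , h′) = N₁ ℕ.+ (K ℕ.+ n) , at
     where
     n = suc (N₂ ℕ.+ N₃)
     close = h n (ℕ.≤-trans (ℕ.m≤m+n N₂ N₃) (ℕ.n≤1+n _)) δ 0<δ
     K = proj₁ close
     at : ∀ k → N₁ ℕ.+ (K ℕ.+ n) ℕ.≤ k → ∣ seq x k - root k ∣ < ε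
     at k k≥ = ≤-<-trans (≤-trans (sum-separates (N₂ ℕ.+ N₃) 0≤x (0≤root k)) (≤-trans (∣∣-tri (M 0 (seq x k) (suc n)) 1ℚ (M 0 (root k) (suc n)))
         (+-mono-≤ (subst (λ z → ∣ z - 1ℚ ∣ ≤ δ + δ) (seq-partialSum x n k) (proj₂ close k (ℕ.≤-trans (ℕ.m≤m+n K n) K+n≤k)))
           (≤-trans (≤-reflexive (∣-∣-sym 1ℚ (M 0 (root k) (suc n)))) (h′ n (ℕ.≤-trans (ℕ.m≤n+m N₃ N₂) (ℕ.n≤1+n _)) k (ℕ.≤-trans (ℕ.m≤n+m n K) K+n≤k)))))) 3δ<ε
       where
       K+n≤k = ℕ.≤-trans (ℕ.m≤n+m (K ℕ.+ n) N₁) k≥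
       0≤x : 0ℚ ≤ seq x k
       0≤x = ≤-trans (<⇒≤ 0<d) (d≤ k (ℕ.≤-trans (ℕ.m≤m+n N₁ _) k≥))

 ν-lower : fromℚ (+ 17521819 / 10000000) ℝ.≤ ν
 ν-lower ε 0<ε = 0 , λ k _ → ≤+ε 0<ε (subst (+ 17521819 / 10000000 ≤_) (trans (*-identityˡ (root k ⁻¹)) (sym (seq-ν k)))
   (≤-÷ {1ℚ} {root k} {+ 17521819 / 10000000} (0<root k) (≤-trans (*-monoˡ (≥0 (+ 17521819 / 10000000)) (root≤b k)) (proj₁ root-bounds))))

 ν-upper : ν ℝ.< fromℚ (+ 17521820 / 10000000)
 ν-upper = + 1 / 1000000000 , >0 (+ 1 / 1000000000) , 0 , λ k _ → subst (λ z → z + + 1 / 1000000000 ≤ + 17521820 / 10000000) (sym (seq-ν k)) (at k)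
   where
   at : ∀ k → root k ⁻¹ + + 1 / 1000000000 ≤ + 17521820 / 10000000
   at k = ≤-trans (≤-cert {a = root k ⁻¹ + + 1 / 1000000000} {b = + 1000000001 / 1000000000 * root k ⁻¹} (0≤* (≥0 (+ 1 / 1000000000)) (0≤-diff 1≤)) (r (root k ⁻¹)))
     (÷-≤ {+ 1000000001 / 1000000000} {root k} {+ 17521820 / 10000000} (0<root k) (≤-trans (proj₂ root-bounds) (*-monoˡ (≥0 (+ 17521820 / 10000000)) (a≤root k))))
     where
     1≤ : 1ℚ ≤ root k ⁻¹
     1≤ = subst (1ℚ ≤_) (*-identityˡ (root k ⁻¹)) (≤-÷ {1ℚ} {root k} {1ℚ} (0<root k) (≤-trans (≤-reflexive (*-identityˡ (root k))) (≤-trans (root≤ k) (≤ᵇ⇒≤ {+ 3 / 5} {1ℚ} _))))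
     r : ∀ x → + 1 / 1000000000 * (x - 1ℚ) ≡ + 1000000001 / 1000000000 * x - (x + + 1 / 1000000000)
     r = solve-∀ ℚ-ring

 M₂ : ℕ → ℕ
 M₂ zero    = 0
 M₂ (suc n) = proj₁ (maximum n)

 M₂-max : ∀ n .⦃ _ : ℕ.NonZero n ⦄ → ℝ.IsM₂ n (M₂ n)
 M₂-max (suc n) = Maximal.is-max (proj₂ (maximum n))

 seq-M₂ : ∀ n k → seq (M₂ (suc n) ℝ./ suc n !) k ≡ top n
 seq-M₂ n k = /!≡ (M₂ (suc n)) (suc n) (top n) (Maximal.value≡ (proj₂ (maximum n))) k

 power-inverse : ∀ k n → (root k ⁻¹) ^ n * root k ^ n ≡ 1ℚ
 power-inverse k n = trans (sym (^-distrib-* (root k ⁻¹) (root k) n)) (trans (cong (_^ n) (⁻¹-* (0<root k))) (1^ n))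

 seq-ν^ : ∀ n k → seq (ν ℝ.^ n) k ≡ (root k ⁻¹) ^ n
 seq-ν^ n k = trans (seq-^ ν n k) (cong (_^ n) (seq-ν k))

 M₂-bound : ∀ n .⦃ _ : ℕ.NonZero n ⦄ → M₂ n ℝ./ n ! ℝ.≤ ν ℝ.^ n
 M₂-bound (suc n) ε 0<ε = suc n , λ k n<k → ≤+ε 0<ε (subst₂ _≤_ (sym (seq-M₂ n k)) (sym (seq-ν^ (suc n) k))
   (*-cancelˡ-≤ {c = root k ^ suc n} (^-pos (suc n) (0<root k)) (begin
     root k ^ suc n * top n ≡⟨ *-comm (root k ^ suc n) (top n) ⟩
     top n * root k ^ suc n ≤⟨ top-bound n k n<k ⟩
     1ℚ ≡⟨ power-inverse k (suc n) ⟨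
     (root k ⁻¹) ^ suc n * root k ^ suc n ≡⟨ *-comm ((root k ⁻¹) ^ suc n) (root k ^ suc n) ⟩
     root k ^ suc n * (root k ⁻¹) ^ suc n ∎)))
   where open ≤-Reasoning

 -- The order of the reals is not decidable, but terms at a late index can be compared. Either the
 -- inequality holds there up to ε/2, or `c` stays below `ν` by a fixed amount, which contradicts
 -- `optimal`.
 M₂-optimal : ∀ c → (∀ n .⦃ _ : ℕ.NonZero n ⦄ → M₂ n ℝ./ n ! ℝ.≤ c ℝ.^ n) → ν ℝ.≤ c
 M₂-optimal c bound ε 0<ε = decide (seq ν N ℚ.≤? seq c N + ε * ½)
   where
   δ = ε * (+ 1 / 8)
   0<δ : 0ℚ < δ
   0<δ = 0<* 0<ε (>0 (+ 1 / 8))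
   νc = cauchy ν δ 0<δ
   cc = cauchy c δ 0<δ
   c₁ = bound 1 ½ (>0 ½)
   N = proj₁ νc ℕ.+ (proj₁ cc ℕ.+ proj₁ c₁)
   νN : proj₁ νc ℕ.≤ N
   νN = ℕ.m≤m+n (proj₁ νc) (proj₁ cc ℕ.+ proj₁ c₁)
   ν-close : ∀ k → N ℕ.≤ k → ∣ seq ν k - seq ν N ∣ ≤ δ
   ν-close k h = <⇒≤ (proj₂ νc k N (ℕ.≤-trans νN h) νN)
   ≤N : proj₁ cc ℕ.≤ N
   ≤N = ℕ.≤-trans (ℕ.m≤m+n (proj₁ cc) (proj₁ c₁)) (ℕ.m≤n+m (proj₁ cc ℕ.+ proj₁ c₁) (proj₁ νc))
   c-close : ∀ k → N ℕ.≤ k → ∣ seq c k - seq c N ∣ ≤ δ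
   c-close k h = <⇒≤ (proj₂ cc k N (ℕ.≤-trans ≤N h) ≤N)
   ½≤c : ∀ k → N ℕ.≤ k → ½ ≤ seq c k
   ½≤c k h = ≤-cert {a = ½} {b = seq c k} (0≤+ (0≤-diff 1≤top₀) (0≤-diff (subst₂ _≤_ (seq-M₂ 0 k) (cong (_+ ½) (*-identityʳ (seq c k))) (proj₂ c₁ k (ℕ.≤-trans (ℕ.≤-trans (ℕ.m≤n+m (proj₁ c₁) (proj₁ cc)) (ℕ.m≤n+m (proj₁ cc ℕ.+ proj₁ c₁) (proj₁ νc))) h)))))
     (r (top 0) (seq c k))
     where
     r : ∀ t c → (t - 1ℚ) + (c + ½ - t) ≡ c - ½
     r = solve-∀ ℚ-ring
   decide : Dec (seq ν N ≤ seq c N + ε * ½) → ∃[ K ] (∀ k → K ℕ.≤ k → seq ν k ≤ seq c k + ε)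
   decide (yes p) = N , λ k h → ≤-cert {a = seq ν k} {b = seq c k + ε}
     (0≤+ (0≤+ (0≤+ (0≤-diff (∣-∣⇒≤ {seq ν k} {seq ν N} (ν-close k h))) (0≤-diff p)) (0≤-diff (∣-∣⇒≥ {seq c k} {seq c N} (c-close k h)))) (0≤* (≥0 (+ 1 / 4)) (<⇒≤ 0<ε)))
     (r (seq ν k) (seq ν N) (seq c k) (seq c N) ε)
     where
     r : ∀ q Q c C e → (Q + e * (+ 1 / 8) - q) + (C + e * ½ - Q) + (c + e * (+ 1 / 8) - C) + + 1 / 4 * e ≡ c + e - q
     r = solve-∀ ℚ-ring
   decide (no ¬p) = contradiction top≤ (optimal {C} {δ} N 0≤C 0<δ gap)
     where
     C = seq c N + δ
     ½≤C : ½ ≤ C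
     ½≤C = ≤+ε 0<δ (½≤c N ℕ.≤-refl)
     0≤C : 0ℚ ≤ C
     0≤C = ≤-trans (≥0 ½) ½≤C
     -- Two Cauchy errors ε/8 reduce the distance ε/2 to ε/4, and multiplication by `root k`, at
     -- least ½, leaves `δ`.
     gap : ∀ k → N ℕ.≤ k → C * root k ≤ 1ℚ - δ
     gap k h = ≤-cert {a = C * root k} {b = 1ℚ - δ}
       (0≤+ (0≤+ (0≤* (0≤root k) (0≤-diff (<⇒≤ (≰⇒> ¬p)))) (0≤* (0≤root k) (0≤-diff (∣-∣⇒≥ {seq ν k} {seq ν N} (ν-close k h)))))
         (0≤* (0≤* (≥0 (+ 1 / 4)) (<⇒≤ 0<ε)) (0≤-diff (½≤root k))))
       (trans (r (root k) (seq ν N) (seq c N) (seq ν k) ε) (cong (λ z → z - δ - C * root k) (trans (cong (_* root k) (seq-ν k)) (⁻¹-* (0<root k)))))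
       where
       r : ∀ x Q c q e → x * (Q - (c + e * ½)) + x * (q + e * (+ 1 / 8) - Q) + + 1 / 4 * e * (x - ½) ≡ q * x - e * (+ 1 / 8) - (c + e * (+ 1 / 8)) * x
       r = solve-∀ ℚ-ring
     top≤ : ∀ n → top n ≤ + 2 / 1 * C ^ suc n
     top≤ n = ≤-trans (subst₂ _≤_ (seq-M₂ n k) (cong (_+ C ^ suc n) (seq-^ c (suc n) k)) (proj₂ eventually k (ℕ.m≤n+m (proj₁ eventually) N)))
       (≤-trans (+-monoˡ-≤ (C ^ suc n) (^-mono-≤ (suc n) (≤-trans (≥0 ½) (½≤c k N≤k)) (∣-∣⇒≤ {seq c k} {seq c N} (c-close k N≤k)))) (≤-reflexive (r (C ^ suc n))))
       where
       -- The hypothesis admits an arbitrary positive error; one of the size of the power of `C`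
       -- itself leads to the factor 2.
       eventually = bound (suc n) (C ^ suc n) (^-pos (suc n) (<-≤-trans (>0 ½) ½≤C))
       k = N ℕ.+ proj₁ eventually
       N≤k = ℕ.m≤m+n N (proj₁ eventually)
       r : ∀ x → x + x ≡ + 2 / 1 * x
       r = solve-∀ ℚ-ring

 λ₀-bound : ℝ.∣ λ₀ ℝ.- fromℚ (+ 2769343 / 10000000) ∣ ℝ.≤ fromℚ (+ 1 / 20000000)
 λ₀-bound ε 0<ε = threshold , λ k h → ≤+ε 0<ε (lam-near k h)

 module SquareRoot (n k : ℕ) where

   private
     m = suc n
     a = isqrt (m ℕ.* (suc k ℕ.* suc k))
     i = ι (suc k) ⁻¹
     ρ = √-approx m k

     ρ≡ : ρ ≡ ι a * i
     ρ≡ = /-≡ a (suc k)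

     ½≤ρ : ½ ≤ ρ
     ½≤ρ = subst (_≤ ρ) (+-identityˡ ½) (proj₂ (proj₂ (proj₂ (√-pos m))) k z≤n)

     0<ρ : 0ℚ < ρ
     0<ρ = <-≤-trans (>0 ½) ½≤ρ

     ι-K² : ι (m ℕ.* (suc k ℕ.* suc k)) ≡ ι m * (ι (suc k) * ι (suc k))
     ι-K² = trans (ι-* m (suc k ℕ.* suc k)) (cong (ι m *_) (ι-* (suc k) (suc k)))

     cancel : ι m * (ι (suc k) * ι (suc k)) * (i * i) ≡ ι m
     cancel = trans (r (ι m) (ι (suc k)) i) (trans (cong (λ z → ι m * (z * z)) (*-⁻¹ (0<ι k))) (*-identityʳ (ι m)))
       where
       r : ∀ m k i → m * (k * k) * (i * i) ≡ m * (k * i * (k * i))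
       r = solve-∀ ℚ-ring

     ρ²≤ : ρ * ρ ≤ ι m
     ρ²≤ = begin
       ρ * ρ ≡⟨ cong (λ z → z * z) ρ≡ ⟩
       ι a * i * (ι a * i) ≡⟨ r (ι a) i ⟩
       ι a * ι a * (i * i) ≡⟨ cong (_* (i * i)) (ι-* a a) ⟨
       ι (a ℕ.* a) * (i * i) ≤⟨ *-monoʳ (0≤sq i) (ι-mono (proj₁ (isqrt-spec (m ℕ.* (suc k ℕ.* suc k))))) ⟩
       ι (m ℕ.* (suc k ℕ.* suc k)) * (i * i) ≡⟨ trans (cong (_* (i * i)) ι-K²) cancel ⟩
       ι m ∎
       where
       open ≤-Reasoning
       r : ∀ a i → a * i * (a * i) ≡ a * a * (i * i)
       r = solve-∀ ℚ-ring

     ≤ρ² : ι m ≤ (ρ + i) * (ρ + i)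
     ≤ρ² = begin
       ι m ≡⟨ trans (cong (_* (i * i)) ι-K²) cancel ⟨
       ι (m ℕ.* (suc k ℕ.* suc k)) * (i * i) ≤⟨ *-monoʳ (0≤sq i) (ι-mono (ℕ.<⇒≤ (proj₂ (isqrt-spec (m ℕ.* (suc k ℕ.* suc k)))))) ⟩
       ι (suc a ℕ.* suc a) * (i * i) ≡⟨ cong (_* (i * i)) (trans (ι-* (suc a) (suc a)) (cong (λ z → z * z) (ι-suc a))) ⟩
       (ι a + 1ℚ) * (ι a + 1ℚ) * (i * i) ≡⟨ r (ι a) i ⟩
       (ι a * i + i) * (ι a * i + i) ≡⟨ cong (λ z → (z + i) * (z + i)) ρ≡ ⟨
       (ρ + i) * (ρ + i) ∎
       where
       open ≤-Reasoning
       r : ∀ a i → (a + 1ℚ) * (a + 1ℚ) * (i * i) ≡ (a * i + i) * (a * i + i)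
       r = solve-∀ ℚ-ring

   s : ℚ
   s = ρ ⁻¹

   seq-^-½ : seq (m ^-½) k ≡ s
   seq-^-½ = seq-inv (ℝ.√ m) (√-pos m) k ½≤ρ

   0≤s : 0ℚ ≤ s
   0≤s = 0≤⁻¹ 0<ρ

   private
     sρ : s * ρ ≡ 1ℚ
     sρ = ⁻¹-* 0<ρ

     s≤2 : s ≤ + 2 / 1
     s≤2 = subst (_≤ + 2 / 1) (*-identityˡ s) (÷-≤ {1ℚ} {ρ} {+ 2 / 1} 0<ρ (≤-trans (≤ᵇ⇒≤ {1ℚ} {+ 2 / 1 * ½} _) (*-monoˡ (≥0 (+ 2 / 1)) ½≤ρ)))

   1≤s²m : 1ℚ ≤ s * s * ι m
   1≤s²m = ≤-trans (≤-reflexive (trans (cong₂ _*_ (sym sρ) (sym sρ)) (r s ρ))) (*-monoˡ (0≤sq s) ρ²≤)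
     where
     r : ∀ s p → s * p * (s * p) ≡ s * s * (p * p)
     r = solve-∀ ℚ-ring

   s²m≤ : ∀ {w} → 1ℚ + + 2 / 1 * i ≤ w → s * s * ι m ≤ w * w
   s²m≤ {w} h = begin
     s * s * ι m ≤⟨ *-monoˡ (0≤sq s) ≤ρ² ⟩
     s * s * ((ρ + i) * (ρ + i)) ≡⟨ r s ρ i ⟩
     (s * ρ + s * i) * (s * ρ + s * i) ≡⟨ cong (λ z → (z + s * i) * (z + s * i)) sρ ⟩
     (1ℚ + s * i) * (1ℚ + s * i) ≤⟨ *-mono-≤ 0≤ 0≤ le le ⟩
     w * w ∎
     where
     open ≤-Reasoning
     0≤i = 0≤⁻¹ (0<ι k)
     0≤ : 0ℚ ≤ 1ℚ + s * i
     0≤ = 0≤+ 0≤1 (0≤* 0≤s 0≤i)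
     le : 1ℚ + s * i ≤ w
     le = ≤-trans (+-monoʳ-≤ 1ℚ (*-monoʳ 0≤i s≤2)) h
     r : ∀ s p i → s * s * ((p + i) * (p + i)) ≡ (s * p + s * i) * (s * p + s * i)
     r = solve-∀ ℚ-ring

 private
   module Asymptotic (d : ℚ) (0<d : 0ℚ < d) (d≤1 : d ≤ 1ℚ) where
     -- Then 6η = d/7, and (1 + d/7)³ ≤ 1 + d for d ≤ 1.
     η = d * (+ 1 / 42)
     0<η : 0ℚ < η
     0<η = 0<* 0<d (>0 (+ 1 / 42))
     open Ratio η 0<η (≤-trans (*-monoʳ (≥0 (+ 1 / 42)) d≤1) (≤ᵇ⇒≤ {1ℚ * (+ 1 / 42)} {½} _))
     0≤d = <⇒≤ 0<d

     w³≤ : w * (w * w) ≤ 1ℚ + d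
     w³≤ = ≤-cert {a = w * (w * w)} {b = 1ℚ + d} (0≤+ (0≤+ (0≤* (0≤* (0≤* (≥0 (+ 1 / 343)) 0≤d) (0≤-diff d≤1)) (0≤+ 0≤d 0≤1)) (0≤* (0≤* (≥0 (+ 3 / 49)) 0≤d) (0≤-diff d≤1))) (0≤* (≥0 (+ 174 / 343)) 0≤d)) (r d)
       where
       r : ∀ d → + 1 / 343 * d * (1ℚ - d) * (d + 1ℚ) + + 3 / 49 * d * (1ℚ - d) + + 174 / 343 * d
         ≡ 1ℚ + d - (1ℚ + + 6 / 1 * (d * (+ 1 / 42))) * ((1ℚ + + 6 / 1 * (d * (+ 1 / 42))) * (1ℚ + + 6 / 1 * (d * (+ 1 / 42))))
       r = solve-∀ ℚ-ring

     small₅ = small (+ 2 / 1) (≥0 (+ 2 / 1)) (0<* (>0 (+ 6 / 1)) 0<η)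

     N : ℕ
     N = N₂ ℕ.+ proj₁ small₅

     close : ∀ n → N ℕ.≤ n → ∀ k → suc n ℕ.≤ k → let y = lam k * seq (suc n ^-½) k * seq (ν ℝ.^ suc n) k in
       ∣ top n - y ∣ ≤ d * y × 0ℚ ≤ y
     close n N≤n k n<k = subst (λ z → ∣ top n - z ∣ ≤ d * z × 0ℚ ≤ z) (sym (cong₂ _*_ (cong (lam k *_) seq-^-½) (seq-ν^ (suc n) k)))
       (∣-∣≤ {top n} {y} (≤-cert {a = top n} {b = y + d * y} (0≤+ (0≤-diff (top≤ 0≤s)) (0≤* 0≤y (0≤-diff w³≤))) (r₁ (top n) y d w))
         (≤-cert {a = y} {b = top n + d * y} (0≤+ (0≤* (0≤-diff d≤1) (0≤+ (0≤-diff ≤top′) (0≤* (Nonneg-top n) (0≤-diff w³≤)))) (0≤* (0≤sq d) (Nonneg-top n))) (r₂ (top n) y d w))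
       , 0≤y)
       where
       open SquareRoot n k
       open Close n k (ℕ.≤-trans (ℕ.m≤m+n N₂ (proj₁ small₅)) N≤n) n<k s 1≤s²m
         (s²m≤ (+-monoʳ-≤ 1ℚ (proj₂ small₅ k (ℕ.≤-trans (ℕ.≤-trans (ℕ.m≤n+m (proj₁ small₅) N₂) N≤n) (ℕ.≤-trans (ℕ.n≤1+n n) n<k)))))
       0≤y : 0ℚ ≤ y
       0≤y = 0≤* (0≤* (0≤lam k) 0≤s) (^-nonneg (suc n) (0≤⁻¹ (0<root k)))
       r₁ : ∀ t y d w → (w * (w * w) * y - t) + y * (1ℚ + d - w * (w * w)) ≡ y + d * y - t
       r₁ = solve-∀ ℚ-ring
       r₂ : ∀ t y d w → (1ℚ - d) * ((w * (w * w) * t - y) + t * (1ℚ + d - w * (w * w))) + d * d * t ≡ t + d * y - y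
       r₂ = solve-∀ ℚ-ring

 asymptotic : (λ n → M₂ n ℝ./ n !) ∼ (λ n → λ₀ ℝ.* n ^-½ ℝ.* ν ℝ.^ n)
 asymptotic ε ε>0 = from (0<+⇒ {ε} ε>0)
   where
   Goal : ℕ → Set
   Goal N = ∀ n .⦃ _ : ℕ.NonZero n ⦄ → N ℕ.≤ n → ℝ.∣ M₂ n ℝ./ n ! ℝ.- λ₀ ℝ.* n ^-½ ℝ.* ν ℝ.^ n ∣ ℝ.≤ ε ℝ.* ℝ.∣ λ₀ ℝ.* n ^-½ ℝ.* ν ℝ.^ n ∣
   from : (∃[ δ ] (0ℚ < δ × ∃[ K ] (∀ k → K ℕ.≤ k → δ ≤ seq ε k))) → ∃[ N ] Goal N
   from (δ , 0<δ , K , δ≤) = suc A.N , goal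
     where
     d = δ ⊓ 1ℚ
     0<d : 0ℚ < d
     0<d = by (ℚ.⊓-sel δ 1ℚ)
       where
       by : d ≡ δ ⊎ d ≡ 1ℚ → 0ℚ < d
       by (inj₁ e) = subst (0ℚ <_) (sym e) 0<δ
       by (inj₂ e) = subst (0ℚ <_) (sym e) 0<1
     module A = Asymptotic d 0<d (ℚ.p⊓q≤q δ 1ℚ)
     goal : Goal (suc A.N)
     goal (suc n) (s≤s N≤n) ε′ 0<ε′ = K ℕ.+ suc n , λ k K+n<k → at k (ℕ.≤-trans (ℕ.m≤m+n K (suc n)) K+n<k) (ℕ.≤-trans (ℕ.m≤n+m (suc n) K) K+n<k)
       where
       at : ∀ k → K ℕ.≤ k → suc n ℕ.≤ k → let y = lam k * seq (suc n ^-½) k * seq (ν ℝ.^ suc n) k in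
         ∣ seq (M₂ (suc n) ℝ./ suc n !) k - y ∣ ≤ seq ε k * ∣ y ∣ + ε′
       at k K≤k n<k = ≤+ε 0<ε′ (≤-trans (subst (λ z → ∣ z - y ∣ ≤ d * y) (sym (seq-M₂ n k)) (proj₁ close))
         (≤-trans (*-monoʳ (proj₂ close) (≤-trans (ℚ.p⊓q≤p δ 1ℚ) (δ≤ k K≤k)))
           (*-monoˡ {y} {∣ y ∣} {seq ε k} (≤-trans (<⇒≤ 0<δ) (δ≤ k K≤k)) (≤∣∣ y))))
         where
         y = lam k * seq (suc n ^-½) k * seq (ν ℝ.^ suc n) k
         close = A.close n N≤n k n<k

open import Defs

theorem4 :
  Σ[ W₂₁ ∈ (ℕ → ℕ) ] Σ[ M₂ ∈ (ℕ → ℕ) ]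
    (∀ n .⦃ _ : NonZero n ⦄ → IsW₂ 1 n (W₂₁ n))
    × (∀ n .⦃ _ : NonZero n ⦄ → IsM₂ n (M₂ n))
    × (Σ[ θ ∈ ℝ ] Σ[ θ>0 ∈ 0ℝ < θ ]
        (EGF[ W₂₁ , θ ]≃ 1ℝ)
        × (∀ x → 0ℝ < x → EGF[ W₂₁ , x ]≃ 1ℝ → x ≃ θ)
        × (let ν = inv θ θ>0 in
            (fromℚ (+ 17521819 ÷ 10000000) ≤ ν × ν < fromℚ (+ 17521820 ÷ 10000000))
            × (∀ n .⦃ _ : NonZero n ⦄ → M₂ n / n ! ≤ ν ^ n)
            × (∀ c → (∀ n .⦃ _ : NonZero n ⦄ → M₂ n / n ! ≤ c ^ n) → ν ≤ c)
            × (Σ[ λ₀ ∈ ℝ ]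
                (∣ λ₀ - fromℚ (+ 2769343 ÷ 10000000) ∣ ≤ fromℚ (+ 1 ÷ 20000000))
                × ((λ n → M₂ n / n !) ∼ (λ n → λ₀ * n ^-½ * ν ^ n)))))
theorem4 = W₂₁ , M₂ , (λ n → W₂₁-max n) , M₂-max , θ , θ>0 , solution , unique
  , (ν-lower , ν-upper) , M₂-bound , M₂-optimal , λ₀ , λ₀-bound , asymptotic
  where
  open Maxima using (W₂₁; W₂₁-max)
  open Reals
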